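{- Let $D<-4$ be the discriminant of an imaginary quadratic field with $D\equiv1\pmod4$, and let $N=|D|$, $\chi=\chi_D$, $h=h(D)$. Put $$E_0(4)=\sum_{0<x<\frac N4}\chi(x),\qquad E_1(4)=\sum_{\frac N4<x<\frac N2}\chi(x).$$ Then: - if $N\equiv7\pmod8$: $E_0(4)=h$ and $E_1(4)=0$; - if $N\equiv3\pmod8$: $E_0(4)=0$ and $E_1(4)=3h$.
   Context: Here $D\equiv 1\pmod 4$ is a negative square-free integer, the discriminant of $K=\mathbb{Q}(\sqrt D)$; $h(D)$ is the order of the ideal class group of $K$; and $\chi_D(x)=\left(\frac{x}{N}\right)$ is the Jacobi symbol (equal to $0$ when $\gcd(x,N)>1$). Sums are over integers $x$ with $1\le x\le N$ and $\gcd(x,N)=1$ in the indicated open intervals. -}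

module Defs where

open import Level using (0ℓ)
open import Data.Bool.Base using (if_then_else_)
open import Data.Fin.Base using (Fin; toℕ)
open import Data.Fin.Properties using (any?; ≡-setoid)
open import Data.Integer.Base as ℤ using (ℤ; +_; 0ℤ; 1ℤ; -1ℤ)
open import Data.Integer.Divisibility using () renaming (_∣_ to _∣ℤ_)
open import Data.List.Base using (List; []; _∷_; map; filter; foldr; applyUpTo)
open import Data.List.Relation.Unary.Any using (Any)
open import Data.Nat.Base using (ℕ; suc; _*_; _<_; NonZero; ∣_-_∣)
open import Data.Nat.Coprimality using (Coprime; coprime?)
open import Data.Nat.Divisibility using (_∣?_)
open import Data.Nat.Primality.Factorisation using (factors; factorise)
open import Data.Nat.Properties using (_<?_)
open import Data.Product.Base using (∃-syntax; _×_; _,_)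
open import Data.Rational.Base as ℚ using (ℚ; 0ℚ; 1ℚ)
open import Data.Rational.Solver using (module +-*-Solver)
open import Function.Bundles using (Inverse)
open import Relation.Binary.Bundles using (Setoid)
open import Relation.Binary.PropositionalEquality
  using (_≡_; _≢_; refl; sym; trans; cong; cong₂; subst)
open import Relation.Nullary.Decidable using (does; _×-dec_)
open import Relation.Unary using (Pred; Decidable; _≐_)

SquareFree : ℤ → Set
SquareFree n = (d : ℤ) → (d ℤ.* d) ∣ℤ n → ℤ.∣ d ∣ ≡ 1

-- For D not a perfect square, ⟨ a , b ⟩ stands for a + b √ D.
record ℚ√ (D : ℤ) : Set where
  constructor ⟨_,_⟩
  field
    re im : ℚ

module _ {D : ℤ} where

  infixl 6 _⊕_
  infixl 7 _⊗_

  fromℤ : ℤ → ℚ√ D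
  fromℤ n = ⟨ n ℚ./ 1 , 0ℚ ⟩

  𝟘 𝟙 : ℚ√ D
  𝟘 = ⟨ 0ℚ , 0ℚ ⟩
  𝟙 = ⟨ 1ℚ , 0ℚ ⟩

  _⊕_ _⊗_ : ℚ√ D → ℚ√ D → ℚ√ D
  ⟨ a , b ⟩ ⊕ ⟨ c , d ⟩ = ⟨ a ℚ.+ c , b ℚ.+ d ⟩
  ⟨ a , b ⟩ ⊗ ⟨ c , d ⟩ =
    ⟨ a ℚ.* c ℚ.+ (D ℚ./ 1) ℚ.* (b ℚ.* d) , a ℚ.* d ℚ.+ b ℚ.* c ⟩

  ⊗-assoc : (x y z : ℚ√ D) → (x ⊗ y) ⊗ z ≡ x ⊗ (y ⊗ z)
  ⊗-assoc ⟨ a , b ⟩ ⟨ c , d ⟩ ⟨ e , f ⟩ = cong₂ ⟨_,_⟩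
    (solve 7 (λ D a b c d e f →
        (a :* c :+ D :* (b :* d)) :* e :+ D :* ((a :* d :+ b :* c) :* f)
        := a :* (c :* e :+ D :* (d :* f)) :+ D :* (b :* (c :* f :+ d :* e)))
      refl (D ℚ./ 1) a b c d e f)
    (solve 7 (λ D a b c d e f →
        (a :* c :+ D :* (b :* d)) :* f :+ (a :* d :+ b :* c) :* e
        := a :* (c :* f :+ d :* e) :+ b :* (c :* e :+ D :* (d :* f)))
      refl (D ℚ./ 1) a b c d e f)
    where open +-*-Solver

  ⊗-comm : (x y : ℚ√ D) → x ⊗ y ≡ y ⊗ x
  ⊗-comm ⟨ a , b ⟩ ⟨ c , d ⟩ = cong₂ ⟨_,_⟩
    (solve 5 (λ D a b c d →
        a :* c :+ D :* (b :* d) := c :* a :+ D :* (d :* b))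
      refl (D ℚ./ 1) a b c d)
    (solve 4 (λ a b c d → a :* d :+ b :* c := c :* b :+ d :* a)
      refl a b c d)
    where open +-*-Solver

  ⊗-identityˡ : (x : ℚ√ D) → 𝟙 ⊗ x ≡ x
  ⊗-identityˡ ⟨ a , b ⟩ = cong₂ ⟨_,_⟩
    (solve 3 (λ D a b →
        con 1ℚ :* a :+ D :* (con 0ℚ :* b) := a)
      refl (D ℚ./ 1) a b)
    (solve 2 (λ a b → con 1ℚ :* b :+ con 0ℚ :* a := b) refl a b)
    where open +-*-Solver

  -- The list c₀ ∷ c₁ ∷ … ∷ cₙ₋₁ ∷ [] encodes the monic polynomial
  -- c₀ + c₁ X + … + cₙ₋₁ Xⁿ⁻¹ + Xⁿ.
  evalMonic : List ℤ → ℚ√ D → ℚ√ D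
  evalMonic []       x = 𝟙
  evalMonic (c ∷ cs) x = fromℤ c ⊕ x ⊗ evalMonic cs x

  -- Membership in the ring of integers.
  Integral : Pred (ℚ√ D) 0ℓ
  Integral x = ∃[ cs ] evalMonic cs x ≡ 𝟘

  -- Span gs is the module generated by gs over the ring of integers.
  data Span : List (ℚ√ D) → Pred (ℚ√ D) 0ℓ where
    []  : Span [] 𝟘
    _∷_ : ∀ {a g gs x} → Integral a → Span gs x → Span (g ∷ gs) (a ⊗ g ⊕ x)

-- A fractional ideal is a nonzero finitely generated submodule of ℚ(√D)
-- over the ring of integers.
record FractionalIdeal (D : ℤ) : Set where
  field
    generators : List (ℚ√ D)
    nonzero    : Any (_≢ 𝟘) generators

module _ {D : ℤ} where

  infix 4 _∈_ _~_
  infixr 7 _·_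

  _∈_ : ℚ√ D → FractionalIdeal D → Set
  x ∈ I = Span (FractionalIdeal.generators I) x

  _·_ : ℚ√ D → FractionalIdeal D → Pred (ℚ√ D) 0ℓ
  (u · I) x = ∃[ y ] y ∈ I × x ≡ u ⊗ y

  -- I and J differ by a principal fractional ideal: I = u J for a unit u
  -- of ℚ(√D).
  record _~_ (I J : FractionalIdeal D) : Set where
    constructor scaled
    field
      u u⁻¹  : ℚ√ D
      isUnit : u ⊗ u⁻¹ ≡ 𝟙
      equal  : (_∈ I) ≐ u · J

  private
    cancel : (u v : ℚ√ D) → u ⊗ v ≡ 𝟙 → ∀ x → u ⊗ (v ⊗ x) ≡ x
    cancel u v uv x = trans (sym (⊗-assoc u v x))
      (trans (cong (_⊗ x) uv) (⊗-identityˡ x))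

  ~-refl : ∀ {I} → I ~ I
  ~-refl {I} = scaled 𝟙 𝟙 (⊗-identityˡ 𝟙)
    ( (λ {x} p → x , p , sym (⊗-identityˡ x))
    , λ { (y , p , refl) → subst (_∈ I) (sym (⊗-identityˡ y)) p })

  ~-sym : ∀ {I J} → I ~ J → J ~ I
  ~-sym {I} {J} (scaled u v uv (I⊆uJ , uJ⊆I)) = scaled v u vu
    ( (λ {x} p → u ⊗ x , uJ⊆I (x , p , refl) , sym (cancel v u vu x))
    , λ { (y , p , refl) → back (I⊆uJ p) })
    where
    vu : v ⊗ u ≡ 𝟙
    vu = trans (⊗-comm v u) uv
    back : ∀ {y} → (u · J) y → v ⊗ y ∈ J
    back (z , q , refl) = subst (_∈ J) (sym (cancel v u vu z)) q

  ~-trans : ∀ {I J L} → I ~ J → J ~ L → I ~ L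
  ~-trans {I} {J} {L} (scaled u v uv (I⊆uJ , uJ⊆I)) (scaled s t st (J⊆sL , sL⊆J)) =
    scaled (u ⊗ s) (t ⊗ v) unit ((λ p → to (I⊆uJ p)) , from)
    where
    unit : (u ⊗ s) ⊗ (t ⊗ v) ≡ 𝟙
    unit = trans (⊗-assoc u s (t ⊗ v)) (trans (cong (u ⊗_) (cancel s t st v)) uv)
    to : ∀ {x} → (u · J) x → ((u ⊗ s) · L) x
    to (y , p , refl) with J⊆sL p
    ... | z , q , refl = z , q , sym (⊗-assoc u s z)
    from : ∀ {x} → ((u ⊗ s) · L) x → x ∈ I
    from (z , q , refl) =
      uJ⊆I (s ⊗ z , sL⊆J (z , q , refl) , ⊗-assoc u s z)

-- The underlying set of the ideal class group: fractional ideals modulo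
-- principal ones (h(D) does not involve the group law).
IdealClasses : ℤ → Setoid 0ℓ 0ℓ
IdealClasses D = record
  { Carrier       = FractionalIdeal D
  ; _≈_           = _~_
  ; isEquivalence = record
    { refl = ~-refl ; sym = ~-sym ; trans = ~-trans }
  }

-- The ideal class group of ℚ(√D) has order h.
IsClassNumber : ℤ → ℕ → Set
IsClassNumber D h = Inverse (IdealClasses D) (≡-setoid h)

-- Meaningful for p an odd prime.
legendre : ℕ → ℕ → ℤ
legendre x p =
  if does (p ∣? x) then 0ℤ
  else if does (any? λ (y : Fin p) → p ∣? ∣ toℕ y * toℕ y - x ∣) then 1ℤ
  else -1ℤ

-- The Jacobi symbol (x / n), for n odd.
jacobi : ℕ → (n : ℕ) .{{_ : NonZero n}} → ℤ
jacobi x n = foldr ℤ._*_ 1ℤ (map (legendre x) (factors (factorise n)))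

χ : (D : ℤ) .{{_ : ℤ.NonZero D}} → ℕ → ℤ
χ D x = jacobi x ℤ.∣ D ∣

-- r N / k < x < (r + 1) N / k and gcd (x, N) = 1.
InSector : (N r k : ℕ) → Pred ℕ 0ℓ
InSector N r k x = r * N < k * x × k * x < suc r * N × Coprime x N

inSector? : ∀ N r k → Decidable (InSector N r k)
inSector? N r k x =
  (r * N <? k * x) ×-dec (k * x <? suc r * N) ×-dec coprime? x N

-- The sum E_r(k) of χ D over 1 ≤ x ≤ ∣ D ∣ in the r-th sector.
E : (D : ℤ) .{{_ : ℤ.NonZero D}} → (r k : ℕ) → ℤ
E D r k = foldr ℤ._+_ 0ℤ
  (map (χ D) (filter (inSector? ℤ.∣ D ∣ r k) (applyUpTo suc ℤ.∣ D ∣)))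

{-# OPTIONS --safe #-}
module Submission where

-- The class number formula N h = - Σ x χ(x), 0 < x < N, is obtained without
-- analysis. The vectors v with Q(v) = n, counted over one form Q for each of the
-- h ideal classes, number h for n = 0 and 2 Σ_{d ∣ n} χ(d) for n ≥ 1. Let S(Q) be
-- the sum of (T - Q(v))³ over Q(v) < T. Sums over the even and over all integers
-- of a function with small third differences agree up to the factor 2, so
-- 4 S(4 Q) - S(Q) = O(T^{5/2}): the areas cancel, and of the n = 0 terms 3 h T³
-- remains. It must be balanced by - 2 Σ χ(d) ψ(m) (T - d m)³ over d m < T, where
-- ψ(m) = - 3 if 4 ∣ m and 1 otherwise. Repeated Abel summation, in d for
-- m < 4 T^{5/8} and in m for larger m, evaluates this sum as
-- - 3 Σ x χ(x) T³ / 2 N up to O(T^{23/8}), and T → ∞ gives the formula.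
-- Since χ(N - x) = - χ(x), sorting x by parity expresses Σ x χ(x) and
-- Σ_{x < N/2} χ(x) through sums over x < N/2 in two ways, the second involving
-- χ(2), which is ± 1 according to N mod 8; this determines both quarter sums.

-- The areas of the ellipses `Q` < T contain π / √N. Comparing two scales removes them before they
-- have to be evaluated, so the whole argument takes place in ℤ, with explicit constants. A sharp
-- cutoff would leave boundary errors as large as the term sought; the cube makes third differences
-- small right up to the boundary. Splitting the divisor sum at m = T^θ leaves errors of order T^(1
-- + 3 θ) from small m and T^(4 - 2 θ) from large m, so every θ strictly between 1/2 and 2/3 works.
-- With θ = 5/8 and T = V⁸ all exponents are integers: the errors are V²⁰ and V²³, against T³ = V²⁴.
-- Ideals of norm n correspond to roots of x² + x + c modulo n. At a prime p these are governed by
-- the symbol of -N modulo p, whereas χ(p) is a symbol modulo N; this is where quadratic reciprocity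
-- is needed. The factor 2 in the count is the number of units, and D < -4 enters there.

open import Data.Empty using (⊥-elim)
open import Data.Integer.Base as ℤ using (ℤ; +_; -[1+_]; 0ℤ; 1ℤ; -1ℤ; ∣_∣)
import Data.Integer.Divisibility.Signed as ℤD
import Data.Integer.Properties as ℤP
open import Data.Nat.Base as ℕ using (ℕ; zero; suc)
open import Data.Nat.Coprimality as Coprimality using (Coprime; coprime?; gcd≡1⇒coprime)
import Data.Nat.Divisibility as ℕD
import Data.Nat.Properties as ℕP
open import Data.Product.Base as Product using (∃; ∃-syntax; _×_; _,_; proj₁; proj₂)
open import Data.Sum.Base as Sum using (_⊎_; inj₁; inj₂)
open import Function.Base using (_∘_)
open import Relation.Binary.PropositionalEquality hiding (J)
open import Relation.Nullary using (Dec; yes; no; ¬_; does; contradiction; _×-dec_)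

-- Ring identities over ℤ and ℕ by polynomial normal forms.

module Normalisation where

  open import Data.Bool.Base using (Bool; true; false; T)
  open import Data.Fin.Base using (Fin; zero; suc)
  open import Data.Integer.Base hiding (suc; _%_; _/_)
  open ℤP
  open import Data.List.Base using (List; []; _∷_; null)
  open import Data.Unit.Base using (tt)
  open import Data.Vec.Base as Vec using (Vec; []; _∷_; lookup; replicate; zipWith; allFin)
  import Data.Vec.Properties as VecP
  open import Algebra.Properties.CommutativeSemigroup *-commutativeSemigroup using () renaming (interchange to *-interchange)
  open import Algebra.Properties.CommutativeSemigroup +-commutativeSemigroup using () renaming (interchange to +-interchange; x∙yz≈y∙xz to +-exchange)

  infix  5 _⊜_
  infixl 6 _:+_ _:-_
  infixl 7 _:*_
  infix  8 :-_
  infix  9 #_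

  -- The flag can forbid subtraction and negation, so that an `Expr false` also has a value in ℕ.
  -- Identities in ℕ are then read off from ℤ through the injective map `+_`.
  data Expr (subtraction : Bool) (n : ℕ) : Set where
    var       : Fin n → Expr subtraction n
    #_        : ℕ → Expr subtraction n
    _:+_ _:*_ : (e f : Expr subtraction n) → Expr subtraction n
    _:-_      : {T subtraction} → (e f : Expr subtraction n) → Expr subtraction n
    :-_       : {T subtraction} → (e : Expr subtraction n) → Expr subtraction n

  _⊜_ : ∀ {A : Set} → A → A → A × A
  _⊜_ = _,_

  evalℤ : ∀ {s n} → Expr s n → Vec ℤ n → ℤ
  evalℤ (var i)  ρ = lookup ρ i
  evalℤ (# k)    ρ = + k
  evalℤ (e :+ f) ρ = evalℤ e ρ + evalℤ f ρ
  evalℤ (e :* f) ρ = evalℤ e ρ * evalℤ f ρ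
  evalℤ (e :- f) ρ = evalℤ e ρ - evalℤ f ρ
  evalℤ (:- e)   ρ = - evalℤ e ρ

  evalℕ : ∀ {n} → Expr false n → Vec ℕ n → ℕ
  evalℕ (var i)  ρ = lookup ρ i
  evalℕ (# k)    ρ = k
  evalℕ (e :+ f) ρ = evalℕ e ρ ℕ.+ evalℕ f ρ
  evalℕ (e :* f) ρ = evalℕ e ρ ℕ.* evalℕ f ρ

  Monomial : ℕ → Set
  Monomial = Vec ℕ

  ⟦_⟧ᵐ : ∀ {n} → Monomial n → Vec ℤ n → ℤ
  ⟦ [] ⟧ᵐ    []      = 1ℤ
  ⟦ e ∷ m ⟧ᵐ (x ∷ ρ) = x ^ e * ⟦ m ⟧ᵐ ρ

  -- Only equality carries evidence. The order decides where terms are placed, hence whether like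
  -- terms meet and cancel, but soundness never depends on it.
  data Comparison {n} (m m′ : Monomial n) : Set where
    lt gt : Comparison m m′
    eq    : m ≡ m′ → Comparison m m′

  compare : ∀ {n} (m m′ : Monomial n) → Comparison m m′
  compare []      []        = eq refl
  compare (e ∷ m) (e′ ∷ m′) = heads (e ℕ.≡ᵇ e′) refl (e ℕ.<ᵇ e′)
    where
    tails : e ≡ e′ → Comparison m m′ → Comparison (e ∷ m) (e′ ∷ m′)
    tails _ lt      = lt
    tails _ gt      = gt
    tails p (eq q)  = eq (cong₂ _∷_ p q)
    heads : ∀ b → (e ℕ.≡ᵇ e′) ≡ b → Bool → Comparison (e ∷ m) (e′ ∷ m′)
    heads true  p _     = tails (ℕP.≡ᵇ⇒≡ e e′ (subst T (sym p) tt)) (compare m m′)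
    heads false _ true  = lt
    heads false _ false = gt

  -- Sums of terms, sorted by monomial.
  Polynomial : ℕ → Set
  Polynomial n = List (ℤ × Monomial n)

  ⟦_⟧ᵖ : ∀ {n} → Polynomial n → Vec ℤ n → ℤ
  ⟦ [] ⟧ᵖ          ρ = 0ℤ
  ⟦ (c , m) ∷ p ⟧ᵖ ρ = c * ⟦ m ⟧ᵐ ρ + ⟦ p ⟧ᵖ ρ

  cons : ∀ {n} → ℤ → Monomial n → Polynomial n → Polynomial n
  cons (+ 0) m p = p
  cons c     m p = (c , m) ∷ p

  insert : ∀ {n} → ℤ → Monomial n → Polynomial n → Polynomial n
  insert c m []                 = cons c m []
  insert c m ((d , m′) ∷ p) with compare m m′
  ... | lt   = (c , m) ∷ (d , m′) ∷ p
  ... | gt   = (d , m′) ∷ insert c m p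
  ... | eq _ = cons (c + d) m p

  add : ∀ {n} → Polynomial n → Polynomial n → Polynomial n
  add []            q = q
  add ((c , m) ∷ p) q = insert c m (add p q)

  addScaled : ∀ {n} → ℤ → Monomial n → Polynomial n → Polynomial n → Polynomial n
  addScaled c m []             r = r
  addScaled c m ((d , m′) ∷ q) r = insert (c * d) (zipWith ℕ._+_ m m′) (addScaled c m q r)

  mul : ∀ {n} → Polynomial n → Polynomial n → Polynomial n
  mul []            q = []
  mul ((c , m) ∷ p) q = addScaled c m q (mul p q)

  unit : ∀ {n} → Fin n → Monomial n
  unit zero    = 1 ∷ replicate _ 0
  unit (suc i) = 0 ∷ unit i

  one : ∀ {n} → Monomial n
  one = replicate _ 0

  negate : ∀ {n} → Polynomial n → Polynomial n
  negate p = addScaled -1ℤ one p []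

  normalise : ∀ {s n} → Expr s n → Polynomial n
  normalise (var i)  = (1ℤ , unit i) ∷ []
  normalise (# k)    = cons (+ k) one []
  normalise (e :+ f) = add (normalise e) (normalise f)
  normalise (e :* f) = mul (normalise e) (normalise f)
  normalise (e :- f) = add (normalise e) (negate (normalise f))
  normalise (:- e)   = negate (normalise e)

  module _ {n : ℕ} (ρ : Vec ℤ n) where

    cons-sound : ∀ c m p → ⟦ cons c m p ⟧ᵖ ρ ≡ c * ⟦ m ⟧ᵐ ρ + ⟦ p ⟧ᵖ ρ
    cons-sound (+ 0)      m p = sym (+-identityˡ (⟦ p ⟧ᵖ ρ))
    cons-sound (+ suc _)  m p = refl
    cons-sound -[1+ _ ]   m p = refl

    insert-sound : ∀ c m p → ⟦ insert c m p ⟧ᵖ ρ ≡ c * ⟦ m ⟧ᵐ ρ + ⟦ p ⟧ᵖ ρ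
    insert-sound c m [] = cons-sound c m []
    insert-sound c m ((d , m′) ∷ p) with compare m m′
    ... | lt      = refl
    ... | gt      = trans (cong (_+_ (d * ⟦ m′ ⟧ᵐ ρ)) (insert-sound c m p)) (+-exchange (d * ⟦ m′ ⟧ᵐ ρ) (c * ⟦ m ⟧ᵐ ρ) (⟦ p ⟧ᵖ ρ))
    ... | eq refl = trans (cons-sound (c + d) m p) (trans (cong (_+ ⟦ p ⟧ᵖ ρ) (*-distribʳ-+ (⟦ m ⟧ᵐ ρ) c d)) (+-assoc (c * ⟦ m ⟧ᵐ ρ) (d * ⟦ m ⟧ᵐ ρ) (⟦ p ⟧ᵖ ρ)))

    add-sound : ∀ p q → ⟦ add p q ⟧ᵖ ρ ≡ ⟦ p ⟧ᵖ ρ + ⟦ q ⟧ᵖ ρ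
    add-sound []            q = sym (+-identityˡ (⟦ q ⟧ᵖ ρ))
    add-sound ((c , m) ∷ p) q = trans (insert-sound c m (add p q)) (trans (cong (_+_ (c * ⟦ m ⟧ᵐ ρ)) (add-sound p q)) (sym (+-assoc (c * ⟦ m ⟧ᵐ ρ) (⟦ p ⟧ᵖ ρ) (⟦ q ⟧ᵖ ρ))))

  monomial-* : ∀ {n} (m m′ : Monomial n) ρ → ⟦ zipWith ℕ._+_ m m′ ⟧ᵐ ρ ≡ ⟦ m ⟧ᵐ ρ * ⟦ m′ ⟧ᵐ ρ
  monomial-* []      []        []      = refl
  monomial-* (e ∷ m) (e′ ∷ m′) (x ∷ ρ) = trans (cong₂ _*_ (^-distribˡ-+-* x e e′) (monomial-* m m′ ρ)) (*-interchange (x ^ e) (x ^ e′) (⟦ m ⟧ᵐ ρ) (⟦ m′ ⟧ᵐ ρ))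

  one-sound : ∀ {n} (ρ : Vec ℤ n) → ⟦ one ⟧ᵐ ρ ≡ 1ℤ
  one-sound []      = refl
  one-sound (x ∷ ρ) = trans (*-identityˡ _) (one-sound ρ)

  unit-sound : ∀ {n} (i : Fin n) ρ → ⟦ unit i ⟧ᵐ ρ ≡ lookup ρ i
  unit-sound zero    (x ∷ ρ) = trans (cong₂ _*_ (*-identityʳ x) (one-sound ρ)) (*-identityʳ x)
  unit-sound (suc i) (x ∷ ρ) = trans (*-identityˡ _) (unit-sound i ρ)

  module _ {n : ℕ} (ρ : Vec ℤ n) where

    addScaled-sound : ∀ c m q r → ⟦ addScaled c m q r ⟧ᵖ ρ ≡ c * ⟦ m ⟧ᵐ ρ * ⟦ q ⟧ᵖ ρ + ⟦ r ⟧ᵖ ρ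
    addScaled-sound c m []             r = sym (trans (cong (_+ ⟦ r ⟧ᵖ ρ) (*-zeroʳ (c * ⟦ m ⟧ᵐ ρ))) (+-identityˡ (⟦ r ⟧ᵖ ρ)))
    addScaled-sound c m ((d , m′) ∷ q) r = begin
      ⟦ insert (c * d) (zipWith ℕ._+_ m m′) (addScaled c m q r) ⟧ᵖ ρ
        ≡⟨ insert-sound ρ (c * d) (zipWith ℕ._+_ m m′) (addScaled c m q r) ⟩
      c * d * ⟦ zipWith ℕ._+_ m m′ ⟧ᵐ ρ + ⟦ addScaled c m q r ⟧ᵖ ρ
        ≡⟨ cong₂ _+_ (trans (cong (c * d *_) (monomial-* m m′ ρ)) (*-interchange c d M (⟦ m′ ⟧ᵐ ρ))) (addScaled-sound c m q r) ⟩
      c * M * (d * ⟦ m′ ⟧ᵐ ρ) + (c * M * ⟦ q ⟧ᵖ ρ + ⟦ r ⟧ᵖ ρ)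
        ≡⟨ sym (+-assoc (c * M * (d * ⟦ m′ ⟧ᵐ ρ)) (c * M * ⟦ q ⟧ᵖ ρ) (⟦ r ⟧ᵖ ρ)) ⟩
      c * M * (d * ⟦ m′ ⟧ᵐ ρ) + c * M * ⟦ q ⟧ᵖ ρ + ⟦ r ⟧ᵖ ρ
        ≡⟨ cong (_+ ⟦ r ⟧ᵖ ρ) (sym (*-distribˡ-+ (c * M) (d * ⟦ m′ ⟧ᵐ ρ) (⟦ q ⟧ᵖ ρ))) ⟩
      c * M * (d * ⟦ m′ ⟧ᵐ ρ + ⟦ q ⟧ᵖ ρ) + ⟦ r ⟧ᵖ ρ ∎
      where
      open ≡-Reasoning
      M : ℤ
      M = ⟦ m ⟧ᵐ ρ

    mul-sound : ∀ p q → ⟦ mul p q ⟧ᵖ ρ ≡ ⟦ p ⟧ᵖ ρ * ⟦ q ⟧ᵖ ρ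
    mul-sound []            q = refl
    mul-sound ((c , m) ∷ p) q = trans (addScaled-sound c m q (mul p q)) (trans (cong (_+_ (c * ⟦ m ⟧ᵐ ρ * ⟦ q ⟧ᵖ ρ)) (mul-sound p q))
      (sym (*-distribʳ-+ (⟦ q ⟧ᵖ ρ) (c * ⟦ m ⟧ᵐ ρ) (⟦ p ⟧ᵖ ρ))))

    negate-sound : ∀ p → ⟦ negate p ⟧ᵖ ρ ≡ - ⟦ p ⟧ᵖ ρ
    negate-sound p = trans (addScaled-sound -1ℤ one p []) (trans (+-identityʳ _) (trans (cong (λ z → -1ℤ * z * ⟦ p ⟧ᵖ ρ) (one-sound ρ)) (-1*i≡-i (⟦ p ⟧ᵖ ρ))))

    normalise-sound : ∀ {s} (e : Expr s n) → ⟦ normalise e ⟧ᵖ ρ ≡ evalℤ e ρ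
    normalise-sound (var i)  = trans (+-identityʳ _) (trans (*-identityˡ _) (unit-sound i ρ))
    normalise-sound (# k)    = trans (cons-sound ρ (+ k) one []) (trans (+-identityʳ _) (trans (cong (+ k *_) (one-sound ρ)) (*-identityʳ (+ k))))
    normalise-sound (e :+ f) = trans (add-sound ρ (normalise e) (normalise f)) (cong₂ _+_ (normalise-sound e) (normalise-sound f))
    normalise-sound (e :* f) = trans (mul-sound (normalise e) (normalise f)) (cong₂ _*_ (normalise-sound e) (normalise-sound f))
    normalise-sound (e :- f) = trans (add-sound ρ (normalise e) (negate (normalise f))) (cong₂ _+_ (normalise-sound e) (trans (negate-sound (normalise f)) (cong -_ (normalise-sound f))))
    normalise-sound (:- e)   = trans (negate-sound (normalise e)) (cong -_ (normalise-sound e))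

  -- Two sides agree if their difference normalises to no terms at all; for this `cons` drops zero
  -- coefficients. On closed expressions the type computes.
  Same : ∀ {s n} → Expr s n × Expr s n → Set
  Same (e , f) = T (null (add (normalise e) (negate (normalise f))))

  same⇒≡ℤ : ∀ {s n} (ef : Expr s n × Expr s n) → Same ef → ∀ ρ → evalℤ (proj₁ ef) ρ ≡ evalℤ (proj₂ ef) ρ
  same⇒≡ℤ (e , f) p ρ = i-j≡0⇒i≡j _ _ (trans (sym difference) (empty (add (normalise e) (negate (normalise f))) p))
    where
    empty : ∀ q → T (null q) → ⟦ q ⟧ᵖ ρ ≡ 0ℤ
    empty [] _ = refl
    difference : ⟦ add (normalise e) (negate (normalise f)) ⟧ᵖ ρ ≡ evalℤ e ρ - evalℤ f ρ
    difference = trans (add-sound ρ (normalise e) (negate (normalise f)))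
      (cong₂ _+_ (normalise-sound ρ e) (trans (negate-sound ρ (normalise f)) (cong -_ (normalise-sound ρ f))))

  evalℤ-pos : ∀ {n} (e : Expr false n) ρ → evalℤ e (Vec.map +_ ρ) ≡ + evalℕ e ρ
  evalℤ-pos (var i)  ρ = VecP.lookup-map i +_ ρ
  evalℤ-pos (# k)    ρ = refl
  evalℤ-pos (e :+ f) ρ = trans (cong₂ _+_ (evalℤ-pos e ρ) (evalℤ-pos f ρ)) (sym (pos-+ (evalℕ e ρ) (evalℕ f ρ)))
  evalℤ-pos (e :* f) ρ = trans (cong₂ _*_ (evalℤ-pos e ρ) (evalℤ-pos f ρ)) (sym (pos-* (evalℕ e ρ) (evalℕ f ρ)))

  same⇒≡ℕ : ∀ {n} (ef : Expr false n × Expr false n) → Same ef → ∀ ρ → evalℕ (proj₁ ef) ρ ≡ evalℕ (proj₂ ef) ρ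
  same⇒≡ℕ (e , f) p ρ = +-injective (trans (sym (evalℤ-pos e ρ)) (trans (same⇒≡ℤ (e , f) p (Vec.map +_ ρ)) (evalℤ-pos f ρ)))

  _⇶_⟶_ : ℕ → Set → Set → Set
  zero  ⇶ A ⟶ B = B
  suc n ⇶ A ⟶ B = A → n ⇶ A ⟶ B

  apply : ∀ {A B : Set} n → n ⇶ A ⟶ B → Vec A n → B
  apply zero    f []       = f
  apply (suc n) f (x ∷ xs) = apply n (f x) xs

  close : ∀ {s} n → n ⇶ Expr s n ⟶ (Expr s n × Expr s n) → Expr s n × Expr s n
  close n f = apply n f (Vec.map var (allFin n))

  For : ∀ {A : Set} n → (Vec A n → Set) → Set
  For zero    P = P []
  For (suc n) P = ∀ x → For n (λ xs → P (x ∷ xs))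

  for : ∀ {A : Set} n {P : Vec A n → Set} → (∀ xs → P xs) → For n P
  for zero    h = h []
  for (suc n) h = λ x → for n (λ xs → h (x ∷ xs))

  -- The hidden argument has type `T true` as soon as the two normal forms cancel, and the η-rule of
  -- the unit type fills it in. An identity is thus proved by writing it down.
  ring : ∀ n (f : n ⇶ Expr true n ⟶ (Expr true n × Expr true n)) → {Same (close n f)} →
    For n (λ ρ → evalℤ (proj₁ (close n f)) ρ ≡ evalℤ (proj₂ (close n f)) ρ)
  ring n f {p} = for n (same⇒≡ℤ (close n f) p)

  semiring : ∀ n (f : n ⇶ Expr false n ⟶ (Expr false n × Expr false n)) → {Same (close n f)} →
    For n (λ ρ → evalℕ (proj₁ (close n f)) ρ ≡ evalℕ (proj₂ (close n f)) ρ)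
  semiring n f {p} = for n (same⇒≡ℕ (close n f) p)

-- Finite sums and products, indicators, reindexing.

module Sums where

  open Normalisation using (ring; _⊜_; _:+_; _:-_; _:*_; :-_; #_)
  open import Data.Bool.Base using (if_then_else_)
  open import Data.Integer.Base hiding (suc)
  open ℤP
  open import Relation.Nullary.Decidable using (dec-true; dec-false)
  open import Algebra.Structures using (IsCommutativeMonoid)

  ≤-by : ∀ {x y} d → 0ℤ ≤ d → y - x ≡ d → x ≤ y
  ≤-by d p eq = 0≤i-j⇒j≤i (subst (0ℤ ≤_) (sym eq) p)

  0≤+ : ∀ {x y} → 0ℤ ≤ x → 0ℤ ≤ y → 0ℤ ≤ x + y
  0≤+ p q = +-mono-≤ p q

  0≤* : ∀ {x y} → 0ℤ ≤ x → 0ℤ ≤ y → 0ℤ ≤ x * y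
  0≤* {+ m} {+ n} _ _ = subst (0ℤ ≤_) (pos-* m n) (+≤+ ℕ.z≤n)
  0≤* { -[1+ m ]} ()
  0≤* {+ m} { -[1+ n ]} _ ()

  i<j⇒0<j-i : ∀ {i j} → i < j → 0ℤ < j - i
  i<j⇒0<j-i {i} {j} i<j = subst (_< j - i) (+-inverseʳ i) (+-monoˡ-< (- i) i<j)

  +-cancelˡ-≡ : ∀ k {x y} → k + x ≡ k + y → x ≡ y
  +-cancelˡ-≡ k {x} {y} e = trans (l k x) (trans (cong (_- k) e) (sym (l k y)))
    where
    l = ring 2 λ k x → x ⊜ (k :+ x) :- k

  +-cancelʳ-≡ : ∀ k {x y} → x + k ≡ y + k → x ≡ y
  +-cancelʳ-≡ k {x} {y} e = +-cancelˡ-≡ k (trans (+-comm k x) (trans e (+-comm y k)))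

  0≤pos : ∀ {n} → 0ℤ ≤ + n
  0≤pos = +≤+ ℕ.z≤n

  0≤sq : ∀ x → 0ℤ ≤ x * x
  0≤sq (+ n)    = 0≤* {+ n} {+ n} 0≤pos 0≤pos
  0≤sq -[1+ n ] = +≤+ ℕ.z≤n

  0≤⇒≡+ : ∀ {x} → 0ℤ ≤ x → ∃[ n ] x ≡ + n
  0≤⇒≡+ {+ n} _ = n , refl
  0≤⇒≡+ { -[1+ n ]} ()

  module BigOp (_∙_ : ℤ → ℤ → ℤ) (ε : ℤ) (isCM : IsCommutativeMonoid _≡_ _∙_ ε) where
    open IsCommutativeMonoid isCM using (assoc; comm; identityˡ; identityʳ)

    ⨁ : ℕ → (ℕ → ℤ) → ℤ
    ⨁ zero    f = ε
    ⨁ (suc n) f = ⨁ n f ∙ f n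

    ⨁-cong< : ∀ n {f g} → (∀ i → i ℕ.< n → f i ≡ g i) → ⨁ n f ≡ ⨁ n g
    ⨁-cong< zero    h = refl
    ⨁-cong< (suc n) h = cong₂ _∙_ (⨁-cong< n (λ i p → h i (ℕP.m<n⇒m<1+n p))) (h n (ℕP.n<1+n n))

    ⨁-cong : ∀ n {f g} → (∀ i → f i ≡ g i) → ⨁ n f ≡ ⨁ n g
    ⨁-cong n h = ⨁-cong< n (λ i _ → h i)

    ⨁-ε : ∀ n → ⨁ n (λ _ → ε) ≡ ε
    ⨁-ε zero    = refl
    ⨁-ε (suc n) = trans (cong (_∙ ε) (⨁-ε n)) (identityˡ ε)

    ⨁-vanish : ∀ n {f} → (∀ i → i ℕ.< n → f i ≡ ε) → ⨁ n f ≡ ε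
    ⨁-vanish n h = trans (⨁-cong< n h) (⨁-ε n)

    interchange : ∀ a b c d → (a ∙ b) ∙ (c ∙ d) ≡ (a ∙ c) ∙ (b ∙ d)
    interchange a b c d = begin
      (a ∙ b) ∙ (c ∙ d) ≡⟨ assoc a b _ ⟩
      a ∙ (b ∙ (c ∙ d)) ≡⟨ cong (a ∙_) (sym (assoc b c d)) ⟩
      a ∙ ((b ∙ c) ∙ d) ≡⟨ cong (λ u → a ∙ (u ∙ d)) (comm b c) ⟩
      a ∙ ((c ∙ b) ∙ d) ≡⟨ cong (a ∙_) (assoc c b d) ⟩
      a ∙ (c ∙ (b ∙ d)) ≡⟨ sym (assoc a c _) ⟩
      (a ∙ c) ∙ (b ∙ d) ∎
      where open ≡-Reasoning

    ⨁-∙ : ∀ n f g → ⨁ n (λ i → f i ∙ g i) ≡ ⨁ n f ∙ ⨁ n g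
    ⨁-∙ zero    f g = sym (identityˡ ε)
    ⨁-∙ (suc n) f g = trans (cong (_∙ (f n ∙ g n)) (⨁-∙ n f g)) (interchange _ _ _ _)

    ⨁-swap : ∀ m n (f : ℕ → ℕ → ℤ) →
      ⨁ m (λ i → ⨁ n (f i)) ≡ ⨁ n (λ j → ⨁ m (λ i → f i j))
    ⨁-swap zero    n f = sym (⨁-ε n)
    ⨁-swap (suc m) n f = trans (cong (_∙ ⨁ n (f m)) (⨁-swap m n f)) (sym (⨁-∙ n _ _))

    ⨁-split : ∀ m n f → ⨁ (m ℕ.+ n) f ≡ ⨁ m f ∙ ⨁ n (λ i → f (m ℕ.+ i))
    ⨁-split m zero    f rewrite ℕP.+-identityʳ m = sym (identityʳ _)
    ⨁-split m (suc n) f rewrite ℕP.+-suc m n =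
      trans (cong (_∙ f (m ℕ.+ n)) (⨁-split m n f)) (assoc _ _ _)

    ⨁-extend : ∀ {m n} f → m ℕ.≤ n → (∀ i → m ℕ.≤ i → i ℕ.< n → f i ≡ ε) → ⨁ n f ≡ ⨁ m f
    ⨁-extend {m} {n} f m≤n h = subst (λ k → ⨁ k f ≡ ⨁ m f) (ℕP.m+[n∸m]≡n m≤n)
      (trans (⨁-split m (n ℕ.∸ m) f) (trans (cong (⨁ m f ∙_) (⨁-vanish (n ℕ.∸ m) λ i i< →
        h (m ℕ.+ i) (ℕP.m≤m+n m i)
          (subst (m ℕ.+ i ℕ.<_) (ℕP.m+[n∸m]≡n m≤n) (ℕP.+-monoʳ-< m i<)))) (identityʳ _)))

    ⨁-blocks : ∀ m n f → ⨁ (n ℕ.* m) f ≡ ⨁ n (λ j → ⨁ m (λ i → f (j ℕ.* m ℕ.+ i)))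
    ⨁-blocks m zero    f = refl
    ⨁-blocks m (suc n) f = trans (cong (λ k → ⨁ k f) (ℕP.+-comm m (n ℕ.* m)))
      (trans (⨁-split (n ℕ.* m) m f) (cong (λ u → u ∙ ⨁ m (λ i → f (n ℕ.* m ℕ.+ i))) (⨁-blocks m n f)))

    ⨁-cons : ∀ n f → ⨁ (suc n) f ≡ f 0 ∙ ⨁ n (f ∘ suc)
    ⨁-cons n f = trans (⨁-split 1 n f) (cong (_∙ ⨁ n (f ∘ suc)) (identityˡ (f 0)))

    ⨁-collapse : ∀ n {i₀} f → i₀ ℕ.< n → (∀ i → i ℕ.< n → i ≢ i₀ → f i ≡ ε) → ⨁ n f ≡ f i₀
    ⨁-collapse (suc n) {i₀} f i₀< h with i₀ ℕP.≟ n
    ... | yes refl = trans (cong (_∙ f n) (⨁-vanish n λ i i< →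
      h i (ℕP.m<n⇒m<1+n i<) (ℕP.<⇒≢ i<))) (identityˡ _)
    ... | no  i₀≢n = trans (cong₂ _∙_
        (⨁-collapse n f (ℕP.≤∧≢⇒< (ℕ.s≤s⁻¹ i₀<) i₀≢n) (λ i i< → h i (ℕP.m<n⇒m<1+n i<)))
        (h n (ℕP.n<1+n n) (i₀≢n ∘ sym)))
      (identityʳ _)

  open BigOp _+_ 0ℤ +-0-isCommutativeMonoid public
    renaming ( ⨁ to ∑; ⨁-cong< to ∑-cong<; ⨁-cong to ∑-cong; ⨁-ε to ∑-0; ⨁-vanish to ∑-vanish
             ; ⨁-∙ to ∑-+; ⨁-swap to ∑-swap; ⨁-split to ∑-split; ⨁-extend to ∑-extend
             ; ⨁-blocks to ∑-blocks; ⨁-cons to ∑-cons; ⨁-collapse to ∑-collapse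
             ; interchange to +-interchange)

  open BigOp _*_ 1ℤ *-1-isCommutativeMonoid public
    renaming ( ⨁ to ∏; ⨁-cong< to ∏-cong<; ⨁-cong to ∏-cong; ⨁-ε to ∏-1; ⨁-vanish to ∏-vanish
             ; ⨁-∙ to ∏-*; ⨁-swap to ∏-swap; ⨁-split to ∏-split; ⨁-extend to ∏-extend
             ; ⨁-blocks to ∏-blocks; ⨁-cons to ∏-cons; ⨁-collapse to ∏-collapse
             ; interchange to *-interchange)

  *-∑ : ∀ n k f → k * ∑ n f ≡ ∑ n (λ i → k * f i)
  *-∑ zero    k f = *-zeroʳ k
  *-∑ (suc n) k f = trans (*-distribˡ-+ k (∑ n f) (f n)) (cong (_+ k * f n) (*-∑ n k f))

  ∑-* : ∀ n k f → ∑ n f * k ≡ ∑ n (λ i → f i * k)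
  ∑-* n k f = trans (*-comm _ k) (trans (*-∑ n k f) (∑-cong n (λ i → *-comm k (f i))))

  ∑-neg : ∀ n f → ∑ n (λ i → - f i) ≡ - ∑ n f
  ∑-neg zero    f = refl
  ∑-neg (suc n) f = trans (cong (_+ - f n) (∑-neg n f)) (sym (neg-distrib-+ (∑ n f) (f n)))

  ∑-- : ∀ n f g → ∑ n (λ i → f i - g i) ≡ ∑ n f - ∑ n g
  ∑-- n f g = trans (∑-+ n f (λ i → - g i)) (cong (_+_ (∑ n f)) (∑-neg n g))

  ∑-const : ∀ n k → ∑ n (λ _ → k) ≡ + n * k
  ∑-const zero    k = refl
  ∑-const (suc n) k = trans (cong (_+ k) (∑-const n k)) (eq (+ n) k)
    where
    eq = ring 2 λ a k → a :* k :+ k ⊜ (# 1 :+ a) :* k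

  ∑-nonneg : ∀ n {f} → (∀ i → i ℕ.< n → 0ℤ ≤ f i) → 0ℤ ≤ ∑ n f
  ∑-nonneg zero    h = ≤-refl
  ∑-nonneg (suc n) h = 0≤+ (∑-nonneg n (λ i p → h i (ℕP.m<n⇒m<1+n p))) (h n (ℕP.n<1+n n))

  ∑-zero-nonneg : ∀ n {f} → (∀ i → i ℕ.< n → 0ℤ ≤ f i) → ∑ n f ≤ 0ℤ → ∀ i → i ℕ.< n → f i ≡ 0ℤ
  ∑-zero-nonneg (suc n) {f} h s i i< with i ℕP.≟ n
  ... | yes refl = ≤-antisym
    (≤-trans (≤-by (∑ n f) (∑-nonneg n (λ i p → h i (ℕP.m<n⇒m<1+n p))) (eq (∑ n f) (f n))) s)
    (h n i<)
    where
    eq = ring 2 λ a b → (a :+ b) :- b ⊜ a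
  ... | no  i≢n  = ∑-zero-nonneg n (λ i p → h i (ℕP.m<n⇒m<1+n p))
    (≤-trans (≤-by (f n) (h n (ℕP.n<1+n n)) (eq (∑ n f) (f n))) s)
    i (ℕP.≤∧≢⇒< (ℕ.s≤s⁻¹ i<) i≢n)
    where
    eq = ring 2 λ a b → (a :+ b) :- a ⊜ b

  ∣∑∣≤ : ∀ n K {f} → (∀ i → i ℕ.< n → ∣ f i ∣ ℕ.≤ K) → ∣ ∑ n f ∣ ℕ.≤ n ℕ.* K
  ∣∑∣≤ zero    K h = ℕ.z≤n
  ∣∑∣≤ (suc n) K {f} h = ℕP.≤-trans (∣i+j∣≤∣i∣+∣j∣ (∑ n f) (f n))
    (ℕP.≤-trans (ℕP.+-mono-≤ (∣∑∣≤ n K (λ i p → h i (ℕP.m<n⇒m<1+n p))) (h n (ℕP.n<1+n n)))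
      (ℕP.≤-reflexive (ℕP.+-comm (n ℕ.* K) K)))

  abstract
    -- Opaque, so that no decision procedure is unfolded during type checking; indicators are
    -- handled only through the four rules that follow.
    ⟦_⟧ : ∀ {p} {P : Set p} → Dec P → ℤ
    ⟦ d ⟧ = if does d then 1ℤ else 0ℤ

    ⟦⟧-yes : ∀ {P : Set} (d : Dec P) → P → ⟦ d ⟧ ≡ 1ℤ
    ⟦⟧-yes (yes _) _ = refl
    ⟦⟧-yes (no ¬p) p = contradiction p ¬p

    ⟦⟧-no : ∀ {P : Set} (d : Dec P) → ¬ P → ⟦ d ⟧ ≡ 0ℤ
    ⟦⟧-no (yes p) ¬p = contradiction p ¬p
    ⟦⟧-no (no _)  _  = refl

    ⟦⟧-cong : ∀ {P Q : Set} (d : Dec P) (e : Dec Q) → (P → Q) → (Q → P) → ⟦ d ⟧ ≡ ⟦ e ⟧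
    ⟦⟧-cong (yes p) e f g = sym (⟦⟧-yes e (f p))
    ⟦⟧-cong (no ¬p) e f g = sym (⟦⟧-no e (¬p ∘ g))

    ⟦⟧-× : ∀ {P Q : Set} (d : Dec P) (e : Dec Q) → ⟦ d ×-dec e ⟧ ≡ ⟦ d ⟧ * ⟦ e ⟧
    ⟦⟧-× (yes p) (yes q) = refl
    ⟦⟧-× (yes p) (no ¬q) = refl
    ⟦⟧-× (no ¬p) (yes q) = refl
    ⟦⟧-× (no ¬p) (no ¬q) = refl

  ⟦⟧*-cong : ∀ {P : Set} (d : Dec P) {x y} → (P → x ≡ y) → ⟦ d ⟧ * x ≡ ⟦ d ⟧ * y
  ⟦⟧*-cong d@(yes p) h = cong (⟦ d ⟧ *_) (h p)
  ⟦⟧*-cong d@(no ¬p) {x} {y} h =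
    trans (cong (_* x) (⟦⟧-no d ¬p)) (sym (cong (_* y) (⟦⟧-no d ¬p)))

  ∑-δ : ∀ n {i₀} (f : ℕ → ℤ) → i₀ ℕ.< n → ∑ n (λ i → ⟦ i ℕP.≟ i₀ ⟧ * f i) ≡ f i₀
  ∑-δ n {i₀} f i₀< = trans
    (∑-collapse n (λ i → ⟦ i ℕP.≟ i₀ ⟧ * f i) i₀< (λ i _ i≢ → cong (_* f i) (⟦⟧-no (i ℕP.≟ i₀) i≢)))
    (trans (cong (_* f i₀) (⟦⟧-yes (i₀ ℕP.≟ i₀) refl)) (*-identityˡ (f i₀)))

  ∑-⟦⟧-unique : ∀ n {P : ℕ → Set} (P? : ∀ i → Dec (P i)) {i₀} → i₀ ℕ.< n → P i₀ →
    (∀ i → i ℕ.< n → P i → i ≡ i₀) → ∑ n (λ i → ⟦ P? i ⟧) ≡ 1ℤ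
  ∑-⟦⟧-unique n P? {i₀} i₀< p uniq = trans
    (∑-collapse n _ i₀< (λ i i< i≢ → ⟦⟧-no (P? i) (i≢ ∘ uniq i i<)))
    (⟦⟧-yes (P? i₀) p)

  ∑-⟦⟧-any : ∀ n {P : ℕ → Set} (P? : ∀ i → Dec (P i)) → ∑ n (λ i → ⟦ P? i ⟧) ≢ 0ℤ →
    ∃[ i ] i ℕ.< n × P i
  ∑-⟦⟧-any n P? h with ℕP.anyUpTo? P? n
  ... | yes p = p
  ... | no ¬p = contradiction (∑-vanish n (λ i i< → ⟦⟧-no (P? i) (λ p → ¬p (i , i< , p)))) h

  ∑-⟦⟧-≤1 : ∀ n {P : ℕ → Set} (P? : ∀ i → Dec (P i)) →
    (∀ {i j} → i ℕ.< n → j ℕ.< n → P i → P j → i ≡ j) → ∑ n (λ i → ⟦ P? i ⟧) ≤ 1ℤ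
  ∑-⟦⟧-≤1 n P? uniq with ℕP.anyUpTo? P? n
  ... | yes (i , i< , p) = ≤-reflexive (∑-⟦⟧-unique n P? i< p (λ j j< q → uniq j< i< q p))
  ... | no ¬p = subst (_≤ 1ℤ) (sym (∑-vanish n (λ i i< → ⟦⟧-no (P? i) (λ p → ¬p (i , i< , p))))) 0≤pos

  module Reindex {n : ℕ} {π : ℕ → ℕ} (π< : ∀ {i} → i ℕ.< n → π i ℕ.< n)
    (π-inj : ∀ {i j} → i ℕ.< n → j ℕ.< n → π i ≡ π j → i ≡ j) where

    private
      fibre : ℕ → ℤ
      fibre t = ∑ n (λ j → ⟦ π j ℕP.≟ t ⟧)

      fibre≤1 : ∀ t → fibre t ≤ 1ℤ
      fibre≤1 t = ∑-⟦⟧-≤1 n (λ j → π j ℕP.≟ t) (λ i< j< p q → π-inj i< j< (trans p (sym q)))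

      ∑fibre : ∑ n fibre ≡ + n
      ∑fibre = begin
        ∑ n fibre ≡⟨ ∑-swap n n (λ t j → ⟦ π j ℕP.≟ t ⟧) ⟩
        ∑ n (λ j → ∑ n (λ t → ⟦ π j ℕP.≟ t ⟧)) ≡⟨ ∑-cong< n (λ j j< →
          ∑-⟦⟧-unique n (λ t → π j ℕP.≟ t) (π< j<) refl (λ _ _ → sym)) ⟩
        ∑ n (λ _ → 1ℤ) ≡⟨ ∑-const n 1ℤ ⟩
        + n * 1ℤ ≡⟨ *-identityʳ (+ n) ⟩
        + n ∎
        where open ≡-Reasoning

      -- The deficits `1ℤ - fibre t` are nonnegative and add up to n - n = 0, so each of them
      -- vanishes: an injective self-map of the numbers below n is onto.
      fibre≡1 : ∀ t → t ℕ.< n → fibre t ≡ 1ℤ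
      fibre≡1 t t< = sym (i-j≡0⇒i≡j 1ℤ (fibre t)
        (∑-zero-nonneg n {λ t → 1ℤ - fibre t} (λ t _ → i≤j⇒0≤j-i (fibre≤1 t))
          (≤-reflexive (trans (∑-- n (λ _ → 1ℤ) fibre)
            (trans (cong₂ _-_ (trans (∑-const n 1ℤ) (*-identityʳ (+ n))) ∑fibre) (i≡j⇒i-j≡0 {+ n} refl))))
          t t<))

    surjective : ∀ {t} → t ℕ.< n → ∃[ j ] j ℕ.< n × π j ≡ t
    surjective {t} t< = ∑-⟦⟧-any n (λ j → π j ℕP.≟ t)
      (λ z → contradiction (trans (sym (fibre≡1 t t<)) z) λ ())

    module _ (_∙_ : ℤ → ℤ → ℤ) (ε : ℤ) (isCM : IsCommutativeMonoid _≡_ _∙_ ε) where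
      open BigOp _∙_ ε isCM

      -- The entries `at i t` sit on the graph of `π`; collapsing the rows gives one side,
      -- collapsing the columns the other.
      ⨁-reindex : ∀ f → ⨁ n (λ i → f (π i)) ≡ ⨁ n f
      ⨁-reindex f = begin
        ⨁ n (λ i → f (π i)) ≡⟨ ⨁-cong< n (λ i i< → sym (pick i i<)) ⟩
        ⨁ n (λ i → ⨁ n (at i)) ≡⟨ ⨁-swap n n at ⟩
        ⨁ n (λ t → ⨁ n (λ i → at i t)) ≡⟨ ⨁-cong< n pick′ ⟩
        ⨁ n f ∎
        where
        open ≡-Reasoning
        at : ℕ → ℕ → ℤ
        at i t = if does (π i ℕP.≟ t) then f t else ε
        at-≡ : ∀ {i t} → π i ≡ t → at i t ≡ f t
        at-≡ {i} {t} eq = cong (if_then f t else ε) (dec-true (π i ℕP.≟ t) eq)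
        at-≢ : ∀ {i t} → π i ≢ t → at i t ≡ ε
        at-≢ {i} {t} ne = cong (if_then f t else ε) (dec-false (π i ℕP.≟ t) ne)
        pick : ∀ i → i ℕ.< n → ⨁ n (at i) ≡ f (π i)
        pick i i< = trans (⨁-collapse n (at i) (π< i<) (λ t _ ne → at-≢ {i} (ne ∘ sym))) (at-≡ {i} refl)
        pick′ : ∀ t → t ℕ.< n → ⨁ n (λ i → at i t) ≡ f t
        pick′ t t< with surjective t<
        ... | j , j< , eq = trans (⨁-collapse n (λ i → at i t) j<
          (λ i i< ne → at-≢ {i} (λ e → ne (π-inj i< j< (trans e (sym eq)))))) (at-≡ {j} eq)

    ∑-reindex : ∀ f → ∑ n (λ i → f (π i)) ≡ ∑ n f
    ∑-reindex = ⨁-reindex _+_ 0ℤ +-0-isCommutativeMonoid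

    ∏-reindex : ∀ f → ∏ n (λ i → f (π i)) ≡ ∏ n f
    ∏-reindex = ⨁-reindex _*_ 1ℤ *-1-isCommutativeMonoid

  ∑-reverse : ∀ n f → ∑ n (λ i → f (n ℕ.∸ suc i)) ≡ ∑ n f
  ∑-reverse n = Reindex.∑-reindex {n} {λ i → n ℕ.∸ suc i}
    (λ {i} i< → ℕP.∸-monoʳ-< {n} {suc i} {0} (ℕ.s≤s ℕ.z≤n) i<)
    (λ {i} {j} i< j< eq → ℕP.suc-injective (ℕP.∸-cancelˡ-≡ i< j< eq))

-- Congruences and periodic functions.

module Modular where

  open Normalisation using (ring; _⊜_; _:+_; _:-_; _:*_; :-_; #_)
  open import Data.Integer.Base hiding (suc; _%_; _/_)
  open ℤD
  open ℤP
  open import Data.Nat.Base using (_%_; _/_)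
  open import Data.Nat.DivMod using (m%n<n; m≡m%n+[m/n]*n)
  open import Data.Nat.GCD using (module Bézout)
  open import Data.Nat.Primality using (Prime; euclidsLemma; prime⇒irreducible)
  open Sums

  infix 4 _≋_[_]

  record _≋_[_] (x y : ℤ) (n : ℕ) : Set where
    constructor mod
    field
      k  : ℤ
      eq : x ≡ y + k * + n

  ∣⇒≋ : ∀ {n x y} → + n ∣ x - y → x ≋ y [ n ]
  ∣⇒≋ {n} {x} {y} (divides q eq) = mod q (trans (l x y) (cong (_+_ y) eq))
    where
    l = ring 2 λ x y → x ⊜ y :+ (x :- y)

  ≋⇒∣ : ∀ {n x y} → x ≋ y [ n ] → + n ∣ x - y
  ≋⇒∣ {n} {y = y} (mod k refl) = divides k (l y (k * + n))
    where
    l = ring 2 λ y z → (y :+ z) :- y ⊜ z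

  ≋-reflexive : ∀ {n x y} → x ≡ y → x ≋ y [ n ]
  ≋-reflexive {n} {x} refl = mod 0ℤ (l x (+ n))
    where
    l = ring 2 λ x n → x ⊜ x :+ # 0 :* n

  ≋-refl : ∀ {n x} → x ≋ x [ n ]
  ≋-refl = ≋-reflexive refl

  ≋-sym : ∀ {n x y} → x ≋ y [ n ] → y ≋ x [ n ]
  ≋-sym {n} {y = y} (mod k refl) = mod (- k) (l y k (+ n))
    where
    l = ring 3 λ y k n → y ⊜ (y :+ k :* n) :+ :- k :* n

  ≋-trans : ∀ {n x y z} → x ≋ y [ n ] → y ≋ z [ n ] → x ≋ z [ n ]
  ≋-trans {n} {z = z} (mod k refl) (mod l refl) = mod (k + l) (e z k l (+ n))
    where
    e = ring 4 λ z k l n → (z :+ l :* n) :+ k :* n ⊜ z :+ (k :+ l) :* n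

  ≋-+ : ∀ {n x y z w} → x ≋ y [ n ] → z ≋ w [ n ] → x + z ≋ y + w [ n ]
  ≋-+ {n} {y = y} {w = w} (mod k refl) (mod l refl) = mod (k + l) (e y w k l (+ n))
    where
    e = ring 5 λ y w k l n → (y :+ k :* n) :+ (w :+ l :* n) ⊜ (y :+ w) :+ (k :+ l) :* n

  ≋-neg : ∀ {n x y} → x ≋ y [ n ] → - x ≋ - y [ n ]
  ≋-neg {n} {y = y} (mod k refl) = mod (- k) (e y k (+ n))
    where
    e = ring 3 λ y k n → :- (y :+ k :* n) ⊜ :- y :+ :- k :* n

  ≋-* : ∀ {n x y z w} → x ≋ y [ n ] → z ≋ w [ n ] → x * z ≋ y * w [ n ]
  ≋-* {n} {y = y} {w = w} (mod k refl) (mod l refl) =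
    mod (k * w + y * l + k * l * + n) (e y w k l (+ n))
    where
    e = ring 5 λ y w k l n → (y :+ k :* n) :* (w :+ l :* n) ⊜ y :* w :+ (k :* w :+ y :* l :+ k :* l :* n) :* n

  ≋-∏ : ∀ {n} r {f g} → (∀ i → i ℕ.< r → f i ≋ g i [ n ]) → ∏ r f ≋ ∏ r g [ n ]
  ≋-∏ zero    h = ≋-refl
  ≋-∏ (suc r) h = ≋-* (≋-∏ r (λ i p → h i (ℕP.m<n⇒m<1+n p))) (h r (ℕP.n<1+n r))

  ≋-∑ : ∀ {n} r {f g} → (∀ i → i ℕ.< r → f i ≋ g i [ n ]) → ∑ r f ≋ ∑ r g [ n ]
  ≋-∑ zero    h = ≋-refl
  ≋-∑ (suc r) h = ≋-+ (≋-∑ r (λ i p → h i (ℕP.m<n⇒m<1+n p))) (h r (ℕP.n<1+n r))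

  ≋0⇒∣ : ∀ {n x} → x ≋ 0ℤ [ n ] → + n ∣ x
  ≋0⇒∣ {n} {x} p = subst (+ n ∣_) (+-identityʳ x) (≋⇒∣ p)

  ∣⇒≋0 : ∀ {n x} → + n ∣ x → x ≋ 0ℤ [ n ]
  ∣⇒≋0 {n} {x} p = ∣⇒≋ (subst (+ n ∣_) (sym (+-identityʳ x)) p)

  ∣-resp-≋ : ∀ {n x y} → x ≋ y [ n ] → + n ∣ x → + n ∣ y
  ∣-resp-≋ e d = ≋0⇒∣ (≋-trans (≋-sym e) (∣⇒≋0 d))

  ℕ∣⇒∣ : ∀ {m n} → m ℕD.∣ n → + m ∣ + n
  ℕ∣⇒∣ = ∣ᵤ⇒∣

  ∣⇒ℕ∣ : ∀ {m n} → + m ∣ + n → m ℕD.∣ n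
  ∣⇒ℕ∣ = ∣⇒∣ᵤ

  %≋ : ∀ x n .{{_ : ℕ.NonZero n}} → + (x % n) ≋ + x [ n ]
  %≋ x n = ≋-sym (mod (+ (x / n)) (trans (cong +_ (m≡m%n+[m/n]*n x n))
    (cong (_+_ (+ (x % n))) (pos-* (x / n) n))))

  ∣∧∣∣<⇒≡0 : ∀ {n x} → + n ∣ x → ∣ x ∣ ℕ.< n → x ≡ 0ℤ
  ∣∧∣∣<⇒≡0 {n} {x} d lt with ∣ x ∣ in eq
  ... | zero  = ∣i∣≡0⇒i≡0 eq
  ... | suc k = contradiction (ℕD.∣⇒≤ (subst (n ℕD.∣_) eq (∣⇒∣ᵤ d))) (ℕP.<⇒≱ lt)

  ∣+m-+n∣< : ∀ {m n b} → m ℕ.< b → n ℕ.< b → ∣ + m - + n ∣ ℕ.< b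
  ∣+m-+n∣< {m} {n} {b} m< n< = subst (ℕ._< b) (cong ∣_∣ (sym (m-n≡m⊖n m n)))
    (ℕP.≤-<-trans (∣m⊝n∣≤m⊔n m n) (ℕP.⊔-lub m< n<))

  ≋⇒≡ : ∀ {n a b} → a ℕ.< n → b ℕ.< n → + a ≋ + b [ n ] → a ≡ b
  ≋⇒≡ {n} {a} {b} a< b< e =
    +-injective (i-j≡0⇒i≡j (+ a) (+ b) (∣∧∣∣<⇒≡0 (≋⇒∣ e) (∣+m-+n∣< a< b<)))

  %≡%⇒≋ : ∀ {n} .{{_ : ℕ.NonZero n}} a b → a % n ≡ b % n → + a ≋ + b [ n ]
  %≡%⇒≋ {n} a b e = ≋-trans (≋-sym (%≋ a n)) (≋-trans (≋-reflexive (cong +_ e)) (%≋ b n))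

  ≋⇒%≡% : ∀ {n} .{{_ : ℕ.NonZero n}} a b → + a ≋ + b [ n ] → a % n ≡ b % n
  ≋⇒%≡% {n} a b e = ≋⇒≡ (m%n<n a n) (m%n<n b n) (≋-trans (%≋ a n) (≋-trans e (≋-sym (%≋ b n))))

  coprime-cancel : ∀ {m n x} → Coprime n m → + n ∣ + m * x → + n ∣ x
  coprime-cancel {m} {n} {x} c d = ∣ᵤ⇒∣ (Coprimality.coprime-divisor {n = m} c
    (subst (n ℕD.∣_) (abs-* (+ m) x) (∣⇒∣ᵤ d)))

  ≋-cancel : ∀ {m n x y} → Coprime n m → + m * x ≋ + m * y [ n ] → x ≋ y [ n ]
  ≋-cancel {m} {n} {x} {y} c e = ∣⇒≋ (coprime-cancel {m} c (subst (+ n ∣_) (l (+ m) x y) (≋⇒∣ e)))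
    where
    l = ring 3 λ m x y → m :* x :- m :* y ⊜ m :* (x :- y)

  Prime∣ : ∀ {p} → Prime p → ∀ x y → + p ∣ x * y → (+ p ∣ x) ⊎ (+ p ∣ y)
  Prime∣ {p} pr x y d = Sum.map ∣ᵤ⇒∣ ∣ᵤ⇒∣
    (euclidsLemma ∣ x ∣ ∣ y ∣ pr (subst (p ℕD.∣_) (abs-* x y) (∣⇒∣ᵤ d)))

  prime∤⇒coprime : ∀ {p m} → Prime p → ¬ p ℕD.∣ m → Coprime p m
  prime∤⇒coprime {p} {m} pr ∤ {d} (d∣p , d∣m) with prime⇒irreducible pr d∣p
  ... | inj₁ refl = refl
  ... | inj₂ refl = contradiction d∣m ∤

  Periodic : ℕ → (ℕ → ℤ) → Set
  Periodic n G = ∀ x → G (x ℕ.+ n) ≡ G x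

  module _ {n : ℕ} {G : ℕ → ℤ} (per : Periodic n G) where

    periodic-* : ∀ k x → G (x ℕ.+ k ℕ.* n) ≡ G x
    periodic-* zero    x = cong G (ℕP.+-identityʳ x)
    periodic-* (suc k) x = trans (cong G (trans (cong (x ℕ.+_) (ℕP.+-comm n (k ℕ.* n)))
      (sym (ℕP.+-assoc x (k ℕ.* n) n)))) (trans (per _) (periodic-* k x))

    periodic-% : .{{_ : ℕ.NonZero n}} → ∀ x → G (x % n) ≡ G x
    periodic-% x = sym (trans (cong G (m≡m%n+[m/n]*n x n)) (periodic-* (x / n) (x % n)))

    -- As m is invertible modulo n, j ↦ i + m j permutes the residues, and a periodic function
    -- depends on the residue alone.
    ∑-affine : .{{_ : ℕ.NonZero n}} → ∀ m → Coprime n m → ∀ i → ∑ n (λ j → G (i ℕ.+ m ℕ.* j)) ≡ ∑ n G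
    ∑-affine m c i = trans (∑-cong n (λ j → sym (periodic-% (i ℕ.+ m ℕ.* j))))
      (Reindex.∑-reindex {n} {λ j → (i ℕ.+ m ℕ.* j) % n} (λ _ → m%n<n _ n) inj G)
      where
      inj : ∀ {j k} → j ℕ.< n → k ℕ.< n → (i ℕ.+ m ℕ.* j) % n ≡ (i ℕ.+ m ℕ.* k) % n → j ≡ k
      inj {j} {k} j< k< e = ≋⇒≡ j< k< (≋-cancel c (∣⇒≋ (subst (+ n ∣_)
        (trans (l (+ i) (+ (m ℕ.* j)) (+ (m ℕ.* k))) (cong₂ _-_ (pos-* m j) (pos-* m k)))
        (≋⇒∣ (%≡%⇒≋ _ _ e)))))
        where
        l = ring 3 λ i a b → (i :+ a) :- (i :+ b) ⊜ a :- b

-- Gauss's lemma and Euler's criterion.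

module Gauss where

  open Normalisation using (ring; _⊜_; _:+_; _:-_; _:*_; :-_; #_)
  open import Data.Bool.Base using (if_then_else_)
  open import Data.Integer.Base hiding (suc; _%_; _/_)
  open ℤD
  open ℤP
  open import Data.Nat.Base using (_%_; _/_)
  open import Data.Nat.DivMod using (m%n<n)
  open import Data.Nat.Primality using (Prime; prime⇒nonTrivial; ¬prime[1]; euclidsLemma)
  open Sums
  open Modular

  ±1 : ℤ → Set
  ±1 z = z ≡ 1ℤ ⊎ z ≡ -1ℤ

  ±1-* : ∀ {x y} → ±1 x → ±1 y → ±1 (x * y)
  ±1-* (inj₁ refl) (inj₁ refl) = inj₁ refl
  ±1-* (inj₁ refl) (inj₂ refl) = inj₂ refl
  ±1-* (inj₂ refl) (inj₁ refl) = inj₂ refl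
  ±1-* (inj₂ refl) (inj₂ refl) = inj₁ refl

  ±1-∏ : ∀ n {f} → (∀ i → ±1 (f i)) → ±1 (∏ n f)
  ±1-∏ zero    h = inj₁ refl
  ±1-∏ (suc n) h = ±1-* (±1-∏ n h) (h n)

  ±1-square : ∀ {x} → ±1 x → x * x ≡ 1ℤ
  ±1-square (inj₁ refl) = refl
  ±1-square (inj₂ refl) = refl

  ±1-≋ : ∀ {n x y} → 2 ℕ.< n → ±1 x → ±1 y → x ≋ y [ n ] → x ≡ y
  ±1-≋ {n} 2< px py e = i-j≡0⇒i≡j _ _ (∣∧∣∣<⇒≡0 (≋⇒∣ e) (ℕP.≤-<-trans (bound px py) 2<))
    where
    bound : ∀ {x y} → ±1 x → ±1 y → ∣ x - y ∣ ℕ.≤ 2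
    bound (inj₁ refl) (inj₁ refl) = ℕ.z≤n
    bound (inj₁ refl) (inj₂ refl) = ℕP.≤-refl
    bound (inj₂ refl) (inj₁ refl) = ℕP.≤-refl
    bound (inj₂ refl) (inj₂ refl) = ℕ.z≤n

  signOf : ∀ {P : Set} → Dec P → ℤ
  signOf d = if does d then 1ℤ else -1ℤ

  signOf-±1 : ∀ {P : Set} (d : Dec P) → ±1 (signOf d)
  signOf-±1 (yes _) = inj₁ refl
  signOf-±1 (no  _) = inj₂ refl

  ∏-const-* : ∀ n x y → ∏ n (λ _ → x * y) ≡ ∏ n (λ _ → x) * ∏ n (λ _ → y)
  ∏-const-* n x y = ∏-* n (λ _ → x) (λ _ → y)

  prime∣∏ : ∀ {p} → Prime p → ∀ n {f} → + p ∣ ∏ n f → ∃[ i ] i ℕ.< n × + p ∣ f i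
  prime∣∏ {p} pr zero d = contradiction (∣⇒ℕ∣ {p} {1} d) λ d′ →
    contradiction (sym (ℕD.∣1⇒≡1 d′)) (ℕP.<⇒≢ (ℕ.nonTrivial⇒n>1 p {{prime⇒nonTrivial pr}}))
  prime∣∏ pr (suc n) {f} d with Prime∣ pr (∏ n f) (f n) d
  ... | inj₂ e = n , ℕP.n<1+n n , e
  ... | inj₁ e with prime∣∏ pr n e
  ...   | i , i< , e′ = i , ℕP.m<n⇒m<1+n i< , e′

  -- Iterated forward differences stand in for the bound on the number of roots of a polynomial
  -- modulo p: they show that quadratic nonresidues exist.
  Δ : ℕ → (ℕ → ℤ) → ℕ → ℤ
  Δ zero    f x = f x
  Δ (suc n) f x = Δ n f (suc x) - Δ n f x

  pow : ℕ → ℕ → ℤ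
  pow k x = ∏ k (λ _ → + x)

  fact : ℕ → ℤ
  fact n = ∏ n (λ i → + suc i)

  Δ-cong : ∀ n {f g} → (∀ x → f x ≡ g x) → ∀ x → Δ n f x ≡ Δ n g x
  Δ-cong zero    h x = h x
  Δ-cong (suc n) h x = cong₂ _-_ (Δ-cong n h (suc x)) (Δ-cong n h x)

  -- The Leibniz rule has only two terms, because the differences of x vanish from the second on. It
  -- turns statements about `pow` into inductions on the exponent.
  Δ-leibniz : ∀ n g x →
    Δ (suc n) (λ x → g x * + x) x ≡ + x * Δ (suc n) g x + + suc n * Δ n g (suc x)
  Δ-leibniz zero g x = l (g (suc x)) (g x) (+ x)
    where
    l = ring 3 λ a b x → a :* (# 1 :+ x) :- b :* x ⊜ x :* (a :- b) :+ # 1 :* a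
  Δ-leibniz (suc n) g x rewrite Δ-leibniz n g x | Δ-leibniz n g (suc x) =
    l (Δ n g (suc (suc x))) (Δ n g (suc x)) (Δ n g x) (+ x) (+ n)
    where
    l = ring 5 λ a b c x n → ((# 1 :+ x) :* (a :- b) :+ (# 1 :+ n) :* a) :- (x :* (b :- c) :+ (# 1 :+ n) :* b) ⊜ x :* ((a :- b) :- (b :- c)) :+ (# 1 :+ (# 1 :+ n)) :* (a :- b)

  Δ-pow-< : ∀ n k x → k ℕ.< n → Δ n (pow k) x ≡ 0ℤ
  Δ-pow-< (suc zero) zero x _ = refl
  Δ-pow-< (suc (suc n)) zero x _ = cong₂ _-_ (Δ-pow-< (suc n) 0 (suc x) (ℕ.s≤s ℕ.z≤n)) (Δ-pow-< (suc n) 0 x (ℕ.s≤s ℕ.z≤n))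
  Δ-pow-< (suc n) (suc k) x (ℕ.s≤s k<n) = trans (Δ-leibniz n (pow k) x)
    (trans (cong₂ (λ u v → + x * u + + suc n * v) (Δ-pow-< (suc n) k x (ℕP.m<n⇒m<1+n k<n)) (Δ-pow-< n k (suc x) k<n))
      (l (+ x) (+ suc n)))
    where
    l = ring 2 λ a b → a :* # 0 :+ b :* # 0 ⊜ # 0

  Δ-pow : ∀ n x → Δ n (pow n) x ≡ fact n
  Δ-pow zero    x = refl
  Δ-pow (suc n) x = trans (Δ-leibniz n (pow n) x)
    (trans (cong₂ (λ u v → + x * u + + suc n * v) (Δ-pow-< (suc n) n x (ℕP.n<1+n n)) (Δ-pow n (suc x)))
      (l (+ x) (+ suc n) (fact n)))
    where
    l = ring 3 λ a b c → a :* # 0 :+ b :* c ⊜ c :* b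

  Δ-≋1 : ∀ {p} n {f} x → (∀ i → i ℕ.≤ suc n → f (i ℕ.+ x) ≋ 1ℤ [ p ]) → Δ (suc n) f x ≋ 0ℤ [ p ]
  Δ-≋1 zero    x h = ≋-+ (h 1 ℕP.≤-refl) (≋-neg (h 0 ℕ.z≤n))
  Δ-≋1 {p} (suc n) {f} x h = ≋-+
    (Δ-≋1 n (suc x) (λ i i≤ → subst (λ u → f u ≋ 1ℤ [ p ]) (sym (ℕP.+-suc i x)) (h (suc i) (ℕ.s≤s i≤))))
    (≋-neg (Δ-≋1 n x (λ i i≤ → h i (ℕP.m≤n⇒m≤1+n i≤))))

  module Symbol (r : ℕ) where

    p : ℕ
    p = suc (r ℕ.+ r)

    low? : ∀ x → Dec (x % p ℕ.≤ r)
    low? x = x % p ℕP.≤? r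

    sg : ℕ → ℤ
    sg x = signOf (low? x)

    -- The distance from x to the nearest multiple of p; `sg x` tells on which side of that multiple
    -- x lies.
    fold : ℕ → ℕ
    fold x = if does (low? x) then x % p else p ℕ.∸ x % p

    -- The sign of Gauss's lemma, used as the working form of the Legendre symbol: reciprocity reads
    -- its factors off from lattice points, and multiplicativity follows from `euler`.
    γ : ℕ → ℤ
    γ a = ∏ r (λ i → sg (a ℕ.* suc i))

    γ-±1 : ∀ a → ±1 (γ a)
    γ-±1 a = ±1-∏ r (λ i → signOf-±1 (low? (a ℕ.* suc i)))

    private
      fold-spec : ∀ x → fold x ℕ.≤ r × (+ x ≋ sg x * + fold x [ p ])
      fold-spec x = spec (low? x)
        where
        open ≡-Reasoning
        l₁ = ring 2 λ a b → a ⊜ (:- # 1) :* b :+ # 1 :* (a :+ b)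
        spec : (d : Dec (x % p ℕ.≤ r)) → let f = if does d then x % p else p ℕ.∸ x % p in
          f ℕ.≤ r × (+ x ≋ signOf d * + f [ p ])
        spec (yes l) = l , ≋-trans (≋-sym (%≋ x p)) (≋-reflexive (sym (*-identityˡ (+ (x % p)))))
        spec (no ¬l) = ℕP.m≤n+o⇒m∸n≤o (suc (r ℕ.+ r)) (x % p) (ℕP.+-monoˡ-≤ r (ℕP.≰⇒> ¬l)) ,
          ≋-trans (≋-sym (%≋ x p)) (mod 1ℤ (begin
            + (x % p) ≡⟨ l₁ (+ (x % p)) (+ (p ℕ.∸ x % p)) ⟩
            -1ℤ * + (p ℕ.∸ x % p) + + 1 * (+ (x % p) + + (p ℕ.∸ x % p))
              ≡⟨ cong (λ u → -1ℤ * + (p ℕ.∸ x % p) + + 1 * + u) (ℕP.m+[n∸m]≡n (ℕP.<⇒≤ (m%n<n x p))) ⟩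
            -1ℤ * + (p ℕ.∸ x % p) + + 1 * + p ∎))

    fold≤r : ∀ x → fold x ℕ.≤ r
    fold≤r = proj₁ ∘ fold-spec

    fold≋ : ∀ x → + x ≋ sg x * + fold x [ p ]
    fold≋ = proj₂ ∘ fold-spec

    sg-cong : ∀ x y → + x ≋ + y [ p ] → sg x ≡ sg y
    sg-cong x y e rewrite ≋⇒%≡% x y e = refl

    γ-cong : ∀ a b → + a ≋ + b [ p ] → γ a ≡ γ b
    γ-cong a b e = ∏-cong r (λ i → sg-cong (a ℕ.* suc i) (b ℕ.* suc i)
      (subst₂ (_≋_[ p ]) (sym (pos-* a (suc i))) (sym (pos-* b (suc i))) (≋-* e (≋-refl {x = + suc i}))))

    module _ (pr : Prime p) where

      1≤r : 1 ℕ.≤ r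
      1≤r = ℕP.n≢0⇒n>0 λ r≡0 → ¬prime[1] (subst (λ r → Prime (suc (r ℕ.+ r))) r≡0 pr)

      2<p : 2 ℕ.< p
      2<p = ℕ.s≤s (ℕP.+-mono-≤ 1≤r 1≤r)

      suc≤r⇒p∤ : ∀ {k} → k ℕ.< r → ¬ p ℕD.∣ suc k
      suc≤r⇒p∤ k<r d = ℕP.<⇒≱ (ℕ.s≤s (ℕP.≤-trans k<r (ℕP.m≤m+n r r))) (ℕD.∣⇒≤ d)

      p∤fact : ¬ + p ∣ fact r
      p∤fact d with prime∣∏ pr r d
      ... | i , i< , e = suc≤r⇒p∤ i< (∣⇒ℕ∣ e)

      module _ {a : ℕ} (p∤a : ¬ p ℕD.∣ a) where

        private
          c : Coprime p a
          c = prime∤⇒coprime pr p∤a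

          -- `fold` permutes 1, ..., r; the shift by one makes it a permutation of the indices 0,
          -- ..., r - 1.
          π : ℕ → ℕ
          π i = ℕ.pred (fold (a ℕ.* suc i))

          fold≢0 : ∀ {i} → i ℕ.< r → fold (a ℕ.* suc i) ≢ 0
          fold≢0 {i} i< e = suc≤r⇒p∤ i< (∣⇒ℕ∣ (coprime-cancel {a} c (subst (+ p ∣_) (pos-* a (suc i))
            (≋0⇒∣ (≋-trans (fold≋ (a ℕ.* suc i)) (≋-reflexive
              (trans (cong (λ u → sg (a ℕ.* suc i) * + u) e) (*-zeroʳ (sg (a ℕ.* suc i))))))))))

          suc-π : ∀ {i} → i ℕ.< r → suc (π i) ≡ fold (a ℕ.* suc i)
          suc-π {i} i< = ℕP.suc-pred (fold (a ℕ.* suc i)) {{ℕ.≢-nonZero (fold≢0 i<)}}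

          π< : ∀ {i} → i ℕ.< r → π i ℕ.< r
          π< {i} i< = subst (ℕ._≤ r) (sym (suc-π i<)) (fold≤r (a ℕ.* suc i))

          -- From a x ≡ ± a y and 0 < x, y < p / 2 the sign must be + .
          same : ∀ {i j s t} → i ℕ.< r → j ℕ.< r → ±1 s → ±1 t → ∀ {u} →
            + a * + suc i ≋ s * u [ p ] → + a * + suc j ≋ t * u [ p ] → i ≡ j
          same {i} {j} i< j< ps pt {u} e f = go ps pt e f
            where
            up : ∀ {k} → k ℕ.< r → suc k ℕ.< p
            up k< = ℕ.s≤s (ℕP.≤-trans k< (ℕP.m≤m+n r r))
            eqs : + a * + suc i ≋ + a * + suc j [ p ] → i ≡ j
            eqs e = ℕP.suc-injective (≋⇒≡ (up i<) (up j<) (≋-cancel c e))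
            opp : + a * + suc i ≋ - (+ a * + suc j) [ p ] → i ≡ j
            opp e = contradiction
              (ℕD.∣⇒≤ (∣⇒ℕ∣ (coprime-cancel {a} c (subst (+ p ∣_) (l (+ a) (+ suc i) (+ suc j)) (≋⇒∣ e)))))
              (ℕP.<⇒≱ (ℕ.s≤s (ℕP.+-mono-≤ i< j<)))
              where
              l = ring 3 λ a x y → a :* x :- :- (a :* y) ⊜ a :* (x :+ y)
            -1* : ∀ {u} → -1ℤ * u ≡ - (1ℤ * u)
            -1* {u} = l u
              where
              l = ring 1 λ u → (:- # 1) :* u ⊜ :- (# 1 :* u)
            1*-1* : ∀ {u} → 1ℤ * u ≡ - (-1ℤ * u)
            1*-1* {u} = l u
              where
              l = ring 1 λ u → # 1 :* u ⊜ :- ((:- # 1) :* u)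
            go : ∀ {s t} → ±1 s → ±1 t → + a * + suc i ≋ s * u [ p ] → + a * + suc j ≋ t * u [ p ] → i ≡ j
            go (inj₁ refl) (inj₁ refl) e f = eqs (≋-trans e (≋-sym f))
            go (inj₂ refl) (inj₂ refl) e f = eqs (≋-trans e (≋-sym f))
            go (inj₁ refl) (inj₂ refl) e f = opp (≋-trans e (≋-trans (≋-reflexive 1*-1*) (≋-neg (≋-sym f))))
            go (inj₂ refl) (inj₁ refl) e f = opp (≋-trans e (≋-trans (≋-reflexive -1*) (≋-neg (≋-sym f))))

          fold≋′ : ∀ i → + a * + suc i ≋ sg (a ℕ.* suc i) * + fold (a ℕ.* suc i) [ p ]
          fold≋′ i = ≋-trans (≋-reflexive (sym (pos-* a (suc i)))) (fold≋ (a ℕ.* suc i))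

          π-inj : ∀ {i j} → i ℕ.< r → j ℕ.< r → π i ≡ π j → i ≡ j
          π-inj {i} {j} i< j< e = same i< j< (signOf-±1 (low? (a ℕ.* suc i))) (signOf-±1 (low? (a ℕ.* suc j)))
            (fold≋′ i)
            (subst (λ u → + a * + suc j ≋ sg (a ℕ.* suc j) * + u [ p ])
              (trans (sym (suc-π j<)) (trans (cong suc (sym e)) (suc-π i<))) (fold≋′ j))

          ∏fold : ∏ r (λ i → + fold (a ℕ.* suc i)) ≡ fact r
          ∏fold = trans (∏-cong< r (λ i i< → cong +_ (sym (suc-π i<))))
            (Reindex.∏-reindex π< π-inj (λ i → + suc i))

        -- The product of the a x over 1 ≤ x ≤ r is a^r r! and, after folding every factor, also
        -- `γ a` r!. The factor r! is prime to p.
        euler : pow r a ≋ γ a [ p ]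
        euler = ∣⇒≋ (cancel (Prime∣ pr (fact r) (pow r a - γ a)
          (subst (+ p ∣_) (l (pow r a) (γ a) (fact r)) (≋⇒∣ all))))
          where
          all : pow r a * fact r ≋ γ a * fact r [ p ]
          all = ≋-trans (≋-reflexive (sym (∏-* r (λ _ → + a) (λ i → + suc i))))
            (≋-trans (≋-∏ r (λ i _ → fold≋′ i))
              (≋-reflexive (trans (∏-* r (λ i → sg (a ℕ.* suc i)) (λ i → + fold (a ℕ.* suc i))) (cong (γ a *_) ∏fold))))
          l = ring 3 λ x y z → x :* z :- y :* z ⊜ z :* (x :- y)
          cancel : (+ p ∣ fact r) ⊎ (+ p ∣ pow r a - γ a) → + p ∣ pow r a - γ a
          cancel (inj₁ d) = contradiction d p∤fact
          cancel (inj₂ d) = d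

      -- Both sides are ± 1 and, by Euler's criterion, congruent modulo p > 2.
      γ-* : ∀ {a b} → ¬ p ℕD.∣ a → ¬ p ℕD.∣ b → γ (a ℕ.* b) ≡ γ a * γ b
      γ-* {a} {b} p∤a p∤b = ±1-≋ 2<p (γ-±1 (a ℕ.* b)) (±1-* (γ-±1 a) (γ-±1 b))
        (≋-trans (≋-sym (euler p∤ab)) (≋-trans (≋-reflexive
          (trans (∏-cong r (λ _ → pos-* a b)) (∏-const-* r (+ a) (+ b)))) (≋-* (euler p∤a) (euler p∤b))))
        where
        p∤ab : ¬ p ℕD.∣ a ℕ.* b
        p∤ab d with euclidsLemma a b pr d
        ... | inj₁ e = p∤a e
        ... | inj₂ e = p∤b e

      -- If γ were trivial, x^r would be 1 modulo p at r + 1 consecutive points,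
      -- although its r-th difference is r!.
      γ-nontrivial : ∃[ a ] ¬ p ℕD.∣ a × γ a ≡ -1ℤ
      γ-nontrivial with ℕP.anyUpTo? (λ i → γ (suc i) ℤP.≟ -1ℤ) (suc r)
      ... | yes (i , i≤r , e) = suc i , p∤ , e
        where
        p∤ : ¬ p ℕD.∣ suc i
        p∤ d = ℕP.<⇒≱ (ℕ.s≤s (ℕP.≤-trans i≤r (ℕP.+-monoˡ-≤ r 1≤r))) (ℕD.∣⇒≤ d)
      ... | no none = contradiction (≋0⇒∣ (≋-trans (≋-reflexive (sym (Δ-pow r 1))) Δ≋0)) p∤fact
        where
        p∤ : ∀ {i} → i ℕ.≤ r → ¬ p ℕD.∣ suc i
        p∤ i≤r d = ℕP.<⇒≱ (ℕ.s≤s (ℕP.≤-trans (ℕ.s≤s i≤r) (ℕP.+-monoˡ-≤ r 1≤r))) (ℕD.∣⇒≤ d)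
        γ≡1 : ∀ i → i ℕ.≤ r → γ (suc i) ≡ 1ℤ
        γ≡1 i i≤r with γ-±1 (suc i)
        ... | inj₁ e = e
        ... | inj₂ e = contradiction (i , ℕ.s≤s i≤r , e) none
        one : ∀ i → i ℕ.≤ r → pow r (i ℕ.+ 1) ≋ 1ℤ [ p ]
        one i i≤r rewrite ℕP.+-comm i 1 = ≋-trans (euler (p∤ i≤r)) (≋-reflexive (γ≡1 i i≤r))
        Δ≋0 : Δ r (pow r) 1 ≋ 0ℤ [ p ]
        Δ≋0 = go r 1≤r one
          where
          go : ∀ n {f} → 1 ℕ.≤ n → (∀ i → i ℕ.≤ n → f (i ℕ.+ 1) ≋ 1ℤ [ p ]) → Δ n f 1 ≋ 0ℤ [ p ]
          go (suc n) _ h = Δ-≋1 n 1 h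

-- Quadratic reciprocity by counting lattice points.

module Reciprocity where

  open Normalisation using (ring; semiring; _⊜_; _:+_; _:-_; _:*_; :-_; #_)
  open import Data.Bool.Base using (if_then_else_)
  open import Data.Integer.Base hiding (suc; _%_; _/_)
  open ℤD
  open ℤP
  open import Data.Nat.Base using (_%_; _/_)
  open import Data.Nat.DivMod using (m%n<n; m≡m%n+[m/n]*n)
  open import Relation.Binary.Definitions using (tri<; tri≈; tri>)
  open Sums
  open Modular
  open Gauss

  abstract
    flipOf : ∀ {P : Set} → Dec P → ℤ
    flipOf d = if does d then -1ℤ else 1ℤ

    flipOf-yes : ∀ {P : Set} (d : Dec P) → P → flipOf d ≡ -1ℤ
    flipOf-yes (yes _) _ = refl
    flipOf-yes (no ¬p) p = contradiction p ¬p

    flipOf-no : ∀ {P : Set} (d : Dec P) → ¬ P → flipOf d ≡ 1ℤ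
    flipOf-no (yes p) ¬p = contradiction p ¬p
    flipOf-no (no _)  _  = refl

    flipOf-cong : ∀ {P Q : Set} (d : Dec P) (e : Dec Q) → (P → Q) → (Q → P) → flipOf d ≡ flipOf e
    flipOf-cong (yes p) e f g = sym (flipOf-yes e (f p))
    flipOf-cong (no ¬p) e f g = sym (flipOf-no e (¬p ∘ g))

    flipOf-±1 : ∀ {P : Set} (d : Dec P) → ±1 (flipOf d)
    flipOf-±1 (yes _) = inj₂ refl
    flipOf-±1 (no  _) = inj₁ refl

  ∏-reverse : ∀ n f → ∏ n (λ i → f (n ℕ.∸ suc i)) ≡ ∏ n f
  ∏-reverse n = Reindex.∏-reindex {n} {λ i → n ℕ.∸ suc i}
    (λ {i} i< → ℕP.∸-monoʳ-< {n} {suc i} {0} (ℕ.s≤s ℕ.z≤n) i<)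
    (λ {i} {j} i< j< eq → ℕP.suc-injective (ℕP.∸-cancelˡ-≡ i< j< eq))

  odd : ℕ → ℕ
  odd r = suc (r ℕ.+ r)

  -- This is p y - q x at the lattice point x = i + 1, y = j + 1, for p = 2 r + 1 and q = 2 s + 1.
  gap : ℕ → ℕ → ℕ → ℕ → ℤ
  gap r s i j = + odd r * + suc j - + odd s * + suc i

  -- For an integer, being at most r is the same as being below p / 2.
  Near : ℕ → ℕ → ℕ → ℕ → Set
  Near r s i j = 0ℤ < gap r s i j × gap r s i j ≤ + r

  near? : ∀ r s i j → Dec (Near r s i j)
  near? r s i j = (0ℤ <? gap r s i j) ×-dec (gap r s i j ≤? + r)

  Far : ℕ → ℕ → ℕ → ℕ → Set
  Far r s i j = + r < gap r s i j

  far? : ∀ r s i j → Dec (Far r s i j)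
  far? r s i j = + r <? gap r s i j

  -- q x mod p exceeds p / 2 exactly when some multiple p y of p lies in
  -- (q x , q x + p / 2).
  sg-near : ∀ r s i → i ℕ.< r →
    Symbol.sg r (odd s ℕ.* suc i) ≡ ∏ s (λ j → flipOf (near? r s i j))
  sg-near r s i i<r = go (low? a)
    where
    open Symbol r
    a = odd s ℕ.* suc i
    t = a % p
    k = a / p

    p*r+r : + p ≡ + r + + r + 1ℤ
    p*r+r = cong +_ (sym (ℕP.+-comm (r ℕ.+ r) 1))

    gap≡ : ∀ j → gap r s i j ≡ + p * (+ suc j - + k) - + t
    gap≡ j = begin
      + p * + suc j - + odd s * + suc i ≡⟨ cong (λ u → + p * + suc j - u) (sym (pos-* (odd s) (suc i))) ⟩
      + p * + suc j - + a ≡⟨ cong (λ u → + p * + suc j - u) a≡ ⟩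
      + p * + suc j - (+ t + + k * + p) ≡⟨ l (+ p) (+ suc j) (+ t) (+ k) ⟩
      + p * (+ suc j - + k) - + t ∎
      where
      open ≡-Reasoning
      a≡ : + a ≡ + t + + k * + p
      a≡ = trans (cong +_ (m≡m%n+[m/n]*n a p)) (cong (_+_ (+ t)) (pos-* k p))
      l = ring 4 λ p j t k → p :* j :- (t :+ k :* p) ⊜ p :* (j :- k) :- t

    -- The gap is congruent to -t modulo p and lies strictly between 0 and p, which leaves only p -
    -- t.
    near⇒ : ∀ {j} → Near r s i j → + t ≡ + p - gap r s i j
    near⇒ {j} (0<z , z≤r) with 0≤⇒≡+ (<⇒≤ 0<z)
    ... | w , z≡w = trans (cong +_ (≋⇒≡ (m%n<n a p) w< e)) (sym (trans (cong (λ u → + p - u) z≡w) (p-w)))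
      where
      0<w : 0 ℕ.< w
      0<w = drop‿+<+ (subst (0ℤ <_) z≡w 0<z)
      w≤r : w ℕ.≤ r
      w≤r = drop‿+≤+ (subst (_≤ + r) z≡w z≤r)
      w≤p : w ℕ.≤ p
      w≤p = ℕP.≤-trans w≤r (ℕP.m≤n⇒m≤1+n (ℕP.m≤m+n r r))
      w< : p ℕ.∸ w ℕ.< p
      w< = ℕP.∸-monoʳ-< {p} {w} {0} 0<w w≤p
      p-w : + p - + w ≡ + (p ℕ.∸ w)
      p-w = trans (m-n≡m⊖n p w) (⊖-≥ w≤p)
      e : + t ≋ + (p ℕ.∸ w) [ p ]
      e = mod (+ suc j - + k - 1ℤ) (trans (l (+ t) (+ p) (+ suc j - + k))
        (cong (λ u → u + (+ suc j - + k - 1ℤ) * + p)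
          (trans (cong (λ u → + p - u) (trans (sym (gap≡ j)) z≡w)) p-w)))
        where
        l = ring 3 λ t p x → t ⊜ (p :- (p :* x :- t)) :+ (x :- # 1) :* p

    low⇒far : t ℕ.≤ r → ∀ j → ¬ Near r s i j
    low⇒far t≤r j n = <⇒≱ (≤-<-trans z≤r (+<+ (ℕP.n<1+n r)))
        (≤-by (+ r - + t) (i≤j⇒0≤j-i (+≤+ t≤r))
          (trans (cong (λ u → gap r s i j - (+ 1 + u)) (l (+ r) (gap r s i j) (+ t)
            (trans (near⇒ n) (cong (_- gap r s i j) p*r+r))))
            (l₂ (gap r s i j) (+ r) (+ t))))
      where
      z≤r = proj₂ n
      l : ∀ r z t → t ≡ (r + r + 1ℤ) - z → r ≡ t + z - r - 1ℤ
      l r z t refl = l′ r z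
        where
        l′ = ring 2 λ r z → r ⊜ ((r :+ r :+ # 1) :- z) :+ z :- r :- # 1
      l₂ = ring 3 λ z r t → z :- (# 1 :+ (t :+ z :- r :- # 1)) ⊜ r :- t

    gap-k : gap r s i k ≡ + p - + t
    gap-k = trans (gap≡ k) (l (+ p) (+ t) (+ k))
      where
      l = ring 3 λ p t k → p :* (# 1 :+ k :- k) :- t ⊜ p :- t

    near-k : r ℕ.< t → Near r s i k
    near-k r<t = subst (0ℤ <_) (sym gap-k) (i<j⇒0<j-i (+<+ (m%n<n a p))) ,
      ≤-by (+ t - (+ 1 + + r)) (i≤j⇒0≤j-i (+≤+ r<t))
        (trans (cong (_-_ (+ r)) (trans gap-k (cong (_- + t) p*r+r))) (l (+ r) (+ t)))
      where
      l = ring 2 λ r t → r :- (r :+ r :+ # 1 :- t) ⊜ t :- (# 1 :+ r)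

    -- The row k + 1 has to lie inside the rectangle. If s ≤ k, then q (i + 1) = t + k p ≥ r + 1 + s
    -- p > q r, although i + 1 ≤ r.
    k<s : r ℕ.< t → k ℕ.< s
    k<s r<t with s ℕP.≤? k
    ... | no ¬s≤k = ℕP.≰⇒> ¬s≤k
    ... | yes s≤k = contradiction upper (ℕP.<⇒≱ lower)
      where
      lower : odd s ℕ.* r ℕ.< t ℕ.+ k ℕ.* p
      lower = ℕP.<-≤-trans (ℕP.≤-trans (ℕP.≤-reflexive (cong suc (lr r s))) (ℕ.s≤s (ℕP.m≤n+m _ s)))
        (ℕP.≤-trans (ℕP.≤-reflexive (cong suc (sym (ℕP.+-assoc s r _)))) (ℕP.≤-trans (ℕP.≤-reflexive (lr2 r s)) (ℕP.+-mono-≤ r<t (ℕP.*-monoˡ-≤ p s≤k))))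
        where
        lr = semiring 2 λ r s → (# 1 :+ (s :+ s)) :* r ⊜ r :+ (s :+ s) :* r
        lr2 = semiring 2 λ r s → # 1 :+ (s :+ r :+ (s :+ s) :* r) ⊜ # 1 :+ r :+ s :* (# 1 :+ (r :+ r))
      upper : t ℕ.+ k ℕ.* p ℕ.≤ odd s ℕ.* r
      upper = ℕP.≤-trans (ℕP.≤-reflexive (sym (m≡m%n+[m/n]*n a p))) (ℕP.*-monoʳ-≤ (odd s) i<r)

    near-unique : ∀ {j} → r ℕ.< t → Near r s i j → j ≡ k
    near-unique {j} r<t n = ℕP.suc-injective (+-injective (*-cancelˡ-≡ (+ p) (+ suc j) (+ suc k)
      (l (+ p * + suc j) (+ p * + suc k) (+ odd s * + suc i)
        (l′ (gap r s i j) (gap r s i k) (+ p)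
          (trans (sym (near⇒ n)) (near⇒ (near-k r<t)))))))
      where
      l : ∀ x y c → x - c ≡ y - c → x ≡ y
      l x y c e = +-cancelʳ-≡ (- c) e
      l′ : ∀ x y p → p - x ≡ p - y → x ≡ y
      l′ x y p e = neg-injective (+-cancelˡ-≡ p e)

    go : (d : Dec (a % p ℕ.≤ r)) → signOf d ≡ ∏ s (λ j → flipOf (near? r s i j))
    go (yes l) = sym (∏-vanish s (λ j _ → flipOf-no (near? r s i j) (low⇒far l j)))
    go (no ¬l) = sym (trans
      (∏-collapse s (λ j → flipOf (near? r s i j)) (k<s r<t)
        (λ j _ j≢k → flipOf-no (near? r s i j) (j≢k ∘ near-unique r<t)))
      (flipOf-yes (near? r s i k) (near-k r<t)))
      where
      r<t = ℕP.≰⇒> ¬l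

  -- The rotation x ↦ r + 1 - x , y ↦ s + 1 - y of the rectangle exchanges the
  -- two corner regions not counted by either symbol.
  far-rotate : ∀ r s i j → i ℕ.< r → j ℕ.< s →
    flipOf (far? r s (r ℕ.∸ suc i) (s ℕ.∸ suc j)) ≡ flipOf (far? s r j i)
  far-rotate r s i j i< j< = flipOf-cong (far? r s (r ℕ.∸ suc i) (s ℕ.∸ suc j)) (far? s r j i)
    (λ f → subst₂ _<_ (l₁ (+ r) (+ s)) (l₂ (+ r) (+ s) (gap s r j i))
      (+-monoˡ-< (+ s - + r) (subst (+ r <_) rot f)))
    (λ f → subst (+ r <_) (sym rot) (subst₂ _<_ (l₁ (+ s) (+ r)) (l₃ (+ r) (+ s) (gap s r j i))
      (+-monoˡ-< (+ r - + s) f)))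
    where
    suc-∸ : ∀ {m n} → m ℕ.< n → + suc (n ℕ.∸ suc m) ≡ + n - + m
    suc-∸ {m} {n} m<n = trans (cong +_ (sym (ℕP.+-∸-assoc 1 m<n))) (sym (trans (m-n≡m⊖n n m) (⊖-≥ (ℕP.<⇒≤ m<n))))
    rot : gap r s (r ℕ.∸ suc i) (s ℕ.∸ suc j) ≡ (+ r - + s) + gap s r j i
    rot = trans (cong₂ (λ u v → + odd r * u - + odd s * v) (suc-∸ j<) (suc-∸ i<)) (l (+ r) (+ s) (+ i) (+ j))
      where
      l = ring 4 λ r s i j → (# 1 :+ (r :+ r)) :* (s :- j) :- (# 1 :+ (s :+ s)) :* (r :- i) ⊜ (r :- s) :+ ((# 1 :+ (s :+ s)) :* (# 1 :+ i) :- (# 1 :+ (r :+ r)) :* (# 1 :+ j))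
    l₁ = ring 2 λ r s → r :+ (s :- r) ⊜ s
    l₂ = ring 3 λ r s z → (r :- s) :+ z :+ (s :- r) ⊜ z
    l₃ = ring 3 λ r s z → z :+ (r :- s) ⊜ (r :- s) :+ z

  module _ (r s : ℕ) (c : Coprime (odd r) (odd s)) where

    private
      gap-swap : ∀ i j → gap s r j i ≡ - gap r s i j
      gap-swap i j = l (+ odd r * + suc j) (+ odd s * + suc i)
        where
        l = ring 2 λ x y → y :- x ⊜ :- (x :- y)

      gap≢0 : ∀ {i j} → i ℕ.< r → gap r s i j ≢ 0ℤ
      gap≢0 {i} {j} i<r e = ℕP.<⇒≱ (ℕ.s≤s (ℕP.≤-trans i<r (ℕP.m≤m+n r r)))
        (ℕD.∣⇒≤ (∣⇒ℕ∣ (coprime-cancel {odd s} c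
          (divides (+ suc j) (trans (sym (i-j≡0⇒i≡j _ _ e)) (*-comm (+ odd r) (+ suc j)))))))

      combine : ∀ {a b c d a′ b′ c′ d′ : ℤ} → a ≡ a′ → b ≡ b′ → c ≡ c′ → d ≡ d′ →
        (a * b) * (c * d) ≡ (a′ * b′) * (c′ * d′)
      combine refl refl refl refl = refl

      above : ∀ i j → 0ℤ < gap r s i j →
        (flipOf (near? r s i j) * flipOf (near? s r j i)) * (flipOf (far? r s i j) * flipOf (far? s r j i)) ≡ -1ℤ
      above i j 0<z = go (gap r s i j ≤? + r)
        where
        z′<0 : gap s r j i < 0ℤ
        z′<0 = subst (_< 0ℤ) (sym (gap-swap i j)) (neg-mono-< 0<z)
        notnear : flipOf (near? s r j i) ≡ 1ℤ
        notnear = flipOf-no (near? s r j i) (λ (a , _) → <-asym a z′<0)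
        notfar : flipOf (far? s r j i) ≡ 1ℤ
        notfar = flipOf-no (far? s r j i) (λ f → <⇒≱ (<-trans f z′<0) 0≤pos)
        go : Dec (gap r s i j ≤ + r) → (flipOf (near? r s i j) * flipOf (near? s r j i)) *
          (flipOf (far? r s i j) * flipOf (far? s r j i)) ≡ -1ℤ
        go (yes z≤r) = combine (flipOf-yes (near? r s i j) (0<z , z≤r)) notnear
          (flipOf-no (far? r s i j) (≤⇒≯ z≤r)) notfar
        go (no z≰r) = combine (flipOf-no (near? r s i j) (z≰r ∘ proj₂)) notnear
          (flipOf-yes (far? r s i j) (≰⇒> z≰r)) notfar

      below : ∀ i j → gap r s i j < 0ℤ →
        (flipOf (near? r s i j) * flipOf (near? s r j i)) * (flipOf (far? r s i j) * flipOf (far? s r j i)) ≡ -1ℤ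
      below i j z<0 = go (gap s r j i ≤? + s)
        where
        0<z′ : 0ℤ < gap s r j i
        0<z′ = subst (0ℤ <_) (sym (gap-swap i j)) (neg-mono-< z<0)
        notnear : flipOf (near? r s i j) ≡ 1ℤ
        notnear = flipOf-no (near? r s i j) (λ (a , _) → <-asym a z<0)
        notfar : flipOf (far? r s i j) ≡ 1ℤ
        notfar = flipOf-no (far? r s i j) (λ f → <⇒≱ (<-trans f z<0) 0≤pos)
        go : Dec (gap s r j i ≤ + s) → (flipOf (near? r s i j) * flipOf (near? s r j i)) *
          (flipOf (far? r s i j) * flipOf (far? s r j i)) ≡ -1ℤ
        go (yes z≤s) = combine notnear (flipOf-yes (near? s r j i) (0<z′ , z≤s))
          notfar (flipOf-no (far? s r j i) (≤⇒≯ z≤s))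
        go (no z≰s) = combine notnear (flipOf-no (near? s r j i) (z≰s ∘ proj₂))
          notfar (flipOf-yes (far? s r j i) (≰⇒> z≰s))

      -- The line p y = q x and two parallels to it cut the rectangle into two near and two far
      -- regions. A lattice point lies in exactly one of them, so exactly one factor is -1;
      -- coprimality keeps the points off the line itself.
      four : ∀ i j → i ℕ.< r →
        (flipOf (near? r s i j) * flipOf (near? s r j i)) * (flipOf (far? r s i j) * flipOf (far? s r j i)) ≡ -1ℤ
      four i j i<r with <-cmp 0ℤ (gap r s i j)
      ... | tri≈ _ e _ = contradiction (sym e) (gap≢0 i<r)
      ... | tri< 0<z _ _ = above i j 0<z
      ... | tri> _ _ z<0 = below i j z<0

      N₁ N₂ F₁ F₂ : ℤ
      N₁ = ∏ r (λ i → ∏ s (λ j → flipOf (near? r s i j)))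
      N₂ = ∏ r (λ i → ∏ s (λ j → flipOf (near? s r j i)))
      F₁ = ∏ r (λ i → ∏ s (λ j → flipOf (far? r s i j)))
      F₂ = ∏ r (λ i → ∏ s (λ j → flipOf (far? s r j i)))

      F₁≡F₂ : F₁ ≡ F₂
      F₁≡F₂ = trans (sym (∏-reverse r _)) (∏-cong< r (λ i i< → trans (sym (∏-reverse s _))
        (∏-cong< s (λ j j< → far-rotate r s i j i< j<))))

      ∏∏-* : ∀ (f g : ℕ → ℕ → ℤ) → ∏ r (λ i → ∏ s (λ j → f i j * g i j)) ≡
        ∏ r (λ i → ∏ s (f i)) * ∏ r (λ i → ∏ s (g i))
      ∏∏-* f g = trans (∏-cong r (λ i → ∏-* s (f i) (g i))) (∏-* r (λ i → ∏ s (f i)) (λ i → ∏ s (g i)))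

    -- Over the whole rectangle the four factors multiply to (-1)^(r s). The near regions account
    -- for the two symbols; the far ones have equal products by the rotation, hence together the
    -- square of a sign.
    reciprocity : Symbol.γ r (odd s) * Symbol.γ s (odd r) ≡ ∏ r (λ _ → ∏ s (λ _ → -1ℤ))
    reciprocity = begin
      Symbol.γ r (odd s) * Symbol.γ s (odd r)
        ≡⟨ cong₂ _*_ (∏-cong< r (λ i i< → sg-near r s i i<))
             (trans (∏-cong< s (λ j j< → sg-near s r j j<)) (∏-swap s r (λ j i → flipOf (near? s r j i)))) ⟩
      N₁ * N₂ ≡⟨ sym (*-identityʳ (N₁ * N₂)) ⟩
      N₁ * N₂ * 1ℤ ≡⟨ cong (N₁ * N₂ *_) (sym (trans (cong (_* F₂) F₁≡F₂) (±1-square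
        (±1-∏ r (λ i → ±1-∏ s (λ j → flipOf-±1 (far? s r j i))))))) ⟩
      N₁ * N₂ * (F₁ * F₂) ≡⟨ cong₂ _*_ (sym (∏∏-* (λ i j → flipOf (near? r s i j)) (λ i j → flipOf (near? s r j i))))
                                         (sym (∏∏-* (λ i j → flipOf (far? r s i j)) (λ i j → flipOf (far? s r j i)))) ⟩
      _ ≡⟨ sym (∏∏-* (λ i j → flipOf (near? r s i j) * flipOf (near? s r j i))
                                                 (λ i j → flipOf (far? r s i j) * flipOf (far? s r j i))) ⟩
      _ ≡⟨ ∏-cong< r (λ i i< → ∏-cong s (λ j → four i j i<)) ⟩
      ∏ r (λ _ → ∏ s (λ _ → -1ℤ)) ∎
      where open ≡-Reasoning

-- The Legendre symbol agrees with the sign of Gauss's lemma.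

module Legendre where

  open Normalisation using (ring; _⊜_; _:+_; _:-_; _:*_; :-_; #_)
  open import Data.Bool.Base using (if_then_else_)
  open import Data.Fin.Base as Fin using (Fin; toℕ; fromℕ<)
  open import Data.Fin.Properties using (any?; toℕ<n; toℕ-fromℕ<)
  open import Data.Integer.Base hiding (suc; _%_; _/_)
  open ℤD
  open ℤP
  open import Data.Nat.Base using (_%_)
  open import Data.Nat.DivMod using (m%n<n)
  open import Data.Nat.Primality using (Prime; euclidsLemma)
  open import Relation.Nullary.Decidable using (dec-true; dec-false)
  open import Defs using (legendre)
  open Sums
  open Modular
  open Gauss
  open Reciprocity

  ∣-∣≡ : ∀ m n → ℕ.∣ m - n ∣ ≡ ∣ + m - + n ∣
  ∣-∣≡ m n = trans (go m n) (cong ∣_∣ (sym (m-n≡m⊖n m n)))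
    where
    go : ∀ m n → ℕ.∣ m - n ∣ ≡ ∣ m ⊖ n ∣
    go zero    zero    = refl
    go zero    (suc n) = refl
    go (suc m) zero    = refl
    go (suc m) (suc n) = trans (go m n) (cong ∣_∣ (sym ([1+m]⊖[1+n]≡m⊖n m n)))

  IsRoot : ℕ → ℕ → ℕ → Set
  IsRoot p x y = + p ∣ + y * + y - + x

  isRoot? : ∀ p x y → Dec (IsRoot p x y)
  isRoot? p x y = + p ∣? + y * + y - + x

  private
    rootᵤ⇒ : ∀ {p x y} → p ℕD.∣ ℕ.∣ y ℕ.* y - x ∣ → IsRoot p x y
    rootᵤ⇒ {p} {x} {y} d = subst (λ u → + p ∣ u - + x) (pos-* y y)
      (∣ᵤ⇒∣ (subst (p ℕD.∣_) (∣-∣≡ (y ℕ.* y) x) d))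

    ⇒rootᵤ : ∀ {p x y} → IsRoot p x y → p ℕD.∣ ℕ.∣ y ℕ.* y - x ∣
    ⇒rootᵤ {p} {x} {y} d = subst (p ℕD.∣_) (sym (∣-∣≡ (y ℕ.* y) x))
      (∣⇒∣ᵤ (subst (λ u → + p ∣ u - + x) (sym (pos-* y y)) d))

  module _ {p x : ℕ} where
    private
      any-root? = any? λ (y : Fin p) → p ℕD.∣? ℕ.∣ toℕ y ℕ.* toℕ y - x ∣

    legendre-∣ : p ℕD.∣ x → legendre x p ≡ 0ℤ
    legendre-∣ d rewrite dec-true (p ℕD.∣? x) d = refl

    legendre-square : ¬ p ℕD.∣ x → ∀ {y} → y ℕ.< p → IsRoot p x y → legendre x p ≡ 1ℤ
    legendre-square ∤ {y} y< d rewrite dec-false (p ℕD.∣? x) ∤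
      | dec-true any-root? (fromℕ< y< , subst (λ y → p ℕD.∣ ℕ.∣ y ℕ.* y - x ∣) (sym (toℕ-fromℕ< y<)) (⇒rootᵤ {y = y} d)) = refl

    legendre-nonsquare : ¬ p ℕD.∣ x → (∀ {y} → y ℕ.< p → ¬ IsRoot p x y) → legendre x p ≡ -1ℤ
    legendre-nonsquare ∤ none rewrite dec-false (p ℕD.∣? x) ∤
      | dec-false any-root? (λ (y , d) → none (toℕ<n y) (rootᵤ⇒ {y = toℕ y} d)) = refl

    data LegendreView : Set where
      divisible : p ℕD.∣ x → legendre x p ≡ 0ℤ → LegendreView
      square    : ¬ p ℕD.∣ x → ∀ {y} → y ℕ.< p → IsRoot p x y → legendre x p ≡ 1ℤ → LegendreView
      nonsquare : ¬ p ℕD.∣ x → (∀ {y} → y ℕ.< p → ¬ IsRoot p x y) → legendre x p ≡ -1ℤ → LegendreView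

    legendreView : LegendreView
    legendreView with p ℕD.∣? x
    ... | yes d = divisible d (legendre-∣ d)
    ... | no ∤ with ℕP.anyUpTo? (isRoot? p x) p
    ...   | yes (y , y< , d) = square ∤ y< d (legendre-square ∤ y< d)
    ...   | no none = nonsquare ∤ none′ (legendre-nonsquare ∤ none′)
      where
      none′ : ∀ {y} → y ℕ.< p → ¬ IsRoot p x y
      none′ {y} y< d = none (y , y< , d)

  module OddPrime (r : ℕ) (pr : Prime (odd r)) where
    open Symbol r using (p; γ; γ-±1; γ-*; γ-cong; γ-nontrivial; euler; 1≤r; 2<p)

    L : ℕ → ℤ
    L x = legendre x p

    rootCount : ℕ → ℤ
    rootCount x = ∑ p (λ y → ⟦ isRoot? p x y ⟧)

    -- A multiple of p has the single root 0, a nonsquare none, and any other square the two roots y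
    -- and p - y.
    rootCount≡ : ∀ x → rootCount x ≡ 1ℤ + L x
    rootCount≡ x with legendreView {p} {x}
    ... | divisible d e = trans (∑-⟦⟧-unique p (isRoot? p x) {0} (ℕ.s≤s ℕ.z≤n)
            (subst (+ p ∣_) (sym (+-identityˡ (- + x))) (∣m⇒∣-m (ℕ∣⇒∣ d))) uniq) (cong (_+_ 1ℤ) (sym e))
      where
      uniq : ∀ y → y ℕ.< p → IsRoot p x y → y ≡ 0
      uniq y y< root = Sum.[ zero! , zero! ]′ (Prime∣ pr (+ y) (+ y)
          (subst (+ p ∣_) (l (+ y * + y) (+ x)) (∣m∣n⇒∣m+n root (ℕ∣⇒∣ d))))
        where
        l = ring 2 λ a b → a :- b :+ b ⊜ a
        zero! : + p ∣ + y → y ≡ 0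
        zero! d = +-injective (∣∧∣∣<⇒≡0 d y<)
    ... | nonsquare _ none e = trans (∑-vanish p (λ y y< → ⟦⟧-no (isRoot? p x y) (none y<)))
            (cong (_+_ 1ℤ) (sym e))
    ... | square ∤ {y} y< root e = trans (begin
        ∑ p (λ z → ⟦ isRoot? p x z ⟧) ≡⟨ ∑-cong< p split ⟩
        ∑ p (λ z → ⟦ z ℕP.≟ y ⟧ * 1ℤ + ⟦ z ℕP.≟ y′ ⟧ * 1ℤ) ≡⟨ ∑-+ p _ _ ⟩
        ∑ p (λ z → ⟦ z ℕP.≟ y ⟧ * 1ℤ) + ∑ p (λ z → ⟦ z ℕP.≟ y′ ⟧ * 1ℤ)
          ≡⟨ cong₂ _+_ (∑-δ p (λ _ → 1ℤ) y<) (∑-δ p (λ _ → 1ℤ) y′<) ⟩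
        + 2 ∎) (cong (_+_ 1ℤ) (sym e))
      where
      open ≡-Reasoning
      y′ = p ℕ.∸ y
      y≢0 : y ≢ 0
      y≢0 refl = ∤ (∣⇒ℕ∣ (subst (+ p ∣_) (neg-involutive (+ x)) (∣m⇒∣-m (subst (+ p ∣_) (+-identityˡ (- + x)) root))))
      y′< : y′ ℕ.< p
      y′< = ℕP.∸-monoʳ-< {p} {y} {0} (ℕP.n≢0⇒n>0 y≢0) (ℕP.<⇒≤ y<)
      +y′ : + y′ ≡ + p - + y
      +y′ = sym (trans (m-n≡m⊖n p y) (⊖-≥ (ℕP.<⇒≤ y<)))
      -- Otherwise 2 y = p = 2 r + 1, but y ≤ r makes 2 y too small and y > r too large.
      y≢y′ : y ≢ y′
      y≢y′ e with y ℕP.≤? r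
      ... | yes y≤r = ℕP.<⇒≢ (ℕ.s≤s (ℕP.+-mono-≤ y≤r y≤r)) y+y
        where
        y+y : y ℕ.+ y ≡ p
        y+y = trans (cong (y ℕ.+_) e) (ℕP.m+[n∸m]≡n (ℕP.<⇒≤ y<))
      ... | no y≰r = ℕP.<⇒≢ (ℕP.<-≤-trans (ℕ.s≤s (ℕP.≤-reflexive (sym (ℕP.+-suc r r))))
          (ℕP.+-mono-≤ (ℕP.≰⇒> y≰r) (ℕP.≰⇒> y≰r))) (sym y+y)
        where
        y+y : y ℕ.+ y ≡ p
        y+y = trans (cong (y ℕ.+_) e) (ℕP.m+[n∸m]≡n (ℕP.<⇒≤ y<))
      root⇒ : ∀ {z} → z ℕ.< p → IsRoot p x z → z ≡ y ⊎ z ≡ y′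
      root⇒ {z} z< d = Sum.map
          (λ e → ≋⇒≡ z< y< (∣⇒≋ e))
          (λ e → ≋⇒≡ z< y′< (∣⇒≋ (subst (+ p ∣_) (trans (l₂ (+ z) (+ y) (+ p)) (cong (λ u → + z - u) (sym +y′)))
            (∣m∣n⇒∣m-n e (∣-refl {+ p})))))
          (Prime∣ pr (+ z - + y) (+ z + + y) (subst (+ p ∣_) (l (+ z) (+ y) (+ x)) (∣m∣n⇒∣m-n d root)))
        where
        l = ring 3 λ z y x → (z :* z :- x) :- (y :* y :- x) ⊜ (z :- y) :* (z :+ y)
        l₂ = ring 3 λ z y p → z :+ y :- p ⊜ z :- (p :- y)
      root′ : IsRoot p x y′
      root′ = subst (λ u → + p ∣ u * u - + x) (sym +y′)
        (subst (+ p ∣_) (l (+ y) (+ x) (+ p)) (∣m∣n⇒∣m+n root (∣m⇒∣m*n (+ p - + 2 * + y) (∣-refl {+ p}))))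
        where
        l = ring 3 λ y x p → (y :* y :- x) :+ p :* (p :- # 2 :* y) ⊜ (p :- y) :* (p :- y) :- x
      split : ∀ z → z ℕ.< p → ⟦ isRoot? p x z ⟧ ≡ ⟦ z ℕP.≟ y ⟧ * 1ℤ + ⟦ z ℕP.≟ y′ ⟧ * 1ℤ
      split z z< with z ℕP.≟ y | z ℕP.≟ y′
      ... | yes a | yes b = contradiction (trans (sym a) b) y≢y′
      ... | yes a@refl | no b = trans (⟦⟧-yes (isRoot? p x z) root)
            (sym (cong₂ (λ u v → u * 1ℤ + v * 1ℤ) (⟦⟧-yes (yes a) a) (⟦⟧-no (no b) b)))
      ... | no a | yes b@refl = trans (⟦⟧-yes (isRoot? p x z) root′)
            (sym (cong₂ (λ u v → u * 1ℤ + v * 1ℤ) (⟦⟧-no (no a) a) (⟦⟧-yes (yes b) b)))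
      ... | no a | no b = trans (⟦⟧-no (isRoot? p x z) none)
            (sym (cong₂ (λ u v → u * 1ℤ + v * 1ℤ) (⟦⟧-no (no a) a) (⟦⟧-no (no b) b)))
        where
        none : ¬ IsRoot p x z
        none d = Sum.[ a , b ]′ (root⇒ z< d)

    -- Every y is a square root of exactly one residue, so the root counts 1 + `L x` add up to p.
    ∑L : ∑ p L ≡ 0ℤ
    ∑L = +-cancelˡ-≡ (+ p) (begin
      + p + ∑ p L ≡⟨ cong (_+ ∑ p L) (sym (trans (∑-const p 1ℤ) (*-identityʳ (+ p)))) ⟩
      ∑ p (λ _ → 1ℤ) + ∑ p L ≡⟨ sym (∑-+ p (λ _ → 1ℤ) L) ⟩
      ∑ p (λ x → 1ℤ + L x) ≡⟨ ∑-cong p (λ x → sym (rootCount≡ x)) ⟩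
      ∑ p (λ x → ∑ p (λ y → ⟦ isRoot? p x y ⟧)) ≡⟨ ∑-swap p p (λ x y → ⟦ isRoot? p x y ⟧) ⟩
      ∑ p (λ y → ∑ p (λ x → ⟦ isRoot? p x y ⟧)) ≡⟨ ∑-cong p (λ y →
        ∑-⟦⟧-unique p (λ x → isRoot? p x y) (m%n<n (y ℕ.* y) p) (root y) (uniq y)) ⟩
      ∑ p (λ y → 1ℤ) ≡⟨ trans (∑-const p 1ℤ) (*-identityʳ (+ p)) ⟩
      + p ≡⟨ sym (+-identityʳ (+ p)) ⟩
      + p + 0ℤ ∎)
      where
      open ≡-Reasoning
      root : ∀ y → IsRoot p (y ℕ.* y % p) y
      root y = ≋⇒∣ (≋-trans (≋-reflexive (sym (pos-* y y))) (≋-sym (%≋ (y ℕ.* y) p)))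
      uniq : ∀ y x → x ℕ.< p → IsRoot p x y → x ≡ y ℕ.* y % p
      uniq y x x< d = ≋⇒≡ x< (m%n<n (y ℕ.* y) p) (≋-trans (≋-sym (∣⇒≋ {x = + y * + y} d)) (∣⇒≋ (root y)))

    abstract
      γ₀ : ℕ → ℤ
      γ₀ x = if does (p ℕD.∣? x) then 0ℤ else γ x

      γ₀-∣ : ∀ {x} → p ℕD.∣ x → γ₀ x ≡ 0ℤ
      γ₀-∣ {x} d rewrite dec-true (p ℕD.∣? x) d = refl

      γ₀-∤ : ∀ {x} → ¬ p ℕD.∣ x → γ₀ x ≡ γ x
      γ₀-∤ {x} d rewrite dec-false (p ℕD.∣? x) d = refl

    ∣-cong : ∀ {a b} → + a ≋ + b [ p ] → p ℕD.∣ a → p ℕD.∣ b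
    ∣-cong e d = ∣⇒ℕ∣ (∣-resp-≋ e (ℕ∣⇒∣ d))

    γ₀-cong : ∀ a b → + a ≋ + b [ p ] → γ₀ a ≡ γ₀ b
    γ₀-cong a b e with p ℕD.∣? b
    ... | yes d = trans (γ₀-∣ (∣-cong (≋-sym e) d)) (sym (γ₀-∣ d))
    ... | no ∤ = trans (γ₀-∤ (∤ ∘ ∣-cong e)) (trans (γ-cong a b e) (sym (γ₀-∤ ∤)))

    γ₀-* : ∀ a b → γ₀ (a ℕ.* b) ≡ γ₀ a * γ₀ b
    γ₀-* a b with p ℕD.∣? a | p ℕD.∣? b
    ... | yes d | _     = trans (γ₀-∣ (ℕD.∣m⇒∣m*n b d)) (sym (cong (_* γ₀ b) (γ₀-∣ d)))
    ... | no ∤  | yes d = trans (γ₀-∣ (ℕD.∣n⇒∣m*n a d)) (sym (trans (cong (γ₀ a *_) (γ₀-∣ d)) (*-zeroʳ (γ₀ a))))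
    ... | no ∤  | no ∤′ = trans (γ₀-∤ λ d → case∣ (euclidsLemma a b pr d))
        (trans (γ-* pr ∤ ∤′) (sym (cong₂ _*_ (γ₀-∤ ∤) (γ₀-∤ ∤′))))
      where
      case∣ : ¬ (p ℕD.∣ a ⊎ p ℕD.∣ b)
      case∣ (inj₁ d) = ∤ d
      case∣ (inj₂ d) = ∤′ d

    -- Multiplication by an a with `γ a` = -1 permutes the residues and reverses the sign of the
    -- sum.
    ∑γ₀ : ∑ p γ₀ ≡ 0ℤ
    ∑γ₀ with γ-nontrivial pr
    ... | a , p∤a , γa = neg⇒0 (begin
        ∑ p γ₀ ≡⟨ sym (∑-affine {G = γ₀} per a (prime∤⇒coprime pr p∤a) 0) ⟩
        ∑ p (λ x → γ₀ (a ℕ.* x)) ≡⟨ ∑-cong p (λ x → trans (γ₀-* a x) (cong (_* γ₀ x) (trans (γ₀-∤ p∤a) γa))) ⟩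
        ∑ p (λ x → -1ℤ * γ₀ x) ≡⟨ sym (*-∑ p -1ℤ γ₀) ⟩
        -1ℤ * ∑ p γ₀ ∎)
      where
      open ≡-Reasoning
      per : Periodic p γ₀
      per x = γ₀-cong (x ℕ.+ p) x (mod 1ℤ (cong (_+_ (+ x)) (sym (*-identityˡ (+ p)))))
      neg⇒0 : ∀ {z} → z ≡ -1ℤ * z → z ≡ 0ℤ
      neg⇒0 {+ zero} _ = refl
      neg⇒0 {+ suc n} ()
      neg⇒0 { -[1+ n ]} ()

    -- γ₀ dominates L, because γ is 1 on squares, and both have sum 0.
    L≤γ₀ : ∀ x → 0ℤ ≤ γ₀ x - L x
    L≤γ₀ x with legendreView {p} {x}
    ... | divisible d e = ≤-reflexive (sym (cong₂ _-_ (γ₀-∣ d) e))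
    ... | nonsquare ∤ _ e = subst (0ℤ ≤_) (sym (cong₂ _-_ (γ₀-∤ ∤) e)) (bound (γ-±1 x))
      where
      bound : ∀ {z} → ±1 z → 0ℤ ≤ z - -1ℤ
      bound (inj₁ refl) = 0≤pos
      bound (inj₂ refl) = 0≤pos
    ... | square ∤ {y} y< root e = ≤-reflexive (sym (cong₂ _-_ γ₀x e))
      where
      sq : + x ≋ + (y ℕ.* y) [ p ]
      sq = ≋-trans (≋-sym (∣⇒≋ root)) (≋-reflexive (sym (pos-* y y)))
      p∤y : ¬ p ℕD.∣ y
      p∤y d = ∤ (∣-cong (≋-sym sq) (ℕD.∣m⇒∣m*n y d))
      γ₀x : γ₀ x ≡ 1ℤ
      γ₀x = trans (γ₀-cong x (y ℕ.* y) sq) (trans (γ₀-* y y) (±1-square (subst ±1 (sym (γ₀-∤ p∤y)) (γ-±1 y))))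

    private
      L≡γ₀< : ∀ x → x ℕ.< p → γ₀ x - L x ≡ 0ℤ
      L≡γ₀< = ∑-zero-nonneg p (λ x _ → L≤γ₀ x)
        (≤-reflexive (trans (∑-- p γ₀ L) (cong₂ _-_ ∑γ₀ ∑L)))

    -- Congruent arguments have the same square roots, and `rootCount` determines `L`.
    L-cong : ∀ a b → + a ≋ + b [ p ] → L a ≡ L b
    L-cong a b e = +-cancelˡ-≡ 1ℤ (trans (sym (rootCount≡ a)) (trans
      (∑-cong p (λ y → ⟦⟧-cong (isRoot? p a y) (isRoot? p b y)
        (∣-resp-≋ (≋-+ (≋-refl {x = + y * + y}) (≋-neg e)))
        (∣-resp-≋ (≋-+ (≋-refl {x = + y * + y}) (≋-neg (≋-sym e))))))
      (rootCount≡ b)))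

    L≡γ₀ : ∀ x → L x ≡ γ₀ x
    L≡γ₀ x = trans (L-cong x (x % p) (≋-sym (%≋ x p))) (trans
      (sym (i-j≡0⇒i≡j _ _ (L≡γ₀< (x % p) (m%n<n x p)))) (γ₀-cong (x % p) x (%≋ x p)))

    L≡γ : ∀ {x} → ¬ p ℕD.∣ x → L x ≡ γ x
    L≡γ {x} ∤ = trans (L≡γ₀ x) (γ₀-∤ ∤)

    L-±1 : ∀ {x} → ¬ p ℕD.∣ x → ±1 (L x)
    L-±1 {x} ∤ = subst ±1 (sym (L≡γ ∤)) (γ-±1 x)

    L-* : ∀ a b → L (a ℕ.* b) ≡ L a * L b
    L-* a b = trans (L≡γ₀ (a ℕ.* b)) (trans (γ₀-* a b) (sym (cong₂ _*_ (L≡γ₀ a) (L≡γ₀ b))))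

    p∤1 : ¬ p ℕD.∣ 1
    p∤1 d = ℕP.<⇒≱ (ℕP.<-trans (ℕP.n<1+n 1) (2<p pr)) (ℕD.∣⇒≤ d)

    L-neg1 : ∀ {x} → + x ≋ -1ℤ [ p ] → L x ≡ ∏ r (λ _ → -1ℤ)
    L-neg1 {x} e = ±1-≋ (2<p pr) (L-±1 ∤) (±1-∏ r (λ _ → inj₂ refl))
      (≋-trans (≋-reflexive (L≡γ ∤)) (≋-trans (≋-sym (euler pr ∤)) (≋-∏ r (λ _ _ → e))))
      where
      ∤ : ¬ p ℕD.∣ x
      ∤ d = p∤1 (∣⇒∣ᵤ { + p} { -1ℤ} (∣-resp-≋ e (ℕ∣⇒∣ d)))

    L1 : L 1 ≡ 1ℤ
    L1 = legendre-square p∤1 {1} (ℕP.<-trans (ℕP.n<1+n 1) (2<p pr)) (divides 0ℤ refl)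

-- The Jacobi symbol: multiplicativity, supplementary laws, reciprocity.

module Jacobi where

  open Normalisation using (ring; semiring; _⊜_; _:+_; _:-_; _:*_; :-_; #_)
  open import Data.Integer.Base hiding (suc; _%_; _/_)
  open ℤD
  open ℤP
  open import Data.List.Base using (List; []; _∷_; map; foldr)
  open import Data.List.Relation.Unary.All as All using (All; []; _∷_)
  open import Data.Nat.Base using (_%_; _/_)
  open import Data.Nat.DivMod using (m%n<n; m<n⇒m%n≡m; [m+n]%n≡m%n; %-distribˡ-*)
  open import Data.Nat.ListAction using (product)
  open import Data.Nat.Primality using (Prime; euclidsLemma; prime⇒nonTrivial; prime⇒irreducible)
  open import Data.Nat.Primality.Factorisation using (PrimeFactorisation; factorise; factors)
  open import Relation.Nullary.Decidable using (toWitness)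
  open import Defs using (legendre; jacobi)
  open Sums
  open Modular
  open Gauss
  open Reciprocity
  open Legendre

  tab₄ tab₈ : ℕ → ℤ
  tab₄ 1 = 1ℤ
  tab₄ 3 = -1ℤ
  tab₄ _ = 0ℤ
  tab₈ 1 = 1ℤ
  tab₈ 3 = -1ℤ
  tab₈ 5 = -1ℤ
  tab₈ 7 = 1ℤ
  tab₈ _ = 0ℤ

  -- The Kronecker symbols (-4 / n) and (8 / n).
  κ₄ κ₈ : ℕ → ℤ
  κ₄ n = tab₄ (n % 4)
  κ₈ n = tab₈ (n % 8)

  private
    tab₄-* : ∀ {i} → i ℕ.< 4 → ∀ {j} → j ℕ.< 4 → tab₄ (i ℕ.* j % 4) ≡ tab₄ i * tab₄ j
    tab₄-* = toWitness {a? = ℕP.allUpTo? (λ i → ℕP.allUpTo? (λ j → tab₄ (i ℕ.* j % 4) ≟ tab₄ i * tab₄ j) 4) 4} _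

    tab₈-* : ∀ {i} → i ℕ.< 8 → ∀ {j} → j ℕ.< 8 → tab₈ (i ℕ.* j % 8) ≡ tab₈ i * tab₈ j
    tab₈-* = toWitness {a? = ℕP.allUpTo? (λ i → ℕP.allUpTo? (λ j → tab₈ (i ℕ.* j % 8) ≟ tab₈ i * tab₈ j) 8) 8} _

  κ₄-* : ∀ m n → κ₄ (m ℕ.* n) ≡ κ₄ m * κ₄ n
  κ₄-* m n = trans (cong tab₄ (%-distribˡ-* m n 4)) (tab₄-* (m%n<n m 4) (m%n<n n 4))

  κ₈-* : ∀ m n → κ₈ (m ℕ.* n) ≡ κ₈ m * κ₈ n
  κ₈-* m n = trans (cong tab₈ (%-distribˡ-* m n 8)) (tab₈-* (m%n<n m 8) (m%n<n n 8))

  alt : ℕ → ℤ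
  alt n = ∏ n (λ _ → -1ℤ)

  alt-+2 : ∀ n → alt (suc (suc n)) ≡ alt n
  alt-+2 n = l (alt n)
    where
    l = ring 1 λ a → a :* (:- # 1) :* (:- # 1) ⊜ a

  κ₄-odd : ∀ r → κ₄ (odd r) ≡ alt r
  κ₄-odd zero = refl
  κ₄-odd (suc zero) = refl
  κ₄-odd (suc (suc r)) = trans (cong tab₄ (trans (cong (_% 4) (l r)) ([m+n]%n≡m%n (odd r) 4)))
    (trans (κ₄-odd r) (sym (alt-+2 r)))
    where
    l = semiring 1 λ r → # 1 :+ ((# 2 :+ r) :+ (# 2 :+ r)) ⊜ # 1 :+ (r :+ r) :+ # 4

  -- The residue of 2 r + 1 modulo 8 depends on r modulo 4. Both parities of r are carried along, so
  -- that m can advance by two, which adds 8.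
  κ₈-odd : ∀ m → κ₈ (odd (m ℕ.+ m)) ≡ alt m × κ₈ (odd (suc (m ℕ.+ m))) ≡ alt (suc m)
  κ₈-odd zero = refl , refl
  κ₈-odd (suc zero) = refl , refl
  κ₈-odd (suc (suc m)) = trans (cong tab₈ (trans (cong (_% 8) (l m)) ([m+n]%n≡m%n (odd (m ℕ.+ m)) 8)))
      (trans (proj₁ (κ₈-odd m)) (sym (alt-+2 m))) ,
    trans (cong tab₈ (trans (cong (_% 8) (l′ m)) ([m+n]%n≡m%n (odd (suc (m ℕ.+ m))) 8)))
      (trans (proj₂ (κ₈-odd m)) (sym (alt-+2 (suc m))))
    where
    l = semiring 1 λ m → # 1 :+ (((# 2 :+ m) :+ (# 2 :+ m)) :+ ((# 2 :+ m) :+ (# 2 :+ m))) ⊜ # 1 :+ ((m :+ m) :+ (m :+ m)) :+ # 8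
    l′ = semiring 1 λ m → # 1 :+ ((# 1 :+ ((# 2 :+ m) :+ (# 2 :+ m))) :+ (# 1 :+ ((# 2 :+ m) :+ (# 2 :+ m)))) ⊜ # 1 :+ ((# 1 :+ (m :+ m)) :+ (# 1 :+ (m :+ m))) :+ # 8

  signOf-yes : ∀ {P : Set} (d : Dec P) → P → signOf d ≡ 1ℤ
  signOf-yes (yes _) _ = refl
  signOf-yes (no ¬p) p = contradiction p ¬p

  signOf-no : ∀ {P : Set} (d : Dec P) → ¬ P → signOf d ≡ -1ℤ
  signOf-no (yes p) ¬p = contradiction p ¬p
  signOf-no (no _)  _  = refl

  halve : ∀ n → ∃[ m ] (n ≡ m ℕ.+ m ⊎ n ≡ suc (m ℕ.+ m))
  halve zero = 0 , inj₁ refl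
  halve (suc n) with halve n
  ... | m , inj₁ e = m , inj₂ (cong suc e)
  ... | m , inj₂ e = suc m , inj₁ (trans (cong suc e) (cong suc (sym (ℕP.+-suc m m))))

  -- Among 2 , 4 , … , 2 r exactly the first a lie below p / 2.
  γ2-split : ∀ r a b → r ≡ a ℕ.+ b → (∀ i → i ℕ.< a → suc i ℕ.+ suc i ℕ.≤ r) →
    (∀ i → r ℕ.< suc (a ℕ.+ i) ℕ.+ suc (a ℕ.+ i)) → Symbol.γ r 2 ≡ alt b
  γ2-split r a b refl lo hi = trans (∏-split a b (λ i → Symbol.sg r (2 ℕ.* suc i)))
    (trans (cong₂ _*_
        (∏-vanish a (λ i i< → signOf-yes (Symbol.low? r (2 ℕ.* suc i))
          (subst (ℕ._≤ r) (sym (small i (ℕP.≤-trans i< (ℕP.m≤m+n a b)))) (lo i i<))))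
        (∏-cong< b (λ i i< → signOf-no (Symbol.low? r (2 ℕ.* suc (a ℕ.+ i)))
          (ℕP.<⇒≱ (subst (r ℕ.<_) (sym (small (a ℕ.+ i) (ℕP.+-monoʳ-< a i<))) (hi i))))))
      (*-identityˡ (alt b)))
    where
    2* : ∀ i → 2 ℕ.* i ≡ i ℕ.+ i
    2* i = cong (i ℕ.+_) (ℕP.+-identityʳ i)
    small : ∀ i → i ℕ.< r → 2 ℕ.* suc i % odd r ≡ suc i ℕ.+ suc i
    small i i< = trans (cong (_% odd r) (2* (suc i))) (m<n⇒m%n≡m (ℕ.s≤s (ℕP.+-mono-≤ i< i<)))

  γ2 : ∀ r → Symbol.γ r 2 ≡ κ₈ (odd r)
  γ2 r with halve r
  ... | m , inj₁ refl = trans (γ2-split (m ℕ.+ m) m m refl (λ i i< → ℕP.+-mono-≤ i< i<)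
          (λ i → ℕP.+-mono-<-≤ (ℕ.s≤s (ℕP.m≤m+n m i)) (ℕP.m≤n⇒m≤1+n (ℕP.m≤m+n m i))))
        (sym (proj₁ (κ₈-odd m)))
  ... | m , inj₂ refl = trans (γ2-split (suc (m ℕ.+ m)) m (suc m) (sym (ℕP.+-suc m m))
          (λ i i< → ℕP.m≤n⇒m≤1+n (ℕP.+-mono-≤ i< i<))
          (λ i → ℕ.s≤s (ℕP.≤-trans (ℕP.≤-reflexive (sym (ℕP.+-suc m m))) (ℕP.+-mono-≤ (ℕP.m≤m+n m i) (ℕ.s≤s (ℕP.m≤m+n m i))))))
        (sym (proj₂ (κ₈-odd m)))

  data IsOddPrime : ℕ → Set where
    oddPrime : ∀ r → Prime (odd r) → IsOddPrime (odd r)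

  ∏ˡ : List ℕ → (ℕ → ℤ) → ℤ
  ∏ˡ ps f = foldr _*_ 1ℤ (map f ps)

  ∏ˡ-* : ∀ ps f g → ∏ˡ ps (λ p → f p * g p) ≡ ∏ˡ ps f * ∏ˡ ps g
  ∏ˡ-* []       f g = refl
  ∏ˡ-* (p ∷ ps) f g = trans (cong (f p * g p *_) (∏ˡ-* ps f g)) (*-interchange (f p) (g p) _ _)

  ∏ˡ-cong : ∀ {ps f g} → All (λ p → f p ≡ g p) ps → ∏ˡ ps f ≡ ∏ˡ ps g
  ∏ˡ-cong []       = refl
  ∏ˡ-cong (e ∷ es) = cong₂ _*_ e (∏ˡ-cong es)

  ∏ˡ-1 : ∀ ps → ∏ˡ ps (λ _ → 1ℤ) ≡ 1ℤ
  ∏ˡ-1 []       = refl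
  ∏ˡ-1 (p ∷ ps) = trans (*-identityˡ _) (∏ˡ-1 ps)

  ∏ˡ-∏ : ∀ ps n (f : ℕ → ℤ) → ∏ˡ ps (λ p → ∏ n (λ _ → f p)) ≡ ∏ n (λ _ → ∏ˡ ps f)
  ∏ˡ-∏ ps zero    f = ∏ˡ-1 ps
  ∏ˡ-∏ ps (suc n) f = trans (∏ˡ-* ps (λ p → ∏ n (λ _ → f p)) f) (cong (_* ∏ˡ ps f) (∏ˡ-∏ ps n f))

  ∏ˡ-product : ∀ ps {κ : ℕ → ℤ} → κ 1 ≡ 1ℤ → (∀ m n → κ (m ℕ.* n) ≡ κ m * κ n) → ∏ˡ ps κ ≡ κ (product ps)
  ∏ˡ-product []       κ1 κ* = sym κ1
  ∏ˡ-product (p ∷ ps) {κ} κ1 κ* = trans (cong (κ p *_) (∏ˡ-product ps κ1 κ*)) (sym (κ* p (product ps)))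

  ∈-∣product : ∀ ps → All (ℕD._∣ product ps) ps
  ∈-∣product []       = []
  ∈-∣product (p ∷ ps) = ℕD.m∣m*n (product ps) ∷ All.map (λ d → ℕD.∣n⇒∣m*n p d) (∈-∣product ps)

  ∏ˡ-zero : ∀ {ps p f} → All Prime ps → Prime p → p ℕD.∣ product ps → f p ≡ 0ℤ → ∏ˡ ps f ≡ 0ℤ
  ∏ˡ-zero {[]} [] pr d e = contradiction (sym (ℕD.∣1⇒≡1 d)) (ℕP.<⇒≢ (ℕ.nonTrivial⇒n>1 _ {{prime⇒nonTrivial pr}}))
  ∏ˡ-zero {q ∷ ps} {p} {f} (prq ∷ prs) pr d e with euclidsLemma q (product ps) pr d
  ... | inj₂ d′ = trans (cong (f q *_) (∏ˡ-zero prs pr d′ e)) (*-zeroʳ (f q))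
  ... | inj₁ d′ with prime⇒irreducible prq d′
  ...   | inj₁ refl = contradiction refl (ℕP.<⇒≢ (ℕ.nonTrivial⇒n>1 _ {{prime⇒nonTrivial pr}}))
  ...   | inj₂ refl = cong (_* ∏ˡ ps f) e

  module JacobiProperties (N : ℕ) .{{nz : ℕ.NonZero N}} (N%4 : N % 4 ≡ 3) where

    open PrimeFactorisation (factorise N) using (isFactorisation; factorsPrime)

    χ : ℕ → ℤ
    χ x = jacobi x N

    private
      ps : List ℕ
      ps = factors (factorise N)

      N≡ : N ≡ product ps
      N≡ = isFactorisation

      N-odd : ¬ 2 ℕD.∣ N
      N-odd (ℕD.divides q e) = bad (q % 4) (m%n<n q 4) (trans (sym (%-distribˡ-* q 2 4)) (trans (cong (_% 4) (sym e)) N%4))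
        where
        bad : ∀ i → i ℕ.< 4 → (i ℕ.* (2 % 4)) % 4 ≢ 3
        bad 0 _ ()
        bad 1 _ ()
        bad 2 _ ()
        bad 3 _ ()
        bad (suc (suc (suc (suc i)))) (ℕ.s≤s (ℕ.s≤s (ℕ.s≤s (ℕ.s≤s ()))))

      toOdd : ∀ {p} → p ℕD.∣ N → Prime p → IsOddPrime p
      toOdd {p} d pr with halve p
      ... | m , inj₁ refl = contradiction (ℕD.∣-trans (ℕD.divides m (l m)) d) N-odd
        where
        l = semiring 1 λ m → m :+ m ⊜ m :* # 2
      ... | m , inj₂ refl = oddPrime m pr

      divs : All (ℕD._∣ N) ps
      divs = subst (λ n → All (ℕD._∣ n) ps) (sym N≡) (∈-∣product ps)

      odds : All IsOddPrime ps
      odds = All.zipWith (λ (d , pr) → toOdd d pr) (divs , factorsPrime)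

      onPrimes : ∀ {P : ℕ → Set} → (∀ r → Prime (odd r) → P (odd r)) → All P ps
      onPrimes h = All.map (λ { (oddPrime r pr) → h r pr }) odds

      κ₄N : κ₄ N ≡ -1ℤ
      κ₄N = cong tab₄ N%4

      ∏κ : ∀ κ → κ 1 ≡ 1ℤ → (∀ m n → κ (m ℕ.* n) ≡ κ m * κ n) → ∏ˡ ps κ ≡ κ N
      ∏κ κ κ1 κ* = trans (∏ˡ-product ps κ1 κ*) (cong κ (sym N≡))

    χ-* : ∀ a b → χ (a ℕ.* b) ≡ χ a * χ b
    χ-* a b = trans (∏ˡ-cong (onPrimes (λ r pr → OddPrime.L-* r pr a b)))
      (∏ˡ-* ps (legendre a) (legendre b))

    χ-1 : χ 1 ≡ 1ℤ
    χ-1 = trans (∏ˡ-cong (onPrimes (λ r pr → OddPrime.L1 r pr))) (∏ˡ-1 ps)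

    χ-cong : ∀ a b → + a ≋ + b [ N ] → χ a ≡ χ b
    χ-cong a b e = ∏ˡ-cong (All.zipWith (λ { (d , oddPrime r pr) →
      OddPrime.L-cong r pr a b (∣⇒≋ (∣-trans (ℕ∣⇒∣ d) (≋⇒∣ e))) }) (divs , odds))

    -- A prime factor 2 r + 1 contributes (-1)^r, its value under `κ₄`. As `κ₄` is completely
    -- multiplicative, the product is `κ₄ N`, and this is -1 for N ≡ 3 modulo 4.
    χ-neg1 : ∀ {x} → + x ≋ -1ℤ [ N ] → χ x ≡ -1ℤ
    χ-neg1 {x} e = begin
      ∏ˡ ps (legendre x) ≡⟨ ∏ˡ-cong (All.zipWith (λ { (d , oddPrime r pr) →
        trans (OddPrime.L-neg1 r pr {x} (∣⇒≋ (∣-trans (ℕ∣⇒∣ d) (≋⇒∣ e)))) (sym (κ₄-odd r)) }) (divs , odds)) ⟩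
      ∏ˡ ps κ₄ ≡⟨ ∏κ κ₄ refl κ₄-* ⟩
      κ₄ N ≡⟨ κ₄N ⟩
      -1ℤ ∎
      where open ≡-Reasoning

    -- The argument of `χ-neg1` with `κ₈`, each prime factor contributing through `γ2`.
    χ-2 : χ 2 ≡ κ₈ N
    χ-2 = begin
      ∏ˡ ps (legendre 2) ≡⟨ ∏ˡ-cong (onPrimes λ r pr → trans (OddPrime.L≡γ r pr {2} (∤2 r pr)) (γ2 r)) ⟩
      ∏ˡ ps κ₈ ≡⟨ ∏κ κ₈ refl κ₈-* ⟩
      κ₈ N ∎
      where
      open ≡-Reasoning
      ∤2 : ∀ r → Prime (odd r) → ¬ odd r ℕD.∣ 2
      ∤2 r pr d = ℕP.<⇒≱ (Symbol.2<p r pr) (ℕD.∣⇒≤ d)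

    χ-prime-∣ : ∀ {p x} → Prime p → p ℕD.∣ N → p ℕD.∣ x → χ x ≡ 0ℤ
    χ-prime-∣ {p} {x} pr p∣N p∣x = ∏ˡ-zero factorsPrime pr (subst (p ℕD.∣_) N≡ p∣N) (legendre-∣ p∣x)

    -- Reciprocity, summed over the prime factors of N.
    χ-reciprocity : ∀ r (pr : Prime (odd r)) → ¬ odd r ℕD.∣ N →
      legendre N (odd r) * χ (odd r) ≡ alt r
    χ-reciprocity r pr ∤N = begin
      legendre N (odd r) * χ (odd r)
        ≡⟨ cong (_* χ (odd r)) (sym (∏κ (λ x → legendre x (odd r)) (OddPrime.L1 r pr) (OddPrime.L-* r pr))) ⟩
      ∏ˡ ps (λ q → legendre q (odd r)) * ∏ˡ ps (legendre (odd r))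
        ≡⟨ sym (∏ˡ-* ps (λ q → legendre q (odd r)) (legendre (odd r))) ⟩
      ∏ˡ ps (λ q → legendre q (odd r) * legendre (odd r) q)
        ≡⟨ ∏ˡ-cong (All.zipWith each (divs , odds)) ⟩
      ∏ˡ ps (λ q → ∏ r (λ _ → κ₄ q)) ≡⟨ ∏ˡ-∏ ps r κ₄ ⟩
      ∏ r (λ _ → ∏ˡ ps κ₄) ≡⟨ ∏-cong r (λ _ → trans (∏κ κ₄ refl κ₄-*) κ₄N) ⟩
      alt r ∎
      where
      open ≡-Reasoning
      each : ∀ {q} → q ℕD.∣ N × IsOddPrime q →
        legendre q (odd r) * legendre (odd r) q ≡ ∏ r (λ _ → κ₄ q)
      each (q∣N , oddPrime s prs) = trans
        (cong₂ _*_ (OddPrime.L≡γ r pr ℓ∤q) (OddPrime.L≡γ s prs q∤ℓ))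
        (trans (reciprocity r s (prime∤⇒coprime pr ℓ∤q)) (∏-cong r (λ _ → sym (κ₄-odd s))))
        where
        ℓ∤q : ¬ odd r ℕD.∣ odd s
        ℓ∤q d = ∤N (ℕD.∣-trans d q∣N)
        q∤ℓ : ¬ odd s ℕD.∣ odd r
        q∤ℓ d with prime⇒irreducible pr d
        ... | inj₁ e = contradiction (sym e) (ℕP.<⇒≢ (ℕP.<-trans (ℕP.n<1+n 1) (Symbol.2<p s prs)))
        ... | inj₂ e = ℓ∤q (ℕD.∣-reflexive (sym e))

    -- Since `r + r` is -1 modulo 2 r + 1, the left side is the symbol of -N. The symbol of -1
    -- cancels the sign of reciprocity, because N ≡ 3 modulo 4.
    χ-prime : ∀ r (pr : Prime (odd r)) → ¬ odd r ℕD.∣ N →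
      legendre ((r ℕ.+ r) ℕ.* N) (odd r) ≡ χ (odd r)
    χ-prime r pr ∤N = begin
      L ((r ℕ.+ r) ℕ.* N) ≡⟨ L-* (r ℕ.+ r) N ⟩
      L (r ℕ.+ r) * L N ≡⟨ cong (_* L N) (L-neg1 {r ℕ.+ r} (mod 1ℤ (l (+ r)))) ⟩
      alt r * L N ≡⟨ cong (_* L N) (sym (χ-reciprocity r pr ∤N)) ⟩
      L N * χ (odd r) * L N ≡⟨ l′ (L N) (χ (odd r)) ⟩
      L N * L N * χ (odd r) ≡⟨ cong (_* χ (odd r)) (±1-square (L-±1 ∤N)) ⟩
      1ℤ * χ (odd r) ≡⟨ *-identityˡ _ ⟩
      χ (odd r) ∎
      where
      open ≡-Reasoning
      open OddPrime r pr
      l = ring 1 λ r → r :+ r ⊜ (:- # 1) :+ # 1 :* (# 1 :+ (r :+ r))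
      l′ = ring 2 λ a b → a :* b :* a ⊜ a :* a :* b

-- Roots of x² + x + c modulo n and the divisor sum of χ.

module Counting where

  open Normalisation using (ring; semiring; _⊜_; _:+_; _:-_; _:*_; :-_; #_)
  open import Data.Integer.Base hiding (suc; _%_; _/_; _^_)
  open ℤD
  open ℤP
  open import Data.List.Base using ([]; _∷_)
  open import Data.Nat.Base using (_%_; _/_; _^_)
  open import Data.Nat.DivMod using ([m+kn]%n≡m%n)
  open import Data.Nat.Induction using (<-rec)
  open import Data.Nat.Primality using (Prime; euclidsLemma; prime⇒nonTrivial; prime⇒nonZero; prime⇒irreducible)
  open import Data.Nat.Primality.Factorisation using (PrimeFactorisation; factorise)
  open Sums
  open Modular
  open import Defs using (legendre)
  open Gauss using (±1; ±1-square; module Symbol)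
  open Reciprocity using (odd)
  open Legendre hiding (square)
  open Jacobi

  coprime-∣* : ∀ {m n} → Coprime m n → ∀ {z} → + m ∣ z → + n ∣ z → + (m ℕ.* n) ∣ z
  coprime-∣* {m} {n} c {z} (divides k refl) d with coprime-cancel {m} (Coprimality.sym c) (subst (+ n ∣_) (*-comm k (+ m)) d)
  ... | divides l refl = divides l (trans (*-assoc l (+ n) (+ m)) (cong (l *_) (trans (*-comm (+ n) (+ m)) (sym (pos-* m n)))))

  -- The map d ↦ p d leaves the range of summation; the terms that it reaches outside vanish by
  -- assumption.
  ∑-multiples : ∀ B p .{{_ : ℕ.NonZero p}} (F : ℕ → ℤ) → (∀ x → B ℕ.≤ x → F x ≡ 0ℤ) →
    ∑ B (λ d → ⟦ p ℕD.∣? d ⟧ * F d) ≡ ∑ B (λ d → F (p ℕ.* d))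
  ∑-multiples B p F F0 = sym (begin
    ∑ B (λ d′ → F (p ℕ.* d′))
      ≡⟨ ∑-cong B (λ d′ → sym (pick d′)) ⟩
    ∑ B (λ d′ → ∑ B (λ d → ⟦ d ℕP.≟ p ℕ.* d′ ⟧ * F d))
      ≡⟨ ∑-swap B B (λ d′ d → ⟦ d ℕP.≟ p ℕ.* d′ ⟧ * F d) ⟩
    ∑ B (λ d → ∑ B (λ d′ → ⟦ d ℕP.≟ p ℕ.* d′ ⟧ * F d))
      ≡⟨ ∑-cong< B (λ d d< → trans (sym (∑-* B (F d) (λ d′ → ⟦ d ℕP.≟ p ℕ.* d′ ⟧))) (cong (_* F d) (count d d<))) ⟩
    ∑ B (λ d → ⟦ p ℕD.∣? d ⟧ * F d) ∎)
    where
    open ≡-Reasoning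
    pick : ∀ d′ → ∑ B (λ d → ⟦ d ℕP.≟ p ℕ.* d′ ⟧ * F d) ≡ F (p ℕ.* d′)
    pick d′ with p ℕ.* d′ ℕP.<? B
    ... | yes lt = ∑-δ B F lt
    ... | no ¬lt = trans (∑-vanish B (λ d d< → cong (_* F d) (⟦⟧-no (d ℕP.≟ p ℕ.* d′) (λ { refl → ¬lt d< }))))
      (sym (F0 (p ℕ.* d′) (ℕP.≮⇒≥ ¬lt)))
    count : ∀ d → d ℕ.< B → ∑ B (λ d′ → ⟦ d ℕP.≟ p ℕ.* d′ ⟧) ≡ ⟦ p ℕD.∣? d ⟧
    count d d< with p ℕD.∣? d
    ... | yes p∣d@(ℕD.divides q e) = trans (∑-⟦⟧-unique B (λ d′ → d ℕP.≟ p ℕ.* d′) {q} q< (trans e (ℕP.*-comm q p))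
            (λ i _ e′ → ℕP.*-cancelˡ-≡ i q p (trans (sym e′) (trans e (ℕP.*-comm q p)))))
          (sym (⟦⟧-yes (yes p∣d) p∣d))
      where
      q< : q ℕ.< B
      q< = ℕP.≤-<-trans (subst (q ℕ.≤_) (sym e) (ℕP.m≤m*n q p)) d<
    ... | no ∤ = trans (∑-vanish B (λ d′ _ → ⟦⟧-no (d ℕP.≟ p ℕ.* d′) (λ { refl → ∤ (ℕD.m∣m*n d′) })))
          (sym (⟦⟧-no (no ∤) ∤))

  ∑-split-∣ : ∀ B p .{{_ : ℕ.NonZero p}} (F : ℕ → ℤ) → (∀ x → B ℕ.≤ x → F x ≡ 0ℤ) →
    ∑ B F ≡ ∑ B (λ d → F (p ℕ.* d)) + ∑ B (λ d → (1ℤ - ⟦ p ℕD.∣? d ⟧) * F d)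
  ∑-split-∣ B p F F0 = trans
    (∑-cong B (λ d → l ⟦ p ℕD.∣? d ⟧ (F d)))
    (trans (∑-+ B (λ d → ⟦ p ℕD.∣? d ⟧ * F d) (λ d → (1ℤ - ⟦ p ℕD.∣? d ⟧) * F d))
      (cong (_+ ∑ B (λ d → (1ℤ - ⟦ p ℕD.∣? d ⟧) * F d)) (∑-multiples B p F F0)))
    where
    l = ring 2 λ a x → x ⊜ a :* x :+ (# 1 :- a) :* x

  valuation : ∀ p → Prime p → ∀ n → .{{ℕ.NonZero n}} → ∃[ k ] ∃[ m ] n ≡ p ^ k ℕ.* m × ¬ p ℕD.∣ m
  valuation p pr = <-rec P step
    where
    P : ℕ → Set
    P n = .{{ℕ.NonZero n}} → ∃[ k ] ∃[ m ] n ≡ p ^ k ℕ.* m × ¬ p ℕD.∣ m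
    step : ∀ n → (∀ {m} → m ℕ.< n → P m) → P n
    step n rec {{nz}} with p ℕD.∣? n
    ... | no ∤ = 0 , n , sym (ℕP.*-identityˡ n) , ∤
    ... | yes (ℕD.divides q refl) with rec {q} (ℕP.m<m*n q p {{ℕP.m*n≢0⇒m≢0 q {{nz}}}} (ℕ.nonTrivial⇒n>1 p {{prime⇒nonTrivial pr}})) {{ℕP.m*n≢0⇒m≢0 q {{nz}}}}
    ...   | k , m , e , ∤ = suc k , m , trans (cong (ℕ._* p) e) (trans (ℕP.*-comm _ p) (sym (ℕP.*-assoc p (p ^ k) m))) , ∤

  prime-divisor : ∀ n → 1 ℕ.< n → ∃[ p ] Prime p × p ℕD.∣ n
  prime-divisor n@(suc (suc _)) _ = go (factors) isFactorisation factorsPrime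
    where
    open PrimeFactorisation (factorise n)
    open import Data.List.Relation.Unary.All using (All; []; _∷_)
    open import Data.Nat.ListAction using (product)
    go : ∀ ps → n ≡ product ps → All Prime ps → ∃[ p ] Prime p × p ℕD.∣ n
    go [] () _
    go (p ∷ ps) e (pr ∷ _) = p , pr , subst (p ℕD.∣_) (sym e) (ℕD.m∣m*n (product ps))
  prime-divisor 1 (ℕ.s≤s ())

  coprime-^ : ∀ {p m} → Prime p → ¬ p ℕD.∣ m → ∀ k → Coprime (p ^ k) m
  coprime-^ {p} {m} pr ∤ zero (d∣1 , _) = ℕD.∣1⇒≡1 d∣1
  coprime-^ {p} {m} pr ∤ (suc k) {d} (d∣ , d∣m) = coprime-^ pr ∤ k
    (Coprimality.coprime-divisor {d} {p} {p ^ k} (Coprimality.sym cop) d∣ , d∣m)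
    where
    cop : Coprime p d
    cop {e} (e∣p , e∣d) with prime⇒irreducible pr e∣p
    ... | inj₁ refl = refl
    ... | inj₂ refl = contradiction (ℕD.∣-trans e∣d d∣m) ∤

  module ClassCount (N c : ℕ) (N+1 : suc N ≡ 4 ℕ.* c) (N-sqfree : ∀ d → d ℕ.* d ℕD.∣ N → d ≡ 1) where

    private
      c≢0 : c ≢ 0
      c≢0 refl = contradiction N+1 λ ()

    N%4≡3 : N % 4 ≡ 3
    N%4≡3 = go c N+1
      where
      go : ∀ c → suc N ≡ 4 ℕ.* c → N % 4 ≡ 3
      go zero ()
      go (suc c) e = trans (cong (_% 4) (ℕP.suc-injective (trans e (l c)))) ([m+kn]%n≡m%n 3 c 4)
        where
        l = semiring 1 λ c → # 4 :* (# 1 :+ c) ⊜ # 1 :+ (# 3 :+ c :* # 4)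

    N-nonZero : ℕ.NonZero N
    N-nonZero = ℕ.≢-nonZero λ { refl → contradiction N%4≡3 λ () }

    open JacobiProperties N {{N-nonZero}} N%4≡3 public

    +N : + N ≡ + 4 * + c - 1ℤ
    +N = trans (l (+ N)) (cong (_- 1ℤ) (trans (cong +_ N+1) (pos-* 4 c)))
      where
      l = ring 1 λ n → n ⊜ (# 1 :+ n) :- # 1

    -- The norm of x + (1 + √-N) / 2.
    f : ℤ → ℤ
    f x = x * x + x + + c

    4f : ∀ x → + 4 * f x ≡ (+ 2 * x + 1ℤ) * (+ 2 * x + 1ℤ) + + N
    4f x = trans (l x (+ c)) (cong (_+_ ((+ 2 * x + 1ℤ) * (+ 2 * x + 1ℤ))) (sym +N))
      where
      l = ring 2 λ x c → # 4 :* (x :* x :+ x :+ c) ⊜ (# 2 :* x :+ # 1) :* (# 2 :* x :+ # 1) :+ (# 4 :* c :- # 1)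

    f-cong : ∀ {n x y} → x ≋ y [ n ] → f x ≋ f y [ n ]
    f-cong e = ≋-+ (≋-+ (≋-* e e) e) ≋-refl

    rootOf : ℕ → ℕ → ℤ
    rootOf a β = ⟦ + a ∣? f (+ β) ⟧

    -- The number of primitive ideals of norm a: they are ℤ a + ℤ (β + ω) with β a root of `f`
    -- modulo a.
    ρ : ℕ → ℤ
    ρ a = ∑ a (rootOf a)

    rootOf-cong : ∀ {a x y} → + x ≋ + y [ a ] → rootOf a x ≡ rootOf a y
    rootOf-cong {a} {x} {y} e = ⟦⟧-cong (+ a ∣? f (+ x)) (+ a ∣? f (+ y)) (∣-resp-≋ (f-cong e)) (∣-resp-≋ (f-cong (≋-sym e)))

    rootOf-periodic : ∀ a → Periodic a (rootOf a)
    rootOf-periodic a x = rootOf-cong (mod 1ℤ (cong (_+_ (+ x)) (sym (*-identityˡ (+ a)))))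

    -- The Chinese remainder theorem. Residues modulo m n are written i + m j, where i is the
    -- residue modulo m; for fixed i they run through all residues modulo n.
    ρ-coprime : ∀ m n .{{_ : ℕ.NonZero m}} .{{_ : ℕ.NonZero n}} → Coprime m n → ρ (m ℕ.* n) ≡ ρ m * ρ n
    ρ-coprime m n cop = begin
      ρ (m ℕ.* n) ≡⟨ cong (λ k → ∑ k (rootOf (m ℕ.* n))) (ℕP.*-comm m n) ⟩
      ∑ (n ℕ.* m) (rootOf (m ℕ.* n)) ≡⟨ ∑-blocks m n (rootOf (m ℕ.* n)) ⟩
      ∑ n (λ j → ∑ m (λ i → rootOf (m ℕ.* n) (j ℕ.* m ℕ.+ i)))
        ≡⟨ ∑-cong n (λ j → ∑-cong m (λ i → both j i)) ⟩
      ∑ n (λ j → ∑ m (λ i → rootOf m i * rootOf n (i ℕ.+ m ℕ.* j)))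
        ≡⟨ ∑-swap n m (λ j i → rootOf m i * rootOf n (i ℕ.+ m ℕ.* j)) ⟩
      ∑ m (λ i → ∑ n (λ j → rootOf m i * rootOf n (i ℕ.+ m ℕ.* j)))
        ≡⟨ ∑-cong m (λ i → trans (sym (*-∑ n (rootOf m i) (λ j → rootOf n (i ℕ.+ m ℕ.* j))))
             (cong (rootOf m i *_) (∑-affine {G = rootOf n} (rootOf-periodic n) m (Coprimality.sym cop) i))) ⟩
      ∑ m (λ i → rootOf m i * ρ n) ≡⟨ sym (∑-* m (ρ n) (rootOf m)) ⟩
      ρ m * ρ n ∎
      where
      open ≡-Reasoning
      both : ∀ j i → rootOf (m ℕ.* n) (j ℕ.* m ℕ.+ i) ≡ rootOf m i * rootOf n (i ℕ.+ m ℕ.* j)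
      both j i = trans (cong (rootOf (m ℕ.* n)) (trans (ℕP.+-comm (j ℕ.* m) i) (cong (i ℕ.+_) (ℕP.*-comm j m))))
        (trans (trans (⟦⟧-cong (+ (m ℕ.* n) ∣? z) ((+ m ∣? z) Relation.Nullary.×-dec (+ n ∣? z))
            (λ d → ∣-trans (ℕ∣⇒∣ (ℕD.m∣m*n n)) d , ∣-trans (ℕ∣⇒∣ (ℕD.n∣m*n m)) d)
            (λ (d , e) → coprime-∣* cop d e))
          (⟦⟧-× (+ m ∣? z) (+ n ∣? z)))
          (cong (_* rootOf n x) (rootOf-cong {m} {x} {i} (mod (+ j) (trans (cong (_+_ (+ i)) (pos-* m j)) (cong (_+_ (+ i)) (*-comm (+ m) (+ j))))))))
        where
        x = i ℕ.+ m ℕ.* j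
        z = f (+ x)

    2x+1 : ∀ x → + 2 * + x + 1ℤ ≡ + (1 ℕ.+ 2 ℕ.* x)
    2x+1 x = trans (+-comm (+ 2 * + x) 1ℤ) (cong (_+_ 1ℤ) (sym (pos-* 2 x)))

    f-ℕ : ∀ x → f (+ x) ≡ + (x ℕ.* x ℕ.+ x ℕ.+ c)
    f-ℕ x = cong (λ u → u + + x + + c) (sym (pos-* x x))

    ∣f⇒∤2x+1 : ∀ {p} → Prime p → ¬ p ℕD.∣ N → ∀ {x} → + p ∣ f (+ x) → ¬ p ℕD.∣ 1 ℕ.+ 2 ℕ.* x
    ∣f⇒∤2x+1 {p} pr ∤N {x} d e = ∤N (∣⇒ℕ∣ (∣m+n∣m⇒∣n (subst (+ p ∣_) (4f (+ x)) (∣n⇒∣m*n (+ 4) d))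
      (∣m⇒∣m*n _ (subst (+ p ∣_) (sym (2x+1 x)) (ℕ∣⇒∣ e)))))

    -- Hensel's lemma: a root modulo p ^ (1 + k) lifts uniquely, f ′ being
    -- invertible modulo p at the roots.
    ρ-lift : ∀ {p} → Prime p → ¬ p ℕD.∣ N → ∀ k → ρ (p ^ suc (suc k)) ≡ ρ (p ^ suc k)
    ρ-lift {p} pr ∤N k = begin
      ρ (p ℕ.* P) ≡⟨ ∑-blocks P p (rootOf (p ℕ.* P)) ⟩
      ∑ p (λ j → ∑ P (λ i → rootOf (p ℕ.* P) (j ℕ.* P ℕ.+ i))) ≡⟨ ∑-swap p P (λ j i → rootOf (p ℕ.* P) (j ℕ.* P ℕ.+ i)) ⟩
      ∑ P (λ i → ∑ p (λ j → rootOf (p ℕ.* P) (j ℕ.* P ℕ.+ i))) ≡⟨ ∑-cong P (λ i → lift i (+ P ∣? f (+ i))) ⟩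
      ∑ P (rootOf P) ∎
      where
      open ≡-Reasoning
      P : ℕ
      P = p ^ suc k
      instance
        _ : ℕ.NonZero p
        _ = prime⇒nonZero pr
        _ : ℕ.NonZero P
        _ = ℕP.m^n≢0 p (suc k)

      expand : ∀ i j → f (+ (j ℕ.* P ℕ.+ i)) ≡ f (+ i) + + P * (+ j * (+ 2 * + i + 1ℤ) + + p * (+ (p ^ k) * (+ j * + j)))
      expand i j = trans (cong f (cong (_+ + i) (pos-* j P))) (l (+ i) (+ j) (+ P) (+ c) {+ p} {+ (p ^ k)} (trans (cong (λ u → + P * u) (pos-* p (p ^ k))) (sym (*-assoc (+ P) (+ p) (+ (p ^ k))))))
        where
        l : ∀ i j P c {q r} → P * P ≡ P * q * r →
          (j * P + i) * (j * P + i) + (j * P + i) + c ≡ (i * i + i + c) + P * (j * (+ 2 * i + 1ℤ) + q * (r * (j * j)))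
        l i j P c {q} {r} e = trans (l₁ i j P c) (trans (cong (λ u → (i * i + i + c) + P * (j * (+ 2 * i + 1ℤ)) + u * (j * j)) e) (l₂ i j P c q r))
          where
          l₁ = ring 4 λ i j P c → (j :* P :+ i) :* (j :* P :+ i) :+ (j :* P :+ i) :+ c ⊜ (i :* i :+ i :+ c) :+ P :* (j :* (# 2 :* i :+ # 1)) :+ P :* P :* (j :* j)
          l₂ = ring 6 λ i j P c q r → (i :* i :+ i :+ c) :+ P :* (j :* (# 2 :* i :+ # 1)) :+ P :* q :* r :* (j :* j) ⊜ (i :* i :+ i :+ c) :+ P :* (j :* (# 2 :* i :+ # 1) :+ q :* (r :* (j :* j)))

      H : ℕ → ℤ
      H x = ⟦ + p ∣? + x ⟧

      H-per : Periodic p H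
      H-per x = ⟦⟧-cong (+ p ∣? + (x ℕ.+ p)) (+ p ∣? + x) (λ d → ∣m+n∣n⇒∣m d ∣-refl) (λ d → ∣m∣n⇒∣m+n d ∣-refl)

      ∑H : ∑ p H ≡ 1ℤ
      ∑H = ∑-⟦⟧-unique p (λ x → + p ∣? + x) {0} (ℕ.>-nonZero⁻¹ p) (divides 0ℤ refl)
        (λ i i< d → +-injective (∣∧∣∣<⇒≡0 d i<))

      lift : ∀ i → (d : Dec (+ P ∣ f (+ i))) → ∑ p (λ j → rootOf (p ℕ.* P) (j ℕ.* P ℕ.+ i)) ≡ rootOf P i
      lift i (no ∤) = trans (∑-vanish p (λ j _ → ⟦⟧-no (+ (p ℕ.* P) ∣? f (+ (j ℕ.* P ℕ.+ i)))
          (λ d → ∤ (∣m+n∣n⇒∣m (subst (+ P ∣_) (expand i j) (∣-trans (ℕ∣⇒∣ (ℕD.n∣m*n p)) d)) (∣m⇒∣m*n _ ∣-refl)))))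
        (sym (⟦⟧-no (+ P ∣? f (+ i)) ∤))
      lift i (yes d@(divides t e)) = trans (trans (∑-cong p term) (trans
          (∑-affine {G = H} H-per (1 ℕ.+ 2 ℕ.* i) (prime∤⇒coprime pr (∣f⇒∤2x+1 pr ∤N {i} (∣-trans (ℕ∣⇒∣ (ℕD.m∣m*n (p ^ k))) d))) t′)
          ∑H)) (sym (⟦⟧-yes (+ P ∣? f (+ i)) d))
        where
        t≥0 : ∃[ t′ ] t ≡ + t′
        t≥0 = 0≤⇒≡+ (*-cancelʳ-≤-pos 0ℤ t (+ P) {{positive (+<+ (ℕ.>-nonZero⁻¹ P))}} (subst (0ℤ ≤_) (trans (sym (f-ℕ i)) e) 0≤pos))
        t′ = proj₁ t≥0
        e′ : ∀ j → f (+ (j ℕ.* P ℕ.+ i)) ≡ + P * (+ (t′ ℕ.+ (1 ℕ.+ 2 ℕ.* i) ℕ.* j) + + p * (+ (p ^ k) * (+ j * + j)))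
        e′ j = trans (expand i j) (trans (cong (_+ _) (trans e (cong (_* + P) (proj₂ t≥0))))
          (trans (l (+ t′) (+ P) (+ j * (+ 2 * + i + 1ℤ)) (+ p * (+ (p ^ k) * (+ j * + j))))
            (cong (λ u → + P * (u + + p * (+ (p ^ k) * (+ j * + j)))) (cong (_+_ (+ t′))
              (trans (*-comm (+ j) (+ 2 * + i + 1ℤ)) (trans (cong (_* + j) (2x+1 i)) (sym (pos-* (1 ℕ.+ 2 ℕ.* i) j))))))))
          where
          l = ring 4 λ t P a b → t :* P :+ P :* (a :+ b) ⊜ P :* ((t :+ a) :+ b)
        -- Divided by P, the value at the lift is linear in j modulo p, with the invertible slope 2
        -- i + 1.
        term : ∀ j → rootOf (p ℕ.* P) (j ℕ.* P ℕ.+ i) ≡ H (t′ ℕ.+ (1 ℕ.+ 2 ℕ.* i) ℕ.* j)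
        term j = ⟦⟧-cong (+ (p ℕ.* P) ∣? f (+ (j ℕ.* P ℕ.+ i))) (+ p ∣? + (t′ ℕ.+ (1 ℕ.+ 2 ℕ.* i) ℕ.* j))
          (λ d → ∣m+n∣n⇒∣m (*-cancelˡ-∣ (+ P) (subst₂ _∣_ (trans (cong +_ (ℕP.*-comm p P)) (pos-* P p)) (e′ j) d)) (∣m⇒∣m*n _ ∣-refl))
          (λ d → subst₂ _∣_ (sym (trans (cong +_ (ℕP.*-comm p P)) (pos-* P p))) (sym (e′ j))
            (*-monoʳ-∣ (+ P) (∣m∣n⇒∣m+n d (∣m⇒∣m*n _ ∣-refl))))

    -- Completing the square turns ρ p into a count of square roots of - N.
    ρ-square : ∀ r → Prime (odd r) → ρ (odd r) ≡ 1ℤ + legendre ((r ℕ.+ r) ℕ.* N) (odd r)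
    ρ-square r pr = begin
      ∑ p (rootOf p) ≡⟨ ∑-cong p square ⟩
      ∑ p (λ β → G (1 ℕ.+ 2 ℕ.* β)) ≡⟨ ∑-affine {G = G} G-per 2 (prime∤⇒coprime pr ∤2) 1 ⟩
      ∑ p G ≡⟨ ∑-cong p root ⟩
      OddPrime.rootCount r pr ((r ℕ.+ r) ℕ.* N) ≡⟨ OddPrime.rootCount≡ r pr ((r ℕ.+ r) ℕ.* N) ⟩
      1ℤ + legendre ((r ℕ.+ r) ℕ.* N) p ∎
      where
      open ≡-Reasoning
      p = odd r
      ∤2 : ¬ p ℕD.∣ 2
      ∤2 d = ℕP.<⇒≱ (Symbol.2<p r pr) (ℕD.∣⇒≤ d)
      G : ℕ → ℤ
      G y = ⟦ + p ∣? + y * + y + + N ⟧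
      G-per : Periodic p G
      G-per y = ⟦⟧-cong (+ p ∣? + (y ℕ.+ p) * + (y ℕ.+ p) + + N) (+ p ∣? + y * + y + + N)
        (∣-resp-≋ (≋-+ (≋-* e e) (≋-refl {x = + N}))) (∣-resp-≋ (≋-+ (≋-* (≋-sym e) (≋-sym e)) (≋-refl {x = + N})))
        where
        e : + (y ℕ.+ p) ≋ + y [ p ]
        e = mod 1ℤ (cong (_+_ (+ y)) (sym (*-identityˡ (+ p))))
      coprime4 : Coprime p 4
      coprime4 = prime∤⇒coprime pr (λ d → Sum.[ ∤2 , ∤2 ]′ (euclidsLemma 2 2 pr d))
      square : ∀ β → rootOf p β ≡ G (1 ℕ.+ 2 ℕ.* β)
      square β = ⟦⟧-cong (+ p ∣? f (+ β)) (+ p ∣? + (1 ℕ.+ 2 ℕ.* β) * + (1 ℕ.+ 2 ℕ.* β) + + N)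
        (λ d → subst (+ p ∣_) e (∣n⇒∣m*n (+ 4) d))
        (λ d → coprime-cancel {4} coprime4 (subst (+ p ∣_) (sym e) d))
        where
        e : + 4 * f (+ β) ≡ + (1 ℕ.+ 2 ℕ.* β) * + (1 ℕ.+ 2 ℕ.* β) + + N
        e = trans (4f (+ β)) (cong (λ u → u * u + + N) (2x+1 β))
      root : ∀ y → G y ≡ ⟦ isRoot? p ((r ℕ.+ r) ℕ.* N) y ⟧
      root y = ⟦⟧-cong (+ p ∣? + y * + y + + N) (isRoot? p ((r ℕ.+ r) ℕ.* N) y)
        (∣-resp-≋ (≋-+ (≋-refl {x = + y * + y}) e)) (∣-resp-≋ (≋-+ (≋-refl {x = + y * + y}) (≋-sym e)))
        where
        e : + N ≋ - + ((r ℕ.+ r) ℕ.* N) [ p ]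
        e = mod (+ N) (trans (l (+ r) (+ N)) (cong (λ u → - u + + N * + p) (sym (pos-* (r ℕ.+ r) N))))
          where
          l = ring 2 λ r n → n ⊜ :- ((r :+ r) :* n) :+ n :* (# 1 :+ (r :+ r))

    κ₈-even : ∀ e → c ≡ e ℕ.+ e → κ₈ N ≡ 1ℤ
    κ₈-even zero    e≡ = contradiction e≡ c≢0
    κ₈-even (suc e) e≡ = cong tab₈ (trans (cong (_% 8) (ℕP.suc-injective (trans N+1 (trans (cong (4 ℕ.*_) e≡) (l e))))) ([m+kn]%n≡m%n 7 e 8))
      where
      l = semiring 1 λ e → # 4 :* ((# 1 :+ e) :+ (# 1 :+ e)) ⊜ # 1 :+ (# 7 :+ e :* # 8)

    κ₈-uneven : ∀ e → c ≡ suc (e ℕ.+ e) → κ₈ N ≡ -1ℤ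
    κ₈-uneven e e≡ = cong tab₈ (trans (cong (_% 8) (ℕP.suc-injective (trans N+1 (trans (cong (4 ℕ.*_) e≡) (l e))))) ([m+kn]%n≡m%n 3 e 8))
      where
      l = semiring 1 λ e → # 4 :* (# 1 :+ (e :+ e)) ⊜ # 1 :+ (# 3 :+ e :* # 8)

    -- As f(0) = c and f(1) = c + 2, there are two roots or none according to the parity of c, that
    -- is to N = 4 c - 1 modulo 8.
    ρ-2 : ρ 2 ≡ 1ℤ + κ₈ N
    ρ-2 with halve c
    ... | e , inj₁ c≡ = trans (cong₂ (λ u v → 0ℤ + u + v) (⟦⟧-yes (+ 2 ∣? f (+ 0)) (∣ᵤ⇒∣ 2∣c))
            (⟦⟧-yes (+ 2 ∣? f (+ 1)) (∣m∣n⇒∣m+n {+ 2} {+ 2} (divides 1ℤ refl) (ℕ∣⇒∣ 2∣c)))) (cong (_+_ 1ℤ) (sym (κ₈-even e c≡)))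
      where
      2∣c : 2 ℕD.∣ c
      2∣c = ℕD.divides e (trans c≡ (l e))
        where
        l = semiring 1 λ e → e :+ e ⊜ e :* # 2
    ... | e , inj₂ c≡ = trans (cong₂ (λ u v → 0ℤ + u + v) (⟦⟧-no (+ 2 ∣? f (+ 0)) (2∤c ∘ ∣⇒ℕ∣))
            (⟦⟧-no (+ 2 ∣? f (+ 1)) (λ d → 2∤c (∣⇒ℕ∣ (∣m+n∣m⇒∣n {+ 2} {+ 2} d (divides 1ℤ refl)))))) (cong (_+_ 1ℤ) (sym (κ₈-uneven e c≡)))
      where
      2∤c : ¬ 2 ℕD.∣ c
      2∤c d = contradiction (ℕD.∣1⇒≡1 (ℕD.∣m+n∣m⇒∣n (subst (2 ℕD.∣_) (trans c≡ (l e)) d) (ℕD.n∣m*n e))) λ ()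
        where
        l : ∀ e → suc (e ℕ.+ e) ≡ e ℕ.* 2 ℕ.+ 1
        l e = trans (cong suc (l′ e)) (ℕP.+-comm 1 _)
          where
          l′ = semiring 1 λ e → e :+ e ⊜ e :* # 2

    ρ-prime : ∀ {p} → Prime p → ρ p ≡ 1ℤ + χ p
    ρ-prime {p} pr with halve p
    ... | m , inj₂ refl with odd m ℕD.∣? N
    ...   | no ∤N = trans (ρ-square m pr) (cong (_+_ 1ℤ) (χ-prime m pr ∤N))
    ...   | yes ∣N = trans (ρ-square m pr) (cong (_+_ 1ℤ) (trans (legendre-∣ (ℕD.∣n⇒∣m*n (m ℕ.+ m) ∣N))
              (sym (χ-prime-∣ pr ∣N ℕD.∣-refl))))
    ρ-prime {p} pr | m , inj₁ refl with prime⇒irreducible pr (ℕD.divides m (trans (cong (m ℕ.+_) (sym (ℕP.+-identityʳ m))) (ℕP.*-comm 2 m)))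
    ...   | inj₂ e = subst (λ p → ρ p ≡ 1ℤ + χ p) e (trans ρ-2 (cong (_+_ 1ℤ) (sym χ-2)))

    -- If p² divided f(β), then p would divide (2 β + 1)² = 4 f(β) - N, so p² would divide N.
    ρ-ramified : ∀ {p} → Prime p → p ℕD.∣ N → ∀ k → ρ (p ^ suc (suc k)) ≡ 0ℤ
    ρ-ramified {p} pr p∣N k = ∑-vanish (p ^ suc (suc k)) (λ β _ → ⟦⟧-no (+ (p ^ suc (suc k)) ∣? f (+ β)) (bad β))
      where
      bad : ∀ β → ¬ + (p ^ suc (suc k)) ∣ f (+ β)
      bad β d = contradiction (N-sqfree p (∣⇒ℕ∣ p²∣N)) (ℕP.<⇒≢ (ℕ.nonTrivial⇒n>1 p {{prime⇒nonTrivial pr}}) ∘ sym)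
        where
        p²∣f : + (p ℕ.* p) ∣ f (+ β)
        p²∣f = ∣-trans (ℕ∣⇒∣ (subst (p ℕ.* p ℕD.∣_) (ℕP.*-assoc p p (p ^ k)) (ℕD.m∣m*n (p ^ k)))) d
        b = + 2 * + β + 1ℤ
        p∣b : + p ∣ b
        p∣b = Sum.[ (λ d → d) , (λ d → d) ]′ (Prime∣ pr b b (∣m+n∣n⇒∣m (subst (+ p ∣_) (4f (+ β))
          (∣n⇒∣m*n (+ 4) (∣-trans (ℕ∣⇒∣ (ℕD.m∣m*n p)) p²∣f))) (ℕ∣⇒∣ p∣N)))
        p²∣N : + (p ℕ.* p) ∣ + N
        p²∣N = ∣m+n∣m⇒∣n (subst (+ (p ℕ.* p) ∣_) (4f (+ β)) (∣n⇒∣m*n (+ 4) p²∣f)) (sq p∣b)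
          where
          sq : ∀ {b} → + p ∣ b → + (p ℕ.* p) ∣ b * b
          sq {b} (divides q refl) = divides (q * q) (trans (l q (+ p)) (cong (q * q *_) (sym (pos-* p p))))
            where
            l = ring 2 λ q p → q :* p :* (q :* p) ⊜ q :* q :* (p :* p)

    χ-±1 : ∀ {p} → Prime p → ¬ p ℕD.∣ N → ±1 (χ p)
    χ-±1 {p} pr ∤N with halve p
    ... | m , inj₂ refl = subst ±1 (χ-prime m pr ∤N) (OddPrime.L-±1 m pr (λ d → Sum.[ ∤2m , ∤N ]′ (euclidsLemma (m ℕ.+ m) N pr d)))
      where
      ∤2m : ¬ odd m ℕD.∣ m ℕ.+ m
      ∤2m d = ℕP.<⇒≱ (ℕP.n<1+n (m ℕ.+ m)) (ℕD.∣⇒≤ {{ℕ.>-nonZero (ℕP.+-mono-≤ (Symbol.1≤r m pr) ℕ.z≤n)}} d)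
    ... | m , inj₁ refl with prime⇒irreducible pr (ℕD.divides m (trans (cong (m ℕ.+_) (sym (ℕP.+-identityʳ m))) (ℕP.*-comm 2 m)))
    ...   | inj₂ e = subst (λ p → ±1 (χ p)) e (subst ±1 (sym χ-2) κ₈N)
      where
      κ₈N : ±1 (κ₈ N)
      κ₈N = Sum.map (κ₈-even (proj₁ (halve c))) (κ₈-uneven (proj₁ (halve c))) (proj₂ (halve c))

    module Convolution (B : ℕ) where

      -- As Dirichlet series these are ζ(2 s) Σ ρ(a) a^-s and ζ(s) L(s, χ). Their Euler factors are
      -- compared through the recurrences `R-step₁`, `R-step₂` and `τ-step`. The bound B makes the
      -- sums finite and has to exceed n.
      R τ : ℕ → ℤ
      R n = ∑ B (λ g → ∑ B (λ a → ⟦ g ℕ.* g ℕ.* a ℕP.≟ n ⟧ * ρ a))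
      τ n = ∑ B (λ d → ∑ B (λ e → ⟦ d ℕ.* e ℕP.≟ n ⟧ * χ d))

      private
        factor< : ∀ {n d} e → .{{ℕ.NonZero n}} → n ℕ.< B → B ℕ.≤ d → d ℕ.* e ≢ n
        factor< {n} {d} zero {{nz}} n<B B≤d eq = ℕ.≢-nonZero⁻¹ n {{nz}} (trans (sym eq) (ℕP.*-zeroʳ d))
        factor< {n} {d} (suc e) n<B B≤d eq = ℕP.<⇒≱ n<B (ℕP.≤-trans B≤d (subst (d ℕ.≤_) eq (ℕP.m≤m*n d (suc e))))

      module _ {p : ℕ} (pr : Prime p) {m : ℕ} (p∤m : ¬ p ℕD.∣ m) where
        private
          instance
            p≢0 : ℕ.NonZero p
            p≢0 = prime⇒nonZero pr
            m≢0 : ℕ.NonZero m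
            m≢0 = ℕ.≢-nonZero λ { refl → p∤m (p ℕD.∣0) }

          -- Solutions of x e = q m with p ∤ x and q a power of p have q ∣ e.
          unscale : ∀ k x (w : ℕ → ℤ) → ¬ p ℕD.∣ x → p ^ k ℕ.* m ℕ.< B →
            ∑ B (λ e → ⟦ x ℕ.* e ℕP.≟ p ^ k ℕ.* m ⟧ * w e) ≡ ∑ B (λ e → ⟦ x ℕ.* e ℕP.≟ m ⟧ * w (p ^ k ℕ.* e))
          unscale k x w p∤x n<B = begin
            ∑ B (λ e → F e) ≡⟨ ∑-cong B (λ e → restrict e) ⟩
            ∑ B (λ e → ⟦ q ℕD.∣? e ⟧ * F e) ≡⟨ ∑-multiples B q F F0 ⟩
            ∑ B (λ e → F (q ℕ.* e)) ≡⟨ ∑-cong B (λ e → cong (_* w (q ℕ.* e)) (⟦⟧-cong (x ℕ.* (q ℕ.* e) ℕP.≟ q ℕ.* m) (x ℕ.* e ℕP.≟ m)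
              (λ eq → ℕP.*-cancelˡ-≡ (x ℕ.* e) m q (trans (l q x e) eq))
              (λ eq → trans (sym (l q x e)) (cong (q ℕ.*_) eq)))) ⟩
            ∑ B (λ e → ⟦ x ℕ.* e ℕP.≟ m ⟧ * w (q ℕ.* e)) ∎
            where
            open ≡-Reasoning
            q = p ^ k
            instance
              q≢0 : ℕ.NonZero q
              q≢0 = ℕP.m^n≢0 p k
            l = semiring 3 λ q x e → q :* (x :* e) ⊜ x :* (q :* e)
            F : ℕ → ℤ
            F e = ⟦ x ℕ.* e ℕP.≟ q ℕ.* m ⟧ * w e
            F0 : ∀ e → B ℕ.≤ e → F e ≡ 0ℤ
            F0 e B≤e = cong (_* w e) (⟦⟧-no (x ℕ.* e ℕP.≟ q ℕ.* m) (λ eq → factor< x {{ℕP.m*n≢0 q m}} n<B B≤e (trans (ℕP.*-comm e x) eq)))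
            restrict : ∀ e → F e ≡ ⟦ q ℕD.∣? e ⟧ * F e
            restrict e = go (x ℕ.* e ℕP.≟ q ℕ.* m)
              where
              go : Dec (x ℕ.* e ≡ q ℕ.* m) → F e ≡ ⟦ q ℕD.∣? e ⟧ * F e
              go (yes eq) = sym (trans (cong (_* F e) (⟦⟧-yes (q ℕD.∣? e)
                (Coprimality.coprime-divisor {n = x} (coprime-^ pr p∤x k) (subst (q ℕD.∣_) (sym eq) (ℕD.m∣m*n m))))) (*-identityˡ (F e)))
              go (no ne) = trans (cong (_* w e) (⟦⟧-no (x ℕ.* e ℕP.≟ q ℕ.* m) ne))
                (sym (trans (cong (λ u → ⟦ q ℕD.∣? e ⟧ * (u * w e)) (⟦⟧-no (x ℕ.* e ℕP.≟ q ℕ.* m) ne)) (*-zeroʳ ⟦ q ℕD.∣? e ⟧)))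

          away : ∀ {x F G} → (p ℕD.∣ x → G ≡ 0ℤ) → (¬ p ℕD.∣ x → F ≡ G) → (1ℤ - ⟦ p ℕD.∣? x ⟧) * F ≡ G
          away {x} {F} {G} h₁ h₂ = go (p ℕD.∣? x)
            where
            go : Dec (p ℕD.∣ x) → (1ℤ - ⟦ p ℕD.∣? x ⟧) * F ≡ G
            go (yes d) = trans (cong (λ u → (1ℤ - u) * F) (⟦⟧-yes (p ℕD.∣? x) d)) (sym (h₁ d))
            go (no ∤)  = trans (cong (λ u → (1ℤ - u) * F) (⟦⟧-no (p ℕD.∣? x) ∤)) (trans (*-identityˡ F) (h₂ ∤))

        -- The divisors that are multiples of p give the first term after d ↦ p d; those prime to p
        -- divide m.
        τ-step : ∀ k → p ^ suc k ℕ.* m ℕ.< B → τ (p ^ suc k ℕ.* m) ≡ χ p * τ (p ^ k ℕ.* m) + τ m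
        τ-step k n<B = trans (∑-split-∣ B p F F0) (cong₂ _+_
          (trans (∑-cong B first) (sym (*-∑ B (χ p) (λ d → ∑ B (λ e → ⟦ d ℕ.* e ℕP.≟ p ^ k ℕ.* m ⟧ * χ d)))))
          (∑-cong B second))
          where
          n = p ^ suc k ℕ.* m
          instance
            q≢0 : ℕ.NonZero (p ^ suc k)
            q≢0 = ℕP.m^n≢0 p (suc k)
          F : ℕ → ℤ
          F d = ∑ B (λ e → ⟦ d ℕ.* e ℕP.≟ n ⟧ * χ d)
          F0 : ∀ d → B ℕ.≤ d → F d ≡ 0ℤ
          F0 d B≤d = ∑-vanish B (λ e _ → cong (_* χ d) (⟦⟧-no (d ℕ.* e ℕP.≟ n) (factor< e {{ℕP.m*n≢0 (p ^ suc k) m}} n<B B≤d)))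
          first : ∀ d → F (p ℕ.* d) ≡ χ p * ∑ B (λ e → ⟦ d ℕ.* e ℕP.≟ p ^ k ℕ.* m ⟧ * χ d)
          first d = trans (∑-cong B (λ e → trans (cong₂ _*_
              (⟦⟧-cong (p ℕ.* d ℕ.* e ℕP.≟ n) (d ℕ.* e ℕP.≟ p ^ k ℕ.* m)
                (λ eq → ℕP.*-cancelˡ-≡ (d ℕ.* e) (p ^ k ℕ.* m) p (trans (sym (ℕP.*-assoc p d e)) (trans eq (ℕP.*-assoc p (p ^ k) m))))
                (λ eq → trans (ℕP.*-assoc p d e) (trans (cong (p ℕ.*_) eq) (sym (ℕP.*-assoc p (p ^ k) m)))))
              (χ-* p d)) (l ⟦ d ℕ.* e ℕP.≟ p ^ k ℕ.* m ⟧ (χ p) (χ d))))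
            (sym (*-∑ B (χ p) (λ e → ⟦ d ℕ.* e ℕP.≟ p ^ k ℕ.* m ⟧ * χ d)))
            where
            l = ring 3 λ a b c → a :* (b :* c) ⊜ b :* (a :* c)
          second : ∀ d → (1ℤ - ⟦ p ℕD.∣? d ⟧) * F d ≡ ∑ B (λ e → ⟦ d ℕ.* e ℕP.≟ m ⟧ * χ d)
          second d = away
            (λ p∣d → ∑-vanish B (λ e _ → cong (_* χ d) (⟦⟧-no (d ℕ.* e ℕP.≟ m) (λ { refl → p∤m (ℕD.∣m⇒∣m*n e p∣d) }))))
            (λ p∤d → unscale (suc k) d (λ _ → χ d) p∤d n<B)

        private
          -- The g divisible by p are kept aside. For every other g the power p^k divides a, and ρ
          -- splits off its value at p^k.
          R-split : ∀ k → p ^ k ℕ.* m ℕ.< B → R (p ^ k ℕ.* m) ≡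
            ∑ B (λ g → ∑ B (λ a → ⟦ p ℕ.* g ℕ.* (p ℕ.* g) ℕ.* a ℕP.≟ p ^ k ℕ.* m ⟧ * ρ a)) + R m * ρ (p ^ k)
          R-split k n<B = trans (∑-split-∣ B p F F0) (cong (_+_ (∑ B (λ g → F (p ℕ.* g))))
            (trans (∑-cong B second) (sym (∑-* B (ρ (p ^ k)) (λ g → ∑ B (λ a → ⟦ g ℕ.* g ℕ.* a ℕP.≟ m ⟧ * ρ a))))))
            where
            n = p ^ k ℕ.* m
            instance
              q≢0 : ℕ.NonZero (p ^ k)
              q≢0 = ℕP.m^n≢0 p k
            F : ℕ → ℤ
            F g = ∑ B (λ a → ⟦ g ℕ.* g ℕ.* a ℕP.≟ n ⟧ * ρ a)
            F0 : ∀ g → B ℕ.≤ g → F g ≡ 0ℤ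
            F0 g B≤g = ∑-vanish B (λ a _ → cong (_* ρ a) (⟦⟧-no (g ℕ.* g ℕ.* a ℕP.≟ n)
              (λ eq → factor< (g ℕ.* a) {{ℕP.m*n≢0 (p ^ k) m}} n<B B≤g (trans (sym (ℕP.*-assoc g g a)) eq))))
            second : ∀ g → (1ℤ - ⟦ p ℕD.∣? g ⟧) * F g ≡ ∑ B (λ a → ⟦ g ℕ.* g ℕ.* a ℕP.≟ m ⟧ * ρ a) * ρ (p ^ k)
            second g = away {g} {F g}
              (λ p∣g → trans (∑-* B (ρ (p ^ k)) (λ a → ⟦ g ℕ.* g ℕ.* a ℕP.≟ m ⟧ * ρ a)) (∑-vanish B (λ a _ → cong (λ u → u * ρ a * ρ (p ^ k))
                (⟦⟧-no (g ℕ.* g ℕ.* a ℕP.≟ m) (λ { refl → p∤m (ℕD.∣m⇒∣m*n a (ℕD.∣m⇒∣m*n g p∣g)) })))))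
              (λ p∤g → trans (unscale k (g ℕ.* g) ρ (λ d → Sum.[ p∤g , p∤g ]′ (euclidsLemma g g pr d)) n<B)
                (trans (∑-cong B (split g)) (sym (∑-* B (ρ (p ^ k)) (λ a → ⟦ g ℕ.* g ℕ.* a ℕP.≟ m ⟧ * ρ a)))))
              where
              split : ∀ g a → ⟦ g ℕ.* g ℕ.* a ℕP.≟ m ⟧ * ρ (p ^ k ℕ.* a) ≡ ⟦ g ℕ.* g ℕ.* a ℕP.≟ m ⟧ * ρ a * ρ (p ^ k)
              split g a = trans (⟦⟧*-cong (g ℕ.* g ℕ.* a ℕP.≟ m) {ρ (p ^ k ℕ.* a)} {ρ (p ^ k) * ρ a}
                  (λ { refl → ρ-coprime (p ^ k) a {{q≢0}} {{ℕP.m*n≢0⇒n≢0 (g ℕ.* g) {{m≢0}}}}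
                         (coprime-^ pr (λ d → p∤m (ℕD.∣n⇒∣m*n (g ℕ.* g) d)) k) }))
                (l ⟦ g ℕ.* g ℕ.* a ℕP.≟ m ⟧ (ρ (p ^ k)) (ρ a))
                where
                l = ring 3 λ x y z → x :* (y :* z) ⊜ x :* z :* y

        R-step₁ : p ^ 1 ℕ.* m ℕ.< B → R (p ^ 1 ℕ.* m) ≡ R m * ρ (p ^ 1)
        R-step₁ n<B = trans (R-split 1 n<B) (trans (cong (_+ R m * ρ (p ^ 1))
          (∑-vanish B (λ g _ → ∑-vanish B (λ a _ → cong (_* ρ a)
            (⟦⟧-no (p ℕ.* g ℕ.* (p ℕ.* g) ℕ.* a ℕP.≟ p ^ 1 ℕ.* m) (bad g a)))))) (+-identityˡ (R m * ρ (p ^ 1))))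
          where
          bad : ∀ g a → p ℕ.* g ℕ.* (p ℕ.* g) ℕ.* a ≢ p ^ 1 ℕ.* m
          bad g a eq = p∤m (subst (p ℕD.∣_) (ℕP.*-cancelˡ-≡ (p ℕ.* (g ℕ.* g ℕ.* a)) m p
            (trans (l p g a) (trans eq (cong (ℕ._* m) (ℕP.*-identityʳ p))))) (ℕD.m∣m*n (g ℕ.* g ℕ.* a)))
            where
            l = semiring 3 λ p g a → p :* (p :* (g :* g :* a)) ⊜ p :* g :* (p :* g) :* a

        -- If p divides g, then p² can be divided out of g² a and leads back to p^k m; hence a
        -- recurrence of step two.
        R-step₂ : ∀ k → p ^ suc (suc k) ℕ.* m ℕ.< B →
          R (p ^ suc (suc k) ℕ.* m) ≡ R (p ^ k ℕ.* m) + R m * ρ (p ^ suc (suc k))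
        R-step₂ k n<B = trans (R-split (suc (suc k)) n<B) (cong (_+ R m * ρ (p ^ suc (suc k)))
          (∑-cong B (λ g → ∑-cong B (λ a → cong (_* ρ a)
            (⟦⟧-cong (p ℕ.* g ℕ.* (p ℕ.* g) ℕ.* a ℕP.≟ p ^ suc (suc k) ℕ.* m) (g ℕ.* g ℕ.* a ℕP.≟ p ^ k ℕ.* m)
              (λ eq → ℕP.*-cancelˡ-≡ (g ℕ.* g ℕ.* a) (p ^ k ℕ.* m) p (ℕP.*-cancelˡ-≡ _ _ p (trans (l p g a) (trans eq (sym (l₂ p (p ^ k) m))))))
              (λ eq → trans (sym (l p g a)) (trans (cong (λ u → p ℕ.* (p ℕ.* u)) eq) (l₂ p (p ^ k) m))))))))
          where
          l = semiring 3 λ p g a → p :* (p :* (g :* g :* a)) ⊜ p :* g :* (p :* g) :* a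
          l₂ = semiring 3 λ p q m → p :* (p :* (q :* m)) ⊜ p :* (p :* q) :* m

        private
          ρ-p¹ : ρ (p ^ 1) ≡ 1ℤ + χ p
          ρ-p¹ = trans (cong ρ (ℕP.*-identityʳ p)) (ρ-prime pr)

          ρ-p^ : ¬ p ℕD.∣ N → ∀ k → ρ (p ^ suc k) ≡ 1ℤ + χ p
          ρ-p^ ∤N zero    = ρ-p¹
          ρ-p^ ∤N (suc k) = trans (ρ-lift pr ∤N k) (ρ-p^ ∤N k)

          1*m : p ^ 0 ℕ.* m ≡ m
          1*m = ℕP.*-identityˡ m

          smaller : ∀ k → p ^ suc k ℕ.* m ℕ.< B → p ^ k ℕ.* m ℕ.< B
          smaller k = ℕP.≤-<-trans (ℕP.*-monoˡ-≤ m (ℕP.m≤n*m (p ^ k) p))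

        -- For p ∤ N, ρ is 1 + χ(p) at every positive power and χ(p)² = 1, so two steps of `τ-step`
        -- reproduce the recurrence of `R`. For p dividing N, both χ(p) and the values of ρ at
        -- higher powers vanish, and `τ` no longer depends on k.
        R≡τ-power : R m ≡ τ m → ∀ k → p ^ k ℕ.* m ℕ.< B → R (p ^ k ℕ.* m) ≡ τ (p ^ k ℕ.* m)
        R≡τ-power h zero n<B = trans (cong R 1*m) (trans h (cong τ (sym 1*m)))
        R≡τ-power h (suc zero) n<B = begin
          R (p ^ 1 ℕ.* m) ≡⟨ R-step₁ n<B ⟩
          R m * ρ (p ^ 1) ≡⟨ cong₂ _*_ h ρ-p¹ ⟩
          τ m * (1ℤ + χ p) ≡⟨ l (τ m) (χ p) ⟩
          χ p * τ m + τ m ≡⟨ cong (λ u → χ p * τ u + τ m) (sym 1*m) ⟩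
          χ p * τ (p ^ 0 ℕ.* m) + τ m ≡⟨ sym (τ-step 0 n<B) ⟩
          τ (p ^ 1 ℕ.* m) ∎
          where
          open ≡-Reasoning
          l = ring 2 λ t x → t :* (# 1 :+ x) ⊜ x :* t :+ t
        R≡τ-power h (suc (suc k)) n<B = trans (R-step₂ k n<B) (trans
            (cong₂ (λ u v → u + v * ρ (p ^ suc (suc k))) (R≡τ-power h k (smaller k (smaller (suc k) n<B))) h)
            (go (p ℕD.∣? N)))
          where
          open ≡-Reasoning
          go : Dec (p ℕD.∣ N) → τ (p ^ k ℕ.* m) + τ m * ρ (p ^ suc (suc k)) ≡ τ (p ^ suc (suc k) ℕ.* m)
          go (no ∤N) = begin
            τ (p ^ k ℕ.* m) + τ m * ρ (p ^ suc (suc k))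
              ≡⟨ cong₂ (λ u v → u + τ m * v) (trans (sym (*-identityˡ _)) (cong (_* τ (p ^ k ℕ.* m)) (sym (±1-square (χ-±1 pr ∤N))))) (ρ-p^ ∤N (suc k)) ⟩
            χ p * χ p * τ (p ^ k ℕ.* m) + τ m * (1ℤ + χ p) ≡⟨ l (χ p) (τ (p ^ k ℕ.* m)) (τ m) ⟩
            χ p * (χ p * τ (p ^ k ℕ.* m) + τ m) + τ m ≡⟨ cong (λ u → χ p * u + τ m) (sym (τ-step k (smaller (suc k) n<B))) ⟩
            χ p * τ (p ^ suc k ℕ.* m) + τ m ≡⟨ sym (τ-step (suc k) n<B) ⟩
            τ (p ^ suc (suc k) ℕ.* m) ∎
            where
            l = ring 3 λ x a t → x :* x :* a :+ t :* (# 1 :+ x) ⊜ x :* (x :* a :+ t) :+ t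
          go (yes ∣N) = begin
            τ (p ^ k ℕ.* m) + τ m * ρ (p ^ suc (suc k)) ≡⟨ cong₂ (λ u v → u + τ m * v) (flat k (smaller k (smaller (suc k) n<B))) (ρ-ramified pr ∣N k) ⟩
            τ m + τ m * 0ℤ ≡⟨ l (τ m) ⟩
            τ m ≡⟨ sym (flat (suc (suc k)) n<B) ⟩
            τ (p ^ suc (suc k) ℕ.* m) ∎
            where
            l = ring 1 λ t → t :+ t :* # 0 ⊜ t
            flat : ∀ k → p ^ k ℕ.* m ℕ.< B → τ (p ^ k ℕ.* m) ≡ τ m
            flat zero    _   = cong τ 1*m
            flat (suc k) n<B = trans (τ-step k n<B) (trans (cong (λ u → u * τ (p ^ k ℕ.* m) + τ m) (χ-prime-∣ pr ∣N ℕD.∣-refl)) (+-identityˡ (τ m)))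

      R≡τ-1 : 1 ℕ.< B → R 1 ≡ τ 1
      R≡τ-1 1<B = trans
        (trans (∑-collapse B (λ g → ∑ B (λ a → ⟦ g ℕ.* g ℕ.* a ℕP.≟ 1 ⟧ * ρ a)) 1<B
            (λ g _ g≢1 → ∑-vanish B (λ a _ → cong (_* ρ a) (⟦⟧-no (g ℕ.* g ℕ.* a ℕP.≟ 1)
              (λ eq → g≢1 (ℕP.m*n≡1⇒m≡1 g (g ℕ.* a) (trans (sym (ℕP.*-assoc g g a)) eq)))))))
          (trans (∑-collapse B (λ a → ⟦ 1 ℕ.* 1 ℕ.* a ℕP.≟ 1 ⟧ * ρ a) 1<B
            (λ a _ a≢1 → cong (_* ρ a) (⟦⟧-no (1 ℕ.* 1 ℕ.* a ℕP.≟ 1) (λ eq → a≢1 (trans (sym (ℕP.*-identityˡ a)) eq)))))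
            (trans (cong (_* ρ 1) (⟦⟧-yes (1 ℕ.* 1 ℕ.* 1 ℕP.≟ 1) refl))
              (trans (*-identityˡ (ρ 1)) (trans (+-identityˡ (rootOf 1 0)) (⟦⟧-yes (+ 1 ∣? f (+ 0)) (divides (f (+ 0)) (sym (*-identityʳ (f (+ 0)))))))))))
        (sym (trans (∑-collapse B (λ d → ∑ B (λ e → ⟦ d ℕ.* e ℕP.≟ 1 ⟧ * χ d)) 1<B
            (λ d _ d≢1 → ∑-vanish B (λ e _ → cong (_* χ d) (⟦⟧-no (d ℕ.* e ℕP.≟ 1) (d≢1 ∘ ℕP.m*n≡1⇒m≡1 d e)))))
          (trans (∑-collapse B (λ e → ⟦ 1 ℕ.* e ℕP.≟ 1 ⟧ * χ 1) 1<B
            (λ e _ e≢1 → cong (_* χ 1) (⟦⟧-no (1 ℕ.* e ℕP.≟ 1) (λ eq → e≢1 (trans (sym (ℕP.*-identityˡ e)) eq)))))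
            (trans (cong (_* χ 1) (⟦⟧-yes (1 ℕ.* 1 ℕP.≟ 1) refl)) (trans (*-identityˡ (χ 1)) χ-1)))))

      -- Strong induction that removes the full power of one prime at a time.
      R≡τ : ∀ n → .{{ℕ.NonZero n}} → n ℕ.< B → R n ≡ τ n
      R≡τ = <-rec (λ n → .{{ℕ.NonZero n}} → n ℕ.< B → R n ≡ τ n) step
        where
        step : ∀ n → (∀ {m} → m ℕ.< n → .{{ℕ.NonZero m}} → m ℕ.< B → R m ≡ τ m) → .{{ℕ.NonZero n}} → n ℕ.< B → R n ≡ τ n
        step 1 rec n<B = R≡τ-1 n<B
        step n@(suc (suc _)) rec n<B with prime-divisor n (ℕ.s≤s (ℕ.s≤s ℕ.z≤n))
        ... | p , pr , p∣n with valuation p pr n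
        ...   | zero , m , e , p∤m = contradiction (subst (p ℕD.∣_) (trans e (ℕP.*-identityˡ m)) p∣n) p∤m
        ...   | suc k , m , e , p∤m = trans (cong R e) (trans
                (R≡τ-power pr p∤m (rec m<n {{m≢0}} (ℕP.<-trans m<n n<B)) (suc k) (subst (ℕ._< B) e n<B)) (cong τ (sym e)))
          where
          m≢0 : ℕ.NonZero m
          m≢0 = ℕ.≢-nonZero λ { refl → p∤m (p ℕD.∣0) }
          1<q : 1 ℕ.< p ^ suc k
          1<q = ℕP.<-≤-trans (ℕ.nonTrivial⇒n>1 p {{prime⇒nonTrivial pr}}) (ℕP.m≤m*n p (p ^ k) {{ℕP.m^n≢0 p k {{prime⇒nonZero pr}}}})
          m<n : m ℕ.< n
          m<n = subst (m ℕ.<_) (sym (trans e (ℕP.*-comm (p ^ suc k) m))) (ℕP.m<m*n m (p ^ suc k) {{m≢0}} 1<q)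

-- The field ℚ(√D) and its coordinates with respect to 1, ω.

module Field where

  open import Data.Integer.Base using (ℤ; +_; 0ℤ; 1ℤ)
  open import Data.Rational.Base as ℚ using (ℚ; 0ℚ; 1ℚ; ½; ↥_; ↧_; mkℚ)
  import Data.Rational.Properties as ℚP
  open import Data.Rational.Solver using (module +-*-Solver)
  open import Data.Rational.Unnormalised.Base as ℚᵘ using (mkℚᵘ; *≡*)
  import Data.Rational.Unnormalised.Properties as ℚᵘP
  open import Defs

  emb : ℤ → ℚ
  emb i = i ℚ./ 1

  private
    toᵘ-emb : ∀ i → ℚ.toℚᵘ (emb i) ℚᵘ.≃ mkℚᵘ i 0
    toᵘ-emb i = ℚP.toℚᵘ-fromℚᵘ (mkℚᵘ i 0)

  abstract
    emb-+ : ∀ i j → emb (i ℤ.+ j) ≡ emb i ℚ.+ emb j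
    emb-+ i j = ℚP.toℚᵘ-injective (ℚᵘP.≃-trans (toᵘ-emb (i ℤ.+ j)) (ℚᵘP.≃-sym
      (ℚᵘP.≃-trans (ℚP.toℚᵘ-homo-+ (emb i) (emb j))
        (ℚᵘP.≃-trans (ℚᵘP.+-cong (toᵘ-emb i) (toᵘ-emb j)) (*≡* (l i j))))))
      where
      l : ∀ i j → (i ℤ.* + 1 ℤ.+ j ℤ.* + 1) ℤ.* + 1 ≡ (i ℤ.+ j) ℤ.* + 1
      l i j = cong (ℤ._* + 1) (cong₂ ℤ._+_ (ℤP.*-identityʳ i) (ℤP.*-identityʳ j))

    emb-* : ∀ i j → emb (i ℤ.* j) ≡ emb i ℚ.* emb j
    emb-* i j = ℚP.toℚᵘ-injective (ℚᵘP.≃-trans (toᵘ-emb (i ℤ.* j)) (ℚᵘP.≃-sym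
      (ℚᵘP.≃-trans (ℚP.toℚᵘ-homo-* (emb i) (emb j))
        (ℚᵘP.≃-trans (ℚᵘP.*-cong (toᵘ-emb i) (toᵘ-emb j)) (*≡* refl)))))

    emb-injective : ∀ {i j} → emb i ≡ emb j → i ≡ j
    emb-injective {i} {j} e with ℚᵘP.≃-trans (ℚᵘP.≃-sym (toᵘ-emb i)) (ℚᵘP.≃-trans (ℚᵘP.≃-reflexive (cong ℚ.toℚᵘ e)) (toᵘ-emb j))
    ... | *≡* eq = trans (sym (ℤP.*-identityʳ i)) (trans eq (ℤP.*-identityʳ j))

    emb-↧ : ∀ q → emb (↧ q) ℚ.* q ≡ emb (↥ q)
    emb-↧ q@(mkℚ n d-1 _) = ℚP.toℚᵘ-injective (ℚᵘP.≃-trans (ℚP.toℚᵘ-homo-* (emb (↧ q)) q)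
      (ℚᵘP.≃-trans (ℚᵘP.*-cong (toᵘ-emb (↧ q)) ℚᵘP.≃-refl) (ℚᵘP.≃-trans (*≡* l) (ℚᵘP.≃-sym (toᵘ-emb (↥ q))))))
      where
      l : (+ suc d-1 ℤ.* n) ℤ.* + 1 ≡ n ℤ.* + (1 ℕ.* suc d-1)
      l = trans (ℤP.*-identityʳ _) (trans (ℤP.*-comm (+ suc d-1) n) (cong (λ k → n ℤ.* + k) (sym (ℕP.*-identityˡ (suc d-1)))))

  emb-neg : ∀ i → emb (ℤ.- i) ≡ ℚ.- emb i
  emb-neg i = begin
    emb (ℤ.- i) ≡⟨ l (emb (ℤ.- i)) (emb i) ⟩
    (emb (ℤ.- i) ℚ.+ emb i) ℚ.+ ℚ.- emb i ≡⟨ cong (ℚ._+ ℚ.- emb i) (trans (sym (emb-+ (ℤ.- i) i)) (cong emb (ℤP.+-inverseˡ i))) ⟩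
    0ℚ ℚ.+ ℚ.- emb i ≡⟨ ℚP.+-identityˡ _ ⟩
    ℚ.- emb i ∎
    where
    open ≡-Reasoning
    open +-*-Solver
    l : ∀ a b → a ≡ (a ℚ.+ b) ℚ.+ ℚ.- b
    l = solve 2 (λ a b → a := (a :+ b) :+ :- b) refl

  emb-- : ∀ i j → emb (i ℤ.- j) ≡ emb i ℚ.- emb j
  emb-- i j = trans (emb-+ i (ℤ.- j)) (cong (emb i ℚ.+_) (emb-neg j))

  emb-cancel : ∀ s → s ≢ 0ℤ → ∀ {x y} → emb s ℚ.* x ≡ emb s ℚ.* y → x ≡ y
  emb-cancel s s≢0 {x} {y} e = begin
    x ≡⟨ sym (inv x) ⟩
    i ℚ.* (emb s ℚ.* x) ≡⟨ cong (i ℚ.*_) e ⟩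
    i ℚ.* (emb s ℚ.* y) ≡⟨ inv y ⟩
    y ∎
    where
    open ≡-Reasoning
    instance
      nz : ℚ.NonZero (emb s)
      nz = ℚ.≢-nonZero (s≢0 ∘ emb-injective)
    i : ℚ
    i = ℚ.1/ emb s
    inv : ∀ x → i ℚ.* (emb s ℚ.* x) ≡ x
    inv x = trans (sym (ℚP.*-assoc i (emb s) x)) (trans (cong (ℚ._* x) (ℚP.*-inverseˡ (emb s))) (ℚP.*-identityˡ x))

  module _ {D : ℤ} where

    open +-*-Solver

    ⊕-assoc : (x y z : ℚ√ D) → (x ⊕ y) ⊕ z ≡ x ⊕ (y ⊕ z)
    ⊕-assoc ⟨ a , b ⟩ ⟨ c , d ⟩ ⟨ e , f ⟩ = cong₂ ⟨_,_⟩ (ℚP.+-assoc a c e) (ℚP.+-assoc b d f)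

    ⊕-comm : (x y : ℚ√ D) → x ⊕ y ≡ y ⊕ x
    ⊕-comm ⟨ a , b ⟩ ⟨ c , d ⟩ = cong₂ ⟨_,_⟩ (ℚP.+-comm a c) (ℚP.+-comm b d)

    ⊕-identityˡ : (x : ℚ√ D) → 𝟘 ⊕ x ≡ x
    ⊕-identityˡ ⟨ a , b ⟩ = cong₂ ⟨_,_⟩ (ℚP.+-identityˡ a) (ℚP.+-identityˡ b)

    ⊗-zeroʳ : (x : ℚ√ D) → x ⊗ 𝟘 ≡ 𝟘
    ⊗-zeroʳ ⟨ a , b ⟩ = cong₂ ⟨_,_⟩
      (solve 3 (λ D a b → a :* con 0ℚ :+ D :* (b :* con 0ℚ) := con 0ℚ) refl (emb D) a b)
      (solve 2 (λ a b → a :* con 0ℚ :+ b :* con 0ℚ := con 0ℚ) refl a b)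

    ⊗-distribˡ : (x y z : ℚ√ D) → x ⊗ (y ⊕ z) ≡ (x ⊗ y) ⊕ (x ⊗ z)
    ⊗-distribˡ ⟨ a , b ⟩ ⟨ c , d ⟩ ⟨ e , f ⟩ = cong₂ ⟨_,_⟩
      (solve 7 (λ D a b c d e f → a :* (c :+ e) :+ D :* (b :* (d :+ f)) :=
        (a :* c :+ D :* (b :* d)) :+ (a :* e :+ D :* (b :* f))) refl (emb D) a b c d e f)
      (solve 6 (λ a b c d e f → a :* (d :+ f) :+ b :* (c :+ e) :=
        (a :* d :+ b :* c) :+ (a :* f :+ b :* e)) refl a b c d e f)

    fromℤ-⊗ : ∀ s a b → fromℤ {D} s ⊗ ⟨ a , b ⟩ ≡ ⟨ emb s ℚ.* a , emb s ℚ.* b ⟩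
    fromℤ-⊗ s a b = cong₂ ⟨_,_⟩
      (solve 4 (λ D s a b → s :* a :+ D :* (con 0ℚ :* b) := s :* a) refl (emb D) (emb s) a b)
      (solve 3 (λ s a b → s :* b :+ con 0ℚ :* a := s :* b) refl (emb s) a b)

    fromℤ-cancel : ∀ s → s ≢ 0ℤ → {x y : ℚ√ D} → fromℤ s ⊗ x ≡ fromℤ s ⊗ y → x ≡ y
    fromℤ-cancel s s≢0 {⟨ a , b ⟩} {⟨ c , d ⟩} e = cong₂ ⟨_,_⟩
      (emb-cancel s s≢0 (cong ℚ√.re e′)) (emb-cancel s s≢0 (cong ℚ√.im e′))
      where
      e′ = trans (sym (fromℤ-⊗ s a b)) (trans e (fromℤ-⊗ s c d))

    -- x + y ω for ω = (1 + √ D) / 2.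
    ι₀ : ℤ → ℤ → ℚ√ D
    ι₀ x y = ⟨ emb x ℚ.+ emb y ℚ.* ½ , emb y ℚ.* ½ ⟩

    ι₀-fromℤ : ∀ n → ι₀ n 0ℤ ≡ fromℤ n
    ι₀-fromℤ n = cong₂ ⟨_,_⟩ (solve 1 (λ n → n :+ con 0ℚ :* con ½ := n) refl (emb n)) refl

    ι₀-⊕ : ∀ x y z w → ι₀ x y ⊕ ι₀ z w ≡ ι₀ (x ℤ.+ z) (y ℤ.+ w)
    ι₀-⊕ x y z w = cong₂ ⟨_,_⟩
      (trans (solve 4 (λ x y z w → (x :+ y :* con ½) :+ (z :+ w :* con ½) := (x :+ z) :+ (y :+ w) :* con ½)
          refl (emb x) (emb y) (emb z) (emb w))
        (cong₂ (λ u v → u ℚ.+ v ℚ.* ½) (sym (emb-+ x z)) (sym (emb-+ y w))))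
      (trans (sym (ℚP.*-distribʳ-+ ½ (emb y) (emb w))) (cong (ℚ._* ½) (sym (emb-+ y w))))

    ι₀-scale : ∀ s x y → fromℤ s ⊗ ι₀ x y ≡ ι₀ (s ℤ.* x) (s ℤ.* y)
    ι₀-scale s x y = trans (fromℤ-⊗ s _ _) (cong₂ ⟨_,_⟩
      (trans (solve 3 (λ s x y → s :* (x :+ y :* con ½) := s :* x :+ (s :* y) :* con ½) refl (emb s) (emb x) (emb y))
        (cong₂ (λ u v → u ℚ.+ v ℚ.* ½) (sym (emb-* s x)) (sym (emb-* s y))))
      (trans (sym (ℚP.*-assoc (emb s) (emb y) ½)) (cong (ℚ._* ½) (sym (emb-* s y)))))

    ι₀-injective : ∀ {x y z w} → ι₀ x y ≡ ι₀ z w → x ≡ z × y ≡ w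
    ι₀-injective {x} {y} {z} {w} e = emb-injective ex , emb-injective ey
      where
      im : emb y ℚ.* ½ ≡ emb w ℚ.* ½
      im = cong ℚ√.im e
      ey : emb y ≡ emb w
      ey = emb-cancel 1ℤ (λ ()) (trans (dbl (emb y)) (trans (cong₂ ℚ._+_ im im) (sym (dbl (emb w)))))
        where
        dbl : ∀ a → 1ℚ ℚ.* a ≡ a ℚ.* ½ ℚ.+ a ℚ.* ½
        dbl = solve 1 (λ a → con 1ℚ :* a := a :* con ½ :+ a :* con ½) refl
      ex : emb x ≡ emb z
      ex = trans (l (emb x) (emb y ℚ.* ½)) (trans (cong₂ ℚ._-_ (cong ℚ√.re e) im) (sym (l (emb z) (emb w ℚ.* ½))))
        where
        l : ∀ a b → a ≡ (a ℚ.+ b) ℚ.- b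
        l = solve 2 (λ a b → a := (a :+ b) :- b) refl

    -- Multiplication by both denominators gives p + q √D, which is (p - q) + 2 q ω because √D = 2 ω
    -- - 1.
    denominator₀ : ∀ (z : ℚ√ D) → ∃[ s ] ∃[ x ] ∃[ y ] s ≢ 0ℤ × fromℤ s ⊗ z ≡ ι₀ x y
    denominator₀ ⟨ a , b ⟩ = ↧ a ℤ.* ↧ b , p ℤ.- q , q ℤ.+ q , s≢0 , trans (fromℤ-⊗ (↧ a ℤ.* ↧ b) a b) (cong₂ ⟨_,_⟩
        (trans pa (trans (l₁ (emb p) (emb q)) (cong₂ (λ u v → u ℚ.+ v ℚ.* ½) (sym (emb-- p q)) (sym (emb-+ q q)))))
        (trans qb (trans (l₂ (emb q)) (cong (ℚ._* ½) (sym (emb-+ q q))))))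
      where
      p = ↥ a ℤ.* ↧ b
      q = ↥ b ℤ.* ↧ a
      s≢0 : ↧ a ℤ.* ↧ b ≢ 0ℤ
      s≢0 ()
      pa : emb (↧ a ℤ.* ↧ b) ℚ.* a ≡ emb p
      pa = trans (cong (ℚ._* a) (emb-* (↧ a) (↧ b))) (trans (l (emb (↧ a)) (emb (↧ b)) a)
        (trans (cong (ℚ._* emb (↧ b)) (emb-↧ a)) (sym (emb-* (↥ a) (↧ b)))))
        where
        l : ∀ x y z → x ℚ.* y ℚ.* z ≡ (x ℚ.* z) ℚ.* y
        l = solve 3 (λ x y z → x :* y :* z := (x :* z) :* y) refl
      qb : emb (↧ a ℤ.* ↧ b) ℚ.* b ≡ emb q
      qb = trans (cong (ℚ._* b) (emb-* (↧ a) (↧ b))) (trans (l (emb (↧ a)) (emb (↧ b)) b)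
        (trans (cong (ℚ._* emb (↧ a)) (emb-↧ b)) (sym (emb-* (↥ b) (↧ a)))))
        where
        l : ∀ x y z → x ℚ.* y ℚ.* z ≡ (y ℚ.* z) ℚ.* x
        l = solve 3 (λ x y z → x :* y :* z := (y :* z) :* x) refl
      l₁ : ∀ p q → p ≡ (p ℚ.- q) ℚ.+ (q ℚ.+ q) ℚ.* ½
      l₁ = solve 2 (λ p q → p := (p :- q) :+ (q :+ q) :* con ½) refl
      l₂ : ∀ q → q ≡ (q ℚ.+ q) ℚ.* ½
      l₂ = solve 1 (λ q → q := (q :+ q) :* con ½) refl

    module Ring (c : ℤ) (D≡ : D ≡ 1ℤ ℤ.- + 4 ℤ.* c) where

      -- From D = 1 - 4 c follows ω² = ω - c.
      ι₀-⊗ : ∀ x y z w → ι₀ x y ⊗ ι₀ z w ≡ ι₀ (x ℤ.* z ℤ.- c ℤ.* (y ℤ.* w)) (x ℤ.* w ℤ.+ y ℤ.* z ℤ.+ y ℤ.* w)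
      ι₀-⊗ x y z w = cong₂ ⟨_,_⟩
          (trans (cong (λ d → (X ℚ.+ Y ℚ.* ½) ℚ.* (Z ℚ.+ W ℚ.* ½) ℚ.+ d ℚ.* ((Y ℚ.* ½) ℚ.* (W ℚ.* ½))) embD)
            (trans (solve 5 (λ X Y Z W C →
                (X :+ Y :* con ½) :* (Z :+ W :* con ½) :+ (con 1ℚ :- con (emb (+ 4)) :* C) :* ((Y :* con ½) :* (W :* con ½))
                := (X :* Z :- C :* (Y :* W)) :+ (X :* W :+ Y :* Z :+ Y :* W) :* con ½) refl X Y Z W C)
              (cong₂ (λ u v → u ℚ.+ v ℚ.* ½) (sym e₁) (sym e₂))))
          (trans (solve 4 (λ X Y Z W →
                (X :+ Y :* con ½) :* (W :* con ½) :+ (Y :* con ½) :* (Z :+ W :* con ½)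
                := (X :* W :+ Y :* Z :+ Y :* W) :* con ½) refl X Y Z W)
              (cong (ℚ._* ½) (sym e₂)))
        where
        X = emb x
        Y = emb y
        Z = emb z
        W = emb w
        C = emb c
        embD : emb D ≡ 1ℚ ℚ.- emb (+ 4) ℚ.* C
        embD = trans (cong emb D≡) (trans (emb-- 1ℤ (+ 4 ℤ.* c)) (cong (λ u → 1ℚ ℚ.- u) (emb-* (+ 4) c)))
        e₁ : emb (x ℤ.* z ℤ.- c ℤ.* (y ℤ.* w)) ≡ X ℚ.* Z ℚ.- C ℚ.* (Y ℚ.* W)
        e₁ = trans (emb-- (x ℤ.* z) (c ℤ.* (y ℤ.* w))) (cong₂ ℚ._-_ (emb-* x z)
          (trans (emb-* c (y ℤ.* w)) (cong (C ℚ.*_) (emb-* y w))))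
        e₂ : emb (x ℤ.* w ℤ.+ y ℤ.* z ℤ.+ y ℤ.* w) ≡ X ℚ.* W ℚ.+ Y ℚ.* Z ℚ.+ Y ℚ.* W
        e₂ = trans (emb-+ (x ℤ.* w ℤ.+ y ℤ.* z) (y ℤ.* w)) (cong₂ ℚ._+_
          (trans (emb-+ (x ℤ.* w) (y ℤ.* z)) (cong₂ ℚ._+_ (emb-* x w) (emb-* y z))) (emb-* y w))

  -- Opaque copies of the field operations, so that type checking never unfolds
  -- rational arithmetic.
  infixl 6 _⊞_
  infixl 7 _⊠_

  abstract
    _⊞_ _⊠_ : ∀ {D} → ℚ√ D → ℚ√ D → ℚ√ D
    _⊞_ = _⊕_
    _⊠_ = _⊗_

    ι : ∀ {D} → ℤ → ℤ → ℚ√ D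
    ι = ι₀

  0K 1K : ∀ {D} → ℚ√ D
  0K = ι 0ℤ 0ℤ
  1K = ι 1ℤ 0ℤ

  abstract
    ⊞≡⊕ : ∀ {D} (x y : ℚ√ D) → x ⊞ y ≡ x ⊕ y
    ⊞≡⊕ x y = refl

    ⊠≡⊗ : ∀ {D} (x y : ℚ√ D) → x ⊠ y ≡ x ⊗ y
    ⊠≡⊗ x y = refl

    ι≡fromℤ : ∀ {D} n → ι {D} n 0ℤ ≡ fromℤ n
    ι≡fromℤ n = ι₀-fromℤ n

    0K≡𝟘 : ∀ {D} → 0K {D} ≡ 𝟘
    0K≡𝟘 = ι₀-fromℤ 0ℤ

    1K≡𝟙 : ∀ {D} → 1K {D} ≡ 𝟙
    1K≡𝟙 = ι₀-fromℤ 1ℤ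

    ⊞-assoc : ∀ {D} (x y z : ℚ√ D) → (x ⊞ y) ⊞ z ≡ x ⊞ (y ⊞ z)
    ⊞-assoc = ⊕-assoc

    ⊞-comm : ∀ {D} (x y : ℚ√ D) → x ⊞ y ≡ y ⊞ x
    ⊞-comm = ⊕-comm

    ⊞-identityˡ : ∀ {D} (x : ℚ√ D) → 0K ⊞ x ≡ x
    ⊞-identityˡ x = trans (cong (_⊕ x) 0K≡𝟘) (⊕-identityˡ x)

    ⊠-assoc : ∀ {D} (x y z : ℚ√ D) → (x ⊠ y) ⊠ z ≡ x ⊠ (y ⊠ z)
    ⊠-assoc = ⊗-assoc

    ⊠-comm : ∀ {D} (x y : ℚ√ D) → x ⊠ y ≡ y ⊠ x
    ⊠-comm = ⊗-comm

    ⊠-identityˡ : ∀ {D} (x : ℚ√ D) → 1K ⊠ x ≡ x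
    ⊠-identityˡ x = trans (cong (_⊗ x) 1K≡𝟙) (⊗-identityˡ x)

    ⊠-zeroʳ : ∀ {D} (x : ℚ√ D) → x ⊠ 0K ≡ 0K
    ⊠-zeroʳ x = trans (cong (x ⊗_) 0K≡𝟘) (trans (⊗-zeroʳ x) (sym 0K≡𝟘))

    ⊠-distribˡ : ∀ {D} (x y z : ℚ√ D) → x ⊠ (y ⊞ z) ≡ x ⊠ y ⊞ x ⊠ z
    ⊠-distribˡ = ⊗-distribˡ

    ι-⊞ : ∀ {D} x y z w → ι {D} x y ⊞ ι z w ≡ ι (x ℤ.+ z) (y ℤ.+ w)
    ι-⊞ = ι₀-⊕

    ι-scale : ∀ {D} s x y → ι {D} s 0ℤ ⊠ ι x y ≡ ι (s ℤ.* x) (s ℤ.* y)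
    ι-scale s x y = trans (cong (_⊗ ι x y) (ι₀-fromℤ s)) (ι₀-scale s x y)

    ι-⊠ : ∀ {D} c → D ≡ 1ℤ ℤ.- + 4 ℤ.* c → ∀ x y z w →
      ι {D} x y ⊠ ι z w ≡ ι (x ℤ.* z ℤ.- c ℤ.* (y ℤ.* w)) (x ℤ.* w ℤ.+ y ℤ.* z ℤ.+ y ℤ.* w)
    ι-⊠ c D≡ = Ring.ι₀-⊗ c D≡

    ι-injective : ∀ {D x y z w} → ι {D} x y ≡ ι z w → x ≡ z × y ≡ w
    ι-injective = ι₀-injective

    ι-cancel : ∀ {D} s → s ≢ 0ℤ → {x y : ℚ√ D} → ι s 0ℤ ⊠ x ≡ ι s 0ℤ ⊠ y → x ≡ y
    ι-cancel s s≢0 {x} {y} e = fromℤ-cancel s s≢0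
      (trans (cong (_⊗ x) (sym (ι₀-fromℤ s))) (trans e (cong (_⊗ y) (ι₀-fromℤ s))))

    denominator : ∀ {D} (z : ℚ√ D) → ∃[ s ] ∃[ x ] ∃[ y ] s ≢ 0ℤ × ι s 0ℤ ⊠ z ≡ ι x y
    denominator z = scale (denominator₀ z)
      where
      scale : ∃[ s ] ∃[ x ] ∃[ y ] s ≢ 0ℤ × fromℤ s ⊗ z ≡ ι₀ x y →
        ∃[ s ] ∃[ x ] ∃[ y ] s ≢ 0ℤ × ι s 0ℤ ⊠ z ≡ ι x y
      scale (s , x , y , s≢0 , e) = s , x , y , s≢0 , trans (cong (_⊗ z) (ι₀-fromℤ s)) e

    reciprocal : ∀ {D} s → s ≢ 0ℤ → ∃[ r ] ι {D} s 0ℤ ⊠ r ≡ 1K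
    reciprocal s s≢0 = ⟨ ℚ.1/ emb s , 0ℚ ⟩ , trans (cong (_⊗ ⟨ ℚ.1/ emb s , 0ℚ ⟩) (ι₀-fromℤ s))
      (trans (fromℤ-⊗ s (ℚ.1/ emb s) 0ℚ) (trans (cong₂ ⟨_,_⟩ (ℚP.*-inverseʳ (emb s)) (ℚP.*-zeroʳ (emb s))) (sym 1K≡𝟙)))
      where
      instance
        nz : ℚ.NonZero (emb s)
        nz = ℚ.≢-nonZero (s≢0 ∘ emb-injective)

  module _ {D : ℤ} where

    ⊞-interchange : (a b c d : ℚ√ D) → (a ⊞ b) ⊞ (c ⊞ d) ≡ (a ⊞ c) ⊞ (b ⊞ d)
    ⊞-interchange a b c d = trans (⊞-assoc a b (c ⊞ d)) (trans (cong (a ⊞_) (trans (sym (⊞-assoc b c d))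
      (trans (cong (_⊞ d) (⊞-comm b c)) (⊞-assoc c b d)))) (sym (⊞-assoc a c (b ⊞ d))))

    ⊞-identityʳ : (x : ℚ√ D) → x ⊞ 0K ≡ x
    ⊞-identityʳ x = trans (⊞-comm x 0K) (⊞-identityˡ x)

    ⊠-identityʳ : (x : ℚ√ D) → x ⊠ 1K ≡ x
    ⊠-identityʳ x = trans (⊠-comm x 1K) (⊠-identityˡ x)

    ⊠-distribʳ : (x y z : ℚ√ D) → (y ⊞ z) ⊠ x ≡ y ⊠ x ⊞ z ⊠ x
    ⊠-distribʳ x y z = trans (⊠-comm (y ⊞ z) x) (trans (⊠-distribˡ x y z) (cong₂ _⊞_ (⊠-comm x y) (⊠-comm x z)))

    ⊠-swap : (x y z : ℚ√ D) → x ⊠ (y ⊠ z) ≡ y ⊠ (x ⊠ z)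
    ⊠-swap x y z = trans (sym (⊠-assoc x y z)) (trans (cong (_⊠ z) (⊠-comm x y)) (⊠-assoc y x z))

    ι-+ : ∀ i j → ι {D} (i ℤ.+ j) 0ℤ ≡ ι i 0ℤ ⊞ ι j 0ℤ
    ι-+ i j = sym (ι-⊞ i 0ℤ j 0ℤ)

    ι-* : ∀ i j → ι {D} (i ℤ.* j) 0ℤ ≡ ι i 0ℤ ⊠ ι j 0ℤ
    ι-* i j = sym (trans (ι-scale i j 0ℤ) (cong (ι (i ℤ.* j)) (ℤP.*-zeroʳ i)))

-- The ring of integers is ℤ + ℤ ω.

module Integers where

  open Normalisation using (ring; semiring; _⊜_; _:+_; _:-_; _:*_; :-_; #_)
  open import Data.Integer.Base hiding (suc; _%_; _/_; _^_)
  open ℤD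
  open import Data.List.Base using ([]; _∷_)
  open import Data.Nat.Base using (_^_)
  open import Data.Nat.DivMod using (m/n*n≡m)
  open import Data.Nat.GCD using (gcd; gcd[m,n]∣m; gcd[m,n]∣n; gcd[m,n]≢0)
  open import Data.Nat.Primality using (prime[2])
  open import Data.Vec.Base as Vec using (Vec; []; _∷_)
  open import Defs hiding (_∈_)
  open Modular using (Prime∣)
  open Field

  abstract
    reduce : ∀ s y → s ≢ 0 → ∃[ g ] ∃[ s′ ] ∃[ y′ ] s ≡ s′ ℕ.* g × y ≡ y′ ℕ.* g × Coprime s′ y′ × g ≢ 0
    reduce s y s≢0 = g , s ℕ./ g , y ℕ./ g , sym (m/n*n≡m (gcd[m,n]∣m s y)) , sym (m/n*n≡m (gcd[m,n]∣n s y)) ,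
      Coprimality.coprime-/gcd s y , g≢0
      where
      g : ℕ
      g = gcd s y
      g≢0 : g ≢ 0
      g≢0 = gcd[m,n]≢0 s y (inj₁ s≢0)
      instance
        _ : ℕ.NonZero g
        _ = ℕ.≢-nonZero g≢0

  coprime-pow : ∀ {u v} → Coprime u v → ∀ k → Coprime (u ^ k) v
  coprime-pow c zero (d∣1 , _) = ℕD.∣1⇒≡1 d∣1
  coprime-pow {u} {v} c (suc k) {d} (d∣ , d∣v) = coprime-pow c k
    (Coprimality.coprime-divisor {d} {u} {u ^ k} (λ (e∣d , e∣u) → c (e∣u , ℕD.∣-trans e∣d d∣v)) d∣ , d∣v)

  n<u^n : ∀ {u} → 1 ℕ.< u → ∀ n → n ℕ.< u ^ n
  n<u^n 1<u zero = ℕ.s≤s ℕ.z≤n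
  n<u^n {u} 1<u (suc n) = ℕP.<-≤-trans (ℕ.s≤s (n<u^n 1<u n))
    (ℕP.≤-trans (ℕP.+-mono-≤ (ℕP.≤-trans (ℕ.s≤s ℕ.z≤n) (n<u^n 1<u n)) (ℕP.≤-reflexive (sym (ℕP.+-identityʳ (u ^ n))))) (ℕP.*-monoˡ-≤ (u ^ n) 1<u))

  ^-distribʳ-* : ∀ x y k → (x ℕ.* y) ^ k ≡ x ^ k ℕ.* y ^ k
  ^-distribʳ-* x y zero    = refl
  ^-distribʳ-* x y (suc k) = trans (cong (x ℕ.* y ℕ.*_) (^-distribʳ-* x y k)) (l x y (x ^ k) (y ^ k))
    where
    l = semiring 4 λ x y u v → x :* y :* (u :* v) ⊜ x :* u :* (y :* v)

  -- If the powers of v / u have bounded denominators, then v / u is an integer.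
  bounded-powers⇒∣ : ∀ {t u v} → t ≢ 0 → u ≢ 0 → (∀ k → u ^ k ℕD.∣ t ℕ.* v ^ k) → u ℕD.∣ v
  bounded-powers⇒∣ {t} {u} {v} t≢0 u≢0 h with reduce u v u≢0
  ... | g , u′ , v′ , refl , refl , cop , g≢0 with u′ ℕP.≤? 1
  ...   | yes u′≤1 = ℕD.*-monoˡ-∣ g (subst (ℕD._∣ v′) (sym u′≡1) (ℕD.1∣ v′))
    where
    u′≡1 : u′ ≡ 1
    u′≡1 = ℕP.≤-antisym u′≤1 (ℕP.n≢0⇒n>0 λ { refl → u≢0 refl })
  ...   | no u′≰1 = contradiction (ℕD.∣⇒≤ {{ℕ.≢-nonZero t≢0}} u′^t∣t) (ℕP.<⇒≱ (n<u^n (ℕP.≰⇒> u′≰1) t))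
    where
    instance
      _ : ℕ.NonZero (g ^ t)
      _ = ℕP.m^n≢0 g t {{ℕ.≢-nonZero g≢0}}
    *^ : ∀ x y → (x ℕ.* y) ^ t ≡ x ^ t ℕ.* y ^ t
    *^ x y = ^-distribʳ-* x y t
    u′^t∣t : u′ ^ t ℕD.∣ t
    u′^t∣t = Coprimality.coprime-divisor {u′ ^ t} {v′ ^ t} {t}
      (Coprimality.sym (coprime-pow (Coprimality.sym (coprime-pow cop t)) t))
      (subst (u′ ^ t ℕD.∣_) (ℕP.*-comm t (v′ ^ t)) (ℕD.*-cancelʳ-∣ (g ^ t)
        (subst₂ ℕD._∣_ (*^ u′ g) (trans (cong (t ℕ.*_) (*^ v′ g)) (sym (ℕP.*-assoc t (v′ ^ t) (g ^ t)))) (h t))))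

  module _ (N : ℕ) (N-sqfree : ∀ d → d ℕ.* d ℕD.∣ N → d ≡ 1) where

    -- After division by the gcd of s and y, the square of what is left of s is prime to that of y
    -- and so divides N.
    sqfree-∣ : ∀ {s y} → s ≢ 0 → s ℕ.* s ℕD.∣ N ℕ.* (y ℕ.* y) → s ℕD.∣ y
    sqfree-∣ {s} {y} s≢0 d with reduce s y s≢0
    ... | g , s′ , y′ , refl , refl , cop , g≢0 = ℕD.*-monoˡ-∣ g (subst (ℕD._∣ y′) (sym s′≡1) (ℕD.1∣ y′))
      where
      instance
        _ : ℕ.NonZero (g ℕ.* g)
        _ = ℕP.m*n≢0 g g {{ℕ.≢-nonZero g≢0}} {{ℕ.≢-nonZero g≢0}}
      l = semiring 2 λ s g → s :* g :* (s :* g) ⊜ s :* s :* (g :* g)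
      c₂ : Coprime (s′ ^ 2) (y′ ^ 2)
      c₂ = Coprimality.sym (coprime-pow (Coprimality.sym (coprime-pow cop 2)) 2)
      ^2 : ∀ x → x ^ 2 ≡ x ℕ.* x
      ^2 x = cong (x ℕ.*_) (ℕP.*-identityʳ x)
      s′≡1 : s′ ≡ 1
      s′≡1 = N-sqfree s′ (Coprimality.coprime-divisor {s′ ℕ.* s′} {y′ ℕ.* y′} {N}
        (subst₂ Coprime (^2 s′) (^2 y′) c₂)
        (ℕD.*-cancelʳ-∣ (g ℕ.* g) (subst₂ ℕD._∣_ (l s′ g)
          (trans (cong (N ℕ.*_) (l y′ g)) (trans (sym (ℕP.*-assoc N (y′ ℕ.* y′) (g ℕ.* g))) (cong (ℕ._* (g ℕ.* g)) (ℕP.*-comm N (y′ ℕ.* y′))))) d)))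

    sqfree-∣ℤ : ∀ {s y} → s ≢ 0ℤ → s * s ∣ + N * (y * y) → s ∣ y
    sqfree-∣ℤ {s} {y} s≢0 d = ∣ᵤ⇒∣ (sqfree-∣ (s≢0 ∘ ℤP.∣i∣≡0⇒i≡0)
      (subst₂ ℕD._∣_ (ℤP.abs-* s s) (trans (ℤP.abs-* (+ N) (y * y)) (cong (N ℕ.*_) (ℤP.abs-* y y))) (∣⇒∣ᵤ d)))

  module RingOfIntegers {D : ℤ} (N c : ℕ) (D≡ : D ≡ 1ℤ - + 4 * + c) (+N : + N ≡ + 4 * + c - 1ℤ)
    (N-sqfree : ∀ d → d ℕ.* d ℕD.∣ N → d ≡ 1) where

    -- The norm of x + y ω.
    Nm : ℤ → ℤ → ℤ
    Nm x y = x * x + x * y + + c * (y * y)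

    4Nm : ∀ x y → + 4 * Nm x y ≡ (+ 2 * x + y) * (+ 2 * x + y) + + N * (y * y)
    4Nm x y = trans (l x y (+ c)) (cong (λ u → (+ 2 * x + y) * (+ 2 * x + y) + u * (y * y)) (sym +N))
      where
      l = ring 3 λ x y c → # 4 :* (x :* x :+ x :* y :+ c :* (y :* y)) ⊜ (# 2 :* x :+ y) :* (# 2 :* x :+ y) :+ (# 4 :* c :- # 1) :* (y :* y)

    Nm-* : ∀ x y z w → Nm (x * z - + c * (y * w)) (x * w + y * z + y * w) ≡ Nm x y * Nm z w
    Nm-* x y z w = l x y z w (+ c)
      where
      l = ring 5 λ x y z w c → (x :* z :- c :* (y :* w)) :* (x :* z :- c :* (y :* w)) :+ (x :* z :- c :* (y :* w)) :* (x :* w :+ y :* z :+ y :* w) :+ c :* ((x :* w :+ y :* z :+ y :* w) :* (x :* w :+ y :* z :+ y :* w)) ⊜ (x :* x :+ x :* y :+ c :* (y :* y)) :* (z :* z :+ z :* w :+ c :* (w :* w))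

    Nm-scale : ∀ s x y → Nm (s * x) (s * y) ≡ s * s * Nm x y
    Nm-scale s x y = l s x y (+ c)
      where
      l = ring 4 λ s x y c → (s :* x) :* (s :* x) :+ (s :* x) :* (s :* y) :+ c :* ((s :* y) :* (s :* y)) ⊜ s :* s :* (x :* x :+ x :* y :+ c :* (y :* y))

    pw : ℚ√ D → ℕ → ℚ√ D
    pw z zero    = 1K
    pw z (suc k) = z ⊠ pw z k

    abs-^ : ∀ i k → ∣ i ℤ.^ k ∣ ≡ ∣ i ∣ ^ k
    abs-^ i zero    = refl
    abs-^ i (suc k) = trans (ℤP.abs-* i (i ℤ.^ k)) (cong (∣ i ∣ ℕ.*_) (abs-^ i k))

    -- Multiplying z by its denominator s gives x + y ω; bounded denominators of
    -- the powers of z force the norm of z to be an integer.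
    norm-integral : ∀ {z s x y t} → s ≢ 0ℤ → t ≢ 0ℤ → ι s 0ℤ ⊠ z ≡ ι x y →
      (∀ k → ∃[ a ] ∃[ b ] ι t 0ℤ ⊠ pw z k ≡ ι a b) → s * s ∣ Nm x y
    norm-integral {z} {s} {x} {y} {t} s≢0 t≢0 sz h = ∣ᵤ⇒∣ (bounded-powers⇒∣ {∣ t * t ∣}
        (t≢0 ∘ sq0 t ∘ ℤP.∣i∣≡0⇒i≡0) (s≢0 ∘ sq0 s ∘ ℤP.∣i∣≡0⇒i≡0) dv)
      where
      sq0 : ∀ i → i * i ≡ 0ℤ → i ≡ 0ℤ
      sq0 i e = Sum.[ (λ p → p) , (λ p → p) ]′ (ℤP.i*j≡0⇒i≡0∨j≡0 i e)
      power : ∀ k → ∃[ a ] ∃[ b ] ι a b ≡ ι (s ℤ.^ k) 0ℤ ⊠ pw z k × Nm a b ≡ Nm x y ℤ.^ k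
      power zero = 1ℤ , 0ℤ , sym (⊠-identityʳ 1K) , l (+ c)
        where
        l = ring 1 λ c → # 1 :* # 1 :+ # 1 :* # 0 :+ c :* (# 0 :* # 0) ⊜ # 1
      power (suc k) with power k
      ... | a , b , e , n = X , Y , (begin
          ι X Y ≡⟨ sym (ι-⊠ (+ c) D≡ x y a b) ⟩
          ι x y ⊠ ι a b ≡⟨ cong₂ _⊠_ (sym sz) e ⟩
          (ι s 0ℤ ⊠ z) ⊠ (ι (s ℤ.^ k) 0ℤ ⊠ pw z k) ≡⟨ ⊠-assoc (ι s 0ℤ) z (ι (s ℤ.^ k) 0ℤ ⊠ pw z k) ⟩
          ι s 0ℤ ⊠ (z ⊠ (ι (s ℤ.^ k) 0ℤ ⊠ pw z k)) ≡⟨ cong (ι s 0ℤ ⊠_) (⊠-swap z (ι (s ℤ.^ k) 0ℤ) (pw z k)) ⟩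
          ι s 0ℤ ⊠ (ι (s ℤ.^ k) 0ℤ ⊠ (z ⊠ pw z k)) ≡⟨ sym (⊠-assoc (ι s 0ℤ) (ι (s ℤ.^ k) 0ℤ) (z ⊠ pw z k)) ⟩
          (ι s 0ℤ ⊠ ι (s ℤ.^ k) 0ℤ) ⊠ pw z (suc k) ≡⟨ cong (_⊠ pw z (suc k)) (sym (ι-* s (s ℤ.^ k))) ⟩
          ι (s ℤ.^ suc k) 0ℤ ⊠ pw z (suc k) ∎) ,
        trans (Nm-* x y a b) (cong (Nm x y *_) n)
        where
        open ≡-Reasoning
        X = x * a - + c * (y * b)
        Y = x * b + y * a + y * b
      -- Norms of t (x + y ω)^k = s^k (t z^k): the left side has norm t² times a power of the norm
      -- of x + y ω, the right side s^(2 k) times an integer.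
      dv : ∀ k → ∣ s * s ∣ ^ k ℕD.∣ ∣ t * t ∣ ℕ.* ∣ Nm x y ∣ ^ k
      dv k with power k | h k
      ... | a , b , e , n | a′ , b′ , e′ = subst₂ ℕD._∣_ (trans (cong ∣_∣ (sym (^-sq k))) (abs-^ (s * s) k))
          (trans (ℤP.abs-* (t * t) (Nm x y ℤ.^ k)) (cong (∣ t * t ∣ ℕ.*_) (abs-^ (Nm x y) k)))
          (∣⇒∣ᵤ (divides {S * S} (Nm a′ b′) (trans (cong (t * t *_) (sym n)) (trans (sym (Nm-scale t a b))
            (trans (cong₂ Nm (proj₁ comps) (proj₂ comps)) (trans (Nm-scale S a′ b′) (ℤP.*-comm (S * S) (Nm a′ b′))))))))
        where
        S = s ℤ.^ k
        ^-sq : ∀ k → (s * s) ℤ.^ k ≡ s ℤ.^ k * s ℤ.^ k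
        ^-sq zero = refl
        ^-sq (suc k) = trans (cong (s * s *_) (^-sq k)) (l s (s ℤ.^ k))
          where
          l = ring 2 λ s u → s :* s :* (u :* u) ⊜ (s :* u) :* (s :* u)
        comps : t * a ≡ S * a′ × t * b ≡ S * b′
        comps = ι-injective (begin
          ι (t * a) (t * b) ≡⟨ sym (ι-scale t a b) ⟩
          ι t 0ℤ ⊠ ι a b ≡⟨ cong (ι t 0ℤ ⊠_) e ⟩
          ι t 0ℤ ⊠ (ι S 0ℤ ⊠ pw z k) ≡⟨ ⊠-swap (ι t 0ℤ) (ι S 0ℤ) (pw z k) ⟩
          ι S 0ℤ ⊠ (ι t 0ℤ ⊠ pw z k) ≡⟨ cong (ι S 0ℤ ⊠_) e′ ⟩
          ι S 0ℤ ⊠ ι a′ b′ ≡⟨ ι-scale S a′ b′ ⟩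
          ι (S * a′) (S * b′) ∎)
          where open ≡-Reasoning

    -- Polynomials of degree below n by Horner's scheme. The fixed length makes their values the
    -- ℤ-module spanned by 1, z, ..., z^(n-1).
    evalV : ∀ {n} → Vec ℤ n → ℚ√ D → ℚ√ D
    evalV []       z = 0K
    evalV (a ∷ as) z = ι a 0ℤ ⊞ z ⊠ evalV as z

    evalV-+ : ∀ {n} (as bs : Vec ℤ n) z → evalV as z ⊞ evalV bs z ≡ evalV (Vec.zipWith _+_ as bs) z
    evalV-+ [] [] z = ⊞-identityˡ 0K
    evalV-+ (a ∷ as) (b ∷ bs) z = trans (⊞-interchange (ι a 0ℤ) (z ⊠ evalV as z) (ι b 0ℤ) (z ⊠ evalV bs z))
      (cong₂ _⊞_ (sym (ι-+ a b)) (trans (sym (⊠-distribˡ z (evalV as z) (evalV bs z))) (cong (z ⊠_) (evalV-+ as bs z))))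

    evalV-scale : ∀ {n} t (as : Vec ℤ n) z → ι t 0ℤ ⊠ evalV as z ≡ evalV (Vec.map (t *_) as) z
    evalV-scale t [] z = ⊠-zeroʳ (ι t 0ℤ)
    evalV-scale t (a ∷ as) z = trans (⊠-distribˡ (ι t 0ℤ) (ι a 0ℤ) (z ⊠ evalV as z)) (cong₂ _⊞_ (sym (ι-* t a))
      (trans (⊠-swap (ι t 0ℤ) z (evalV as z)) (cong (z ⊠_) (evalV-scale t as z))))

    evalV-0 : ∀ n z → evalV (Vec.replicate n 0ℤ) z ≡ 0K
    evalV-0 zero    z = refl
    evalV-0 (suc n) z = trans (cong (λ u → 0K ⊞ z ⊠ u) (evalV-0 n z)) (trans (⊞-identityˡ (z ⊠ 0K)) (⊠-zeroʳ z))

    -- Multiplication by z raises the degree by one; the leading term t z^n is split off so that the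
    -- monic relation can replace it.
    shift : ∀ {n} x (as : Vec ℤ n) z → ∃[ bs ] ∃[ t ] ι x 0ℤ ⊞ z ⊠ evalV as z ≡ evalV {n} bs z ⊞ ι t 0ℤ ⊠ pw z n
    shift x [] z = [] , x , trans (cong (ι x 0ℤ ⊞_) (⊠-zeroʳ z)) (trans (⊞-comm (ι x 0ℤ) 0K) (cong (0K ⊞_) (sym (⊠-identityʳ (ι x 0ℤ)))))
    shift {suc n} x (a ∷ as) z with shift a as z
    ... | bs , t , e = x ∷ bs , t , trans (cong (λ u → ι x 0ℤ ⊞ z ⊠ u) e)
      (trans (cong (ι x 0ℤ ⊞_) (trans (⊠-distribˡ z (evalV bs z) (ι t 0ℤ ⊠ pw z n)) (cong (z ⊠ evalV bs z ⊞_) (⊠-swap z (ι t 0ℤ) (pw z n)))))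
        (sym (⊞-assoc (ι x 0ℤ) (z ⊠ evalV bs z) (ι t 0ℤ ⊠ pw z (suc n)))))

    -- Each multiplication by z in Horner's scheme costs one more factor s, so s^n serves for all
    -- coefficient vectors at once.
    common-denominator : ∀ z n → ∃[ t ] t ≢ 0ℤ × (∀ (as : Vec ℤ n) → ∃[ x ] ∃[ y ] ι t 0ℤ ⊠ evalV as z ≡ ι x y)
    common-denominator z zero = 1ℤ , (λ ()) , λ { [] → 0ℤ , 0ℤ , ⊠-zeroʳ 1K }
    common-denominator z (suc n) with common-denominator z n | denominator z
    ... | t , t≢0 , h | s , p , q , s≢0 , sz = s * t , st≢0 , go
      where
      open ≡-Reasoning
      st≢0 : s * t ≢ 0ℤ
      st≢0 e = Sum.[ s≢0 , t≢0 ]′ (ℤP.i*j≡0⇒i≡0∨j≡0 s e)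
      go : ∀ (as : Vec ℤ (suc n)) → ∃[ x ] ∃[ y ] ι (s * t) 0ℤ ⊠ evalV as z ≡ ι x y
      go (a ∷ as) with h as
      ... | x , y , e = s * t * a + X , 0ℤ + Y , (begin
        ι (s * t) 0ℤ ⊠ (ι a 0ℤ ⊞ z ⊠ evalV as z) ≡⟨ ⊠-distribˡ (ι (s * t) 0ℤ) (ι a 0ℤ) (z ⊠ evalV as z) ⟩
        ι (s * t) 0ℤ ⊠ ι a 0ℤ ⊞ ι (s * t) 0ℤ ⊠ (z ⊠ evalV as z) ≡⟨ cong₂ _⊞_
          (sym (ι-* (s * t) a))
          (trans (cong (_⊠ (z ⊠ evalV as z)) (ι-* s t)) (trans (⊠-assoc (ι s 0ℤ) (ι t 0ℤ) (z ⊠ evalV as z))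
            (trans (cong (ι s 0ℤ ⊠_) (⊠-swap (ι t 0ℤ) z (evalV as z))) (sym (⊠-assoc (ι s 0ℤ) z (ι t 0ℤ ⊠ evalV as z)))))) ⟩
        ι (s * t * a) 0ℤ ⊞ (ι s 0ℤ ⊠ z) ⊠ (ι t 0ℤ ⊠ evalV as z) ≡⟨ cong₂ (λ u v → ι (s * t * a) 0ℤ ⊞ u ⊠ v) sz e ⟩
        ι (s * t * a) 0ℤ ⊞ ι p q ⊠ ι x y ≡⟨ cong (ι (s * t * a) 0ℤ ⊞_) (ι-⊠ (+ c) D≡ p q x y) ⟩
        ι (s * t * a) 0ℤ ⊞ ι X Y ≡⟨ ι-⊞ (s * t * a) 0ℤ X Y ⟩
        ι (s * t * a + X) (0ℤ + Y) ∎)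
        where
        X = p * x - + c * (q * y)
        Y = p * y + q * x + q * y

    monic-vec : ∀ cs z → ∃[ n ] ∃[ as ] evalMonic cs z ≡ evalV {n} as z ⊞ pw z n
    monic-vec [] z = 0 , [] , sym (trans (⊞-identityˡ 1K) 1K≡𝟙)
    monic-vec (c ∷ cs) z with monic-vec cs z
    ... | n , as , e = suc n , c ∷ as , (begin
      fromℤ c ⊕ z ⊗ evalMonic cs z ≡⟨ sym (⊞≡⊕ (fromℤ c) (z ⊗ evalMonic cs z)) ⟩
      fromℤ c ⊞ (z ⊗ evalMonic cs z) ≡⟨ cong₂ _⊞_ (sym (ι≡fromℤ c)) (sym (⊠≡⊗ z (evalMonic cs z))) ⟩
      ι c 0ℤ ⊞ z ⊠ evalMonic cs z ≡⟨ cong (λ u → ι c 0ℤ ⊞ z ⊠ u) e ⟩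
      ι c 0ℤ ⊞ z ⊠ (evalV as z ⊞ pw z n) ≡⟨ cong (ι c 0ℤ ⊞_) (⊠-distribˡ z (evalV as z) (pw z n)) ⟩
      ι c 0ℤ ⊞ (z ⊠ evalV as z ⊞ z ⊠ pw z n) ≡⟨ sym (⊞-assoc (ι c 0ℤ) (z ⊠ evalV as z) (z ⊠ pw z n)) ⟩
      ι c 0ℤ ⊞ z ⊠ evalV as z ⊞ z ⊠ pw z n ∎)
      where open ≡-Reasoning

    InSpan : ℕ → ℚ√ D → ℚ√ D → Set
    InSpan n z u = ∃[ as ] u ≡ evalV {n} as z

    -- The monic relation expresses z^n through lower powers, so multiplication by z preserves the
    -- span of 1, ..., z^(n-1). The empty coefficient list encodes the polynomial 1, which has no
    -- root.
    integral⇒closed : ∀ {z} → Integral z → ∃[ n ] InSpan n z 1K × (∀ u → InSpan n z u → InSpan n z (z ⊠ u))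
    integral⇒closed {z} (cs , root) with monic-vec cs z
    ... | zero , [] , e = contradiction (proj₁ (ι-injective {D} (trans (sym (⊞-identityˡ 1K)) (trans (sym e) root′)))) λ ()
      where
      root′ : evalMonic cs z ≡ 0K
      root′ = trans root (sym 0K≡𝟘)
    ... | suc n , cs′ , e = suc n ,
        (1ℤ ∷ Vec.replicate n 0ℤ , sym (trans (cong (λ u → 1K ⊞ z ⊠ u) (evalV-0 n z)) (trans (cong (1K ⊞_) (⊠-zeroʳ z)) (⊞-identityʳ 1K)))) ,
        λ { u (as , refl) → closed as }
      where
      open ≡-Reasoning
      negs : Vec ℤ (suc n)
      negs = Vec.map (-1ℤ *_) cs′
      root′ : evalMonic cs z ≡ 0K
      root′ = trans root (sym 0K≡𝟘)
      pw≡ : pw z (suc n) ≡ evalV negs z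
      pw≡ = begin
        pw z (suc n) ≡⟨ sym (⊞-identityˡ (pw z (suc n))) ⟩
        0K ⊞ pw z (suc n) ≡⟨ cong (_⊞ pw z (suc n)) (sym (trans (evalV-+ cs′ negs z) (trans (cong (λ v → evalV v z) (cancel cs′)) (evalV-0 (suc n) z)))) ⟩
        (evalV cs′ z ⊞ evalV negs z) ⊞ pw z (suc n) ≡⟨ trans (⊞-assoc (evalV cs′ z) (evalV negs z) (pw z (suc n)))
          (trans (cong (evalV cs′ z ⊞_) (⊞-comm (evalV negs z) (pw z (suc n)))) (sym (⊞-assoc (evalV cs′ z) (pw z (suc n)) (evalV negs z)))) ⟩
        (evalV cs′ z ⊞ pw z (suc n)) ⊞ evalV negs z ≡⟨ cong (_⊞ evalV negs z) (trans (sym e) root′) ⟩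
        0K ⊞ evalV negs z ≡⟨ ⊞-identityˡ (evalV negs z) ⟩
        evalV negs z ∎
        where
        cancel : ∀ {m} (as : Vec ℤ m) → Vec.zipWith _+_ as (Vec.map (-1ℤ *_) as) ≡ Vec.replicate m 0ℤ
        cancel []       = refl
        cancel (a ∷ as) = cong₂ _∷_ (l a) (cancel as)
          where
          l = ring 1 λ a → a :+ (:- # 1) :* a ⊜ # 0
      closed : ∀ as → InSpan (suc n) z (z ⊠ evalV as z)
      closed as with shift 0ℤ as z
      ... | bs , t , e′ = Vec.zipWith _+_ bs (Vec.map (t *_) negs) , (begin
        z ⊠ evalV as z ≡⟨ sym (⊞-identityˡ (z ⊠ evalV as z)) ⟩
        0K ⊞ z ⊠ evalV as z ≡⟨ e′ ⟩
        evalV bs z ⊞ ι t 0ℤ ⊠ pw z (suc n) ≡⟨ cong (λ u → evalV bs z ⊞ ι t 0ℤ ⊠ u) pw≡ ⟩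
        evalV bs z ⊞ ι t 0ℤ ⊠ evalV negs z ≡⟨ cong (evalV bs z ⊞_) (evalV-scale t negs z) ⟩
        evalV bs z ⊞ evalV (Vec.map (t *_) negs) z ≡⟨ evalV-+ bs (Vec.map (t *_) negs) z ⟩
        evalV (Vec.zipWith _+_ bs (Vec.map (t *_) negs)) z ∎)

    -- The trace and norm of (x + y ω) / s being integers, so are its coordinates.
    coordinates-integral : ∀ {s x y A B m} .{{_ : NonZero s}} → + 2 * x + y ≡ A * s → y ≡ B * s →
      Nm x y ≡ m * (s * s) → s ∣ x
    coordinates-integral {s} {x} {y} {A} {B} {m} eA eB em =
        go (Sum.[ (λ d → d) , flip-sign ]′ (Prime∣ prime[2] (A - B) (A + B) (subst (+ 2 ∣_) (l₀ A B) two)))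
      where
      open ≡-Reasoning
      instance
        ss-nz : NonZero (s * s)
        ss-nz = ℤP.i*j≢0 s s
      l₀ = ring 2 λ A B → A :* A :- B :* B ⊜ (A :- B) :* (A :+ B)
      4m : + 4 * m ≡ A * A + + N * (B * B)
      4m = ℤP.*-cancelˡ-≡ (s * s) _ _ (begin
        s * s * (+ 4 * m) ≡⟨ l₁ s m ⟩
        + 4 * (m * (s * s)) ≡⟨ cong (+ 4 *_) (sym em) ⟩
        + 4 * Nm x y ≡⟨ 4Nm x y ⟩
        (+ 2 * x + y) * (+ 2 * x + y) + + N * (y * y) ≡⟨ cong₂ (λ u v → u * u + + N * (v * v)) eA eB ⟩
        A * s * (A * s) + + N * (B * s * (B * s)) ≡⟨ l₂ A B s (+ N) ⟩
        s * s * (A * A + + N * (B * B)) ∎)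
        where
        l₁ = ring 2 λ s m → s :* s :* (# 4 :* m) ⊜ # 4 :* (m :* (s :* s))
        l₂ = ring 4 λ A B s n → A :* s :* (A :* s) :+ n :* (B :* s :* (B :* s)) ⊜ s :* s :* (A :* A :+ n :* (B :* B))
      two : + 2 ∣ A * A - B * B
      two = divides (+ 2 * m - + 2 * + c * (B * B)) (begin
        A * A - B * B ≡⟨ l₁ (A * A) (B * B) (+ c) ⟩
        A * A + (+ 4 * + c - 1ℤ) * (B * B) - + 4 * + c * (B * B) ≡⟨ cong (λ u → A * A + u * (B * B) - + 4 * + c * (B * B)) (sym +N) ⟩
        A * A + + N * (B * B) - + 4 * + c * (B * B) ≡⟨ cong (_- + 4 * + c * (B * B)) (sym 4m) ⟩
        + 4 * m - + 4 * + c * (B * B) ≡⟨ l₂ m (+ c) (B * B) ⟩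
        (+ 2 * m - + 2 * + c * (B * B)) * + 2 ∎)
        where
        l₁ = ring 3 λ a b c → a :- b ⊜ a :+ (# 4 :* c :- # 1) :* b :- # 4 :* c :* b
        l₂ = ring 3 λ m c b → # 4 :* m :- # 4 :* c :* b ⊜ (# 2 :* m :- # 2 :* c :* b) :* # 2
      flip-sign : + 2 ∣ A + B → + 2 ∣ A - B
      flip-sign d = subst (+ 2 ∣_) (l A B) (∣m∣n⇒∣m-n d (∣m⇒∣m*n B (∣-refl {+ 2})))
        where
        l = ring 2 λ A B → A :+ B :- # 2 :* B ⊜ A :- B
      go : + 2 ∣ A - B → s ∣ x
      go (divides q e) = divides q (ℤP.*-cancelˡ-≡ (+ 2) x (q * s) (begin
        + 2 * x ≡⟨ l₁ x y ⟩
        (+ 2 * x + y) - y ≡⟨ cong₂ _-_ eA eB ⟩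
        A * s - B * s ≡⟨ l₂ A B s ⟩
        (A - B) * s ≡⟨ cong (_* s) e ⟩
        q * + 2 * s ≡⟨ l₃ q s ⟩
        + 2 * (q * s) ∎))
        where
        l₁ = ring 2 λ x y → # 2 :* x ⊜ (# 2 :* x :+ y) :- y
        l₂ = ring 3 λ A B s → A :* s :- B :* s ⊜ (A :- B) :* s
        l₃ = ring 2 λ q s → q :* # 2 :* s ⊜ # 2 :* (q :* s)

    -- The norm of z + 1 exceeds that of z by the trace plus 1. Bounded denominators for the powers
    -- of both elements thus make trace and norm integral. Then s² divides N y², and N is
    -- squarefree.
    closed⇒ι : ∀ {n z s x y t} → InSpan n z 1K → (∀ u → InSpan n z u → InSpan n z (z ⊠ u)) →
      s ≢ 0ℤ → ι s 0ℤ ⊠ z ≡ ι x y → t ≢ 0ℤ → (∀ (as : Vec ℤ n) → ∃[ a ] ∃[ b ] ι t 0ℤ ⊠ evalV as z ≡ ι a b) →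
      ∃[ x ] ∃[ y ] z ≡ ι x y
    closed⇒ι {n} {z} {s} {x} {y} {t} one closed s≢0 sz t≢0 bound = result s∣trace s∣y d₀
      where
      instance
        s-nz : NonZero s
        s-nz = ℤ.≢-nonZero s≢0
      closed₁ : ∀ u → InSpan n z u → InSpan n z ((z ⊞ 1K) ⊠ u)
      closed₁ u m@(bs , e′) = add (closed u m)
        where
        add : InSpan n z (z ⊠ u) → InSpan n z ((z ⊞ 1K) ⊠ u)
        add (as , e) = Vec.zipWith _+_ as bs , trans (⊠-distribʳ u z 1K)
          (trans (cong₂ _⊞_ e (trans (⊠-identityˡ u) e′)) (evalV-+ as bs z))
      powers : ∀ {v} → (∀ u → InSpan n z u → InSpan n z (v ⊠ u)) → ∀ k → InSpan n z (pw v k)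
      powers cl zero        = one
      powers {v} cl (suc k) = cl (pw v k) (powers cl k)
      bounded : ∀ {v} → (∀ u → InSpan n z u → InSpan n z (v ⊠ u)) → ∀ k → ∃[ a ] ∃[ b ] ι t 0ℤ ⊠ pw v k ≡ ι a b
      bounded {v} cl k = at (powers cl k)
        where
        at : InSpan n z (pw v k) → ∃[ a ] ∃[ b ] ι t 0ℤ ⊠ pw v k ≡ ι a b
        at (as , e) with bound as
        ... | a , b , e′ = a , b , trans (cong (ι t 0ℤ ⊠_) e) e′
      d₀ : s * s ∣ Nm x y
      d₀ = norm-integral s≢0 t≢0 sz (bounded closed)
      sz₁ : ι s 0ℤ ⊠ (z ⊞ 1K) ≡ ι (x + s) y
      sz₁ = trans (⊠-distribˡ (ι s 0ℤ) z 1K) (trans (cong₂ _⊞_ sz (⊠-identityʳ (ι s 0ℤ)))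
        (trans (ι-⊞ x y s 0ℤ) (cong (ι (x + s)) (ℤP.+-identityʳ y))))
      d₁ : s * s ∣ Nm (x + s) y
      d₁ = norm-integral s≢0 t≢0 sz₁ (bounded closed₁)
      s∣trace : s ∣ + 2 * x + y
      s∣trace = *-cancelˡ-∣ s (∣m+n∣n⇒∣m (∣m+n∣m⇒∣n (subst (s * s ∣_) (l x y s (+ c)) d₁) d₀) (∣-refl {s * s}))
        where
        l = ring 4 λ x y s c → (x :+ s) :* (x :+ s) :+ (x :+ s) :* y :+ c :* (y :* y) ⊜ (x :* x :+ x :* y :+ c :* (y :* y)) :+ (s :* (# 2 :* x :+ y) :+ s :* s)
      s∣y : s ∣ y
      s∣y = sqfree-∣ℤ N N-sqfree s≢0 (∣m+n∣m⇒∣n (subst (s * s ∣_) (4Nm x y) (∣n⇒∣m*n (+ 4) d₀)) (sq s∣trace))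
        where
        sq : ∀ {a} → s ∣ a → s * s ∣ a * a
        sq (divides q refl) = divides (q * q) (l q s)
          where
          l = ring 2 λ q s → q :* s :* (q :* s) ⊜ q :* q :* (s :* s)
      result : s ∣ + 2 * x + y → s ∣ y → s * s ∣ Nm x y → ∃[ x ] ∃[ y ] z ≡ ι x y
      result (divides A eA) (divides b eb) (divides m em) = finish (coordinates-integral {A = A} {B = b} {m = m} eA eb em)
        where
        finish : s ∣ x → ∃[ x ] ∃[ y ] z ≡ ι x y
        finish (divides a ea) = a , b , ι-cancel s s≢0 (trans sz (trans
          (cong₂ ι (trans ea (ℤP.*-comm a s)) (trans eb (ℤP.*-comm b s))) (sym (ι-scale s a b))))

    abstract
      integral⇒ι : ∀ {z : ℚ√ D} → Integral z → ∃[ x ] ∃[ y ] z ≡ ι x y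
      integral⇒ι {z} int = go (integral⇒closed int) (denominator z)
        where
        go : ∃[ n ] InSpan n z 1K × (∀ u → InSpan n z u → InSpan n z (z ⊠ u)) →
          ∃[ s ] ∃[ x ] ∃[ y ] s ≢ 0ℤ × ι s 0ℤ ⊠ z ≡ ι x y → ∃[ x ] ∃[ y ] z ≡ ι x y
        go (n , one , closed) (s , x , y , s≢0 , sz) with common-denominator z n
        ... | t , t≢0 , bound = closed⇒ι one closed s≢0 sz t≢0 bound

    abstract
      -- x + y ω is a root of its characteristic polynomial, whose coefficients are the norm and
      -- minus the trace.
      ι⇒integral : ∀ x y → Integral (ι {D} x y)
      ι⇒integral x y = n ∷ t ∷ [] , (begin
          fromℤ {D} n ⊕ ι x y ⊗ (fromℤ {D} t ⊕ ι x y ⊗ 𝟙 {D}) ≡⟨ sym (⊞≡⊕ (fromℤ {D} n) (ι x y ⊗ (fromℤ {D} t ⊕ ι x y ⊗ 𝟙 {D}))) ⟩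
          fromℤ {D} n ⊞ (ι x y ⊗ (fromℤ {D} t ⊕ ι x y ⊗ 𝟙 {D})) ≡⟨ cong₂ _⊞_ (sym (ι≡fromℤ n)) (sym (⊠≡⊗ (ι x y) (fromℤ {D} t ⊕ ι x y ⊗ 𝟙 {D}))) ⟩
          ι n 0ℤ ⊞ ι x y ⊠ (fromℤ {D} t ⊕ ι x y ⊗ 𝟙 {D}) ≡⟨ cong (λ u → ι n 0ℤ ⊞ ι x y ⊠ u) inner ⟩
          ι n 0ℤ ⊞ ι x y ⊠ ι (t + x) (0ℤ + y) ≡⟨ cong (ι n 0ℤ ⊞_) (ι-⊠ (+ c) D≡ x y (t + x) (0ℤ + y)) ⟩
          ι n 0ℤ ⊞ ι X Y ≡⟨ ι-⊞ n 0ℤ X Y ⟩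
          ι (n + X) (0ℤ + Y) ≡⟨ cong₂ ι (l₁ x y (+ c)) (l₂ x y) ⟩
          0K ≡⟨ 0K≡𝟘 ⟩
          𝟘 ∎)
        where
        open ≡-Reasoning
        n t X Y : ℤ
        n = Nm x y
        t = - (+ 2 * x + y)
        X = x * (t + x) - + c * (y * (0ℤ + y))
        Y = x * (0ℤ + y) + y * (t + x) + y * (0ℤ + y)
        inner : fromℤ {D} t ⊕ ι x y ⊗ 𝟙 {D} ≡ ι (t + x) (0ℤ + y)
        inner = trans (sym (⊞≡⊕ (fromℤ {D} t) (ι x y ⊗ 𝟙 {D}))) (trans (cong₂ _⊞_ (sym (ι≡fromℤ t))
          (trans (sym (⊠≡⊗ (ι x y) 𝟙)) (trans (cong (ι x y ⊠_) (sym 1K≡𝟙)) (⊠-identityʳ (ι x y))))) (ι-⊞ t 0ℤ x y))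
        l₁ : ∀ x y c → (x * x + x * y + c * (y * y)) +
          (x * (- (+ 2 * x + y) + x) - c * (y * (0ℤ + y))) ≡ 0ℤ
        l₁ = ring 3 λ x y c → (x :* x :+ x :* y :+ c :* (y :* y)) :+ (x :* (:- (# 2 :* x :+ y) :+ x) :- c :* (y :* (# 0 :+ y))) ⊜ # 0
        l₂ : ∀ x y → 0ℤ + (x * (0ℤ + y) + y * (- (+ 2 * x + y) + x) + y * (0ℤ + y)) ≡ 0ℤ
        l₂ = ring 2 λ x y → # 0 :+ (x :* (# 0 :+ y) :+ y :* (:- (# 2 :* x :+ y) :+ x) :+ y :* (# 0 :+ y)) ⊜ # 0

-- Lattice bases of fractional ideals.

module Ideals where

  open Normalisation using (ring; _⊜_; _:+_; _:-_; _:*_; :-_; #_)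
  open import Data.Integer.Base hiding (suc; _%_; _/_; _^_)
  open ℤD using (_∣_)
  open import Data.List.Base using (List; []; _∷_)
  open import Data.List.Relation.Unary.Any using (Any; here; there)
  open import Data.Nat.GCD using (module Bézout)
  open import Defs
  open Sums using (≤-by; 0≤sq; 0≤pos)
  open Field
  open Integers

  record Bezout (a b : ℤ) : Set where
    constructor bezout
    field
      g a′ b′ s t : ℤ
      a≡   : a ≡ g * a′
      b≡   : b ≡ g * b′
      unit : s * a′ + t * b′ ≡ 1ℤ

  coprime⇒bezout : ∀ {m n} → Coprime m n → ∃[ s ] ∃[ t ] s * + m + t * + n ≡ 1ℤ
  coprime⇒bezout {m} {n} c with Coprimality.coprime-Bézout c
  ... | Bézout.+- x y eq = + x , - + y , l (+ x * + m) (+ y) (+ n) (sym (trans (cong (λ u → 1ℤ + u) (sym (ℤP.pos-* y n))) (trans (cong +_ eq) (ℤP.pos-* x m))))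
    where
    l : ∀ u y n → u ≡ 1ℤ + y * n → u + - y * n ≡ 1ℤ
    l u y n refl = l′ y n
      where
      l′ = ring 2 λ y n → # 1 :+ y :* n :+ :- y :* n ⊜ # 1
  ... | Bézout.-+ x y eq = - + x , + y , l (+ x) (+ m) (+ y * + n) (sym (trans (cong (λ u → 1ℤ + u) (sym (ℤP.pos-* x m))) (trans (cong +_ eq) (ℤP.pos-* y n))))
    where
    l : ∀ x m u → u ≡ 1ℤ + x * m → - x * m + u ≡ 1ℤ
    l x m u refl = l′ x m
      where
      l′ = ring 2 λ x m → :- x :* m :+ (# 1 :+ x :* m) ⊜ # 1

  ±∣∣ : ∀ i → ∃[ e ] e * e ≡ 1ℤ × i ≡ e * + ∣ i ∣
  ±∣∣ (+ n)    = 1ℤ , refl , sym (ℤP.*-identityˡ (+ n))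
  ±∣∣ -[1+ n ] = -1ℤ , refl , sym (ℤP.-1*i≡-i (+ suc n))

  abstract
    bezout-ℕ : ∀ m n → Bezout (+ m) (+ n)
    bezout-ℕ zero    n = bezout (+ n) 0ℤ 1ℤ 0ℤ 1ℤ (sym (ℤP.*-zeroʳ (+ n))) (sym (ℤP.*-identityʳ (+ n))) refl
    bezout-ℕ m@(suc _) n with reduce m n (λ ())
    ... | g , m′ , n′ , m≡ , n≡ , cop , _ with coprime⇒bezout cop
    ...   | s , t , e = bezout (+ g) (+ m′) (+ n′) s t
            (trans (cong +_ m≡) (trans (ℤP.pos-* m′ g) (ℤP.*-comm (+ m′) (+ g))))
            (trans (cong +_ n≡) (trans (ℤP.pos-* n′ g) (ℤP.*-comm (+ n′) (+ g)))) e

    bezout-ℤ : ∀ a b → Bezout a b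
    bezout-ℤ a b with ±∣∣ a | ±∣∣ b | bezout-ℕ ∣ a ∣ ∣ b ∣
    ... | e , ee , a≡ | d , dd , b≡ | bezout g a′ b′ s t ga gb u = bezout g (e * a′) (d * b′) (s * e) (t * d)
        (trans a≡ (trans (cong (e *_) ga) (l e g a′))) (trans b≡ (trans (cong (d *_) gb) (l d g b′)))
        (trans (l₂ s e a′ t d b′) (trans (cong₂ (λ x y → x * (s * a′) + y * (t * b′)) ee dd)
          (trans (cong₂ _+_ (ℤP.*-identityˡ (s * a′)) (ℤP.*-identityˡ (t * b′))) u)))
      where
      l : ∀ e g a → e * (g * a) ≡ g * (e * a)
      l = ring 3 λ e g a → e :* (g :* a) ⊜ g :* (e :* a)
      l₂ : ∀ s e a t d b → s * e * (e * a) + t * d * (d * b) ≡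
        e * e * (s * a) + d * d * (t * b)
      l₂ = ring 6 λ s e a t d b → s :* e :* (e :* a) :+ t :* d :* (d :* b) ⊜ e :* e :* (s :* a) :+ d :* d :* (t :* b)

  -- (X , Y) lies in the lattice spanned by (A , 0) and (B , G).
  record InLattice (A B G X Y : ℤ) : Set where
    constructor lattice
    field
      x y : ℤ
      X≡  : X ≡ x * A + y * B
      Y≡  : Y ≡ y * G

  -- Membership in the same lattice with (m , n) as a third generator.
  record Extended (A B G m n X Y : ℤ) : Set where
    constructor extended
    field
      x y t : ℤ
      X≡    : X ≡ x * A + y * B + t * m
      Y≡    : Y ≡ y * G + t * n

  module _ {A B G m n : ℤ} where

    HasBasis : Set
    HasBasis = ∃[ A′ ] ∃[ B′ ] ∃[ G′ ] (∀ X Y →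
      (Extended A B G m n X Y → InLattice A′ B′ G′ X Y) × (InLattice A′ B′ G′ X Y → Extended A B G m n X Y))

    -- The vector s (B , G) + t (m , n) has the gcd G′ as second coordinate. The relation between G
    -- and n leaves (n₁ B - G₁ m , 0), which a second gcd merges with (A , 0).
    extend-basis : (e : Bezout G n) → Bezout A (Bezout.b′ e * B - Bezout.a′ e * m) → HasBasis
    extend-basis (bezout G′ G₁ n₁ s t G≡ n≡ u) (bezout A′ A₁ K₁ p q A≡ K≡ v) =
      A′ , s * B + t * m , G′ , λ X Y → to X Y , from X Y
      where
      B′ = s * B + t * m
      to : ∀ X Y → Extended A B G m n X Y → InLattice A′ B′ G′ X Y
      to X Y (extended x y r X≡ Y≡) = lattice (x * A₁ + (y * t - r * s) * K₁) (y * G₁ + r * n₁)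
        (begin
          X ≡⟨ X≡ ⟩
          x * A + y * B + r * m ≡⟨ cong (λ w → x * A + w) (sym (ℤP.*-identityˡ (y * B + r * m))) ⟨≡ (ℤP.+-assoc (x * A) (y * B) (r * m)) ⟩
          x * A + 1ℤ * (y * B + r * m) ≡⟨ cong (λ w → x * A + w * (y * B + r * m)) (sym u) ⟩
          x * A + (s * G₁ + t * n₁) * (y * B + r * m) ≡⟨ l₁ x A s G₁ t n₁ y B r m ⟩
          x * A + (y * t - r * s) * (n₁ * B - G₁ * m) + (y * G₁ + r * n₁) * B′
            ≡⟨ cong₂ (λ a k → x * a + (y * t - r * s) * k + (y * G₁ + r * n₁) * B′) A≡ K≡ ⟩
          x * (A′ * A₁) + (y * t - r * s) * (A′ * K₁) + (y * G₁ + r * n₁) * B′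
            ≡⟨ l₂ x A′ A₁ (y * t - r * s) K₁ ((y * G₁ + r * n₁) * B′) ⟩
          (x * A₁ + (y * t - r * s) * K₁) * A′ + (y * G₁ + r * n₁) * B′ ∎)
        (trans Y≡ (trans (cong₂ (λ a b → y * a + r * b) G≡ n≡) (l₃ y G′ G₁ r n₁)))
        where
        open ≡-Reasoning
        _⟨≡_ : ∀ {a b c : ℤ} → b ≡ c → a ≡ b → a ≡ c
        p ⟨≡ q = trans q p
        l₁ = ring 10 λ x A s G t n y B r m → x :* A :+ (s :* G :+ t :* n) :* (y :* B :+ r :* m) ⊜ x :* A :+ (y :* t :- r :* s) :* (n :* B :- G :* m) :+ (y :* G :+ r :* n) :* (s :* B :+ t :* m)
        l₂ = ring 6 λ x a b c k z → x :* (a :* b) :+ c :* (a :* k) :+ z ⊜ (x :* b :+ c :* k) :* a :+ z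
        l₃ = ring 5 λ y g a r b → y :* (g :* a) :+ r :* (g :* b) ⊜ (y :* a :+ r :* b) :* g
      from : ∀ X Y → InLattice A′ B′ G′ X Y → Extended A B G m n X Y
      from X Y (lattice x y X≡ Y≡) = extended (x * p) (x * q * n₁ + y * s) (y * t - x * q * G₁)
        (begin
          X ≡⟨ X≡ ⟩
          x * A′ + y * B′ ≡⟨ cong (λ w → x * w + y * B′) A′≡ ⟩
          x * (p * A + q * (n₁ * B - G₁ * m)) + y * B′ ≡⟨ l₁ x p A q n₁ B G₁ m y s t ⟩
          x * p * A + (x * q * n₁ + y * s) * B + (y * t - x * q * G₁) * m ∎)
        (begin
          Y ≡⟨ Y≡ ⟩
          y * G′ ≡⟨ cong (y *_) (sym (ℤP.*-identityˡ G′)) ⟩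
          y * (1ℤ * G′) ≡⟨ cong (λ w → y * (w * G′)) (sym u) ⟩
          y * ((s * G₁ + t * n₁) * G′) ≡⟨ l₂ y s G₁ t n₁ G′ (x * q) ⟩
          (x * q * n₁ + y * s) * (G′ * G₁) + (y * t - x * q * G₁) * (G′ * n₁)
            ≡⟨ cong₂ (λ a b → (x * q * n₁ + y * s) * a + (y * t - x * q * G₁) * b) (sym G≡) (sym n≡) ⟩
          (x * q * n₁ + y * s) * G + (y * t - x * q * G₁) * n ∎)
        where
        open ≡-Reasoning
        A′≡ : A′ ≡ p * A + q * (n₁ * B - G₁ * m)
        A′≡ = begin
          A′ ≡⟨ sym (ℤP.*-identityʳ A′) ⟩
          A′ * 1ℤ ≡⟨ cong (A′ *_) (sym v) ⟩
          A′ * (p * A₁ + q * K₁) ≡⟨ l A′ p A₁ q K₁ ⟩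
          p * (A′ * A₁) + q * (A′ * K₁) ≡⟨ cong₂ (λ a k → p * a + q * k) (sym A≡) (sym K≡) ⟩
          p * A + q * (n₁ * B - G₁ * m) ∎
          where
          l = ring 5 λ g p a q k → g :* (p :* a :+ q :* k) ⊜ p :* (g :* a) :+ q :* (g :* k)
        l₁ = ring 11 λ x p A q n B G m y s t → x :* (p :* A :+ q :* (n :* B :- G :* m)) :+ y :* (s :* B :+ t :* m) ⊜ x :* p :* A :+ (x :* q :* n :+ y :* s) :* B :+ (y :* t :- x :* q :* G) :* m
        l₂ = ring 7 λ y s a t b g z → y :* ((s :* a :+ t :* b) :* g) ⊜ (z :* b :+ y :* s) :* (g :* a) :+ (y :* t :- z :* a) :* (g :* b)

  abstract
    -- One step of Hermite normal form.
    adjoin : ∀ A B G m n → HasBasis {A} {B} {G} {m} {n}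
    adjoin A B G m n = extend-basis e (bezout-ℤ A (Bezout.b′ e * B - Bezout.a′ e * m))
      where
      e : Bezout G n
      e = bezout-ℤ G n

  module Classes {D : ℤ} (N c : ℕ) (D≡ : D ≡ 1ℤ - + 4 * + c) (+N : + N ≡ + 4 * + c - 1ℤ)
    (N-sqfree : ∀ d → d ℕ.* d ℕD.∣ N → d ≡ 1) (N≢0 : N ≢ 0) where

    open RingOfIntegers {D} N c D≡ +N N-sqfree

    private
      K = ℚ√ D

      mulK : ∀ x y z w → ι {D} x y ⊠ ι z w ≡ ι (x * z - + c * (y * w)) (x * w + y * z + y * w)
      mulK = ι-⊠ (+ c) D≡

      ω : K
      ω = ι 0ℤ 1ℤ

      mulω : ∀ X Y → ω ⊠ ι X Y ≡ ι (- (+ c * Y)) (X + Y)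
      mulω X Y = trans (mulK 0ℤ 1ℤ X Y) (cong₂ ι (l₁ (+ c) X Y) (l₂ X Y))
        where
        l₁ = ring 3 λ c X Y → # 0 :* X :- c :* (# 1 :* Y) ⊜ :- (c :* Y)
        l₂ = ring 2 λ X Y → # 0 :* Y :+ # 1 :* X :+ # 1 :* Y ⊜ X :+ Y

    combine : ∀ {a g z x : K} {gs : List K} → Integral a → Span gs z → x ≡ a ⊠ g ⊞ z → Span (g ∷ gs) x
    combine {a} {g} {z} {gs = gs} int sp refl = subst (Span (g ∷ gs))
      (sym (trans (⊞≡⊕ (a ⊠ g) z) (cong (_⊕ z) (⊠≡⊗ a g)))) (int ∷ sp)

    record Combination (g : K) (gs : List K) (x : K) : Set where
      constructor combination
      field
        l₁ l₂ : ℤ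
        rest  : K
        sp    : Span gs rest
        x≡    : x ≡ ι l₁ l₂ ⊠ g ⊞ rest

    uncombine : ∀ {g x : K} {gs : List K} → Span (g ∷ gs) x → Combination g gs x
    uncombine {g} {gs = gs} (_∷_ {a} {x = z} int sp) = go (integral⇒ι int)
      where
      go : ∃[ l₁ ] ∃[ l₂ ] a ≡ ι l₁ l₂ → Combination g gs (a ⊗ g ⊕ z)
      go (l₁ , l₂ , a≡) = combination l₁ l₂ z sp (trans (sym (⊞≡⊕ (a ⊗ g) z))
        (cong (_⊞ z) (trans (sym (⊠≡⊗ a g)) (cong (_⊠ g) a≡))))

    span-0 : ∀ (gs : List K) → Span gs 0K
    span-0 []       = subst (Span []) (sym 0K≡𝟘) []
    span-0 (g ∷ gs) = combine (ι⇒integral 0ℤ 0ℤ) (span-0 gs)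
      (sym (trans (cong (_⊞ 0K) (trans (⊠-comm 0K g) (⊠-zeroʳ g))) (⊞-identityˡ 0K)))

    span-gen : ∀ {gs : List K} → Any (_≢ 𝟘) gs → ∃[ z ] z ≢ 0K × Span gs z
    span-gen {g ∷ gs} (here g≢0) = g , (λ e → g≢0 (trans e 0K≡𝟘)) , combine (ι⇒integral 1ℤ 0ℤ) (span-0 gs)
      (sym (trans (cong (_⊞ 0K) (⊠-identityˡ g)) (⊞-identityʳ g)))
    span-gen {g ∷ gs} (there any) with span-gen any
    ... | z , z≢0 , sp = z , z≢0 , combine (ι⇒integral 0ℤ 0ℤ) sp
      (sym (trans (cong (_⊞ z) (trans (⊠-comm 0K g) (⊠-zeroʳ g))) (⊞-identityˡ z)))

    span-ω : ∀ {gs : List K} {z} → Span gs z → Span gs (ω ⊠ z)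
    span-ω {[]} [] = subst (Span []) (sym (trans (cong (ω ⊠_) (sym 0K≡𝟘)) (trans (⊠-zeroʳ ω) 0K≡𝟘))) []
    span-ω {g ∷ gs} sp = go (uncombine sp)
      where
      go : ∀ {z} → Combination g gs z → Span (g ∷ gs) (ω ⊠ z)
      go (combination l₁ l₂ rest sp refl) = combine (ι⇒integral X Y) (span-ω sp)
        (trans (⊠-distribˡ ω (ι l₁ l₂ ⊠ g) rest) (cong (_⊞ ω ⊠ rest)
          (trans (sym (⊠-assoc ω (ι l₁ l₂) g)) (cong (_⊠ g) (mulω l₁ l₂)))))
        where
        X = - (+ c * l₂)
        Y = l₁ + l₂

    -- A Hermite basis of s · Span gs.
    record Hermite (gs : List K) : Set where
      constructor hermite
      field
        s A B G : ℤ
        s≢0     : s ≢ 0ℤ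
        to      : ∀ {z} → Span gs z → ∃[ X ] ∃[ Y ] ι s 0ℤ ⊠ z ≡ ι X Y × InLattice A B G X Y
        from    : ∀ {z X Y} → ι s 0ℤ ⊠ z ≡ ι X Y → InLattice A B G X Y → Span gs z

    hermiteBasis : ∀ gs → Hermite gs
    hermiteBasis [] = hermite 1ℤ 0ℤ 0ℤ 0ℤ (λ ())
      (λ { [] → 0ℤ , 0ℤ , trans (⊠-identityˡ 𝟘) (sym 0K≡𝟘) , lattice 0ℤ 0ℤ refl refl })
      λ { {z} e (lattice x y refl refl) → subst (Span []) (sym (trans (sym (⊠-identityˡ z)) (trans e
        (trans (cong₂ ι (l x y) (ℤP.*-zeroʳ y)) 0K≡𝟘)))) [] }
      where
      l = ring 2 λ x y → x :* # 0 :+ y :* # 0 ⊜ # 0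
    hermiteBasis (g ∷ gs) = extend (hermiteBasis gs) (denominator g)
      where
      extend : Hermite gs → ∃[ d ] ∃[ m ] ∃[ n ] d ≢ 0ℤ × ι d 0ℤ ⊠ g ≡ ι m n → Hermite (g ∷ gs)
      -- Over ℤ the generator g contributes both g and ω g, hence two uses of `adjoin`. After
      -- scaling by s d their coordinates are (s m , s n) and (m₂ , n₂).
      extend (hermite s A B G s≢0 to from) (d , m , n , d≢0 , dg) = twice (adjoin (d * A) (d * B) (d * G) (s * m) (s * n))
        where
        sd = s * d
        m₂ = s * (- (+ c * n))
        n₂ = s * (m + n)
        sd≢0 : sd ≢ 0ℤ
        sd≢0 e = Sum.[ s≢0 , d≢0 ]′ (ℤP.i*j≡0⇒i≡0∨j≡0 s e)
        -- Coordinates of s d (l₁ + l₂ ω) g + d (s z).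
        coords : ∀ l₁ l₂ z X Y → ι s 0ℤ ⊠ z ≡ ι X Y → ι sd 0ℤ ⊠ (ι l₁ l₂ ⊠ g ⊞ z) ≡
          ι (d * X + (l₁ * (s * m) + l₂ * m₂)) (d * Y + (l₁ * (s * n) + l₂ * n₂))
        coords l₁ l₂ z X Y sz = begin
          ι sd 0ℤ ⊠ (ι l₁ l₂ ⊠ g ⊞ z) ≡⟨ ⊠-distribˡ (ι sd 0ℤ) (ι l₁ l₂ ⊠ g) z ⟩
          ι sd 0ℤ ⊠ (ι l₁ l₂ ⊠ g) ⊞ ι sd 0ℤ ⊠ z ≡⟨ cong₂ _⊞_ left right ⟩
          ι P Q ⊞ ι (d * X) (d * Y) ≡⟨ ι-⊞ P Q (d * X) (d * Y) ⟩
          ι (P + d * X) (Q + d * Y) ≡⟨ cong₂ ι (e₁ s l₁ l₂ m n (+ c) (d * X)) (e₂ s l₁ l₂ m n (d * Y)) ⟩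
          ι (d * X + (l₁ * (s * m) + l₂ * m₂)) (d * Y + (l₁ * (s * n) + l₂ * n₂)) ∎
          where
          open ≡-Reasoning
          P = s * (l₁ * m - + c * (l₂ * n))
          Q = s * (l₁ * n + l₂ * m + l₂ * n)
          e₁ = ring 7 λ s l₁ l₂ m n c X → s :* (l₁ :* m :- c :* (l₂ :* n)) :+ X ⊜ X :+ (l₁ :* (s :* m) :+ l₂ :* (s :* (:- (c :* n))))
          e₂ = ring 6 λ s l₁ l₂ m n Y → s :* (l₁ :* n :+ l₂ :* m :+ l₂ :* n) :+ Y ⊜ Y :+ (l₁ :* (s :* n) :+ l₂ :* (s :* (m :+ n)))
          left : ι sd 0ℤ ⊠ (ι l₁ l₂ ⊠ g) ≡ ι P Q
          left = begin
            ι sd 0ℤ ⊠ (ι l₁ l₂ ⊠ g) ≡⟨ cong (_⊠ (ι l₁ l₂ ⊠ g)) (ι-* s d) ⟩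
            (ι s 0ℤ ⊠ ι d 0ℤ) ⊠ (ι l₁ l₂ ⊠ g) ≡⟨ ⊠-assoc (ι s 0ℤ) (ι d 0ℤ) (ι l₁ l₂ ⊠ g) ⟩
            ι s 0ℤ ⊠ (ι d 0ℤ ⊠ (ι l₁ l₂ ⊠ g)) ≡⟨ cong (ι s 0ℤ ⊠_) (trans (⊠-swap (ι d 0ℤ) (ι l₁ l₂) g) (cong (ι l₁ l₂ ⊠_) dg)) ⟩
            ι s 0ℤ ⊠ (ι l₁ l₂ ⊠ ι m n) ≡⟨ cong (ι s 0ℤ ⊠_) (mulK l₁ l₂ m n) ⟩
            ι s 0ℤ ⊠ ι (l₁ * m - + c * (l₂ * n)) (l₁ * n + l₂ * m + l₂ * n) ≡⟨ ι-scale s (l₁ * m - + c * (l₂ * n)) (l₁ * n + l₂ * m + l₂ * n) ⟩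
            ι P Q ∎
          right : ι sd 0ℤ ⊠ z ≡ ι (d * X) (d * Y)
          right = begin
            ι sd 0ℤ ⊠ z ≡⟨ cong (_⊠ z) (trans (cong (λ u → ι u 0ℤ) (ℤP.*-comm s d)) (ι-* d s)) ⟩
            (ι d 0ℤ ⊠ ι s 0ℤ) ⊠ z ≡⟨ ⊠-assoc (ι d 0ℤ) (ι s 0ℤ) z ⟩
            ι d 0ℤ ⊠ (ι s 0ℤ ⊠ z) ≡⟨ cong (ι d 0ℤ ⊠_) sz ⟩
            ι d 0ℤ ⊠ ι X Y ≡⟨ ι-scale d X Y ⟩
            ι (d * X) (d * Y) ∎

        twice : HasBasis {d * A} {d * B} {d * G} {s * m} {s * n} → Hermite (g ∷ gs)
        twice (A₁ , B₁ , G₁ , eq₁) = done (adjoin A₁ B₁ G₁ m₂ n₂)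
          where
          done : HasBasis {A₁} {B₁} {G₁} {m₂} {n₂} → Hermite (g ∷ gs)
          done (A₂ , B₂ , G₂ , eq₂) = hermite sd A₂ B₂ G₂ sd≢0 (to′ ∘ uncombine) from′
            where
            to′ : ∀ {z} → Combination g gs z → ∃[ X ] ∃[ Y ] ι sd 0ℤ ⊠ z ≡ ι X Y × InLattice A₂ B₂ G₂ X Y
            to′ (combination l₁ l₂ rest sp refl) = place (to sp)
              where
              place : ∃[ X ] ∃[ Y ] ι s 0ℤ ⊠ rest ≡ ι X Y × InLattice A B G X Y →
                ∃[ X ] ∃[ Y ] ι sd 0ℤ ⊠ (ι l₁ l₂ ⊠ g ⊞ rest) ≡ ι X Y × InLattice A₂ B₂ G₂ X Y
              place (X , Y , e , lattice x y X≡ Y≡) = X₂ , Y₂ , coords l₁ l₂ rest X Y e ,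
                proj₁ (eq₂ X₂ Y₂) (step (proj₁ (eq₁ X₁ Y₁) (extended x y l₁
                  (cong (_+ l₁ * (s * m)) (trans (cong (d *_) X≡) (k₁ d x A y B)))
                  (cong (_+ l₁ * (s * n)) (trans (cong (d *_) Y≡) (k₂ d y G))))))
                where
                X₁ = d * X + l₁ * (s * m)
                Y₁ = d * Y + l₁ * (s * n)
                X₂ = d * X + (l₁ * (s * m) + l₂ * m₂)
                Y₂ = d * Y + (l₁ * (s * n) + l₂ * n₂)
                k₁ = ring 5 λ d x A y B → d :* (x :* A :+ y :* B) ⊜ x :* (d :* A) :+ y :* (d :* B)
                k₂ = ring 3 λ d y G → d :* (y :* G) ⊜ y :* (d :* G)
                step : InLattice A₁ B₁ G₁ X₁ Y₁ → Extended A₁ B₁ G₁ m₂ n₂ X₂ Y₂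
                step (lattice x₁ y₁ ex ey) = extended x₁ y₁ l₂
                  (trans (sym (ℤP.+-assoc (d * X) (l₁ * (s * m)) (l₂ * m₂))) (cong (_+ l₂ * m₂) ex))
                  (trans (sym (ℤP.+-assoc (d * Y) (l₁ * (s * n)) (l₂ * n₂))) (cong (_+ l₂ * n₂) ey))
            from′ : ∀ {z X Y} → ι sd 0ℤ ⊠ z ≡ ι X Y → InLattice A₂ B₂ G₂ X Y → Span (g ∷ gs) z
            from′ {z} {X} {Y} e lat₂ = second (proj₂ (eq₂ X Y) lat₂)
              where
              second : Extended A₁ B₁ G₁ m₂ n₂ X Y → Span (g ∷ gs) z
              second (extended x₁ y₁ l₂ X≡ Y≡) = first (proj₂ (eq₁ (x₁ * A₁ + y₁ * B₁) (y₁ * G₁)) (lattice x₁ y₁ refl refl))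
                where
                first : Extended (d * A) (d * B) (d * G) (s * m) (s * n) (x₁ * A₁ + y₁ * B₁) (y₁ * G₁) → Span (g ∷ gs) z
                first (extended x y l₁ P≡ Q≡) = scaleBack (reciprocal s s≢0)
                  where
                  X′ = x * A + y * B
                  Y′ = y * G
                  scaleBack : ∃[ r ] ι s 0ℤ ⊠ r ≡ 1K → Span (g ∷ gs) z
                  scaleBack (r , sr) = combine (ι⇒integral l₁ l₂) (from sz′ (lattice x y refl refl))
                    (ι-cancel sd sd≢0 (trans e (trans (cong₂ ι
                      (trans X≡ (trans (cong (_+ l₂ * m₂) P≡) (k₁ d x A y B (l₁ * (s * m)) (l₂ * m₂))))
                      (trans Y≡ (trans (cong (_+ l₂ * n₂) Q≡) (k₂ d y G (l₁ * (s * n)) (l₂ * n₂)))))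
                      (sym (coords l₁ l₂ z′ X′ Y′ sz′)))))
                    where
                    z′ = r ⊠ ι X′ Y′
                    sz′ : ι s 0ℤ ⊠ z′ ≡ ι X′ Y′
                    sz′ = trans (sym (⊠-assoc (ι s 0ℤ) r (ι X′ Y′))) (trans (cong (_⊠ ι X′ Y′) sr) (⊠-identityˡ (ι X′ Y′)))
                    k₁ = ring 7 λ d x A y B u v → x :* (d :* A) :+ y :* (d :* B) :+ u :+ v ⊜ d :* (x :* A :+ y :* B) :+ (u :+ v)
                    k₂ = ring 5 λ d y G u v → y :* (d :* G) :+ u :+ v ⊜ d :* (y :* G) :+ (u :+ v)

    -- By `disc` the form a x² + (2 b + 1) x y + c′ y² has discriminant (2 b + 1)² - 4 a c′ = -N =
    -- D.
    record Form : Set where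
      field
        a    : ℕ
        b c′ : ℤ
        a≢0  : a ≢ 0
        disc : b * b + b + + c ≡ + a * c′

    -- The ideal with ℤ-basis a , b + ω.
    J : Form → FractionalIdeal D
    J F = record
      { generators = ι (+ a) 0ℤ ∷ ι b 1ℤ ∷ []
      ; nonzero    = here λ e → a≢0 (ℤP.+-injective (proj₁ (ι-injective (trans e (sym 0K≡𝟘)))))
      }
      where open Form F

    module _ (F : Form) where
      open Form F

      -- The coefficients come from the ring of integers, so ω (b + ω) occurs; `disc` brings it back
      -- into the ℤ-span of the two generators.
      ∈J⇒ : ∀ {z} → z ∈ J F → ∃[ x ] ∃[ y ] z ≡ ι (x * + a + y * b) y
      ∈J⇒ {z} sp = outer (uncombine sp)
        where
        outer : Combination (ι (+ a) 0ℤ) (ι b 1ℤ ∷ []) z → ∃[ x ] ∃[ y ] z ≡ ι (x * + a + y * b) y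
        outer (combination l₁ l₂ rest sp₁ z≡) = inner (uncombine sp₁)
          where
          inner : Combination (ι b 1ℤ) [] rest → ∃[ x ] ∃[ y ] z ≡ ι (x * + a + y * b) y
          inner (combination m₁ m₂ _ [] rest≡) = x , y , (begin
              z ≡⟨ z≡ ⟩
              ι l₁ l₂ ⊠ ι (+ a) 0ℤ ⊞ rest ≡⟨ cong (ι l₁ l₂ ⊠ ι (+ a) 0ℤ ⊞_) rest≡ ⟩
              ι l₁ l₂ ⊠ ι (+ a) 0ℤ ⊞ (ι m₁ m₂ ⊠ ι b 1ℤ ⊞ 𝟘) ≡⟨ cong (ι l₁ l₂ ⊠ ι (+ a) 0ℤ ⊞_)
                (trans (cong (ι m₁ m₂ ⊠ ι b 1ℤ ⊞_) (sym 0K≡𝟘)) (⊞-identityʳ (ι m₁ m₂ ⊠ ι b 1ℤ))) ⟩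
              ι l₁ l₂ ⊠ ι (+ a) 0ℤ ⊞ ι m₁ m₂ ⊠ ι b 1ℤ ≡⟨ cong₂ _⊞_ (mulK l₁ l₂ (+ a) 0ℤ) (mulK m₁ m₂ b 1ℤ) ⟩
              ι P Q ⊞ ι P′ Q′ ≡⟨ ι-⊞ P Q P′ Q′ ⟩
              ι (P + P′) (Q + Q′) ≡⟨ cong₂ ι X≡ (k₂ l₁ l₂ m₁ m₂ (+ a) b) ⟩
              ι (x * + a + y * b) y ∎)
            where
            open ≡-Reasoning
            x y P Q P′ Q′ : ℤ
            x = l₁ - l₂ * b - m₂ * c′
            y = l₂ * + a + (m₁ + m₂ * b + m₂)
            P = l₁ * + a - + c * (l₂ * 0ℤ)
            Q = l₁ * 0ℤ + l₂ * + a + l₂ * 0ℤ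
            P′ = m₁ * b - + c * (m₂ * 1ℤ)
            Q′ = m₁ * 1ℤ + m₂ * b + m₂ * 1ℤ
            k₂ = ring 6 λ l₁ l₂ m₁ m₂ a b → (l₁ :* # 0 :+ l₂ :* a :+ l₂ :* # 0) :+ (m₁ :* # 1 :+ m₂ :* b :+ m₂ :* # 1) ⊜ l₂ :* a :+ (m₁ :+ m₂ :* b :+ m₂)
            X≡ : P + P′ ≡ x * + a + y * b
            X≡ = begin
              P + P′ ≡⟨ k₁ l₁ l₂ m₁ m₂ (+ a) b (+ c) ⟩
              (l₁ - l₂ * b) * + a - m₂ * (b * b + b + + c) + y * b ≡⟨ cong (λ u → (l₁ - l₂ * b) * + a - m₂ * u + y * b) disc ⟩
              (l₁ - l₂ * b) * + a - m₂ * (+ a * c′) + y * b ≡⟨ k₃ l₁ l₂ m₂ (+ a) b c′ (y * b) ⟩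
              x * + a + y * b ∎
              where
              k₁ = ring 7 λ l₁ l₂ m₁ m₂ a b c → (l₁ :* a :- c :* (l₂ :* # 0)) :+ (m₁ :* b :- c :* (m₂ :* # 1)) ⊜ (l₁ :- l₂ :* b) :* a :- m₂ :* (b :* b :+ b :+ c) :+ (l₂ :* a :+ (m₁ :+ m₂ :* b :+ m₂)) :* b
              k₃ = ring 7 λ l₁ l₂ m₂ a b c z → (l₁ :- l₂ :* b) :* a :- m₂ :* (a :* c) :+ z ⊜ (l₁ :- l₂ :* b :- m₂ :* c) :* a :+ z

      ⇒∈J : ∀ x y → ι (x * + a + y * b) y ∈ J F
      ⇒∈J x y = combine (ι⇒integral x 0ℤ) (combine (ι⇒integral y 0ℤ) (span-0 []) refl) (sym (begin
        ι x 0ℤ ⊠ ι (+ a) 0ℤ ⊞ (ι y 0ℤ ⊠ ι b 1ℤ ⊞ 0K) ≡⟨ cong (ι x 0ℤ ⊠ ι (+ a) 0ℤ ⊞_) (⊞-identityʳ (ι y 0ℤ ⊠ ι b 1ℤ)) ⟩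
        ι x 0ℤ ⊠ ι (+ a) 0ℤ ⊞ ι y 0ℤ ⊠ ι b 1ℤ ≡⟨ cong₂ _⊞_ (ι-scale x (+ a) 0ℤ) (ι-scale y b 1ℤ) ⟩
        ι (x * + a) (x * 0ℤ) ⊞ ι (y * b) (y * 1ℤ) ≡⟨ ι-⊞ (x * + a) (x * 0ℤ) (y * b) (y * 1ℤ) ⟩
        ι (x * + a + y * b) (x * 0ℤ + y * 1ℤ) ≡⟨ cong (ι (x * + a + y * b)) (k x y) ⟩
        ι (x * + a + y * b) y ∎))
        where
        open ≡-Reasoning
        k = ring 2 λ x y → x :* # 0 :+ y :* # 1 ⊜ y

    abstract
      J⇒ : ∀ F {z} → z ∈ J F → ∃[ x ] ∃[ y ] z ≡ ι (x * + (Form.a F) + y * Form.b F) y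
      J⇒ F = ∈J⇒ F

      ⇒J : ∀ F x y → ι (x * + (Form.a F) + y * Form.b F) y ∈ J F
      ⇒J F = ⇒∈J F

    4f≡ : ∀ b → + 4 * (b * b + b + + c) ≡ (+ 2 * b + 1ℤ) * (+ 2 * b + 1ℤ) + + N
    4f≡ b = trans (k b (+ c)) (cong (λ u → (+ 2 * b + 1ℤ) * (+ 2 * b + 1ℤ) + u) (sym +N))
      where
      k = ring 2 λ b c → # 4 :* (b :* b :+ b :+ c) ⊜ (# 2 :* b :+ # 1) :* (# 2 :* b :+ # 1) :+ (# 4 :* c :- # 1)

    f≢0 : ∀ b → b * b + b + + c ≢ 0ℤ
    f≢0 b e = N≢0 (ℤP.+-injective (ℤP.≤-antisym (≤-by s (0≤sq (+ 2 * b + 1ℤ)) (trans (k (+ N) s (trans (sym (4f≡ b)) (cong (+ 4 *_) e))) refl)) 0≤pos))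
      where
      s = (+ 2 * b + 1ℤ) * (+ 2 * b + 1ℤ)
      k : ∀ n s → s + n ≡ + 4 * 0ℤ → 0ℤ - n ≡ s
      k n s e = trans (cong (_- n) (trans (sym (ℤP.*-zeroʳ (+ 4))) (sym e))) (k′ s n)
        where
        k′ = ring 2 λ s n → s :+ n :- n ⊜ s

    record Reduced (I : FractionalIdeal D) : Set where
      constructor reduced
      field
        form  : Form
        equiv : I ~ J form

    -- A lattice stable under ω has the shape G · (ℤ a + ℤ (b + ω)).
    module _ (I : FractionalIdeal D) (H : Hermite (FractionalIdeal.generators I)) where
      open Hermite H

      private
        at-r : ∀ {r : K} X Y → ι s 0ℤ ⊠ r ≡ 1K → ι s 0ℤ ⊠ (r ⊠ ι X Y) ≡ ι X Y
        at-r {r} X Y sr = trans (sym (⊠-assoc (ι s 0ℤ) r (ι X Y))) (trans (cong (_⊠ ι X Y) sr) (⊠-identityˡ (ι X Y)))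

        stable : ∀ {X Y} → InLattice A B G X Y → InLattice A B G (- (+ c * Y)) (X + Y)
        stable {X} {Y} lat = go (reciprocal s s≢0)
          where
          go : ∃[ r ] ι s 0ℤ ⊠ r ≡ 1K → InLattice A B G (- (+ c * Y)) (X + Y)
          go (r , sr) = back (to (span-ω (from (at-r X Y sr) lat)))
            where
            back : ∃[ X′ ] ∃[ Y′ ] ι s 0ℤ ⊠ (ω ⊠ (r ⊠ ι X Y)) ≡ ι X′ Y′ × InLattice A B G X′ Y′ → InLattice A B G (- (+ c * Y)) (X + Y)
            back (X′ , Y′ , e , lat′) = subst₂ (InLattice A B G) (sym (proj₁ same)) (sym (proj₂ same)) lat′
              where
              same : - (+ c * Y) ≡ X′ × X + Y ≡ Y′
              same = ι-injective (trans (sym (mulω X Y)) (trans (cong (ω ⊠_) (sym (at-r X Y sr))) (trans (⊠-swap ω (ι s 0ℤ) (r ⊠ ι X Y)) e)))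

        bottom : InLattice A B G (- (+ c * 0ℤ)) (A + 0ℤ)
        bottom = stable (lattice 1ℤ 0ℤ (k A B) (sym (ℤP.*-zeroˡ G)))
          where
          k = ring 2 λ A B → A ⊜ # 1 :* A :+ # 0 :* B

        top : InLattice A B G (- (+ c * G)) (B + G)
        top = stable (lattice 0ℤ 1ℤ (k A B) (sym (ℤP.*-identityˡ G)))
          where
          k = ring 2 λ A B → B ⊜ # 0 :* A :+ # 1 :* B

        α y b x : ℤ
        α = InLattice.y bottom
        y = InLattice.y top
        b = y - 1ℤ
        x = InLattice.x top

        A≡ : A ≡ α * G
        A≡ = trans (sym (ℤP.+-identityʳ A)) (InLattice.Y≡ bottom)

        B≡ : B ≡ b * G
        B≡ = trans (k₁ B G) (trans (cong (_- G) (InLattice.Y≡ top)) (k₂ y G))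
          where
          k₁ = ring 2 λ B G → B ⊜ B :+ G :- G
          k₂ = ring 2 λ y G → y :* G :- G ⊜ (y :- # 1) :* G

        -- The image of G (b + ω) under ω lies in the lattice; comparing coordinates shows that α
        -- divides b² + b + c.
        norm-rel : (b * b + b + + c) * G ≡ (- x * α) * G
        norm-rel = begin
          (b * b + b + + c) * G ≡⟨ k₁ b (+ c) G ⟩
          y′ * (b * G) - - (+ c * G) ≡⟨ cong₂ (λ u v → u * (b * G) - v) (k₃ y) (trans (InLattice.X≡ top) (cong₂ (λ u v → x * u + y * v) A≡ B≡)) ⟩
          y * (b * G) - (x * (α * G) + y * (b * G)) ≡⟨ k₂ y (b * G) x α G ⟩
          (- x * α) * G ∎
          where
          open ≡-Reasoning
          y′ = b + 1ℤ
          k₁ = ring 3 λ b c G → (b :* b :+ b :+ c) :* G ⊜ (b :+ # 1) :* (b :* G) :- :- (c :* G)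
          k₂ = ring 5 λ y z x a G → y :* z :- (x :* (a :* G) :+ y :* z) ⊜ (:- x :* a) :* G
          k₃ = ring 1 λ y → y :- # 1 :+ # 1 ⊜ y

        G≢0 : G ≢ 0ℤ
        G≢0 G≡0 = gen (span-gen (FractionalIdeal.nonzero I))
          where
          gen : ¬ (∃[ z ] z ≢ 0K × Span (FractionalIdeal.generators I) z)
          gen (z , z≢0 , sp) = zero! (to sp)
            where
            zero! : ¬ (∃[ X ] ∃[ Y ] ι s 0ℤ ⊠ z ≡ ι X Y × InLattice A B G X Y)
            zero! (X , Y , e , lattice u v X≡ Y≡) = z≢0 (ι-cancel s s≢0 (trans e (trans (cong₂ ι
              (trans X≡ (trans (cong₂ (λ p q → u * p + v * q) (trans A≡ (cong (α *_) G≡0)) (trans B≡ (cong (b *_) G≡0))) (k u α v b)))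
              (trans Y≡ (trans (cong (v *_) G≡0) (ℤP.*-zeroʳ v)))) (sym (⊠-zeroʳ (ι s 0ℤ))))))
              where
              k = ring 4 λ u a v b → u :* (a :* # 0) :+ v :* (b :* # 0) ⊜ # 0

        instance
          G-nz : NonZero G
          G-nz = ℤ.≢-nonZero G≢0

        f≡ : b * b + b + + c ≡ - x * α
        f≡ = ℤP.*-cancelʳ-≡ _ _ G norm-rel

        -- The first coefficient of a form is a natural number, so the sign of α moves into c′ and
        -- into the coordinate along it.
        withSign : ∃[ e ] e * e ≡ 1ℤ × α ≡ e * + ∣ α ∣ → Reduced I
        withSign (e , ee , α≡) = reduced F (build (reciprocal s s≢0) (reciprocal G G≢0))
          where
          F : Form
          F = record
            { a    = ∣ α ∣
            ; b    = b
            ; c′   = - x * e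
            ; a≢0  = λ α≡0 → f≢0 b (trans f≡ (trans (cong (- x *_) (ℤP.∣i∣≡0⇒i≡0 α≡0)) (ℤP.*-zeroʳ (- x))))
            ; disc = trans f≡ (trans (cong (- x *_) α≡) (k (- x) e (+ ∣ α ∣)))
            }
            where
            k = ring 3 λ x e a → x :* (e :* a) ⊜ a :* (x :* e)
          build : ∃[ r ] ι s 0ℤ ⊠ r ≡ 1K → ∃[ q ] ι G 0ℤ ⊠ q ≡ 1K → I ~ J F
          build (r , sr) (q , Gq) = scaled u v unit ((λ {z} → ⊆ {z}) , λ {z} → ⊇ {z})
            where
            open ≡-Reasoning
            u v : K
            u = r ⊠ ι G 0ℤ
            v = q ⊠ ι s 0ℤ
            unit : u ⊗ v ≡ 𝟙
            unit = trans (sym (⊠≡⊗ u v)) (begin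
              (r ⊠ ι G 0ℤ) ⊠ (q ⊠ ι s 0ℤ) ≡⟨ ⊠-assoc r (ι G 0ℤ) (q ⊠ ι s 0ℤ) ⟩
              r ⊠ (ι G 0ℤ ⊠ (q ⊠ ι s 0ℤ)) ≡⟨ cong (r ⊠_) (trans (sym (⊠-assoc (ι G 0ℤ) q (ι s 0ℤ))) (trans (cong (_⊠ ι s 0ℤ) Gq) (⊠-identityˡ (ι s 0ℤ)))) ⟩
              r ⊠ ι s 0ℤ ≡⟨ trans (⊠-comm r (ι s 0ℤ)) sr ⟩
              1K ≡⟨ 1K≡𝟙 ⟩
              𝟙 ∎)
            su : ∀ X Y → ι s 0ℤ ⊠ (u ⊠ ι X Y) ≡ ι (G * X) (G * Y)
            su X Y = begin
              ι s 0ℤ ⊠ (u ⊠ ι X Y) ≡⟨ cong (ι s 0ℤ ⊠_) (⊠-assoc r (ι G 0ℤ) (ι X Y)) ⟩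
              ι s 0ℤ ⊠ (r ⊠ (ι G 0ℤ ⊠ ι X Y)) ≡⟨ cong (λ w → ι s 0ℤ ⊠ (r ⊠ w)) (ι-scale G X Y) ⟩
              ι s 0ℤ ⊠ (r ⊠ ι (G * X) (G * Y)) ≡⟨ at-r (G * X) (G * Y) sr ⟩
              ι (G * X) (G * Y) ∎
            coords : ∀ m n → m * A + n * B ≡ G * ((m * e) * + ∣ α ∣ + n * b)
            coords m n = trans (cong₂ (λ p q → m * p + n * q) (trans A≡ (cong (_* G) α≡)) B≡) (k m e (+ ∣ α ∣) G n b)
              where
              k = ring 6 λ m e a G n b → m :* (e :* a :* G) :+ n :* (b :* G) ⊜ G :* ((m :* e) :* a :+ n :* b)
            ⊆ : ∀ {z} → z ∈ I → (u · J F) z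
            ⊆ {z} sp = place (to sp)
              where
              place : ∃[ X ] ∃[ Y ] ι s 0ℤ ⊠ z ≡ ι X Y × InLattice A B G X Y → (u · J F) z
              place (X , Y , ez , lattice m n X≡ Y≡) = ι P n , ⇒J F (m * e) n ,
                  trans (ι-cancel s s≢0 (trans ez (trans (cong₂ ι (trans X≡ (coords m n)) (trans Y≡ (ℤP.*-comm n G))) (sym (su P n))))) (⊠≡⊗ u (ι P n))
                where
                P : ℤ
                P = (m * e) * + ∣ α ∣ + n * b
            ⊇ : ∀ {z} → (u · J F) z → z ∈ I
            ⊇ {z} (w , w∈J , z≡) = place (J⇒ F w∈J)
              where
              place : ∃[ m ] ∃[ n ] w ≡ ι (m * + ∣ α ∣ + n * b) n → z ∈ I
              place (m , n , w≡) = from {X = G * P} {G * n} (trans (cong (ι s 0ℤ ⊠_) (trans z≡ (trans (sym (⊠≡⊗ u w)) (cong (u ⊠_) w≡)))) (su P n))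
                  (lattice (m * e) n (sym (trans (coords (m * e) n) (cong (λ t → G * (t * + ∣ α ∣ + n * b)) me²))) (ℤP.*-comm G n))
                where
                P : ℤ
                P = m * + ∣ α ∣ + n * b
                me² : m * e * e ≡ m
                me² = trans (ℤP.*-assoc m e e) (trans (cong (m *_) ee) (ℤP.*-identityʳ m))

      reduced-by : Reduced I
      reduced-by = withSign (±∣∣ α)

    abstract
      reduce-ideal : ∀ I → Reduced I
      reduce-ideal I = reduced-by I (hermiteBasis (FractionalIdeal.generators I))

-- Equivalence of ideals and representation of integers by forms.

module Represent where

  open Normalisation using (ring; _⊜_; _:+_; _:-_; _:*_; :-_; #_)
  open import Data.Integer.Base hiding (suc; _%_; _/_; _^_)
  open ℤD
  open import Data.Integer.DivMod using (n%ℕd<d; a≡a%ℕn+[a/ℕn]*n)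
  open import Defs
  open Sums using (≤-by; 0≤*; 0≤+; 0≤sq; 0≤pos; +-cancelʳ-≡)
  open Field
  open Integers
  open Ideals

  unit⇒±1 : ∀ {i j} → i * j ≡ 1ℤ → i ≡ 1ℤ ⊎ i ≡ -1ℤ
  unit⇒±1 {i} {j} e = go i (ℕP.m*n≡1⇒m≡1 ∣ i ∣ ∣ j ∣ (trans (sym (ℤP.abs-* i j)) (cong ∣_∣ e)))
    where
    go : ∀ i → ∣ i ∣ ≡ 1 → i ≡ 1ℤ ⊎ i ≡ -1ℤ
    go (+ n)    e = inj₁ (cong +_ e)
    go -[1+ n ] e = inj₂ (cong -[1+_] (ℕP.suc-injective e))

  det⇒coprime : ∀ {x y z w} → x * w - y * z ≡ 1ℤ → Coprime ∣ x ∣ ∣ y ∣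
  det⇒coprime {x} {y} {z} {w} e {d} (d∣x , d∣y) = ℕD.∣1⇒≡1 (∣⇒∣ᵤ (subst (+ d ∣_) e
    (∣m∣n⇒∣m-n (∣m⇒∣m*n {m = x} w (∣ᵤ⇒∣ d∣x)) (∣m⇒∣m*n {m = y} z (∣ᵤ⇒∣ d∣y)))))

  coprime⇒det : ∀ {x y} → Coprime ∣ x ∣ ∣ y ∣ → ∃[ s ] ∃[ r ] x * s - y * r ≡ 1ℤ
  coprime⇒det {x} {y} c with coprime⇒bezout c | ±∣∣ x | ±∣∣ y
  ... | s , t , e | ε , εε , x≡ | δ , δδ , y≡ = ε * s , - (δ * t) , (begin
      x * (ε * s) - y * (- (δ * t)) ≡⟨ cong₂ (λ u v → u * (ε * s) - v * (- (δ * t))) x≡ y≡ ⟩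
      (ε * X) * (ε * s) - (δ * Y) * (- (δ * t)) ≡⟨ k ε X s δ Y t ⟩
      (ε * ε) * (s * X) + (δ * δ) * (t * Y) ≡⟨ cong₂ (λ u v → u * (s * X) + v * (t * Y)) εε δδ ⟩
      1ℤ * (s * X) + 1ℤ * (t * Y) ≡⟨ cong₂ _+_ (ℤP.*-identityˡ (s * X)) (ℤP.*-identityˡ (t * Y)) ⟩
      s * X + t * Y ≡⟨ e ⟩
      1ℤ ∎)
    where
    open ≡-Reasoning
    X = + ∣ x ∣
    Y = + ∣ y ∣
    k = ring 6 λ ε X s δ Y t → (ε :* X) :* (ε :* s) :- (δ :* Y) :* (:- (δ :* t)) ⊜ (ε :* ε) :* (s :* X) :+ (δ :* δ) :* (t :* Y)

  module Representations {D : ℤ} (N c : ℕ) (D≡ : D ≡ 1ℤ - + 4 * + c) (+N : + N ≡ + 4 * + c - 1ℤ)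
    (N-sqfree : ∀ d → d ℕ.* d ℕD.∣ N → d ≡ 1) (4<N : 4 ℕ.< N) where

    N≢0 : N ≢ 0
    N≢0 refl = contradiction 4<N λ ()

    open RingOfIntegers {D} N c D≡ +N N-sqfree using (Nm)
    open Classes {D} N c D≡ +N N-sqfree N≢0 public

    module _ (F : Form) where
      open Form F

      private
        mulK : ∀ x y z w → ι {D} x y ⊠ ι z w ≡ ι (x * z - + c * (y * w)) (x * w + y * z + y * w)
        mulK = ι-⊠ (+ c) D≡

        instance
          a-nz : NonZero (+ a)
          a-nz = ℤ.≢-nonZero (a≢0 ∘ ℤP.+-injective)

      -- The norm of x a + y (b + ω), divided by the norm a of the ideal.
      Q : ℤ → ℤ → ℤ
      Q x y = + a * (x * x) + (+ 2 * b + 1ℤ) * (x * y) + c′ * (y * y)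

      disc4 : + 4 * (+ a * c′) ≡ (+ 2 * b + 1ℤ) * (+ 2 * b + 1ℤ) + + N
      disc4 = trans (cong (+ 4 *_) (sym disc)) (4f≡ b)

      4aQ : ∀ x y → + 4 * + a * Q x y ≡
        (+ 2 * + a * x + (+ 2 * b + 1ℤ) * y) * (+ 2 * + a * x + (+ 2 * b + 1ℤ) * y) + + N * (y * y)
      4aQ x y = trans (k₁ (+ a) B c′ x y) (trans (cong (λ u → (+ 2 * + a * x + B * y) * (+ 2 * + a * x + B * y) + (u - B * B) * (y * y)) disc4)
        (k₂ ((+ 2 * + a * x + B * y) * (+ 2 * + a * x + B * y)) (B * B) (+ N) (y * y)))
        where
        B = + 2 * b + 1ℤ
        k₁ = ring 5 λ a B c x y → # 4 :* a :* (a :* (x :* x) :+ B :* (x :* y) :+ c :* (y :* y)) ⊜ (# 2 :* a :* x :+ B :* y) :* (# 2 :* a :* x :+ B :* y) :+ (# 4 :* (a :* c) :- B :* B) :* (y :* y)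
        k₂ = ring 4 λ s b n y → s :+ (b :+ n :- b) :* y ⊜ s :+ n :* y

      0≤Q : ∀ x y → 0ℤ ≤ Q x y
      0≤Q x y = ℤP.*-cancelˡ-≤-pos 0ℤ (Q x y) (+ 4 * + a) {{positive′}} (subst (_≤ + 4 * + a * Q x y) (sym (ℤP.*-zeroʳ (+ 4 * + a)))
        (subst (0ℤ ≤_) (sym (4aQ x y)) (0≤+ (0≤sq (+ 2 * + a * x + (+ 2 * b + 1ℤ) * y)) (0≤* {+ N} 0≤pos (0≤sq y)))))
        where
        positive′ : Positive (+ 4 * + a)
        positive′ = positive (subst (0ℤ <_) (ℤP.pos-* 4 a) (+<+ (ℕP.*-mono-< {0} {4} {0} {a} (ℕ.s≤s ℕ.z≤n) (ℕP.n≢0⇒n>0 a≢0))))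

      -- J F = (α / n) · (n , β + ω) for α = x a + y (b + ω).
      record Rel (n : ℕ) (β x y : ℤ) : Set where
        constructor rel
        field
          z w : ℤ
          z≡  : + n * z ≡ (β - b) * x - c′ * y
          w≡  : + n * w ≡ + a * x + (β + b + 1ℤ) * y

      -- In the basis of `J F`, α has the coordinates (x , y) and α (β + ω) / n the coordinates (z ,
      -- w). The value n of `Q` therefore makes the determinant of the change of basis 1.
      rel-det : ∀ {n β x y} (R : Rel n β x y) → + n * (x * Rel.w R - y * Rel.z R) ≡ Q x y
      rel-det {n} {β} {x} {y} (rel z w z≡ w≡) = trans (k (+ n) x y z w)
        (trans (cong₂ (λ u v → x * u - y * v) w≡ z≡) (k₂ (+ a) b c′ x y β))
        where
        k = ring 5 λ n x y z w → n :* (x :* w :- y :* z) ⊜ x :* (n :* w) :- y :* (n :* z)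
        k₂ = ring 6 λ a b c x y β → x :* (a :* x :+ (β :+ b :+ # 1) :* y) :- y :* ((β :- b) :* x :- c :* y) ⊜ a :* (x :* x) :+ (# 2 :* b :+ # 1) :* (x :* y) :+ c :* (y :* y)

      rel-det1 : ∀ {n β x y} → n ≢ 0 → (R : Rel n β x y) → Q x y ≡ + n → x * Rel.w R - y * Rel.z R ≡ 1ℤ
      rel-det1 {n} n≢0 R q = ℤP.*-cancelˡ-≡ (+ n) _ 1ℤ {{ℤ.≢-nonZero (n≢0 ∘ ℤP.+-injective)}}
        (trans (rel-det R) (trans q (sym (ℤP.*-identityʳ (+ n)))))

      module _ (G : Form) where
        open Form G renaming (a to n; b to β; c′ to γ; a≢0 to n≢0; disc to discG)

        private
          instance
            n-nz : NonZero (+ n)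
            n-nz = ℤ.≢-nonZero (n≢0 ∘ ℤP.+-injective)

          coordsF : ∀ {s t s′ t′} → ι {D} (s * + a + t * b) t ≡ ι (s′ * + a + t′ * b) t′ → s ≡ s′ × t ≡ t′
          coordsF {s} {t} {s′} {t′} e = ℤP.*-cancelʳ-≡ s s′ (+ a) (+-cancelʳ-≡ (t * b)
            (trans (proj₁ e′) (cong (λ u → s′ * + a + u * b) (sym (proj₂ e′))))) , proj₂ e′
            where
            e′ = ι-injective e

          linear : ∀ {u x y z w} → u ⊠ ι (+ n) 0ℤ ≡ ι (x * + a + y * b) y → u ⊠ ι β 1ℤ ≡ ι (z * + a + w * b) w →
            ∀ p q → u ⊠ ι (p * + n + q * β) q ≡
              ι {D} ((p * x + q * z) * + a + (p * y + q * w) * b) (p * y + q * w)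
          linear {u} {x} {y} {z} {w} un uβ p q = begin
            u ⊠ ι (p * + n + q * β) q ≡⟨ cong (u ⊠_) (sym split) ⟩
            u ⊠ (ι p 0ℤ ⊠ ι (+ n) 0ℤ ⊞ ι q 0ℤ ⊠ ι β 1ℤ) ≡⟨ ⊠-distribˡ u _ _ ⟩
            u ⊠ (ι p 0ℤ ⊠ ι (+ n) 0ℤ) ⊞ u ⊠ (ι q 0ℤ ⊠ ι β 1ℤ) ≡⟨ cong₂ _⊞_ (⊠-swap u (ι p 0ℤ) (ι (+ n) 0ℤ)) (⊠-swap u (ι q 0ℤ) (ι β 1ℤ)) ⟩
            ι p 0ℤ ⊠ (u ⊠ ι (+ n) 0ℤ) ⊞ ι q 0ℤ ⊠ (u ⊠ ι β 1ℤ) ≡⟨ cong₂ (λ s t → ι p 0ℤ ⊠ s ⊞ ι q 0ℤ ⊠ t) un uβ ⟩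
            ι p 0ℤ ⊠ ι (x * + a + y * b) y ⊞ ι q 0ℤ ⊠ ι (z * + a + w * b) w ≡⟨ cong₂ _⊞_ (ι-scale p _ y) (ι-scale q _ w) ⟩
            ι (p * (x * + a + y * b)) (p * y) ⊞ ι (q * (z * + a + w * b)) (q * w) ≡⟨ ι-⊞ _ _ _ _ ⟩
            ι (p * (x * + a + y * b) + q * (z * + a + w * b)) (p * y + q * w) ≡⟨ cong (λ s → ι s (p * y + q * w)) (k p x (+ a) y b q z w) ⟩
            ι ((p * x + q * z) * + a + (p * y + q * w) * b) (p * y + q * w) ∎
            where
            open ≡-Reasoning
            k = ring 8 λ p x a y b q z w → p :* (x :* a :+ y :* b) :+ q :* (z :* a :+ w :* b) ⊜ (p :* x :+ q :* z) :* a :+ (p :* y :+ q :* w) :* b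
            split : ι {D} p 0ℤ ⊠ ι (+ n) 0ℤ ⊞ ι q 0ℤ ⊠ ι β 1ℤ ≡ ι (p * + n + q * β) q
            split = trans (cong₂ _⊞_ (ι-scale p (+ n) 0ℤ) (ι-scale q β 1ℤ)) (trans (ι-⊞ _ _ _ _)
              (cong (ι (p * + n + q * β)) (k′ p q)))
              where
              k′ = ring 2 λ p q → p :* # 0 :+ q :* # 1 ⊜ q

          gen₁ : ι {D} (1ℤ * + n + 0ℤ * β) 0ℤ ≡ ι (+ n) 0ℤ
          gen₁ = cong (λ s → ι s 0ℤ) (k (+ n) β)
            where
            k = ring 2 λ n β → # 1 :* n :+ # 0 :* β ⊜ n

          gen₂ : ι {D} (0ℤ * + n + 1ℤ * β) 1ℤ ≡ ι β 1ℤ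
          gen₂ = cong (λ s → ι s 1ℤ) (k (+ n) β)
            where
            k = ring 2 λ n β → # 0 :* n :+ # 1 :* β ⊜ β

        -- If `J F` = u `J G`, the images of the generators n and β + ω have coordinates (x , y) and
        -- (z , w). Multiplying the first by β + ω and the second by n gives the same element, which
        -- is `Rel`. Surjectivity makes the determinant a unit, and Q ≥ 0 excludes -1.
        equiv⇒rel : J F ~ J G → ∃[ x ] ∃[ y ] Rel n β x y × Q x y ≡ + n
        equiv⇒rel (scaled u v unit (F⊆uG , uG⊆F)) = go (J⇒ F (member (1ℤ) 0ℤ)) (J⇒ F (member 0ℤ 1ℤ))
          where
          member : ∀ p q → u ⊠ ι (p * + n + q * β) q ∈ J F
          member p q = uG⊆F (_ , ⇒J G p q , ⊠≡⊗ u (ι (p * + n + q * β) q))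
          go : ∃[ x ] ∃[ y ] u ⊠ ι (1ℤ * + n + 0ℤ * β) 0ℤ ≡ ι (x * + a + y * b) y →
            ∃[ z ] ∃[ w ] u ⊠ ι (0ℤ * + n + 1ℤ * β) 1ℤ ≡ ι (z * + a + w * b) w →
            ∃[ x ] ∃[ y ] Rel n β x y × Q x y ≡ + n
          go (x , y , un′) (z , w , uβ′) = x , y , R , Q≡n
            where
            un : u ⊠ ι (+ n) 0ℤ ≡ ι (x * + a + y * b) y
            un = trans (cong (u ⊠_) (sym gen₁)) un′
            uβ : u ⊠ ι β 1ℤ ≡ ι (z * + a + w * b) w
            uβ = trans (cong (u ⊠_) (sym gen₂)) uβ′
            open ≡-Reasoning
            both : + n * (z * + a + w * b) ≡ β * (x * + a + y * b) - + c * (1ℤ * y) ×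
              + n * w ≡ β * y + 1ℤ * (x * + a + y * b) + 1ℤ * y
            both = ι-injective (begin
              ι (+ n * (z * + a + w * b)) (+ n * w) ≡⟨ sym (ι-scale (+ n) (z * + a + w * b) w) ⟩
              ι (+ n) 0ℤ ⊠ ι (z * + a + w * b) w ≡⟨ cong (ι (+ n) 0ℤ ⊠_) (sym uβ) ⟩
              ι (+ n) 0ℤ ⊠ (u ⊠ ι β 1ℤ) ≡⟨ trans (⊠-swap (ι (+ n) 0ℤ) u (ι β 1ℤ)) (cong (u ⊠_) (⊠-comm (ι (+ n) 0ℤ) (ι β 1ℤ))) ⟩
              u ⊠ (ι β 1ℤ ⊠ ι (+ n) 0ℤ) ≡⟨ ⊠-swap u (ι β 1ℤ) (ι (+ n) 0ℤ) ⟩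
              ι β 1ℤ ⊠ (u ⊠ ι (+ n) 0ℤ) ≡⟨ cong (ι β 1ℤ ⊠_) un ⟩
              ι β 1ℤ ⊠ ι (x * + a + y * b) y ≡⟨ mulK β 1ℤ (x * + a + y * b) y ⟩
              ι (β * (x * + a + y * b) - + c * (1ℤ * y)) (β * y + 1ℤ * (x * + a + y * b) + 1ℤ * y) ∎)
            w≡ : + n * w ≡ + a * x + (β + b + 1ℤ) * y
            w≡ = trans (proj₂ both) (k β y x (+ a) b)
              where
              k = ring 5 λ β y x a b → β :* y :+ # 1 :* (x :* a :+ y :* b) :+ # 1 :* y ⊜ a :* x :+ (β :+ b :+ # 1) :* y
            z≡ : + n * z ≡ (β - b) * x - c′ * y
            z≡ = ℤP.*-cancelʳ-≡ _ _ (+ a) (begin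
              + n * z * + a ≡⟨ k₁ (+ n) z (+ a) w b ⟩
              + n * (z * + a + w * b) - + n * w * b ≡⟨ cong₂ (λ s t → s - t * b) (proj₁ both) w≡ ⟩
              β * (x * + a + y * b) - + c * (1ℤ * y) - (+ a * x + (β + b + 1ℤ) * y) * b ≡⟨ k₂ β x (+ a) y b (+ c) ⟩
              (β - b) * x * + a - (b * b + b + + c) * y ≡⟨ cong (λ s → (β - b) * x * + a - s * y) disc ⟩
              (β - b) * x * + a - + a * c′ * y ≡⟨ k₃ ((β - b) * x) (+ a) c′ y ⟩
              ((β - b) * x - c′ * y) * + a ∎)
              where
              k₁ = ring 5 λ n z a w b → n :* z :* a ⊜ n :* (z :* a :+ w :* b) :- n :* w :* b
              k₂ = ring 6 λ β x a y b c → β :* (x :* a :+ y :* b) :- c :* (# 1 :* y) :- (a :* x :+ (β :+ b :+ # 1) :* y) :* b ⊜ (β :- b) :* x :* a :- (b :* b :+ b :+ c) :* y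
              k₃ = ring 4 λ s a c y → s :* a :- a :* c :* y ⊜ (s :- c :* y) :* a
            R : Rel n β x y
            R = rel z w z≡ w≡
            preimage : ∀ s t → ∃[ p ] ∃[ q ] s ≡ p * x + q * z × t ≡ p * y + q * w
            preimage s t = at (F⊆uG (⇒J F s t))
              where
              at : (u · J G) (ι (s * + a + t * b) t) → ∃[ p ] ∃[ q ] s ≡ p * x + q * z × t ≡ p * y + q * w
              at (v′ , v∈G , e) = at′ (J⇒ G v∈G)
                where
                at′ : ∃[ p ] ∃[ q ] v′ ≡ ι (p * + n + q * β) q → ∃[ p ] ∃[ q ] s ≡ p * x + q * z × t ≡ p * y + q * w
                at′ (p , q , v≡) = p , q , coordsF (trans e (trans (sym (⊠≡⊗ u v′)) (trans (cong (u ⊠_) v≡) (linear un uβ p q))))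
            det±1 : ∃[ d ] (x * w - y * z) * d ≡ 1ℤ
            det±1 = inv (preimage 1ℤ 0ℤ) (preimage 0ℤ 1ℤ)
              where
              inv : ∃[ p ] ∃[ q ] 1ℤ ≡ p * x + q * z × 0ℤ ≡ p * y + q * w →
                ∃[ p ] ∃[ q ] 0ℤ ≡ p * x + q * z × 1ℤ ≡ p * y + q * w → ∃[ d ] (x * w - y * z) * d ≡ 1ℤ
              inv (p , q , e₁ , e₂) (p′ , q′ , e₃ , e₄) = p * q′ - q * p′ , (begin
                (x * w - y * z) * (p * q′ - q * p′) ≡⟨ k x y z w p q p′ q′ ⟩
                (p * x + q * z) * (p′ * y + q′ * w) - (p * y + q * w) * (p′ * x + q′ * z)
                ≡⟨ cong₂ _-_ (cong₂ _*_ (sym e₁) (sym e₄)) (cong₂ _*_ (sym e₂) (sym e₃)) ⟩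
                1ℤ ∎)
                where
                k = ring 8 λ x y z w p q p′ q′ → (x :* w :- y :* z) :* (p :* q′ :- q :* p′) ⊜ (p :* x :+ q :* z) :* (p′ :* y :+ q′ :* w) :- (p :* y :+ q :* w) :* (p′ :* x :+ q′ :* z)
            Q≡n : Q x y ≡ + n
            Q≡n = Sum.[ (λ e → trans (sym (rel-det R)) (trans (cong (+ n *_) e) (ℤP.*-identityʳ (+ n)))) , absurd ]′ (unit⇒±1 (proj₂ det±1))
              where
              absurd : x * w - y * z ≡ -1ℤ → Q x y ≡ + n
              absurd e = contradiction (ℤP.+-injective (ℤP.≤-antisym
                  (≤-by (Q x y) (0≤Q x y) (trans (ℤP.+-identityˡ (- + n)) (sym (trans (sym (rel-det R)) (trans (cong (+ n *_) e) (k (+ n))))))) 0≤pos)) n≢0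
                where
                k = ring 1 λ n → n :* (:- # 1) ⊜ :- n

        -- The scalar is u = α / n. Its inverse is the conjugate of α divided by a, because α has
        -- norm n a.
        rel⇒equiv : ∀ {x y} → Rel n β x y → Q x y ≡ + n → J F ~ J G
        rel⇒equiv {x} {y} R@(rel z w z≡ w≡) q = build (reciprocal (+ n) (n≢0 ∘ ℤP.+-injective)) (reciprocal (+ a) (a≢0 ∘ ℤP.+-injective))
          where
          open ≡-Reasoning
          X : ℤ
          X = x * + a + y * b
          α ᾱ : ℚ√ D
          α = ι X y
          ᾱ = ι (X + y) (- y)
          norm : α ⊠ ᾱ ≡ ι (+ n * + a) 0ℤ
          norm = trans (mulK X y (X + y) (- y)) (cong₂ ι (trans (k₁ x y (+ a) b (+ c)) (trans (cong (λ u → + a * (+ a * (x * x) + (+ 2 * b + 1ℤ) * (x * y)) + u * (y * y)) disc)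
              (trans (k₃ (+ a) (+ a * (x * x) + (+ 2 * b + 1ℤ) * (x * y)) c′ (y * y)) (cong (_* + a) q)))) (k₂ X y))
            where
            k₁ = ring 5 λ x y a b c → (x :* a :+ y :* b) :* (x :* a :+ y :* b :+ y) :- c :* (y :* (:- y)) ⊜ a :* (a :* (x :* x) :+ (# 2 :* b :+ # 1) :* (x :* y)) :+ (b :* b :+ b :+ c) :* (y :* y)
            k₂ = ring 2 λ X y → X :* (:- y) :+ y :* (X :+ y) :+ y :* (:- y) ⊜ # 0
            k₃ = ring 4 λ a s c t → a :* s :+ a :* c :* t ⊜ (s :+ c :* t) :* a
          nβ : ι β 1ℤ ⊠ α ≡ ι (+ n) 0ℤ ⊠ ι (z * + a + w * b) w
          nβ = trans (mulK β 1ℤ X y) (trans (cong₂ ι (sym first) (sym second)) (sym (ι-scale (+ n) (z * + a + w * b) w)))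
            where
            second : + n * w ≡ β * y + 1ℤ * X + 1ℤ * y
            second = trans w≡ (k (+ a) x β b y)
              where
              k = ring 5 λ a x β b y → a :* x :+ (β :+ b :+ # 1) :* y ⊜ β :* y :+ # 1 :* (x :* a :+ y :* b) :+ # 1 :* y
            first : + n * (z * + a + w * b) ≡ β * X - + c * (1ℤ * y)
            first = begin
              + n * (z * + a + w * b) ≡⟨ k₁ (+ n) z (+ a) w b ⟩
              (+ n * z) * + a + (+ n * w) * b ≡⟨ cong₂ (λ s t → s * + a + t * b) z≡ w≡ ⟩
              ((β - b) * x - c′ * y) * + a + (+ a * x + (β + b + 1ℤ) * y) * b ≡⟨ k₂ β b x c′ y (+ a) ⟩
              β * X + (b * b + b) * y - + a * c′ * y ≡⟨ cong (λ u → β * X + (b * b + b) * y - u * y) (sym disc) ⟩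
              β * X + (b * b + b) * y - (b * b + b + + c) * y ≡⟨ k₃ (β * X) (b * b + b) (+ c) y ⟩
              β * X - + c * (1ℤ * y) ∎
              where
              k₁ = ring 5 λ n z a w b → n :* (z :* a :+ w :* b) ⊜ (n :* z) :* a :+ (n :* w) :* b
              k₂ = ring 6 λ β b x c y a → ((β :- b) :* x :- c :* y) :* a :+ (a :* x :+ (β :+ b :+ # 1) :* y) :* b ⊜ β :* (x :* a :+ y :* b) :+ (b :* b :+ b) :* y :- a :* c :* y
              k₃ = ring 4 λ s t c y → s :+ t :* y :- (t :+ c) :* y ⊜ s :- c :* (# 1 :* y)
          build : ∃[ r ] ι (+ n) 0ℤ ⊠ r ≡ 1K → ∃[ s ] ι (+ a) 0ℤ ⊠ s ≡ 1K → J F ~ J G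
          build (r , nr) (s , as) = scaled u v unit ((λ {t} → ⊆ {t}) , λ {t} → ⊇ {t})
            where
            u v : ℚ√ D
            u = r ⊠ α
            v = s ⊠ ᾱ
            rn : ∀ t → r ⊠ (ι (+ n) 0ℤ ⊠ t) ≡ t
            rn t = trans (sym (⊠-assoc r (ι (+ n) 0ℤ) t)) (trans (cong (_⊠ t) (trans (⊠-comm r (ι (+ n) 0ℤ)) nr)) (⊠-identityˡ t))
            unit : u ⊗ v ≡ 𝟙
            unit = trans (sym (⊠≡⊗ u v)) (begin
              (r ⊠ α) ⊠ (s ⊠ ᾱ) ≡⟨ ⊠-assoc r α (s ⊠ ᾱ) ⟩
              r ⊠ (α ⊠ (s ⊠ ᾱ)) ≡⟨ cong (r ⊠_) (trans (⊠-swap α s ᾱ) (cong (s ⊠_) (trans norm (ι-* (+ n) (+ a))))) ⟩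
              r ⊠ (s ⊠ (ι (+ n) 0ℤ ⊠ ι (+ a) 0ℤ)) ≡⟨ cong (r ⊠_) (⊠-swap s (ι (+ n) 0ℤ) (ι (+ a) 0ℤ)) ⟩
              r ⊠ (ι (+ n) 0ℤ ⊠ (s ⊠ ι (+ a) 0ℤ)) ≡⟨ rn (s ⊠ ι (+ a) 0ℤ) ⟩
              s ⊠ ι (+ a) 0ℤ ≡⟨ trans (⊠-comm s (ι (+ a) 0ℤ)) as ⟩
              1K ≡⟨ 1K≡𝟙 ⟩
              𝟙 ∎)
            un : u ⊠ ι (+ n) 0ℤ ≡ α
            un = trans (⊠-assoc r α (ι (+ n) 0ℤ)) (trans (cong (r ⊠_) (⊠-comm α (ι (+ n) 0ℤ))) (rn α))
            uβ : u ⊠ ι β 1ℤ ≡ ι (z * + a + w * b) w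
            uβ = trans (⊠-assoc r α (ι β 1ℤ)) (trans (cong (r ⊠_) (trans (⊠-comm α (ι β 1ℤ)) nβ)) (rn _))
            det1 : x * w - y * z ≡ 1ℤ
            det1 = rel-det1 n≢0 R q
            ⊆ : ∀ {t} → t ∈ J F → (u · J G) t
            ⊆ {t} t∈F = at (J⇒ F t∈F)
              where
              at : ∃[ i ] ∃[ j ] t ≡ ι (i * + a + j * b) j → (u · J G) t
              at (i , j , t≡) = ι (p * + n + q′ * β) q′ , ⇒J G p q′ , trans t≡ (trans (sym (trans (linear un uβ p q′)
                  (cong₂ (λ i j → ι (i * + a + j * b) j) e₁ e₂))) (⊠≡⊗ u _))
                where
                p q′ : ℤ
                p = i * w - j * z
                q′ = j * x - i * y
                e₁ : p * x + q′ * z ≡ i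
                e₁ = trans (k i j x y z w) (trans (cong (i *_) det1) (ℤP.*-identityʳ i))
                  where
                  k = ring 6 λ i j x y z w → (i :* w :- j :* z) :* x :+ (j :* x :- i :* y) :* z ⊜ i :* (x :* w :- y :* z)
                e₂ : p * y + q′ * w ≡ j
                e₂ = trans (k i j x y z w) (trans (cong (j *_) det1) (ℤP.*-identityʳ j))
                  where
                  k = ring 6 λ i j x y z w → (i :* w :- j :* z) :* y :+ (j :* x :- i :* y) :* w ⊜ j :* (x :* w :- y :* z)
            ⊇ : ∀ {t} → (u · J G) t → t ∈ J F
            ⊇ {t} (t′ , t′∈G , t≡) = at (J⇒ G t′∈G)
              where
              at : ∃[ p ] ∃[ q ] t′ ≡ ι (p * + n + q * β) q → t ∈ J F
              at (p , q′ , t′≡) = subst (_∈ J F) (sym (trans t≡ (trans (sym (⊠≡⊗ u t′)) (trans (cong (u ⊠_) t′≡) (linear un uβ p q′)))))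
                (⇒J F (p * x + q′ * z) (p * y + q′ * w))

      -- Norms of (β + ω) α = n (z a + w (b + ω)), divided by a, give (β² + β + c) n = n² Q(z , w).
      rel⇒∣ : ∀ {n β x y} → n ≢ 0 → Rel n β x y → Q x y ≡ + n → + n ∣ β * β + β + + c
      rel⇒∣ {n} {β} {x} {y} n≢0 (rel z w z≡ w≡) q = divides (Q z w) (ℤP.*-cancelʳ-≡ _ _ (+ n) {{ℤ.≢-nonZero (n≢0 ∘ ℤP.+-injective)}} (begin
        (β * β + β + + c) * + n ≡⟨ cong₂ (λ u v → (β * β + β + u) * v) c≡ (sym q) ⟩
        (β * β + β + (+ a * c′ - b * b - b)) * Q x y ≡⟨ k₁ β (+ a) b c′ x y ⟩
        + a * (Z * Z) + (+ 2 * b + 1ℤ) * (Z * W) + c′ * (W * W) ≡⟨ cong₂ (λ Z W → + a * (Z * Z) + (+ 2 * b + 1ℤ) * (Z * W) + c′ * (W * W)) (sym z≡) (sym w≡) ⟩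
        Q (+ n * z) (+ n * w) ≡⟨ k₂ (+ n) z w (+ a) b c′ ⟩
        Q z w * + n * + n ∎))
        where
        open ≡-Reasoning
        Z = (β - b) * x - c′ * y
        W = + a * x + (β + b + 1ℤ) * y
        c≡ : + c ≡ + a * c′ - b * b - b
        c≡ = trans (k b (+ c)) (cong (λ u → u - b * b - b) disc)
          where
          k = ring 2 λ b c → c ⊜ b :* b :+ b :+ c :- b :* b :- b
        k₁ = ring 6 λ β a b c x y → (β :* β :+ β :+ (a :* c :- b :* b :- b)) :* (a :* (x :* x) :+ (# 2 :* b :+ # 1) :* (x :* y) :+ c :* (y :* y)) ⊜ a :* (((β :- b) :* x :- c :* y) :* ((β :- b) :* x :- c :* y)) :+ (# 2 :* b :+ # 1) :* (((β :- b) :* x :- c :* y) :* (a :* x :+ (β :+ b :+ # 1) :* y)) :+ c :* ((a :* x :+ (β :+ b :+ # 1) :* y) :* (a :* x :+ (β :+ b :+ # 1) :* y))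
        k₂ = ring 6 λ n z w a b c → a :* ((n :* z) :* (n :* z)) :+ (# 2 :* b :+ # 1) :* ((n :* z) :* (n :* w)) :+ c :* ((n :* w) :* (n :* w)) ⊜ (a :* (z :* z) :+ (# 2 :* b :+ # 1) :* (z :* w) :+ c :* (w :* w)) :* n :* n

      rel-shift : ∀ {n β β′ x y} → + n ∣ β′ - β → Rel n β x y → Rel n β′ x y
      rel-shift {n} {β} {β′} {x} {y} (divides k e) (rel z w z≡ w≡) = rel (z + k * x) (w + k * y)
          (trans (l₁ (+ n) z k x) (trans (cong₂ (λ u v → u + v * x) z≡ (sym e)) (l₂ β β′ b x (c′ * y))))
          (trans (l₁ (+ n) w k y) (trans (cong₂ (λ u v → u + v * y) w≡ (sym e)) (l₃ β β′ b y (+ a * x))))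
        where
        l₁ = ring 4 λ n z k x → n :* (z :+ k :* x) ⊜ n :* z :+ (k :* n) :* x
        l₂ = ring 5 λ β β′ b x s → (β :- b) :* x :- s :+ (β′ :- β) :* x ⊜ (β′ :- b) :* x :- s
        l₃ = ring 5 λ β β′ b y s → s :+ (β :+ b :+ # 1) :* y :+ (β′ :- β) :* y ⊜ s :+ (β′ :+ b :+ # 1) :* y

      -- A primitive vector is completed by (r , s) to a basis of determinant 1; 2 β₀ + 1 is the
      -- middle coefficient of the form in that basis.
      rel-exists : ∀ {n x y} .{{_ : ℕ.NonZero n}} → Coprime ∣ x ∣ ∣ y ∣ → Q x y ≡ + n → ∃[ β ] β ℕ.< n × Rel n (+ β) x y
      rel-exists {n} {x} {y} cop q = reduceβ (coprime⇒det {x} {y} cop)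
        where
        open ≡-Reasoning
        reduceβ : ∃[ s ] ∃[ r ] x * s - y * r ≡ 1ℤ → ∃[ β ] β ℕ.< n × Rel n (+ β) x y
        reduceβ (s , r , e) = β₀ %ℕ n , n%ℕd<d β₀ n , rel-shift (divides (- (β₀ /ℕ n))
            (trans (cong (λ u → + (β₀ %ℕ n) - u) (a≡a%ℕn+[a/ℕn]*n β₀ n)) (l (+ (β₀ %ℕ n)) (β₀ /ℕ n) (+ n)))) base
          where
          P R β₀ : ℤ
          P = b * x + c′ * y
          R = - (+ a * x + (b + 1ℤ) * y)
          β₀ = s * P - r * R
          l = ring 3 λ u v n → u :- (u :+ v :* n) ⊜ :- v :* n
          base : Rel n β₀ x y
          base = rel r s
              (begin
                + n * r ≡⟨ cong (_* r) (sym q) ⟩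
                Q x y * r ≡⟨ k₁ (+ a) b c′ x y s r ⟩
                (β₀ - b) * x - c′ * y - P * (x * s - y * r - 1ℤ) ≡⟨ cong (λ u → (β₀ - b) * x - c′ * y - P * (u - 1ℤ)) e ⟩
                (β₀ - b) * x - c′ * y - P * 0ℤ ≡⟨ k₀ ((β₀ - b) * x - c′ * y) P ⟩
                (β₀ - b) * x - c′ * y ∎)
              (begin
                + n * s ≡⟨ cong (_* s) (sym q) ⟩
                Q x y * s ≡⟨ k₂ (+ a) b c′ x y s r ⟩
                + a * x + (β₀ + b + 1ℤ) * y - R * (x * s - y * r - 1ℤ) ≡⟨ cong (λ u → + a * x + (β₀ + b + 1ℤ) * y - R * (u - 1ℤ)) e ⟩
                + a * x + (β₀ + b + 1ℤ) * y - R * 0ℤ ≡⟨ k₀ (+ a * x + (β₀ + b + 1ℤ) * y) R ⟩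
                + a * x + (β₀ + b + 1ℤ) * y ∎)
            where
            k₀ = ring 2 λ u v → u :- v :* # 0 ⊜ u
            k₁ = ring 7 λ a b c x y s r → (a :* (x :* x) :+ (# 2 :* b :+ # 1) :* (x :* y) :+ c :* (y :* y)) :* r ⊜ (s :* (b :* x :+ c :* y) :- r :* (:- (a :* x :+ (b :+ # 1) :* y)) :- b) :* x :- c :* y :- (b :* x :+ c :* y) :* (x :* s :- y :* r :- # 1)
            k₂ = ring 7 λ a b c x y s r → (a :* (x :* x) :+ (# 2 :* b :+ # 1) :* (x :* y) :+ c :* (y :* y)) :* s ⊜ a :* x :+ (s :* (b :* x :+ c :* y) :- r :* (:- (a :* x :+ (b :+ # 1) :* y)) :+ b :+ # 1) :* y :- (:- (a :* x :+ (b :+ # 1) :* y)) :* (x :* s :- y :* r :- # 1)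

      -- Subtracting the two relations shows that n divides (β - β′) x and (β - β′) y, where x and y
      -- are coprime.
      rel-residue-unique : ∀ {n β β′ x y} → Coprime ∣ x ∣ ∣ y ∣ → Rel n β x y → Rel n β′ x y → + n ∣ β - β′
      rel-residue-unique {n} {β} {β′} {x} {y} cop (rel z w z≡ w≡) (rel z′ w′ z≡′ w≡′) = go (coprime⇒det {x} {y} cop)
        where
        open ≡-Reasoning
        go : ∃[ s ] ∃[ r ] x * s - y * r ≡ 1ℤ → + n ∣ β - β′
        go (s , r , e) = divides ((z - z′) * s - (w - w′) * r) (begin
          β - β′ ≡⟨ sym (ℤP.*-identityʳ (β - β′)) ⟩
          (β - β′) * 1ℤ ≡⟨ cong ((β - β′) *_) (sym e) ⟩
          (β - β′) * (x * s - y * r) ≡⟨ k₁ β β′ b x y s r (c′ * y) (+ a * x) ⟩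
          (((β - b) * x - c′ * y) - ((β′ - b) * x - c′ * y)) * s -
            ((+ a * x + (β + b + 1ℤ) * y) - (+ a * x + (β′ + b + 1ℤ) * y)) * r
            ≡⟨ cong₂ (λ u v → u * s - v * r) (cong₂ _-_ (sym z≡) (sym z≡′)) (cong₂ _-_ (sym w≡) (sym w≡′)) ⟩
          (+ n * z - + n * z′) * s - (+ n * w - + n * w′) * r ≡⟨ k₂ (+ n) z z′ s w w′ r ⟩
          ((z - z′) * s - (w - w′) * r) * + n ∎)
          where
          k₁ = ring 9 λ β β′ b x y s r u v → (β :- β′) :* (x :* s :- y :* r) ⊜ (((β :- b) :* x :- u) :- ((β′ :- b) :* x :- u)) :* s :- ((v :+ (β :+ b :+ # 1) :* y) :- (v :+ (β′ :+ b :+ # 1) :* y)) :* r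
          k₂ = ring 7 λ n z z′ s w w′ r → (n :* z :- n :* z′) :* s :- (n :* w :- n :* w′) :* r ⊜ ((z :- z′) :* s :- (w :- w′) :* r) :* n

      -- The quotient of two generators is a unit of norm 1, and t ² + N u ² = 4
      -- has only the trivial solutions.
      rel-unique : ∀ {n β x y x₀ y₀} → n ≢ 0 → Rel n β x y → Rel n β x₀ y₀ → Q x y ≡ + n → Q x₀ y₀ ≡ + n →
        (x₀ ≡ x × y₀ ≡ y) ⊎ (x₀ ≡ - x × y₀ ≡ - y)
      rel-unique {n} {β} {x} {y} {x₀} {y₀} n≢0 R@(rel z w z≡ w≡) (rel z₀ w₀ z₀≡ w₀≡) q q₀ =
          Sum.map (λ κ≡ → mult 1ℤ κ≡ (ℤP.*-identityˡ x) (ℤP.*-identityˡ y)) (λ κ≡ → mult -1ℤ κ≡ (ℤP.-1*i≡-i x) (ℤP.-1*i≡-i y)) (unit⇒±1 κ²≡1)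
        where
        open ≡-Reasoning
        instance
          n-nz : NonZero (+ n)
          n-nz = ℤ.≢-nonZero (n≢0 ∘ ℤP.+-injective)
          nn-nz : NonZero (+ n * + n)
          nn-nz = ℤP.i*j≢0 (+ n) (+ n)
        B u t : ℤ
        B = + 2 * b + 1ℤ
        -- The second generator times the conjugate of the first is a (t - u √D) / 2.
        u = y * x₀ - x * y₀
        t = + 2 * + a * (x * x₀) + B * (x * y₀ + y * x₀) + + 2 * c′ * (y * y₀)
        n∣au : + n ∣ + a * u
        n∣au = divides (w₀ * y - w * y₀) (sym (begin
          (w₀ * y - w * y₀) * + n ≡⟨ k₁ w₀ y w y₀ (+ n) ⟩
          (+ n * w₀) * y - (+ n * w) * y₀ ≡⟨ cong₂ (λ p q → p * y - q * y₀) w₀≡ w≡ ⟩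
          (+ a * x₀ + (β + b + 1ℤ) * y₀) * y - (+ a * x + (β + b + 1ℤ) * y) * y₀ ≡⟨ k₂ (+ a) x₀ (β + b + 1ℤ) y₀ y x ⟩
          + a * u ∎))
          where
          k₁ = ring 5 λ w₀ y w y₀ n → (w₀ :* y :- w :* y₀) :* n ⊜ (n :* w₀) :* y :- (n :* w) :* y₀
          k₂ = ring 6 λ a x₀ s y₀ y x → (a :* x₀ :+ s :* y₀) :* y :- (a :* x :+ s :* y) :* y₀ ⊜ a :* (y :* x₀ :- x :* y₀)
        n∣cu : + n ∣ c′ * u
        n∣cu = divides (z₀ * x - z * x₀) (sym (begin
          (z₀ * x - z * x₀) * + n ≡⟨ k₁ z₀ x z x₀ (+ n) ⟩
          (+ n * z₀) * x - (+ n * z) * x₀ ≡⟨ cong₂ (λ p q → p * x - q * x₀) z₀≡ z≡ ⟩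
          ((β - b) * x₀ - c′ * y₀) * x - ((β - b) * x - c′ * y) * x₀ ≡⟨ k₂ (β - b) x₀ c′ y₀ x y ⟩
          c′ * u ∎))
          where
          k₁ = ring 5 λ z₀ x z x₀ n → (z₀ :* x :- z :* x₀) :* n ⊜ (n :* z₀) :* x :- (n :* z) :* x₀
          k₂ = ring 6 λ s x₀ c y₀ x y → (s :* x₀ :- c :* y₀) :* x :- (s :* x :- c :* y) :* x₀ ⊜ c :* (y :* x₀ :- x :* y₀)
        n∣Bu : + n ∣ B * u
        n∣Bu = divides (w * x₀ - w₀ * x + (z * y₀ - z₀ * y)) (sym (begin
          (w * x₀ - w₀ * x + (z * y₀ - z₀ * y)) * + n ≡⟨ k₁ w x₀ w₀ x z y₀ z₀ y (+ n) ⟩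
          (+ n * w) * x₀ - (+ n * w₀) * x + ((+ n * z) * y₀ - (+ n * z₀) * y)
            ≡⟨ cong₂ _+_ (cong₂ (λ p q → p * x₀ - q * x) w≡ w₀≡) (cong₂ (λ p q → p * y₀ - q * y) z≡ z₀≡) ⟩
          (+ a * x + (β + b + 1ℤ) * y) * x₀ - (+ a * x₀ + (β + b + 1ℤ) * y₀) * x +
            (((β - b) * x - c′ * y) * y₀ - ((β - b) * x₀ - c′ * y₀) * y) ≡⟨ k₂ (+ a) β b c′ x y x₀ y₀ ⟩
          B * u ∎))
          where
          k₁ = ring 9 λ w x₀ w₀ x z y₀ z₀ y n → (w :* x₀ :- w₀ :* x :+ (z :* y₀ :- z₀ :* y)) :* n ⊜ (n :* w) :* x₀ :- (n :* w₀) :* x :+ ((n :* z) :* y₀ :- (n :* z₀) :* y)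
          k₂ = ring 8 λ a β b c x y x₀ y₀ → (a :* x :+ (β :+ b :+ # 1) :* y) :* x₀ :- (a :* x₀ :+ (β :+ b :+ # 1) :* y₀) :* x :+ (((β :- b) :* x :- c :* y) :* y₀ :- ((β :- b) :* x₀ :- c :* y₀) :* y) ⊜ (# 2 :* b :+ # 1) :* (y :* x₀ :- x :* y₀)
        n²∣ : ∀ {i j} → + n ∣ i → + n ∣ j → + n * + n ∣ i * j
        n²∣ (divides p refl) (divides r refl) = divides (p * r) (l p r (+ n))
          where
          l = ring 3 λ p r n → p :* n :* (r :* n) ⊜ p :* r :* (n :* n)
        -- N u² = 4 (a u) (c′ u) - (B u)² is divisible by n², and N is squarefree.
        n∣u : + n ∣ u
        n∣u = sqfree-∣ℤ N N-sqfree (n≢0 ∘ ℤP.+-injective) (subst (+ n * + n ∣_) (begin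
            + 4 * ((+ a * u) * (c′ * u)) - (B * u) * (B * u) ≡⟨ k₁ (+ a) u c′ B ⟩
            (+ 4 * (+ a * c′) - B * B) * (u * u) ≡⟨ cong (λ v → (v - B * B) * (u * u)) disc4 ⟩
            (B * B + + N - B * B) * (u * u) ≡⟨ k₂ (B * B) (+ N) (u * u) ⟩
            + N * (u * u) ∎)
          (∣m∣n⇒∣m-n (∣n⇒∣m*n (+ 4) (n²∣ n∣au n∣cu)) (n²∣ n∣Bu n∣Bu)))
          where
          k₁ = ring 4 λ a u c B → # 4 :* ((a :* u) :* (c :* u)) :- (B :* u) :* (B :* u) ⊜ (# 4 :* (a :* c) :- B :* B) :* (u :* u)
          k₂ = ring 3 λ b n u → (b :+ n :- b) :* u ⊜ n :* u
        pell : t * t + + N * (u * u) ≡ + 4 * (+ n * + n)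
        pell = begin
          t * t + + N * (u * u) ≡⟨ cong (λ v → t * t + v * (u * u)) N≡ ⟩
          t * t + (+ 4 * (+ a * c′) - B * B) * (u * u) ≡⟨ k (+ a) B c′ x y x₀ y₀ ⟩
          + 4 * (Q x y * Q x₀ y₀) ≡⟨ cong₂ (λ p q → + 4 * (p * q)) q q₀ ⟩
          + 4 * (+ n * + n) ∎
          where
          N≡ : + N ≡ + 4 * (+ a * c′) - B * B
          N≡ = trans (l (+ N) (B * B)) (cong (_- B * B) (sym disc4))
            where
            l = ring 2 λ n b → n ⊜ b :+ n :- b
          k = ring 7 λ a B c x y x₀ y₀ → (# 2 :* a :* (x :* x₀) :+ B :* (x :* y₀ :+ y :* x₀) :+ # 2 :* c :* (y :* y₀)) :* (# 2 :* a :* (x :* x₀) :+ B :* (x :* y₀ :+ y :* x₀) :+ # 2 :* c :* (y :* y₀)) :+ (# 4 :* (a :* c) :- B :* B) :* ((y :* x₀ :- x :* y₀) :* (y :* x₀ :- x :* y₀)) ⊜ # 4 :* ((a :* (x :* x) :+ B :* (x :* y) :+ c :* (y :* y)) :* (a :* (x₀ :* x₀) :+ B :* (x₀ :* y₀) :+ c :* (y₀ :* y₀)))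
        u≡0 : u ≡ 0ℤ
        u≡0 = go n∣u
          where
          go : + n ∣ u → u ≡ 0ℤ
          go (divides m u≡) with m ℤP.≟ 0ℤ
          ... | yes m≡0 = trans u≡ (trans (cong (_* + n) m≡0) (ℤP.*-zeroˡ (+ n)))
          ... | no m≢0 = contradiction N≤4 (ℕP.<⇒≱ 4<N)
            where
            -- t ² + N n ² m ² = 4 n ² with ∣ m ∣ ≥ 1.
            1≤m² : 0ℤ ≤ m * m - 1ℤ
            1≤m² = ℤP.i≤j⇒0≤j-i (subst (1ℤ ≤_) (trans (ℤP.pos-* ∣ m ∣ ∣ m ∣) (sq m)) (+≤+ (ℕP.*-mono-≤ 1≤∣m∣ 1≤∣m∣)))
              where
              1≤∣m∣ : 1 ℕ.≤ ∣ m ∣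
              1≤∣m∣ = ℕP.n≢0⇒n>0 (m≢0 ∘ ℤP.∣i∣≡0⇒i≡0)
              sq : ∀ m → + ∣ m ∣ * + ∣ m ∣ ≡ m * m
              sq (+ _)    = refl
              sq -[1+ _ ] = refl
            N≤4 : N ℕ.≤ 4
            N≤4 = ℤP.drop‿+≤+ (ℤP.*-cancelʳ-≤-pos (+ N) (+ 4) (+ n * + n) {{positive′}} (≤-by (t * t + + N * (m * m - 1ℤ) * (+ n * + n))
                (0≤+ (0≤sq t) (0≤* (0≤* {+ N} 0≤pos 1≤m²) (0≤sq (+ n)))) (trans (cong (_- + N * (+ n * + n)) (sym pell)) (trans (cong (λ v → t * t + + N * (v * v) - + N * (+ n * + n)) u≡) (k (t * t) (+ N) m (+ n))))))
              where
              positive′ : Positive (+ n * + n)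
              positive′ = positive (subst (0ℤ <_) (ℤP.pos-* n n) (+<+ (ℕP.*-mono-< {0} {n} {0} {n} (ℕP.n≢0⇒n>0 n≢0) (ℕP.n≢0⇒n>0 n≢0))))
              k = ring 4 λ t N m n → t :+ N :* ((m :* n) :* (m :* n)) :- N :* (n :* n) ⊜ t :+ N :* (m :* m :- # 1) :* (n :* n)
        κ : ℤ
        κ = x₀ * w - z * y₀
        det1 : x * w - y * z ≡ 1ℤ
        det1 = rel-det1 n≢0 R q
        x₀≡ : x₀ ≡ κ * x
        x₀≡ = begin
          x₀ ≡⟨ sym (ℤP.*-identityʳ x₀) ⟩
          x₀ * 1ℤ ≡⟨ cong (x₀ *_) (sym det1) ⟩
          x₀ * (x * w - y * z) ≡⟨ k x₀ x w y z y₀ ⟩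
          κ * x - z * u ≡⟨ cong (λ v → κ * x - z * v) u≡0 ⟩
          κ * x - z * 0ℤ ≡⟨ k₀ (κ * x) z ⟩
          κ * x ∎
          where
          k = ring 6 λ x₀ x w y z y₀ → x₀ :* (x :* w :- y :* z) ⊜ (x₀ :* w :- z :* y₀) :* x :- z :* (y :* x₀ :- x :* y₀)
          k₀ = ring 2 λ p z → p :- z :* # 0 ⊜ p
        y₀≡ : y₀ ≡ κ * y
        y₀≡ = begin
          y₀ ≡⟨ sym (ℤP.*-identityʳ y₀) ⟩
          y₀ * 1ℤ ≡⟨ cong (y₀ *_) (sym det1) ⟩
          y₀ * (x * w - y * z) ≡⟨ k x₀ x w y z y₀ ⟩
          κ * y - w * u ≡⟨ cong (λ v → κ * y - w * v) u≡0 ⟩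
          κ * y - w * 0ℤ ≡⟨ k₀ (κ * y) w ⟩
          κ * y ∎
          where
          k = ring 6 λ x₀ x w y z y₀ → y₀ :* (x :* w :- y :* z) ⊜ (x₀ :* w :- z :* y₀) :* y :- w :* (y :* x₀ :- x :* y₀)
          k₀ = ring 2 λ p z → p :- z :* # 0 ⊜ p
        κ²≡1 : κ * κ ≡ 1ℤ
        κ²≡1 = ℤP.*-cancelʳ-≡ (κ * κ) 1ℤ (+ n) (begin
          κ * κ * + n ≡⟨ cong (κ * κ *_) (sym q) ⟩
          κ * κ * Q x y ≡⟨ k κ x y (+ a) B c′ ⟩
          Q (κ * x) (κ * y) ≡⟨ cong₂ Q (sym x₀≡) (sym y₀≡) ⟩
          Q x₀ y₀ ≡⟨ trans q₀ (sym (ℤP.*-identityˡ (+ n))) ⟩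
          1ℤ * + n ∎)
          where
          k = ring 6 λ κ x y a B c → κ :* κ :* (a :* (x :* x) :+ B :* (x :* y) :+ c :* (y :* y)) ⊜ a :* ((κ :* x) :* (κ :* x)) :+ B :* ((κ :* x) :* (κ :* y)) :+ c :* ((κ :* y) :* (κ :* y))
        mult : ∀ {x′ y′} e → κ ≡ e → e * x ≡ x′ → e * y ≡ y′ → x₀ ≡ x′ × y₀ ≡ y′
        mult e κ≡ ex ey = trans x₀≡ (trans (cong (_* x) κ≡) ex) , trans y₀≡ (trans (cong (_* y) κ≡) ey)

      Q-definite : ∀ x y → Q x y ≡ 0ℤ → x ≡ 0ℤ × y ≡ 0ℤ
      Q-definite x y q = x≡0 , y≡0
        where
        s = + 2 * + a * x + (+ 2 * b + 1ℤ) * y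
        sq0 : ∀ {i} → i * i ≡ 0ℤ → i ≡ 0ℤ
        sq0 {i} e = Sum.[ (λ p → p) , (λ p → p) ]′ (ℤP.i*j≡0⇒i≡0∨j≡0 i e)
        sum≡0 : s * s + + N * (y * y) ≡ 0ℤ
        sum≡0 = trans (sym (4aQ x y)) (trans (cong (+ 4 * + a *_) q) (ℤP.*-zeroʳ (+ 4 * + a)))
        y≡0 : y ≡ 0ℤ
        y≡0 = Sum.[ (λ e → contradiction (ℤP.+-injective e) N≢0) , sq0 ]′ (ℤP.i*j≡0⇒i≡0∨j≡0 (+ N)
          (ℤP.≤-antisym (≤-by (s * s) (0≤sq s) (trans (cong (_- + N * (y * y)) (sym sum≡0)) (k (s * s) (+ N * (y * y))))) (0≤* {+ N} 0≤pos (0≤sq y))))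
          where
          k = ring 2 λ u v → u :+ v :- v ⊜ u
        x≡0 : x ≡ 0ℤ
        x≡0 = Sum.[ (λ e → contradiction (ℤP.+-injective e) a≢0) , sq0 ]′ (ℤP.i*j≡0⇒i≡0∨j≡0 (+ a)
          (trans (k (+ a) (+ 2 * b + 1ℤ) c′ x) (trans (cong (Q x) (sym y≡0)) q)))
          where
          k = ring 4 λ a B c x → a :* (x :* x) ⊜ a :* (x :* x) :+ B :* (x :* # 0) :+ c :* (# 0 :* # 0)

-- Power bounds with explicit constants, third differences of cubes.

module Bounds where

  open Normalisation using (ring; semiring; _⊜_; _:+_; _:-_; _:*_; :-_; #_)
  open import Data.Integer.Base hiding (suc; _%_; _/_; _^_)
  open ℤP
  open import Data.Nat.Base using (_^_)
  open Sums

  -- An O(S^e) with its constant in the type, so that constants can be added over the classes and be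
  -- seen not to depend on S.
  record Bd (S K e : ℕ) (x : ℤ) : Set where
    constructor bd
    field bound : ∣ x ∣ ℕ.≤ K ℕ.* S ^ e

  module _ {S : ℕ} where

    Bd-+ : ∀ {K L e x y} → Bd S K e x → Bd S L e y → Bd S (K ℕ.+ L) e (x + y)
    Bd-+ {K} {L} {e} {x} {y} (bd p) (bd q) = bd (ℕP.≤-trans (∣i+j∣≤∣i∣+∣j∣ x y)
      (ℕP.≤-trans (ℕP.+-mono-≤ p q) (ℕP.≤-reflexive (sym (ℕP.*-distribʳ-+ (S ^ e) K L)))))

    Bd-neg : ∀ {K e x} → Bd S K e x → Bd S K e (- x)
    Bd-neg {K} {e} {x} (bd p) = bd (subst (ℕ._≤ K ℕ.* S ^ e) (sym (∣-i∣≡∣i∣ x)) p)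

    Bd-- : ∀ {K L e x y} → Bd S K e x → Bd S L e y → Bd S (K ℕ.+ L) e (x - y)
    Bd-- p q = Bd-+ p (Bd-neg q)

    Bd-* : ∀ {K L d e x y} → Bd S K d x → Bd S L e y → Bd S (K ℕ.* L) (d ℕ.+ e) (x * y)
    Bd-* {K} {L} {d} {e} {x} {y} (bd p) (bd q) = bd (ℕP.≤-trans (ℕP.≤-reflexive (abs-* x y))
      (ℕP.≤-trans (ℕP.*-mono-≤ p q) (ℕP.≤-reflexive (trans (l K (S ^ d) L (S ^ e)) (cong (K ℕ.* L ℕ.*_) (sym (ℕP.^-distribˡ-+-* S d e)))))))
      where
      l = semiring 4 λ a b c d → a :* b :* (c :* d) ⊜ a :* c :* (b :* d)

    Bd-const : ∀ x → Bd S ∣ x ∣ 0 x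
    Bd-const x = bd (ℕP.≤-reflexive (sym (ℕP.*-identityʳ ∣ x ∣)))

    Bd-scale : ∀ k {L e x} → Bd S L e x → Bd S (∣ k ∣ ℕ.* L) e (k * x)
    Bd-scale k p = Bd-* (Bd-const k) p

    Bd-raise : ∀ {K d e x} → 1 ℕ.≤ S → d ℕ.≤ e → Bd S K d x → Bd S K e x
    Bd-raise {K} {d} {e} 1≤S d≤e (bd p) = bd (ℕP.≤-trans p (ℕP.*-monoʳ-≤ K (ℕP.^-monoʳ-≤ S {{ℕ.>-nonZero 1≤S}} d≤e)))

    Bd-mono : ∀ {K L e x} → K ℕ.≤ L → Bd S K e x → Bd S L e x
    Bd-mono {e = e} K≤L (bd p) = bd (ℕP.≤-trans p (ℕP.*-monoˡ-≤ (S ^ e) K≤L))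

    Bd-∑ : ∀ n {K L d e f} → n ℕ.≤ L ℕ.* S ^ d → (∀ i → i ℕ.< n → Bd S K e (f i)) → Bd S (L ℕ.* K) (d ℕ.+ e) (∑ n f)
    Bd-∑ n {K} {L} {d} {e} n≤ h = bd (ℕP.≤-trans (∣∑∣≤ n (K ℕ.* S ^ e) (λ i i< → Bd.bound (h i i<)))
      (ℕP.≤-trans (ℕP.*-monoˡ-≤ (K ℕ.* S ^ e) n≤) (ℕP.≤-reflexive (trans (l L (S ^ d) K (S ^ e)) (cong (L ℕ.* K ℕ.*_) (sym (ℕP.^-distribˡ-+-* S d e)))))))
      where
      l = semiring 4 λ a b c d → a :* b :* (c :* d) ⊜ a :* c :* (b :* d)

  cube : ℤ → ℤ
  cube x = x * x * x

  cube⁺ : ℤ → ℤ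
  cube⁺ x@(+ _)    = cube x
  cube⁺ -[1+ _ ] = 0ℤ

  cube⁺-nonneg : ∀ {x} → 0ℤ ≤ x → cube⁺ x ≡ cube x
  cube⁺-nonneg {+ _} _ = refl

  cube⁺-nonpos : ∀ {x} → x ≤ 0ℤ → cube⁺ x ≡ 0ℤ
  cube⁺-nonpos {+ zero} _ = refl
  cube⁺-nonpos {+ suc _} (+≤+ ())
  cube⁺-nonpos { -[1+ _ ]} _ = refl

  Δ³ : ℤ → ℤ → ℤ → ℤ → ℤ
  Δ³ a b c d = d - + 3 * c + + 3 * b - a

  module _ {S : ℕ} where

    Bd-cube : ∀ {K x} → Bd S K 1 x → Bd S (K ℕ.* K ℕ.* K) 3 (cube x)
    Bd-cube p = Bd-* (Bd-* p p) p

    cube⁺-near : ∀ {R p q} → p < 0ℤ → Bd S R 1 (q - p) → Bd S (R ℕ.* R ℕ.* R) 3 (cube⁺ q)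
    cube⁺-near {R} {p} { -[1+ n ]} p<0 b = bd ℕ.z≤n
    cube⁺-near {R} {p} {q@(+ n)} p<0 (bd b) = Bd-cube {K = R} {x = q} (bd (ℕP.≤-trans n≤ b))
      where
      n≤ : n ℕ.≤ ∣ q - p ∣
      n≤ = drop‿+≤+ (≤-trans {j = q - p} (≤-by (- p) (neg-mono-≤ (<⇒≤ p<0)) (l q p)) (i≤∣i∣ (q - p)))
        where
        l = ring 2 λ q p → q :- p :- q ⊜ :- p
        i≤∣i∣ : ∀ i → i ≤ + ∣ i ∣
        i≤∣i∣ (+ _)    = ≤-refl
        i≤∣i∣ -[1+ _ ] = -≤+

    Δ³-near : ∀ {R p a b c d} → p < 0ℤ → Bd S R 1 (a - p) → Bd S R 1 (b - p) → Bd S R 1 (c - p) → Bd S R 1 (d - p) →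
      Bd S (8 ℕ.* (R ℕ.* R ℕ.* R)) 3 (Δ³ (cube⁺ a) (cube⁺ b) (cube⁺ c) (cube⁺ d))
    Δ³-near {R} {p} {a} {b} {c} {d} p<0 ba bb bc bd′ = Bd-mono (ℕP.≤-reflexive (l (R ℕ.* R ℕ.* R)))
      (Bd-- (Bd-+ (Bd-- (cube⁺-near {q = d} p<0 bd′) (Bd-scale (+ 3) (cube⁺-near {q = c} p<0 bc)))
        (Bd-scale (+ 3) (cube⁺-near {q = b} p<0 bb))) (cube⁺-near {q = a} p<0 ba))
      where
      l = semiring 1 λ r → r :+ # 3 :* r :+ # 3 :* r :+ r ⊜ # 8 :* r

    module _ {A E P : ℕ} (1≤S : 1 ℕ.≤ S) {p d e : ℤ} (bp : Bd S P 2 p) (bdd : Bd S A 1 d) (be : Bd S E 0 e) where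

      private
        B = A ℕ.+ E
        p₁ = p + d
        p₂ = p + + 2 * d + e
        p₃ = p + + 3 * d + + 3 * e

        be₁ : Bd S E 1 e
        be₁ = Bd-raise 1≤S ℕ.z≤n be

        lin : ∀ i j → ∣ i ∣ ℕ.≤ 3 → ∣ j ∣ ℕ.≤ 3 → ∀ {z} → z ≡ i * d + j * e → Bd S (3 ℕ.* B) 1 z
        lin i j i≤ j≤ refl = Bd-mono (ℕP.≤-trans (ℕP.+-mono-≤ (ℕP.*-monoˡ-≤ A i≤) (ℕP.*-monoˡ-≤ E j≤)) (ℕP.≤-reflexive (sym (ℕP.*-distribˡ-+ 3 A E))))
          (Bd-+ (Bd-scale i bdd) (Bd-scale j be₁))

        R = 3 ℕ.* B

        smooth : Bd S (18 ℕ.* (P ℕ.* E ℕ.* B) ℕ.+ 54 ℕ.* (B ℕ.* B ℕ.* B)) 3 (Δ³ (cube p) (cube p₁) (cube p₂) (cube p₃))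
        smooth = subst (Bd S _ 3) (sym (k p d e)) (Bd-mono (ℕP.≤-reflexive (l P E B))
            (Bd-+ (Bd-scale (+ 18) (Bd-* (Bd-* bp be) d+e))
              (Bd-+ (Bd-- (Bd-scale (+ 27) (Bd-cube d+e)) (Bd-scale (+ 3) (Bd-cube 2d+e))) (Bd-scale (+ 3) (Bd-cube d′)))))
          where
          d′ : Bd S B 1 d
          d′ = Bd-mono (ℕP.m≤m+n A E) bdd
          d+e : Bd S B 1 (d + e)
          d+e = Bd-+ bdd be₁
          2d+e : Bd S (2 ℕ.* B) 1 (d + (d + e))
          2d+e = Bd-mono (ℕP.≤-reflexive (cong (B ℕ.+_) (sym (ℕP.+-identityʳ B)))) (Bd-+ d′ d+e)
          l = semiring 3 λ P E B → # 18 :* (P :* E :* B) :+ (# 27 :* (B :* B :* B) :+ # 3 :* (# 2 :* B :* (# 2 :* B) :* (# 2 :* B)) :+ # 3 :* (B :* B :* B)) ⊜ # 18 :* (P :* E :* B) :+ # 54 :* (B :* B :* B)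
          k = ring 3 λ p d e → (p :+ # 3 :* d :+ # 3 :* e) :* (p :+ # 3 :* d :+ # 3 :* e) :* (p :+ # 3 :* d :+ # 3 :* e) :- # 3 :* ((p :+ # 2 :* d :+ e) :* (p :+ # 2 :* d :+ e) :* (p :+ # 2 :* d :+ e)) :+ # 3 :* ((p :+ d) :* (p :+ d) :* (p :+ d)) :- p :* p :* p ⊜ # 18 :* (p :* e :* (d :+ e)) :+ (# 27 :* ((d :+ e) :* (d :+ e) :* (d :+ e)) :- # 3 :* ((d :+ (d :+ e)) :* (d :+ (d :+ e)) :* (d :+ (d :+ e))) :+ # 3 :* (d :* d :* d))

      -- The arguments are four consecutive values of a quadratic polynomial with first difference d
      -- and second difference e. If all are nonnegative, the third difference of the cubes expands
      -- into p e (d + e) and cubic terms in d and e. Otherwise one of them is negative, and the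
      -- others lie within 3 (A + E) S of it. The constants 54 and 8 · 27 of the two cases are both
      -- covered by 216.
      third-difference : Bd S (18 ℕ.* (P ℕ.* E ℕ.* B) ℕ.+ 216 ℕ.* (B ℕ.* B ℕ.* B)) 3 (Δ³ (cube⁺ p) (cube⁺ p₁) (cube⁺ p₂) (cube⁺ p₃))
      third-difference = go (0ℤ ≤? p) (0ℤ ≤? p₁) (0ℤ ≤? p₂) (0ℤ ≤? p₃)
        where
        Goal : Set
        Goal = Bd S (18 ℕ.* (P ℕ.* E ℕ.* B) ℕ.+ 216 ℕ.* (B ℕ.* B ℕ.* B)) 3 (Δ³ (cube⁺ p) (cube⁺ p₁) (cube⁺ p₂) (cube⁺ p₃))
        near : Bd S (8 ℕ.* (R ℕ.* R ℕ.* R)) 3 (Δ³ (cube⁺ p) (cube⁺ p₁) (cube⁺ p₂) (cube⁺ p₃)) → Goal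
        near = Bd-mono (ℕP.≤-trans (ℕP.≤-reflexive (l B)) (ℕP.m≤n+m _ (18 ℕ.* (P ℕ.* E ℕ.* B))))
          where
          l = semiring 1 λ B → # 8 :* (# 3 :* B :* (# 3 :* B) :* (# 3 :* B)) ⊜ # 216 :* (B :* B :* B)
        z≤ : 0 ℕ.≤ 3
        z≤ = ℕ.z≤n
        1≤3 : 1 ℕ.≤ 3
        1≤3 = ℕ.s≤s ℕ.z≤n
        2≤3 : 2 ℕ.≤ 3
        2≤3 = ℕ.s≤s (ℕ.s≤s ℕ.z≤n)
        3≤3 : 3 ℕ.≤ 3
        3≤3 = ℕP.≤-refl
        go : Dec (0ℤ ≤ p) → Dec (0ℤ ≤ p₁) → Dec (0ℤ ≤ p₂) → Dec (0ℤ ≤ p₃) → Goal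
        go (yes a) (yes b) (yes c) (yes f) = subst (Bd S _ 3)
          (sym (cong₂ _-_ (cong₂ _+_ (cong₂ (λ u v → u - + 3 * v) (cube⁺-nonneg f) (cube⁺-nonneg c)) (cong (+ 3 *_) (cube⁺-nonneg b))) (cube⁺-nonneg a)))
          (Bd-mono (ℕP.+-monoʳ-≤ (18 ℕ.* (P ℕ.* E ℕ.* B)) (ℕP.*-monoˡ-≤ (B ℕ.* B ℕ.* B) (ℕP.m≤m+n 54 162))) smooth)
        go (no a) _ _ _ = near (Δ³-near {a = p} {p₁} {p₂} {p₃} (≰⇒> a)
          (lin 0ℤ 0ℤ z≤ z≤ (l₀ p d e)) (lin (+ 1) 0ℤ 1≤3 z≤ (l₁ p d e)) (lin (+ 2) (+ 1) 2≤3 1≤3 (l₂ p d e)) (lin (+ 3) (+ 3) 3≤3 3≤3 (l₃ p d e)))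
          where
          l₀ = ring 3 λ p d e → p :- p ⊜ # 0 :* d :+ # 0 :* e
          l₁ = ring 3 λ p d e → p :+ d :- p ⊜ # 1 :* d :+ # 0 :* e
          l₂ = ring 3 λ p d e → p :+ # 2 :* d :+ e :- p ⊜ # 2 :* d :+ # 1 :* e
          l₃ = ring 3 λ p d e → p :+ # 3 :* d :+ # 3 :* e :- p ⊜ # 3 :* d :+ # 3 :* e
        go (yes _) (no b) _ _ = near (Δ³-near {a = p} {p₁} {p₂} {p₃} (≰⇒> b)
          (lin (- + 1) 0ℤ 1≤3 z≤ (l₀ p d e)) (lin 0ℤ 0ℤ z≤ z≤ (l₁ p d e)) (lin (+ 1) (+ 1) 1≤3 1≤3 (l₂ p d e)) (lin (+ 2) (+ 3) 2≤3 3≤3 (l₃ p d e)))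
          where
          l₀ = ring 3 λ p d e → p :- (p :+ d) ⊜ :- # 1 :* d :+ # 0 :* e
          l₁ = ring 3 λ p d e → p :+ d :- (p :+ d) ⊜ # 0 :* d :+ # 0 :* e
          l₂ = ring 3 λ p d e → p :+ # 2 :* d :+ e :- (p :+ d) ⊜ # 1 :* d :+ # 1 :* e
          l₃ = ring 3 λ p d e → p :+ # 3 :* d :+ # 3 :* e :- (p :+ d) ⊜ # 2 :* d :+ # 3 :* e
        go (yes _) (yes _) (no c) _ = near (Δ³-near {a = p} {p₁} {p₂} {p₃} (≰⇒> c)
          (lin (- + 2) (- + 1) 2≤3 1≤3 (l₀ p d e)) (lin (- + 1) (- + 1) 1≤3 1≤3 (l₁ p d e)) (lin 0ℤ 0ℤ z≤ z≤ (l₂ p d e)) (lin (+ 1) (+ 2) 1≤3 2≤3 (l₃ p d e)))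
          where
          l₀ = ring 3 λ p d e → p :- (p :+ # 2 :* d :+ e) ⊜ :- # 2 :* d :+ :- # 1 :* e
          l₁ = ring 3 λ p d e → p :+ d :- (p :+ # 2 :* d :+ e) ⊜ :- # 1 :* d :+ :- # 1 :* e
          l₂ = ring 3 λ p d e → p :+ # 2 :* d :+ e :- (p :+ # 2 :* d :+ e) ⊜ # 0 :* d :+ # 0 :* e
          l₃ = ring 3 λ p d e → p :+ # 3 :* d :+ # 3 :* e :- (p :+ # 2 :* d :+ e) ⊜ # 1 :* d :+ # 2 :* e
        go (yes _) (yes _) (yes _) (no f) = near (Δ³-near {a = p} {p₁} {p₂} {p₃} (≰⇒> f)
          (lin (- + 3) (- + 3) 3≤3 3≤3 (l₀ p d e)) (lin (- + 2) (- + 3) 2≤3 3≤3 (l₁ p d e)) (lin (- + 1) (- + 2) 1≤3 2≤3 (l₂ p d e)) (lin 0ℤ 0ℤ z≤ z≤ (l₃ p d e)))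
          where
          l₀ = ring 3 λ p d e → p :- (p :+ # 3 :* d :+ # 3 :* e) ⊜ :- # 3 :* d :+ :- # 3 :* e
          l₁ = ring 3 λ p d e → p :+ d :- (p :+ # 3 :* d :+ # 3 :* e) ⊜ :- # 2 :* d :+ :- # 3 :* e
          l₂ = ring 3 λ p d e → p :+ # 2 :* d :+ e :- (p :+ # 3 :* d :+ # 3 :* e) ⊜ :- # 1 :* d :+ :- # 2 :* e
          l₃ = ring 3 λ p d e → p :+ # 3 :* d :+ # 3 :* e :- (p :+ # 3 :* d :+ # 3 :* e) ⊜ # 0 :* d :+ # 0 :* e

-- Counting representations by one form for each ideal class.

module VectorCount where

  open Normalisation using (ring; _⊜_; _:+_; _:-_; _:*_; :-_; #_)
  open import Data.Fin.Base as Fin using (Fin; toℕ; fromℕ<)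
  open import Data.Fin.Properties using (toℕ<n; toℕ-fromℕ<; fromℕ<-toℕ)
  open import Data.Integer.Base hiding (suc; _%_; _/_; _^_)
  open ℤD
  open ℤP hiding (i≤j⇒0≤j-i)
  open import Function.Bundles using (Inverse)
  open import Relation.Nullary.Decidable using (map′)
  open import Defs using (IsClassNumber; _~_; ~-sym; ~-trans)
  open Sums
  open Modular using (≋⇒≡; ∣⇒≋)
  open Ideals
  open Represent

  box : ℕ → (ℤ → ℤ) → ℤ
  box M F = ∑ (suc (M ℕ.+ M)) (λ i → F (+ i - + M))

  centre : ∀ {M i} → i ℕ.< suc (M ℕ.+ M) → ∣ + i - + M ∣ ℕ.≤ M
  centre {M} {i} (ℕ.s≤s i≤) = subst (ℕ._≤ M) (cong ∣_∣ (sym (m-n≡m⊖n i M))) (go (ℕP.≤-total i M))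
    where
    go : i ℕ.≤ M ⊎ M ℕ.≤ i → ∣ i ⊖ M ∣ ℕ.≤ M
    go (inj₁ i≤M) = subst (ℕ._≤ M) (cong ∣_∣ (sym (⊖-≤ i≤M))) (subst (ℕ._≤ M) (sym (∣-i∣≡∣i∣ (+ (M ℕ.∸ i)))) (ℕP.m∸n≤m M i))
    go (inj₂ M≤i) = subst (ℕ._≤ M) (cong ∣_∣ (sym (⊖-≥ M≤i))) (ℕP.m≤n+o⇒m∸n≤o i M i≤)

  private
    index : ∀ {M x} → ∣ x ∣ ℕ.≤ M → ∃[ i ] i ℕ.< suc (M ℕ.+ M) × + i - + M ≡ x
    index {M} {+ n} n≤M = n ℕ.+ M , ℕ.s≤s (ℕP.+-monoˡ-≤ M n≤M) , l (+ n) (+ M)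
      where
      l = ring 2 λ n M → n :+ M :- M ⊜ n
    index {M} { -[1+ n ]} n<M = M ℕ.∸ suc n , ℕ.s≤s (ℕP.≤-trans (ℕP.m∸n≤m M (suc n)) (ℕP.m≤m+n M M)) ,
      trans (cong (_- + M) (sym (trans (m-n≡m⊖n M (suc n)) (⊖-≥ n<M)))) (l (+ M) (+ suc n))
      where
      l = ring 2 λ M n → M :- n :- M ⊜ :- n

  box-cong : ∀ M {F G} → (∀ x → ∣ x ∣ ℕ.≤ M → F x ≡ G x) → box M F ≡ box M G
  box-cong M h = ∑-cong< (suc (M ℕ.+ M)) (λ i i< → h (+ i - + M) (centre i<))

  box-0 : ∀ M {F} → (∀ x → ∣ x ∣ ℕ.≤ M → F x ≡ 0ℤ) → box M F ≡ 0ℤ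
  box-0 M h = ∑-vanish (suc (M ℕ.+ M)) (λ i i< → h (+ i - + M) (centre i<))

  box-+ : ∀ M F G → box M (λ x → F x + G x) ≡ box M F + box M G
  box-+ M F G = ∑-+ (suc (M ℕ.+ M)) _ _

  *-box : ∀ M k F → k * box M F ≡ box M (λ x → k * F x)
  *-box M k F = *-∑ (suc (M ℕ.+ M)) k _

  box-∑ : ∀ M n (F : ℤ → ℕ → ℤ) → box M (λ x → ∑ n (F x)) ≡ ∑ n (λ i → box M (λ x → F x i))
  box-∑ M n F = ∑-swap (suc (M ℕ.+ M)) n _

  box-box : ∀ M M′ (F : ℤ → ℤ → ℤ) → box M (λ x → box M′ (F x)) ≡ box M′ (λ y → box M (λ x → F x y))
  box-box M M′ F = ∑-swap (suc (M ℕ.+ M)) (suc (M′ ℕ.+ M′)) _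

  box-collapse : ∀ M {x₀} F → ∣ x₀ ∣ ℕ.≤ M → (∀ x → ∣ x ∣ ℕ.≤ M → x ≢ x₀ → F x ≡ 0ℤ) → box M F ≡ F x₀
  box-collapse M {x₀} F x₀≤ h with index {M} {x₀} x₀≤
  ... | i₀ , i₀< , e = trans (∑-collapse (suc (M ℕ.+ M)) (λ i → F (+ i - + M)) i₀<
      (λ i i< i≢ → h (+ i - + M) (centre i<) (λ e′ → i≢ (+-injective (+-cancelʳ-≡ (- + M) (trans e′ (sym e)))))))
    (cong F e)

  box₂ : ℕ → (ℤ → ℤ → ℤ) → ℤ
  box₂ M F = box M (λ x → box M (F x))

  box₂-cong : ∀ M {F G} → (∀ x y → F x y ≡ G x y) → box₂ M F ≡ box₂ M G
  box₂-cong M h = box-cong M (λ x _ → box-cong M (λ y _ → h x y))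

  box₂-0 : ∀ M {F} → (∀ x y → F x y ≡ 0ℤ) → box₂ M F ≡ 0ℤ
  box₂-0 M h = box-0 M (λ x _ → box-0 M (λ y _ → h x y))

  box₂-+ : ∀ M F G → box₂ M (λ x y → F x y + G x y) ≡ box₂ M F + box₂ M G
  box₂-+ M F G = trans (box-cong M (λ x _ → box-+ M (F x) (G x)))
    (box-+ M (λ x → box M (F x)) (λ x → box M (G x)))

  *-box₂ : ∀ M k F → k * box₂ M F ≡ box₂ M (λ x y → k * F x y)
  *-box₂ M k F = trans (*-box M k (λ x → box M (F x))) (box-cong M (λ x _ → *-box M k (F x)))

  box₂-∑ : ∀ M n (F : ℤ → ℤ → ℕ → ℤ) → box₂ M (λ x y → ∑ n (F x y)) ≡ ∑ n (λ i → box₂ M (λ x y → F x y i))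
  box₂-∑ M n F = trans (box-cong M (λ x _ → box-∑ M n (F x))) (box-∑ M n (λ x i → box M (λ y → F x y i)))

  box₂-box : ∀ M M′ (F : ℤ → ℤ → ℤ → ℤ) → box₂ M (λ x y → box M′ (F x y)) ≡ box M′ (λ z → box₂ M (λ x y → F x y z))
  box₂-box M M′ F = trans (box-cong M (λ x _ → box-box M M′ (F x)))
    (box-box M M′ (λ x z → box M (λ y → F x y z)))

  box₂-box₂ : ∀ M M′ (F : ℤ → ℤ → ℤ → ℤ → ℤ) →
    box₂ M (λ x y → box₂ M′ (F x y)) ≡ box₂ M′ (λ z w → box₂ M (λ x y → F x y z w))
  box₂-box₂ M M′ F = trans (box₂-box M M′ (λ x y z → box M′ (F x y z)))
    (box-cong M′ (λ z _ → box₂-box M M′ (λ x y → F x y z)))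

  box₂-collapse : ∀ M {x₀ y₀} F → ∣ x₀ ∣ ℕ.≤ M → ∣ y₀ ∣ ℕ.≤ M → (∀ x y → (x ≡ x₀ → y ≢ y₀) → F x y ≡ 0ℤ) → box₂ M F ≡ F x₀ y₀
  box₂-collapse M {x₀} {y₀} F x₀≤ y₀≤ h = trans
    (box-collapse M _ x₀≤ (λ x _ x≢ → box-0 M (λ y _ → h x y (λ e → contradiction e x≢))))
    (box-collapse M (F x₀) y₀≤ (λ y _ y≢ → h x₀ y (λ _ → y≢)))

  module FormCount {D : ℤ} (N c : ℕ) (D≡ : D ≡ 1ℤ - + 4 * + c) (+N : + N ≡ + 4 * + c - 1ℤ)
    (N-sqfree : ∀ d → d ℕ.* d ℕD.∣ N → d ≡ 1) (4<N : 4 ℕ.< N) where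

    open Representations {D} N c D≡ +N N-sqfree 4<N public

    rel? : ∀ F n β x y → Dec (Rel F n β x y)
    rel? F n β x y = map′
      (λ (divides z ez , divides w ew) → rel z w (trans (*-comm (+ n) z) (sym ez)) (trans (*-comm (+ n) w) (sym ew)))
      (λ (rel z w ez ew) → divides z (trans (sym ez) (*-comm (+ n) z)) , divides w (trans (sym ew) (*-comm (+ n) w)))
      ((+ n ∣? (β - b) * x - c′ * y) ×-dec (+ n ∣? + a * x + (β + b + 1ℤ) * y))
      where open Form F

    rel-neg : ∀ {F n β x y} → Rel F n β x y → Rel F n β (- x) (- y)
    rel-neg {F} {n} {β} {x} {y} (rel z w ez ew) = rel (- z) (- w)
      (trans (l (+ n) z) (trans (cong -_ ez) (l₁ (β - b) x c′ y)))
      (trans (l (+ n) w) (trans (cong -_ ew) (l₂ (+ a) x (β + b + 1ℤ) y)))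
      where
      open Form F
      l = ring 2 λ n z → n :* :- z ⊜ :- (n :* z)
      l₁ = ring 4 λ s x c y → :- (s :* x :- c :* y) ⊜ s :* :- x :- c :* :- y
      l₂ = ring 4 λ a x s y → :- (a :* x :+ s :* y) ⊜ a :* :- x :+ s :* :- y

    Q-neg : ∀ F x y → Q F (- x) (- y) ≡ Q F x y
    Q-neg F x y = l (+ a) (+ 2 * b + 1ℤ) c′ x y
      where
      open Form F
      l = ring 5 λ a B c x y → a :* (:- x :* :- x) :+ B :* (:- x :* :- y) :+ c :* (:- y :* :- y) ⊜ a :* (x :* x) :+ B :* (x :* y) :+ c :* (y :* y)

    Q-scale : ∀ F g x y → Q F (g * x) (g * y) ≡ g * g * Q F x y
    Q-scale F g x y = l (+ a) (+ 2 * b + 1ℤ) c′ g x y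
      where
      open Form F
      l = ring 6 λ a B c g x y → a :* ((g :* x) :* (g :* x)) :+ B :* ((g :* x) :* (g :* y)) :+ c :* ((g :* y) :* (g :* y)) ⊜ g :* g :* (a :* (x :* x) :+ B :* (x :* y) :+ c :* (y :* y))

    Q-00 : ∀ F → Q F 0ℤ 0ℤ ≡ 0ℤ
    Q-00 F = l (+ a) (+ 2 * b + 1ℤ) c′
      where
      open Form F
      l = ring 3 λ a B c → a :* (# 0 :* # 0) :+ B :* (# 0 :* # 0) :+ c :* (# 0 :* # 0) ⊜ # 0

    isForm : ∀ {n β} → n ≢ 0 → + n ∣ β * β + β + + c → Form
    isForm {n} {β} n≢0 (divides q e) = record { a = n ; b = β ; c′ = q ; a≢0 = n≢0 ; disc = trans e (*-comm q (+ n)) }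

    cop? : ∀ x y → Dec (Coprime ∣ x ∣ ∣ y ∣)
    cop? x y = coprime? ∣ x ∣ ∣ y ∣

    rootOf : ℕ → ℕ → ℤ
    rootOf n β = ⟦ + n ∣? + β * + β + + β + + c ⟧

    ρ : ℕ → ℤ
    ρ n = ∑ n (rootOf n)

    -- Counts are sums over finite boxes; `boxed` guarantees that every vector of value at most T
    -- lies in the box of its form.
    module Count (h : ℕ) (F : ℕ → Form)
      (cover : ∀ G → ∃[ k ] k ℕ.< h × J (F k) ~ J G)
      (distinct : ∀ {k l} G → k ℕ.< h → l ℕ.< h → J (F k) ~ J G → J (F l) ~ J G → k ≡ l)
      (M : ℕ → ℕ) (T : ℕ) (boxed : ∀ k x y → Q (F k) x y ≤ + T → ∣ x ∣ ℕ.≤ M k × ∣ y ∣ ℕ.≤ M k) where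

      primitives : ℕ → ℕ → ℤ
      primitives k n = box₂ (M k) (λ x y → ⟦ cop? x y ×-dec (Q (F k) x y ≟ + n) ⟧)

      private
        P : ℕ → ℕ → ℕ → ℤ → ℤ → Set
        P n k β x y = + n ∣ + β * + β + + β + + c × (Coprime ∣ x ∣ ∣ y ∣ × (Q (F k) x y ≡ + n × Rel (F k) n (+ β) x y))

        P? : ∀ n k β x y → Dec (P n k β x y)
        P? n k β x y = (+ n ∣? + β * + β + + β + + c) ×-dec (cop? x y ×-dec ((Q (F k) x y ≟ + n) ×-dec rel? (F k) n (+ β) x y))

        -- A primitive vector of value n determines exactly one β modulo n, so these vectors can be
        -- sorted by β.
        residue : ∀ {n} → n ≢ 0 → ∀ k x y →
          ⟦ cop? x y ×-dec (Q (F k) x y ≟ + n) ⟧ ≡ ∑ n (λ β → ⟦ P? n k β x y ⟧)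
        residue {n} n≢0 k x y = go (cop? x y ×-dec (Q (F k) x y ≟ + n))
          where
          go : Dec (Coprime ∣ x ∣ ∣ y ∣ × Q (F k) x y ≡ + n) →
            ⟦ cop? x y ×-dec (Q (F k) x y ≟ + n) ⟧ ≡ ∑ n (λ β → ⟦ P? n k β x y ⟧)
          go (no ¬p) = trans (⟦⟧-no (cop? x y ×-dec (Q (F k) x y ≟ + n)) ¬p)
            (sym (∑-vanish n (λ β _ → ⟦⟧-no (P? n k β x y) (λ (_ , cp , q , _) → ¬p (cp , q)))))
          go (yes (cp , q)) = trans (⟦⟧-yes (cop? x y ×-dec (Q (F k) x y ≟ + n)) (cp , q))
              (sym (at (rel-exists (F k) {{ℕ.≢-nonZero n≢0}} cp q)))
            where
            at : ∃[ β ] β ℕ.< n × Rel (F k) n (+ β) x y → ∑ n (λ β → ⟦ P? n k β x y ⟧) ≡ 1ℤ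
            at (β , β< , R) = ∑-⟦⟧-unique n (λ β → P? n k β x y) β< (rel⇒∣ (F k) n≢0 R q , cp , q , R)
              (λ β′ β′< (_ , _ , _ , R′) → ≋⇒≡ β′< β< (∣⇒≋ (rel-residue-unique (F k) cp R′ R)))

        -- A root β modulo n makes ℤ n + ℤ (β + ω) an ideal. It is equivalent to the ideal of
        -- exactly one of the forms, and the scalar is unique up to sign, so exactly two vectors
        -- belong to β.
        two : ∀ {n} → n ≢ 0 → n ℕ.≤ T → ∀ β → + n ∣ + β * + β + + β + + c →
          ∑ h (λ k → box₂ (M k) (λ x y → ⟦ P? n k β x y ⟧)) ≡ + 2
        two {n} n≢0 n≤T β d = at (cover G)
          where
          G : Form
          G = isForm n≢0 d
          at : ∃[ k ] k ℕ.< h × J (F k) ~ J G → ∑ h (λ k → box₂ (M k) (λ x y → ⟦ P? n k β x y ⟧)) ≡ + 2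
          at (k , k< , k~) = trans (∑-collapse h _ k< (λ l l< l≢k → box₂-0 (M l) (λ x y → ⟦⟧-no (P? n l β x y)
                (λ (_ , _ , q , R) → l≢k (distinct G l< k< (rel⇒equiv (F l) G R q) k~)))))
              (pair (equiv⇒rel (F k) G k~))
            where
            pair : ∃[ x ] ∃[ y ] Rel (F k) n (+ β) x y × Q (F k) x y ≡ + n → box₂ (M k) (λ x y → ⟦ P? n k β x y ⟧) ≡ + 2
            pair (x₀ , y₀ , R , q) = trans (box₂-cong (M k) split) (trans
                (box₂-+ (M k) (δ x₀ y₀) (δ (- x₀) (- y₀))) (cong₂ _+_ (sum-δ x₀ y₀ in₀) (sum-δ (- x₀) (- y₀) (in₀′))))
              where
              cp : Coprime ∣ x₀ ∣ ∣ y₀ ∣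
              cp = det⇒coprime {x₀} {y₀} {Rel.z R} {Rel.w R} (rel-det1 (F k) n≢0 R q)
              cp′ : Coprime ∣ - x₀ ∣ ∣ - y₀ ∣
              cp′ = subst₂ Coprime (sym (∣-i∣≡∣i∣ x₀)) (sym (∣-i∣≡∣i∣ y₀)) cp
              in₀ : ∣ x₀ ∣ ℕ.≤ M k × ∣ y₀ ∣ ℕ.≤ M k
              in₀ = boxed k x₀ y₀ (≤-trans (≤-reflexive q) (+≤+ n≤T))
              in₀′ : ∣ - x₀ ∣ ℕ.≤ M k × ∣ - y₀ ∣ ℕ.≤ M k
              in₀′ = subst (ℕ._≤ M k) (sym (∣-i∣≡∣i∣ x₀)) (proj₁ in₀) , subst (ℕ._≤ M k) (sym (∣-i∣≡∣i∣ y₀)) (proj₂ in₀)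
              δ : ℤ → ℤ → ℤ → ℤ → ℤ
              δ a b x y = ⟦ (x ≟ a) ×-dec (y ≟ b) ⟧
              sum-δ : ∀ a b → ∣ a ∣ ℕ.≤ M k × ∣ b ∣ ℕ.≤ M k → box₂ (M k) (δ a b) ≡ 1ℤ
              sum-δ a b (a≤ , b≤) = trans (box₂-collapse (M k) (δ a b) a≤ b≤
                (λ x y ne → ⟦⟧-no ((x ≟ a) ×-dec (y ≟ b)) (λ (e , e′) → ne e e′))) (⟦⟧-yes ((a ≟ a) ×-dec (b ≟ b)) (refl , refl))
              nonzero : ¬ (x₀ ≡ - x₀ × y₀ ≡ - y₀)
              nonzero (ex , ey) = n≢0 (+-injective (trans (sym q) (trans (cong₂ (Q (F k)) (self ex) (self ey)) (Q-00 (F k)))))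
                where
                self : ∀ {x} → x ≡ - x → x ≡ 0ℤ
                self {+ zero}  _ = refl
                self {+ suc _} ()
                self { -[1+ _ ]} ()
              split : ∀ x y → ⟦ P? n k β x y ⟧ ≡ δ x₀ y₀ x y + δ (- x₀) (- y₀) x y
              split x y = go ((x ≟ x₀) ×-dec (y ≟ y₀)) ((x ≟ - x₀) ×-dec (y ≟ - y₀))
                where
                go : Dec (x ≡ x₀ × y ≡ y₀) → Dec (x ≡ - x₀ × y ≡ - y₀) → ⟦ P? n k β x y ⟧ ≡ δ x₀ y₀ x y + δ (- x₀) (- y₀) x y
                go (yes (refl , refl)) (yes e) = contradiction e nonzero
                go (yes (refl , refl)) (no ne) = trans (⟦⟧-yes (P? n k β x y) (d , cp , q , R))
                  (sym (cong₂ _+_ (⟦⟧-yes ((x ≟ x₀) ×-dec (y ≟ y₀)) (refl , refl)) (⟦⟧-no ((x ≟ - x₀) ×-dec (y ≟ - y₀)) ne)))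
                go (no ne) (yes (refl , refl)) = trans (⟦⟧-yes (P? n k β x y) (d , cp′ , trans (Q-neg (F k) x₀ y₀) q , rel-neg R))
                  (sym (cong₂ _+_ (⟦⟧-no ((x ≟ x₀) ×-dec (y ≟ y₀)) ne) (⟦⟧-yes ((x ≟ - x₀) ×-dec (y ≟ - y₀)) (refl , refl))))
                go (no ne) (no ne′) = trans (⟦⟧-no (P? n k β x y) (λ (_ , _ , q′ , R′) → Sum.[ ne , ne′ ]′ (rel-unique (F k) n≢0 R R′ q q′)))
                  (sym (cong₂ _+_ (⟦⟧-no ((x ≟ x₀) ×-dec (y ≟ y₀)) ne) (⟦⟧-no ((x ≟ - x₀) ×-dec (y ≟ - y₀)) ne′)))

      primitive-count : ∀ n → n ≢ 0 → n ℕ.≤ T → ∑ h (λ k → primitives k n) ≡ + 2 * ρ n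
      primitive-count n n≢0 n≤T = begin
        ∑ h (λ k → primitives k n)
          ≡⟨ ∑-cong h (λ k → trans (box₂-cong (M k) (residue n≢0 k)) (box₂-∑ (M k) n (λ x y β → ⟦ P? n k β x y ⟧))) ⟩
        ∑ h (λ k → ∑ n (λ β → box₂ (M k) (λ x y → ⟦ P? n k β x y ⟧)))
          ≡⟨ ∑-swap h n (λ k β → box₂ (M k) (λ x y → ⟦ P? n k β x y ⟧)) ⟩
        ∑ n (λ β → ∑ h (λ k → box₂ (M k) (λ x y → ⟦ P? n k β x y ⟧)))
          ≡⟨ ∑-cong n (λ β → each β (+ n ∣? + β * + β + + β + + c)) ⟩
        ∑ n (λ β → + 2 * rootOf n β)
          ≡⟨ sym (*-∑ n (+ 2) (rootOf n)) ⟩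
        + 2 * ρ n ∎
        where
        open ≡-Reasoning
        each : ∀ β → Dec (+ n ∣ + β * + β + + β + + c) → ∑ h (λ k → box₂ (M k) (λ x y → ⟦ P? n k β x y ⟧)) ≡ + 2 * rootOf n β
        each β (yes d) = trans (two n≢0 n≤T β d) (sym (cong (+ 2 *_) (⟦⟧-yes (+ n ∣? + β * + β + + β + + c) d)))
        each β (no ∤) = trans (∑-vanish h (λ k _ → box₂-0 (M k) (λ x y → ⟦⟧-no (P? n k β x y) (∤ ∘ proj₁))))
          (sym (trans (cong (+ 2 *_) (⟦⟧-no (+ n ∣? + β * + β + + β + + c) ∤)) refl))

      vectors : ℕ → ℕ → ℤ
      vectors k n = box₂ (M k) (λ x y → ⟦ Q (F k) x y ≟ + n ⟧)

      private
        -- Every nonzero vector is uniquely g times a primitive one.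
        S : ℕ → ℕ → ℕ → ℤ → ℤ → ℤ → ℤ → Set
        S n k g x′ y′ x y = (x ≡ + g * x′ × y ≡ + g * y′) × (Coprime ∣ x′ ∣ ∣ y′ ∣ × Q (F k) x y ≡ + n)

        S? : ∀ n k g x′ y′ x y → Dec (S n k g x′ y′ x y)
        S? n k g x′ y′ x y = ((x ≟ + g * x′) ×-dec (y ≟ + g * y′)) ×-dec (cop? x′ y′ ×-dec (Q (F k) x y ≟ + n))

        content : ∀ x y → ¬ (x ≡ 0ℤ × y ≡ 0ℤ) → ∃[ g ] ∃[ x′ ] ∃[ y′ ] g ≢ 0 × x ≡ + g * x′ × y ≡ + g * y′ × Coprime ∣ x′ ∣ ∣ y′ ∣
        content x y ≢0 = go (bezout-ℤ x y)
          where
          go : Bezout x y → ∃[ g ] ∃[ x′ ] ∃[ y′ ] g ≢ 0 × x ≡ + g * x′ × y ≡ + g * y′ × Coprime ∣ x′ ∣ ∣ y′ ∣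
          go (bezout g a b s t x≡ y≡ u) = sign′ (±∣∣ g)
            where
            sign′ : ∃[ e ] e * e ≡ 1ℤ × g ≡ e * + ∣ g ∣ → ∃[ g ] ∃[ x′ ] ∃[ y′ ] g ≢ 0 × x ≡ + g * x′ × y ≡ + g * y′ × Coprime ∣ x′ ∣ ∣ y′ ∣
            sign′ (e , ee , g≡) = ∣ g ∣ , e * a , e * b ,
              (λ g≡0 → ≢0 (trans x≡ (trans (cong (_* a) (∣i∣≡0⇒i≡0 {g} g≡0)) (*-zeroˡ a)) , trans y≡ (trans (cong (_* b) (∣i∣≡0⇒i≡0 {g} g≡0)) (*-zeroˡ b)))) ,
              trans x≡ (trans (cong (_* a) g≡) (l e (+ ∣ g ∣) a)) , trans y≡ (trans (cong (_* b) g≡) (l e (+ ∣ g ∣) b)) ,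
              det⇒coprime {e * a} {e * b} { - (e * t)} {e * s} (trans (l₂ e a b s t) (trans (cong (_* (s * a + t * b)) ee) (trans (*-identityˡ (s * a + t * b)) u)))
              where
              l = ring 3 λ e g a → e :* g :* a ⊜ g :* (e :* a)
              l₂ = ring 5 λ e a b s t → e :* a :* (e :* s) :- e :* b :* :- (e :* t) ⊜ e :* e :* (s :* a :+ t :* b)

        content-unique : ∀ {g g′ x y x′ y′} → g ≢ 0 → Coprime ∣ x ∣ ∣ y ∣ → Coprime ∣ x′ ∣ ∣ y′ ∣ →
          + g * x ≡ + g′ * x′ → + g * y ≡ + g′ * y′ → g ≡ g′ × x ≡ x′ × y ≡ y′
        content-unique {g} {g′} {x} {y} {x′} {y′} g≢0 c₁ c₂ ex ey = g≡ , cancel ex , cancel ey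
          where
          instance
            g-nz : NonZero (+ g)
            g-nz = ≢-nonZero (g≢0 ∘ +-injective)
          div : ∀ {g g′ x y x′ y′} → Coprime ∣ x ∣ ∣ y ∣ → + g * x ≡ + g′ * x′ → + g * y ≡ + g′ * y′ → + g′ ∣ + g
          div {g} {g′} {x} {y} {x′} {y′} c ex ey = go (coprime⇒det {x} {y} c)
            where
            go : ∃[ s ] ∃[ r ] x * s - y * r ≡ 1ℤ → + g′ ∣ + g
            go (s , r , e) = divides (x′ * s - y′ * r) (begin
              + g ≡⟨ sym (*-identityʳ (+ g)) ⟩
              + g * 1ℤ ≡⟨ cong (+ g *_) (sym e) ⟩
              + g * (x * s - y * r) ≡⟨ l (+ g) x s y r ⟩
              (+ g * x) * s - (+ g * y) * r ≡⟨ cong₂ (λ u v → u * s - v * r) ex ey ⟩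
              (+ g′ * x′) * s - (+ g′ * y′) * r ≡⟨ l₂ (+ g′) x′ s y′ r ⟩
              (x′ * s - y′ * r) * + g′ ∎)
              where
              open ≡-Reasoning
              l = ring 5 λ g x s y r → g :* (x :* s :- y :* r) ⊜ (g :* x) :* s :- (g :* y) :* r
              l₂ = ring 5 λ g x s y r → (g :* x) :* s :- (g :* y) :* r ⊜ (x :* s :- y :* r) :* g
          g≡ : g ≡ g′
          g≡ = ℕD.∣-antisym (∣⇒∣ᵤ (div {g′} {g} {x′} {y′} {x} {y} c₂ (sym ex) (sym ey))) (∣⇒∣ᵤ (div {g} {g′} {x} {y} {x′} {y′} c₁ ex ey))
          cancel : ∀ {x x′} → + g * x ≡ + g′ * x′ → x ≡ x′
          cancel {x} {x′} e = *-cancelˡ-≡ (+ g) x x′ (trans e (cong (λ u → + u * x′) (sym g≡)))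

        inBox : ∀ {n} → n ℕ.≤ T → ∀ k {x y} → Q (F k) x y ≡ + n → ∣ x ∣ ℕ.≤ M k × ∣ y ∣ ℕ.≤ M k
        inBox n≤T k {x} {y} q = boxed k x y (≤-trans (≤-reflexive q) (+≤+ n≤T))

        Q≢0⇒ : ∀ {n k x y} → n ≢ 0 → Q (F k) x y ≡ + n → ¬ (x ≡ 0ℤ × y ≡ 0ℤ)
        Q≢0⇒ {k = k} n≢0 q (refl , refl) = n≢0 (+-injective (trans (sym q) (Q-00 (F k))))

        Q-g : ∀ {g n k x′ y′ x y} → S n k g x′ y′ x y → + g * + g * Q (F k) x′ y′ ≡ + n
        Q-g {g} {n} {k} {x′} {y′} ((ex , ey) , _ , q) = trans (sym (Q-scale (F k) (+ g) x′ y′)) (trans (cong₂ (Q (F k)) (sym ex) (sym ey)) q)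

      module _ (B : ℕ) {n : ℕ} (n≢0 : n ≢ 0) (n<B : n ℕ.< B) (n≤T : n ℕ.≤ T) where

        private
          small : ∀ g {a} → g ℕ.* g ℕ.* a ≡ n → g ≢ 0 × a ≢ 0 × g ℕ.≤ n × a ℕ.≤ n
          small g {a} e = g≢0 , a≢0 , subst (g ℕ.≤_) (trans (sym (ℕP.*-assoc g g a)) e) (ℕP.m≤m*n g (g ℕ.* a) {{ga-nz}}) ,
            subst (a ℕ.≤_) e (ℕP.m≤n*m a (g ℕ.* g) {{gg-nz}})
            where
            g≢0 : g ≢ 0
            g≢0 refl = n≢0 (sym e)
            a≢0 : a ≢ 0
            a≢0 refl = n≢0 (trans (sym e) (ℕP.*-zeroʳ (g ℕ.* g)))
            gg-nz : ℕ.NonZero (g ℕ.* g)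
            gg-nz = ℕP.m*n≢0 g g {{ℕ.≢-nonZero g≢0}} {{ℕ.≢-nonZero g≢0}}
            ga-nz : ℕ.NonZero (g ℕ.* a)
            ga-nz = ℕP.m*n≢0 g a {{ℕ.≢-nonZero g≢0}} {{ℕ.≢-nonZero a≢0}}

          factor : ∀ {k g x′ y′ x y} → S n k g x′ y′ x y → ∃[ a ] Q (F k) x′ y′ ≡ + a × g ℕ.* g ℕ.* a ≡ n
          factor {k} {g} {x′} {y′} {x} {y} s = go (0≤⇒≡+ (0≤Q (F k) x′ y′))
            where
            go : ∃[ a ] Q (F k) x′ y′ ≡ + a → ∃[ a ] Q (F k) x′ y′ ≡ + a × g ℕ.* g ℕ.* a ≡ n
            go (a , e) = a , e , +-injective (trans (pos-* (g ℕ.* g) a) (trans (cong₂ _*_ (pos-* g g) (sym e)) (Q-g {g} {n} {k} {x′} {y′} {x} {y} s)))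

          spread : ∀ k x y → ⟦ Q (F k) x y ≟ + n ⟧ ≡ ∑ B (λ g → box₂ (M k) (λ x′ y′ → ⟦ S? n k g x′ y′ x y ⟧))
          spread k x y = go (Q (F k) x y ≟ + n)
            where
            go : Dec (Q (F k) x y ≡ + n) → ⟦ Q (F k) x y ≟ + n ⟧ ≡ ∑ B (λ g → box₂ (M k) (λ x′ y′ → ⟦ S? n k g x′ y′ x y ⟧))
            go (no ¬q) = trans (⟦⟧-no (Q (F k) x y ≟ + n) ¬q)
              (sym (∑-vanish B (λ g _ → box₂-0 (M k) (λ x′ y′ → ⟦⟧-no (S? n k g x′ y′ x y) (¬q ∘ proj₂ ∘ proj₂)))))
            go (yes q) = trans (⟦⟧-yes (Q (F k) x y ≟ + n) q) (sym (at (content x y (Q≢0⇒ {k = k} {x} {y} n≢0 q))))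
              where
              at : ∃[ g ] ∃[ x′ ] ∃[ y′ ] g ≢ 0 × x ≡ + g * x′ × y ≡ + g * y′ × Coprime ∣ x′ ∣ ∣ y′ ∣ →
                ∑ B (λ g → box₂ (M k) (λ x′ y′ → ⟦ S? n k g x′ y′ x y ⟧)) ≡ 1ℤ
              at (g , x′ , y′ , g≢0 , ex , ey , cp) = trans
                  (∑-collapse B _ (ℕP.≤-<-trans g≤n n<B) (λ g₂ _ g₂≢ → box₂-0 (M k) (λ x₂ y₂ → ⟦⟧-no (S? n k g₂ x₂ y₂ x y) (λ s → g₂≢ (sym (proj₁ (same {g₂} {x₂} {y₂} s)))))))
                  (trans (box₂-collapse (M k) (λ x₂ y₂ → ⟦ S? n k g x₂ y₂ x y ⟧) (proj₁ in′) (proj₂ in′)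
                    (λ x₂ y₂ ne → ⟦⟧-no (S? n k g x₂ y₂ x y) (λ s → ne (sym (proj₁ (proj₂ (same {g} {x₂} {y₂} s)))) (sym (proj₂ (proj₂ (same {g} {x₂} {y₂} s)))))))
                    (⟦⟧-yes (S? n k g x′ y′ x y) s₀))
                where
                s₀ : S n k g x′ y′ x y
                s₀ = (ex , ey) , cp , q
                same : ∀ {g₂ x₂ y₂} → S n k g₂ x₂ y₂ x y → g ≡ g₂ × x′ ≡ x₂ × y′ ≡ y₂
                same ((ex₂ , ey₂) , cp₂ , _) = content-unique g≢0 cp cp₂ (trans (sym ex) ex₂) (trans (sym ey) ey₂)
                fac : ∃[ a ] Q (F k) x′ y′ ≡ + a × g ℕ.* g ℕ.* a ≡ n
                fac = factor {k} {g} {x′} {y′} {x} {y} s₀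
                g≤n : g ℕ.≤ n
                g≤n = proj₁ (proj₂ (proj₂ (small g (proj₂ (proj₂ fac)))))
                in′ : ∣ x′ ∣ ℕ.≤ M k × ∣ y′ ∣ ℕ.≤ M k
                in′ = inBox (ℕP.≤-trans (proj₂ (proj₂ (proj₂ (small g (proj₂ (proj₂ fac)))))) n≤T) k {x′} {y′} (proj₁ (proj₂ fac))

          -- In this order of summation (x , y) is forced to be g (x′ , y′), and n = g² a, where a
          -- is the value at the primitive vector.
          gather : ∀ k g x′ y′ → box₂ (M k) (λ x y → ⟦ S? n k g x′ y′ x y ⟧) ≡
            ∑ B (λ a → ⟦ g ℕ.* g ℕ.* a ℕP.≟ n ⟧ * ⟦ cop? x′ y′ ×-dec (Q (F k) x′ y′ ≟ + a) ⟧)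
          gather k g x′ y′ = go (S? n k g x′ y′ (+ g * x′) (+ g * y′))
            where
            go : Dec (S n k g x′ y′ (+ g * x′) (+ g * y′)) → box₂ (M k) (λ x y → ⟦ S? n k g x′ y′ x y ⟧) ≡
              ∑ B (λ a → ⟦ g ℕ.* g ℕ.* a ℕP.≟ n ⟧ * ⟦ cop? x′ y′ ×-dec (Q (F k) x′ y′ ≟ + a) ⟧)
            go (no ¬s) = trans (box₂-0 (M k) (λ x y → ⟦⟧-no (S? n k g x′ y′ x y) (λ { s@((refl , refl) , _) → ¬s s })))
              (sym (∑-vanish B (λ a _ → zero-term a (g ℕ.* g ℕ.* a ℕP.≟ n) (cop? x′ y′ ×-dec (Q (F k) x′ y′ ≟ + a)))))
              where
              zero-term : ∀ a (d : Dec (g ℕ.* g ℕ.* a ≡ n)) (e : Dec (Coprime ∣ x′ ∣ ∣ y′ ∣ × Q (F k) x′ y′ ≡ + a)) → ⟦ d ⟧ * ⟦ e ⟧ ≡ 0ℤ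
              zero-term a d (no ne) = trans (cong (⟦ d ⟧ *_) (⟦⟧-no (no ne) ne)) (*-zeroʳ ⟦ d ⟧)
              zero-term a (no ne) e@(yes _) = cong (_* ⟦ e ⟧) (⟦⟧-no (no ne) ne)
              zero-term a (yes ga) (yes (cp , qa)) = ⊥-elim (¬s ((refl , refl) , cp , trans (Q-scale (F k) (+ g) x′ y′)
                (trans (cong₂ _*_ (sym (pos-* g g)) qa) (trans (sym (pos-* (g ℕ.* g) a)) (cong +_ ga)))))
            go (yes s@(_ , cp , q)) = trans
                (trans (box₂-collapse (M k) (λ x y → ⟦ S? n k g x′ y′ x y ⟧) (proj₁ in₀) (proj₂ in₀)
                  (λ x y ne → ⟦⟧-no (S? n k g x′ y′ x y) (λ ((ex , ey) , _) → ne ex ey))) (⟦⟧-yes (S? n k g x′ y′ (+ g * x′) (+ g * y′)) s))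
                (sym (at (factor {k} {g} {x′} {y′} {+ g * x′} {+ g * y′} s)))
              where
              in₀ : ∣ + g * x′ ∣ ℕ.≤ M k × ∣ + g * y′ ∣ ℕ.≤ M k
              in₀ = inBox n≤T k {+ g * x′} {+ g * y′} q
              at : ∃[ a ] Q (F k) x′ y′ ≡ + a × g ℕ.* g ℕ.* a ≡ n →
                ∑ B (λ a → ⟦ g ℕ.* g ℕ.* a ℕP.≟ n ⟧ * ⟦ cop? x′ y′ ×-dec (Q (F k) x′ y′ ≟ + a) ⟧) ≡ 1ℤ
              at (a , qa , ga) = trans (∑-collapse B _ (ℕP.≤-<-trans (proj₂ (proj₂ (proj₂ (small g ga)))) n<B)
                (λ a₂ _ a₂≢ → trans (cong (⟦ g ℕ.* g ℕ.* a₂ ℕP.≟ n ⟧ *_) (⟦⟧-no (cop? x′ y′ ×-dec (Q (F k) x′ y′ ≟ + a₂))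
                  (λ (_ , qa₂) → a₂≢ (+-injective (trans (sym qa₂) qa))))) (*-zeroʳ ⟦ g ℕ.* g ℕ.* a₂ ℕP.≟ n ⟧)))
                (cong₂ _*_ (⟦⟧-yes (g ℕ.* g ℕ.* a ℕP.≟ n) ga) (⟦⟧-yes (cop? x′ y′ ×-dec (Q (F k) x′ y′ ≟ + a)) (cp , qa)))

          vectors≡ : ∀ k → vectors k n ≡ ∑ B (λ g → ∑ B (λ a → ⟦ g ℕ.* g ℕ.* a ℕP.≟ n ⟧ * primitives k a))
          vectors≡ k = begin
            box₂ (M k) (λ x y → ⟦ Q (F k) x y ≟ + n ⟧)
              ≡⟨ trans (box₂-cong (M k) (spread k)) (box₂-∑ (M k) B (λ x y g → box₂ (M k) (λ x′ y′ → ⟦ S? n k g x′ y′ x y ⟧))) ⟩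
            ∑ B (λ g → box₂ (M k) (λ x y → box₂ (M k) (λ x′ y′ → ⟦ S? n k g x′ y′ x y ⟧)))
              ≡⟨ ∑-cong B (λ g → trans (box₂-box₂ (M k) (M k) (λ x y x′ y′ → ⟦ S? n k g x′ y′ x y ⟧)) (box₂-cong (M k) (gather k g))) ⟩
            ∑ B (λ g → box₂ (M k) (λ x′ y′ → ∑ B (λ a → ⟦ g ℕ.* g ℕ.* a ℕP.≟ n ⟧ * ⟦ cop? x′ y′ ×-dec (Q (F k) x′ y′ ≟ + a) ⟧)))
              ≡⟨ ∑-cong B (λ g → trans (box₂-∑ (M k) B (λ x′ y′ a → ⟦ g ℕ.* g ℕ.* a ℕP.≟ n ⟧ * ⟦ cop? x′ y′ ×-dec (Q (F k) x′ y′ ≟ + a) ⟧))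
                   (∑-cong B (λ a → sym (*-box₂ (M k) ⟦ g ℕ.* g ℕ.* a ℕP.≟ n ⟧ (λ x′ y′ → ⟦ cop? x′ y′ ×-dec (Q (F k) x′ y′ ≟ + a) ⟧))))) ⟩
            ∑ B (λ g → ∑ B (λ a → ⟦ g ℕ.* g ℕ.* a ℕP.≟ n ⟧ * primitives k a)) ∎
            where open ≡-Reasoning

        vector-count : ∑ h (λ k → vectors k n) ≡ + 2 * ∑ B (λ g → ∑ B (λ a → ⟦ g ℕ.* g ℕ.* a ℕP.≟ n ⟧ * ρ a))
        vector-count = begin
          ∑ h (λ k → vectors k n)
            ≡⟨ ∑-cong h vectors≡ ⟩
          ∑ h (λ k → ∑ B (λ g → ∑ B (λ a → ⟦ g ℕ.* g ℕ.* a ℕP.≟ n ⟧ * primitives k a)))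
            ≡⟨ trans (∑-swap h B (λ k g → ∑ B (λ a → ⟦ g ℕ.* g ℕ.* a ℕP.≟ n ⟧ * primitives k a)))
                 (∑-cong B (λ g → ∑-swap h B (λ k a → ⟦ g ℕ.* g ℕ.* a ℕP.≟ n ⟧ * primitives k a))) ⟩
          ∑ B (λ g → ∑ B (λ a → ∑ h (λ k → ⟦ g ℕ.* g ℕ.* a ℕP.≟ n ⟧ * primitives k a)))
            ≡⟨ ∑-cong B (λ g → ∑-cong B (λ a → each g a)) ⟩
          ∑ B (λ g → ∑ B (λ a → + 2 * (⟦ g ℕ.* g ℕ.* a ℕP.≟ n ⟧ * ρ a)))
            ≡⟨ trans (∑-cong B (λ g → sym (*-∑ B (+ 2) (λ a → ⟦ g ℕ.* g ℕ.* a ℕP.≟ n ⟧ * ρ a)))) (sym (*-∑ B (+ 2) (λ g → ∑ B (λ a → ⟦ g ℕ.* g ℕ.* a ℕP.≟ n ⟧ * ρ a)))) ⟩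
          + 2 * ∑ B (λ g → ∑ B (λ a → ⟦ g ℕ.* g ℕ.* a ℕP.≟ n ⟧ * ρ a)) ∎
          where
          open ≡-Reasoning
          each : ∀ g a → ∑ h (λ k → ⟦ g ℕ.* g ℕ.* a ℕP.≟ n ⟧ * primitives k a) ≡ + 2 * (⟦ g ℕ.* g ℕ.* a ℕP.≟ n ⟧ * ρ a)
          each g a = trans (sym (*-∑ h ⟦ g ℕ.* g ℕ.* a ℕP.≟ n ⟧ (λ k → primitives k a)))
            (trans (⟦⟧*-cong (g ℕ.* g ℕ.* a ℕP.≟ n) (λ e → primitive-count a (proj₁ (proj₂ (small g e))) (ℕP.≤-trans (proj₂ (proj₂ (proj₂ (small g e)))) n≤T)))
              (l ⟦ g ℕ.* g ℕ.* a ℕP.≟ n ⟧ (ρ a)))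
            where
            l = ring 2 λ x y → x :* (# 2 :* y) ⊜ # 2 :* (x :* y)

      zero-count : ∑ h (λ k → vectors k 0) ≡ + h
      zero-count = trans (∑-cong h one) (trans (∑-const h 1ℤ) (*-identityʳ (+ h)))
        where
        one : ∀ k → vectors k 0 ≡ 1ℤ
        one k = trans (box₂-collapse (M k) (λ x y → ⟦ Q (F k) x y ≟ 0ℤ ⟧) ℕ.z≤n ℕ.z≤n
            (λ x y ne → ⟦⟧-no (Q (F k) x y ≟ 0ℤ) (λ q → ne (proj₁ (Q≡0 x y q)) (proj₂ (Q≡0 x y q)))))
          (⟦⟧-yes (Q (F k) 0ℤ 0ℤ ≟ 0ℤ) (Q-00 (F k)))
          where
          Q≡0 : ∀ x y → Q (F k) x y ≡ 0ℤ → x ≡ 0ℤ × y ≡ 0ℤ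
          Q≡0 x y q = Q-definite (F k) x y q

    module Representatives {h : ℕ} (inv : IsClassNumber D h) where
      open Inverse inv using (to; from; to-cong; from-cong; inverseˡ; inverseʳ)

      formOf : Fin h → Form
      formOf k = Reduced.form (reduce-ideal (from k))

      formOf~ : ∀ k → from k ~ J (formOf k)
      formOf~ k = Reduced.equiv (reduce-ideal (from k))

      principal : Form
      principal = record { a = 1 ; b = 0ℤ ; c′ = + c ; a≢0 = λ () ; disc = l (+ c) }
        where
        l = ring 1 λ c → # 0 :* # 0 :+ # 0 :+ c ⊜ # 1 :* c

      -- Sums run over natural numbers, so the family of representatives is continued beyond h, with
      -- the principal form as default.
      F : ℕ → Form
      F k with k ℕP.<? h
      ... | yes k<h = formOf (fromℕ< k<h)
      ... | no _    = principal

      F≡ : ∀ {k} (k<h : k ℕ.< h) → F k ≡ formOf (fromℕ< k<h)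
      F≡ {k} k<h with k ℕP.<? h
      ... | yes p = cong (λ p → formOf (fromℕ< p)) (ℕP.<-irrelevant p k<h)
      ... | no ¬p = contradiction k<h ¬p

      class : ∀ {k} (k<h : k ℕ.< h) → to (J (F k)) ≡ fromℕ< k<h
      class {k} k<h = trans (cong (to ∘ J) (F≡ k<h)) (trans (to-cong (~-sym (formOf~ (fromℕ< k<h)))) (inverseˡ (~-refl′ (from (fromℕ< k<h)))))
        where
        ~-refl′ : ∀ I → I ~ I
        ~-refl′ I = ~-trans (Reduced.equiv (reduce-ideal I)) (~-sym (Reduced.equiv (reduce-ideal I)))

      cover : ∀ G → ∃[ k ] k ℕ.< h × J (F k) ~ J G
      cover G = toℕ k , toℕ<n k , ~-trans (subst (λ f → J f ~ from k) (sym Fk) (~-sym (formOf~ k))) (inverseʳ refl)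
        where
        k : Fin h
        k = to (J G)
        Fk : F (toℕ k) ≡ formOf k
        Fk = trans (F≡ (toℕ<n k)) (cong formOf (fromℕ<-toℕ k (toℕ<n k)))

      distinct : ∀ {k l} G → k ℕ.< h → l ℕ.< h → J (F k) ~ J G → J (F l) ~ J G → k ≡ l
      distinct {k} {l} G k< l< e e′ = trans (sym (toℕ-fromℕ< k<)) (trans (cong toℕ (trans (sym (class k<))
        (trans (to-cong (~-trans e (~-sym e′))) (class l<)))) (toℕ-fromℕ< l<))

-- Sums over lattice points at two scales.

module Lattice where

  open Normalisation using (ring; semiring; _⊜_; _:+_; _:-_; _:*_; :-_; #_)
  open import Data.Integer.Base hiding (suc; _%_; _/_; _^_)
  open ℤP
  open import Data.Nat.Base using (_^_)
  open Sums
  open Bounds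
  open VectorCount

  ∑-shift : ∀ n (a : ℕ → ℤ) → a 0 ≡ 0ℤ → a n ≡ 0ℤ → ∑ n (λ j → a (suc j)) ≡ ∑ n a
  ∑-shift n a a0 an = begin
    ∑ n (λ j → a (suc j)) ≡⟨ sym (+-identityˡ (∑ n (λ j → a (suc j)))) ⟩
    0ℤ + ∑ n (λ j → a (suc j)) ≡⟨ cong (_+ ∑ n (λ j → a (suc j))) (sym a0) ⟩
    a 0 + ∑ n (λ j → a (suc j)) ≡⟨ sym (∑-cons n a) ⟩
    ∑ n a + a n ≡⟨ cong (_+_ (∑ n a)) an ⟩
    ∑ n a + 0ℤ ≡⟨ +-identityʳ (∑ n a) ⟩
    ∑ n a ∎
    where open ≡-Reasoning

  -- The sum over even integers, doubled, against the sum over all integers: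
  -- an alternating sum, hence a quarter of a sum of third differences.
  module EvenSum {S M : ℕ} (1≤M : 1 ℕ.≤ M) (G : ℤ → ℤ) (vanish : ∀ x → M ℕ.≤ ∣ x ∣ → G x ≡ 0ℤ) where

    private
      n : ℕ
      n = suc (M ℕ.+ M)

      -- The offset `M + M` is even, so the parity of the index is that of the integer.
      H : ℕ → ℤ
      H i = G (+ i - + (M ℕ.+ M))

      E O : ℤ
      E = ∑ n (λ j → H (j ℕ.* 2))
      O = ∑ n (λ j → H (suc (j ℕ.* 2)))

      below : ∀ i → i ℕ.≤ M → H i ≡ 0ℤ
      below i i≤M = vanish _ (subst (M ℕ.≤_) (sym (trans (cong ∣_∣ (trans (m-n≡m⊖n i (M ℕ.+ M)) (⊖-≤ (ℕP.≤-trans i≤M (ℕP.m≤m+n M M))))) (∣-i∣≡∣i∣ (+ (M ℕ.+ M ℕ.∸ i)))))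
        (ℕP.≤-trans (ℕP.≤-reflexive (sym (ℕP.m+n∸n≡m M M))) (ℕP.∸-monoʳ-≤ (M ℕ.+ M) i≤M)))

      above : ∀ i → M ℕ.+ M ℕ.+ M ℕ.≤ i → H i ≡ 0ℤ
      above i le = vanish _ (subst (M ℕ.≤_) (sym (cong ∣_∣ (trans (m-n≡m⊖n i (M ℕ.+ M)) (⊖-≥ (ℕP.≤-trans (ℕP.m≤m+n (M ℕ.+ M) M) le)))))
        (ℕP.≤-trans (ℕP.≤-reflexive (sym (ℕP.m+n∸m≡n (M ℕ.+ M) M))) (ℕP.∸-monoˡ-≤ (M ℕ.+ M) le)))

      even≡ : box M (λ x → G (+ 2 * x)) ≡ E
      even≡ = ∑-cong n (λ j → cong G (trans (l (+ j) (+ M)) (cong (_- + (M ℕ.+ M)) (sym (pos-* j 2)))))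
        where
        l = ring 2 λ j m → # 2 :* (j :- m) ⊜ j :* # 2 :- (m :+ m)

      all≡ : box M G ≡ E + O
      all≡ = sym (begin
        E + O ≡⟨ sym (∑-+ n (λ j → H (j ℕ.* 2)) (λ j → H (suc (j ℕ.* 2)))) ⟩
        ∑ n (λ j → H (j ℕ.* 2) + H (suc (j ℕ.* 2))) ≡⟨ ∑-cong n (λ j → cong₂ _+_ (trans (cong H (sym (ℕP.+-identityʳ (j ℕ.* 2)))) (sym (+-identityˡ _))) (cong H (ℕP.+-comm 1 (j ℕ.* 2)))) ⟩
        ∑ n (λ j → ∑ 2 (λ i → H (j ℕ.* 2 ℕ.+ i))) ≡⟨ sym (∑-blocks 2 n H) ⟩
        ∑ (n ℕ.* 2) H ≡⟨ cong (λ k → ∑ k H) (l M) ⟩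
        ∑ (M ℕ.+ (n ℕ.+ suc M)) H ≡⟨ ∑-split M (n ℕ.+ suc M) H ⟩
        ∑ M H + ∑ (n ℕ.+ suc M) (λ i → H (M ℕ.+ i)) ≡⟨ cong₂ _+_ (∑-vanish M (λ i i< → below i (ℕP.<⇒≤ i<))) (∑-split n (suc M) (λ i → H (M ℕ.+ i))) ⟩
        0ℤ + (∑ n (λ i → H (M ℕ.+ i)) + ∑ (suc M) (λ i → H (M ℕ.+ (n ℕ.+ i))))
          ≡⟨ cong (_+_ 0ℤ) (cong₂ _+_ (∑-cong n (λ i → cong G (l₂ (+ M) (+ i)))) (∑-vanish (suc M) (λ i _ → above (M ℕ.+ (n ℕ.+ i)) (big i)))) ⟩
        0ℤ + (box M G + 0ℤ) ≡⟨ l₃ (box M G) ⟩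
        box M G ∎)
        where
        open ≡-Reasoning
        l = semiring 1 λ M → (# 1 :+ (M :+ M)) :* # 2 ⊜ M :+ (# 1 :+ (M :+ M) :+ (# 1 :+ M))
        l₂ = ring 2 λ M i → M :+ i :- (M :+ M) ⊜ i :- M
        l₃ = ring 1 λ a → # 0 :+ (a :+ # 0) ⊜ a
        big : ∀ i → M ℕ.+ M ℕ.+ M ℕ.≤ M ℕ.+ (n ℕ.+ i)
        big i = ℕP.≤-trans (ℕP.≤-reflexive (ℕP.+-assoc M M M)) (ℕP.+-monoʳ-≤ M (ℕP.≤-trans (ℕP.n≤1+n (M ℕ.+ M)) (ℕP.m≤m+n n i)))

      D : ℕ → ℤ
      D j = Δ³ (H (j ℕ.* 2)) (H (suc (j ℕ.* 2))) (H (suc (suc (j ℕ.* 2)))) (H (suc (suc (suc (j ℕ.* 2)))))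

      -- Shifting by two changes neither E nor O, because `G` vanishes towards both ends. The
      -- weights 1, -3, 3, -1 thus give O - 3 E + 3 O - E.
      ∑D : ∑ n D ≡ - (+ 4 * (E - O))
      ∑D = begin
        ∑ n D
          ≡⟨ trans (∑-- n (λ j → h₃ j - + 3 * h₂ j + + 3 * h₁ j) h₀) (cong (_- ∑ n h₀) (trans (∑-+ n (λ j → h₃ j - + 3 * h₂ j) (λ j → + 3 * h₁ j))
               (cong₂ _+_ (trans (∑-- n h₃ (λ j → + 3 * h₂ j)) (cong (_-_ (∑ n h₃)) (sym (*-∑ n (+ 3) h₂)))) (sym (*-∑ n (+ 3) h₁))))) ⟩
        ∑ n h₃ - + 3 * ∑ n h₂ + + 3 * ∑ n h₁ - ∑ n h₀
          ≡⟨ cong₂ (λ u v → u - + 3 * v + + 3 * O - E) (∑-shift n h₁ (below 1 1≤M) (above _ big₁)) (∑-shift n h₀ (below 0 ℕ.z≤n) (above _ big₀)) ⟩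
        O - + 3 * E + + 3 * O - E ≡⟨ l E O ⟩
        - (+ 4 * (E - O)) ∎
        where
        open ≡-Reasoning
        h₀ h₁ h₂ h₃ : ℕ → ℤ
        h₀ j = H (j ℕ.* 2)
        h₁ j = H (suc (j ℕ.* 2))
        h₂ j = H (suc (suc (j ℕ.* 2)))
        h₃ j = H (suc (suc (suc (j ℕ.* 2))))
        l = ring 2 λ e o → o :- # 3 :* e :+ # 3 :* o :- e ⊜ :- (# 4 :* (e :- o))
        big₀ : M ℕ.+ M ℕ.+ M ℕ.≤ n ℕ.* 2
        big₀ = ℕP.≤-trans (ℕP.m≤m+n (M ℕ.+ M ℕ.+ M) (2 ℕ.+ M)) (ℕP.≤-reflexive (k M))
          where
          k = semiring 1 λ M → M :+ M :+ M :+ (# 2 :+ M) ⊜ (# 1 :+ (M :+ M)) :* # 2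
        big₁ : M ℕ.+ M ℕ.+ M ℕ.≤ suc (n ℕ.* 2)
        big₁ = ℕP.m≤n⇒m≤1+n big₀

      ∣-∣≤4 : ∀ z → ∣ z ∣ ℕ.≤ ∣ - (+ 4 * z) ∣
      ∣-∣≤4 z = subst (∣ z ∣ ℕ.≤_) (sym (trans (∣-i∣≡∣i∣ (+ 4 * z)) (abs-* (+ 4) z))) (ℕP.m≤n*m ∣ z ∣ 4)

    even-sum : ∀ {K μ} → n ℕ.≤ μ ℕ.* S ^ 1 →
      (∀ x → ∣ x ∣ ℕ.≤ M ℕ.+ M → Bd S K 3 (Δ³ (G x) (G (x + + 1)) (G (x + + 2)) (G (x + + 3)))) →
      Bd S (μ ℕ.* K) 4 (+ 2 * box M (λ x → G (+ 2 * x)) - box M G)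
    even-sum {K} {μ} n≤ third = subst (Bd S (μ ℕ.* K) 4)
        (sym (trans (cong₂ (λ u v → + 2 * u - v) even≡ all≡) (l E O)))
        (bd (ℕP.≤-trans (∣-∣≤4 (E - O)) (Bd.bound (subst (Bd S (μ ℕ.* K) 4) ∑D (Bd-∑ n {L = μ} {d = 1} n≤ each)))))
      where
      l = ring 2 λ e o → # 2 :* e :- (e :+ o) ⊜ e :- o
      each : ∀ j → j ℕ.< n → Bd S K 3 (D j)
      each j (ℕ.s≤s j≤) = subst (Bd S K 3) (cong₃ (Δ³ (G x)) (cong G (s₁ (+ (j ℕ.* 2)) (+ (M ℕ.+ M)))) (cong G (s₂ (+ (j ℕ.* 2)) (+ (M ℕ.+ M)))) (cong G (s₃ (+ (j ℕ.* 2)) (+ (M ℕ.+ M)))))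
          (third x x≤)
        where
        x = + (j ℕ.* 2) - + (M ℕ.+ M)
        cong₃ : ∀ (f : ℤ → ℤ → ℤ → ℤ) {a b c a′ b′ c′} → a ≡ a′ → b ≡ b′ → c ≡ c′ → f a b c ≡ f a′ b′ c′
        cong₃ f refl refl refl = refl
        s₁ = ring 2 λ a m → a :- m :+ # 1 ⊜ # 1 :+ a :- m
        s₂ = ring 2 λ a m → a :- m :+ # 2 ⊜ # 2 :+ a :- m
        s₃ = ring 2 λ a m → a :- m :+ # 3 ⊜ # 3 :+ a :- m
        x≤ : ∣ x ∣ ℕ.≤ M ℕ.+ M
        x≤ = subst (ℕ._≤ M ℕ.+ M) (cong ∣_∣ (sym (m-n≡m⊖n (j ℕ.* 2) (M ℕ.+ M)))) (go (ℕP.≤-total (j ℕ.* 2) (M ℕ.+ M)))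
          where
          go : j ℕ.* 2 ℕ.≤ M ℕ.+ M ⊎ M ℕ.+ M ℕ.≤ j ℕ.* 2 → ∣ j ℕ.* 2 ⊖ (M ℕ.+ M) ∣ ℕ.≤ M ℕ.+ M
          go (inj₁ le) = subst (ℕ._≤ M ℕ.+ M) (sym (trans (cong ∣_∣ (⊖-≤ le)) (∣-i∣≡∣i∣ (+ (M ℕ.+ M ℕ.∸ j ℕ.* 2))))) (ℕP.m∸n≤m (M ℕ.+ M) (j ℕ.* 2))
          go (inj₂ ge) = subst (ℕ._≤ M ℕ.+ M) (sym (cong ∣_∣ (⊖-≥ ge))) (ℕP.m≤n+o⇒m∸n≤o (j ℕ.* 2) (M ℕ.+ M)
            (ℕP.≤-trans (ℕP.*-monoˡ-≤ 2 j≤) (ℕP.≤-reflexive (trans (ℕP.*-comm (M ℕ.+ M) 2) (cong (M ℕ.+ M ℕ.+_) (ℕP.+-identityʳ (M ℕ.+ M)))))))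

  quad : ℤ → ℤ → ℤ → ℤ → ℤ
  quad α β δ x = α * (x * x) + β * x + δ

  quad-third-K : ℤ → ℕ → ℕ → ℕ → ℕ
  quad-third-K α μ B C = 18 ℕ.* (P ℕ.* E ℕ.* (A ℕ.+ E)) ℕ.+ 216 ℕ.* ((A ℕ.+ E) ℕ.* (A ℕ.+ E) ℕ.* (A ℕ.+ E))
    where
    P = 1 ℕ.+ (∣ α ∣ ℕ.* (μ ℕ.* μ) ℕ.+ B ℕ.* μ ℕ.+ C)
    A = ∣ α ∣ ℕ.* (2 ℕ.* μ ℕ.+ 1) ℕ.+ B
    E = 2 ℕ.* ∣ α ∣

  quad-third : ∀ {S} → 1 ℕ.≤ S → ∀ {μ B C} α {β δ x} → Bd S B 1 β → Bd S C 2 δ → Bd S μ 1 x →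
    let G = λ x → cube⁺ (+ (S ℕ.* S) - quad α β δ x) in
    Bd S (quad-third-K α μ B C) 3 (Δ³ (G x) (G (x + + 1)) (G (x + + 2)) (G (x + + 3)))
  quad-third {S} 1≤S {μ} {B} {C} α {β} {δ} {x} bβ bδ bx = subst (Bd S (quad-third-K α μ B C) 3)
      (cong₃ (Δ³ (cube⁺ p)) (cong cube⁺ (e₁ T α β δ x)) (cong cube⁺ (e₂ T α β δ x)) (cong cube⁺ (e₃ T α β δ x)))
      (third-difference 1≤S bp bd′ be)
    where
    T p d e : ℤ
    T = + (S ℕ.* S)
    p = T - quad α β δ x
    d = - (α * (+ 2 * x + + 1) + β)
    e = - (+ 2 * α)
    cong₃ : ∀ (f : ℤ → ℤ → ℤ → ℤ) {a b c a′ b′ c′} → a ≡ a′ → b ≡ b′ → c ≡ c′ → f a b c ≡ f a′ b′ c′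
    cong₃ f refl refl refl = refl
    bT : Bd S 1 2 T
    bT = bd (ℕP.≤-reflexive (l S))
      where
      l = semiring 1 λ S → S :* S ⊜ # 1 :* (S :* (S :* # 1))
    bp : Bd S (1 ℕ.+ (∣ α ∣ ℕ.* (μ ℕ.* μ) ℕ.+ B ℕ.* μ ℕ.+ C)) 2 p
    bp = Bd-- bT (Bd-+ (Bd-+ (Bd-scale α (Bd-* bx bx)) (Bd-* bβ bx)) bδ)
    bd′ : Bd S (∣ α ∣ ℕ.* (2 ℕ.* μ ℕ.+ 1) ℕ.+ B) 1 d
    bd′ = Bd-neg (Bd-+ (Bd-scale α (Bd-+ (Bd-scale (+ 2) bx) (Bd-raise 1≤S ℕ.z≤n (Bd-const (+ 1))))) bβ)
    be : Bd S (2 ℕ.* ∣ α ∣) 0 e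
    be = Bd-neg (Bd-scale (+ 2) (Bd-const α))
    e₁ = ring 5 λ T α β δ x → T :- (α :* (x :* x) :+ β :* x :+ δ) :+ :- (α :* (# 2 :* x :+ # 1) :+ β) ⊜ T :- (α :* ((x :+ # 1) :* (x :+ # 1)) :+ β :* (x :+ # 1) :+ δ)
    e₂ = ring 5 λ T α β δ x → T :- (α :* (x :* x) :+ β :* x :+ δ) :+ # 2 :* :- (α :* (# 2 :* x :+ # 1) :+ β) :+ :- (# 2 :* α) ⊜ T :- (α :* ((x :+ # 2) :* (x :+ # 2)) :+ β :* (x :+ # 2) :+ δ)
    e₃ = ring 5 λ T α β δ x → T :- (α :* (x :* x) :+ β :* x :+ δ) :+ # 3 :* :- (α :* (# 2 :* x :+ # 1) :+ β) :+ # 3 :* :- (# 2 :* α) ⊜ T :- (α :* ((x :+ # 3) :* (x :+ # 3)) :+ β :* (x :+ # 3) :+ δ)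

  -- From 4 y² ≤ N y² ≤ 4 α q ≤ 4 α S² follows y² ≤ α S² ≤ (α S)².
  coordinate-bound : ∀ {α S y N} {s q : ℤ} → 4 ℕ.≤ N → + 4 * + α * q ≡ s * s + + N * (y * y) → q ≤ + (S ℕ.* S) →
    ∣ y ∣ ℕ.≤ α ℕ.* S
  coordinate-bound {α} {S} {y} {N} {s} {q} 4≤N eq q≤ = ℕP.≮⇒≥ λ lt → ℕP.<⇒≱ (ℕP.*-mono-< lt lt)
      (ℕP.≤-trans (drop‿+≤+ y²≤) (squeeze α))
    where
    squeeze : ∀ α → α ℕ.* (S ℕ.* S) ℕ.≤ α ℕ.* S ℕ.* (α ℕ.* S)
    squeeze zero = ℕ.z≤n
    squeeze α@(suc _) = ℕP.≤-trans (ℕP.m≤n*m (α ℕ.* (S ℕ.* S)) α) (ℕP.≤-reflexive (l α S))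
      where
      l = semiring 2 λ a S → a :* (a :* (S :* S)) ⊜ a :* S :* (a :* S)
    abs² : ∀ y → + (∣ y ∣ ℕ.* ∣ y ∣) ≡ y * y
    abs² (+ n)    = pos-* n n
    abs² -[1+ n ] = refl
    y²≤ : + (∣ y ∣ ℕ.* ∣ y ∣) ≤ + (α ℕ.* (S ℕ.* S))
    y²≤ = subst₂ _≤_ (sym (abs² y)) (sym (pos-* α (S ℕ.* S))) (*-cancelˡ-≤-pos (y * y) (+ α * + (S ℕ.* S)) (+ 4)
      (≤-by (s * s + (+ N - + 4) * (y * y) + + 4 * + α * (+ (S ℕ.* S) - q))
        (0≤+ (0≤+ (0≤sq s) (0≤* (i≤j⇒0≤j-i (+≤+ 4≤N)) (0≤sq y))) (0≤* {+ 4 * + α} (subst (0ℤ ≤_) (pos-* 4 α) 0≤pos) (i≤j⇒0≤j-i q≤)))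
        (trans (l (+ α) (+ (S ℕ.* S)) q (y * y)) (trans (cong (λ u → u - + 4 * (y * y) + + 4 * + α * (+ (S ℕ.* S) - q)) eq)
          (l₂ (s * s) (+ N) (y * y) (+ 4 * + α * (+ (S ℕ.* S) - q)))))))
      where
      l = ring 4 λ a T q y → # 4 :* (a :* T) :- # 4 :* y ⊜ # 4 :* a :* q :- # 4 :* y :+ # 4 :* a :* (T :- q)
      l₂ = ring 4 λ s n y t → s :+ n :* y :- # 4 :* y :+ t ⊜ s :+ (n :- # 4) :* y :+ t

  module FormSum {D : ℤ} (N c : ℕ) (D≡ : D ≡ 1ℤ - + 4 * + c) (+N : + N ≡ + 4 * + c - 1ℤ)
    (N-sqfree : ∀ d → d ℕ.* d ℕD.∣ N → d ≡ 1) (4<N : 4 ℕ.< N) where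

    open FormCount {D} N c D≡ +N N-sqfree 4<N

    module _ (F : Form) where
      open Form F

      private
        C : ℤ
        C = + 2 * b + 1ℤ

        1≤a : 1 ℕ.≤ a
        1≤a = ℕP.n≢0⇒n>0 a≢0

      -- By `disc4`, 4 a c′ = (2 b + 1)² + N > 0.
      c′-pos : ∃[ γ ] c′ ≡ + γ × 1 ℕ.≤ γ
      c′-pos = go c′ refl
        where
        4ac′>0 : 0ℤ < + 4 * (+ a * c′)
        4ac′>0 = subst (0ℤ <_) (sym (disc4 F)) (<-≤-trans (+<+ (ℕP.<-trans (ℕ.s≤s ℕ.z≤n) 4<N))
          (≤-by (C * C) (0≤sq C) (l (C * C) (+ N))))
          where
          l = ring 2 λ s n → s :+ n :- n ⊜ s
        go : ∀ z → c′ ≡ z → ∃[ γ ] c′ ≡ + γ × 1 ℕ.≤ γ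
        go (+ suc γ) e = suc γ , e , ℕ.s≤s ℕ.z≤n
        go (+ zero) e = contradiction 4ac′>0 (<-irrefl (sym (trans (cong (λ z → + 4 * (+ a * z)) e) (l (+ a)))))
          where
          l = ring 1 λ a → # 4 :* (a :* # 0) ⊜ # 0
        go -[1+ γ ] e = contradiction (<⇒≤ 4ac′>0) (<⇒≱ (subst (_< 0ℤ) (trans (sym (l (+ a) (+ suc γ))) (cong (λ z → + 4 * (+ a * z)) (sym e)))
            (neg-mono-< {0ℤ} {+ 4 * (+ a * + suc γ)} (subst (0ℤ <_) (trans (pos-* 4 (a ℕ.* suc γ)) (cong (+ 4 *_) (pos-* a (suc γ))))
              (+<+ (ℕP.*-mono-≤ {1} {4} {1} {a ℕ.* suc γ} (ℕ.s≤s ℕ.z≤n) (ℕP.*-mono-≤ 1≤a (ℕ.s≤s (ℕ.z≤n {γ})))))))))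
          where
          l = ring 2 λ a g → # 4 :* (a :* :- g) ⊜ :- (# 4 :* (a :* g))

      γ : ℕ
      γ = proj₁ c′-pos

      c′≡ : c′ ≡ + γ
      c′≡ = proj₁ (proj₂ c′-pos)

      1≤γ : 1 ℕ.≤ γ
      1≤γ = proj₂ (proj₂ c′-pos)

      -- Larger than both a and γ, so that the weight vanishes already on the boundary of the box,
      -- as `EvenSum` requires.
      μ : ℕ
      μ = a ℕ.+ γ

      y-bound : ∀ {S x y} → Q F x y ≤ + (S ℕ.* S) → ∣ y ∣ ℕ.≤ a ℕ.* S
      y-bound {S} {x} {y} = coordinate-bound {a} {S} {y} {N} {+ 2 * + a * x + C * y} (ℕP.<⇒≤ 4<N) (4aQ F x y)

      x-bound : ∀ {S x y} → Q F x y ≤ + (S ℕ.* S) → ∣ x ∣ ℕ.≤ γ ℕ.* S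
      x-bound {S} {x} {y} = coordinate-bound {γ} {S} {x} {N} {+ 2 * + γ * y + C * x} (ℕP.<⇒≤ 4<N)
        (trans (cong (λ z → + 4 * + γ * (+ a * (x * x) + C * (x * y) + z * (y * y))) c′≡) (trans (k₁ (+ a) C (+ γ) x y)
          (cong (λ u → (+ 2 * + γ * y + C * x) * (+ 2 * + γ * y + C * x) + u * (x * x)) (trans (cong (_- C * C) (trans (cong (λ z → + 4 * (+ a * z)) (sym c′≡)) (disc4 F))) (k₂ (C * C) (+ N))))))
        where
        k₁ = ring 5 λ a C g x y → # 4 :* g :* (a :* (x :* x) :+ C :* (x :* y) :+ g :* (y :* y)) ⊜ (# 2 :* g :* y :+ C :* x) :* (# 2 :* g :* y :+ C :* x) :+ (# 4 :* (a :* g) :- C :* C) :* (x :* x)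
        k₂ = ring 2 λ s n → s :+ n :- s ⊜ n

      in-box : ∀ {S} x y → Q F x y ≤ + (S ℕ.* S) → ∣ x ∣ ℕ.≤ μ ℕ.* S × ∣ y ∣ ℕ.≤ μ ℕ.* S
      in-box {S} x y q = ℕP.≤-trans (x-bound {S} {x} {y} q) (ℕP.*-monoˡ-≤ S (ℕP.m≤n+m γ a)) ,
        ℕP.≤-trans (y-bound {S} {x} {y} q) (ℕP.*-monoˡ-≤ S (ℕP.m≤m+n a γ))

      module _ {S : ℕ} (1≤S : 1 ℕ.≤ S) where

        private
          M : ℕ
          M = μ ℕ.* S

          T : ℤ
          T = + (S ℕ.* S)

          W : ℤ → ℤ → ℤ
          W x y = cube⁺ (T - Q F x y)

          1≤M : 1 ℕ.≤ M
          1≤M = ℕP.*-mono-≤ {1} {μ} (ℕP.≤-trans 1≤a (ℕP.m≤m+n a γ)) 1≤S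

          outside : ∀ {x y} → ¬ Q F x y ≤ T → W x y ≡ 0ℤ
          outside {x} {y} ¬q = cube⁺-nonpos (i≤j⇒i-j≤0 (<⇒≤ (≰⇒> ¬q)))

          vanish-x : ∀ x y → M ℕ.≤ ∣ x ∣ → W x y ≡ 0ℤ
          vanish-x x y M≤ = outside {x} {y} λ q → ℕP.<⇒≱ (ℕP.≤-<-trans (x-bound {S} {x} {y} q)
            (ℕP.<-≤-trans (ℕP.m<n+m (γ ℕ.* S) (ℕP.*-mono-≤ 1≤a 1≤S)) (ℕP.≤-reflexive (sym (ℕP.*-distribʳ-+ S a γ))))) M≤

          vanish-y : ∀ x y → M ℕ.≤ ∣ y ∣ → W x y ≡ 0ℤ
          vanish-y x y M≤ = outside {x} {y} λ q → ℕP.<⇒≱ (ℕP.≤-<-trans (y-bound {S} {x} {y} q)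
            (ℕP.<-≤-trans (ℕP.m<m+n (a ℕ.* S) (ℕP.*-mono-≤ 1≤γ 1≤S)) (ℕP.≤-reflexive (sym (ℕP.*-distribʳ-+ S a γ))))) M≤

          μ₂ : ℕ
          μ₂ = μ ℕ.+ μ

          coord : ∀ {x} → ∣ x ∣ ℕ.≤ M ℕ.+ M → Bd S μ₂ 1 x
          coord {x} x≤ = bd (ℕP.≤-trans x≤ (ℕP.≤-reflexive (l μ S)))
            where
            l = semiring 2 λ m S → m :* S :+ m :* S ⊜ (m :+ m) :* (S :* # 1)

          count : suc (M ℕ.+ M) ℕ.≤ (3 ℕ.* μ) ℕ.* S ^ 1
          count = ℕP.≤-trans (ℕP.+-monoˡ-≤ (M ℕ.+ M) 1≤M) (ℕP.≤-reflexive (l μ S))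
            where
            l = semiring 2 λ m S → m :* S :+ (m :* S :+ m :* S) ⊜ # 3 :* m :* (S :* # 1)

          Kx Ky : ℕ
          Kx = quad-third-K (+ a) μ₂ (∣ C ∣ ℕ.* μ₂) (∣ c′ ∣ ℕ.* (μ₂ ℕ.* μ₂))
          Ky = quad-third-K c′ μ₂ (∣ C ∣ ℕ.* μ₂) (a ℕ.* (μ₂ ℕ.* μ₂))

          third-x : ∀ y → ∣ y ∣ ℕ.≤ M ℕ.+ M → ∀ x → ∣ x ∣ ℕ.≤ M ℕ.+ M → Bd S Kx 3 (Δ³ (W x y) (W (x + + 1) y) (W (x + + 2) y) (W (x + + 3) y))
          third-x y y≤ x x≤ = subst (Bd S Kx 3) (same (G≡ x) (G≡ (x + + 1)) (G≡ (x + + 2)) (G≡ (x + + 3)))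
              (quad-third 1≤S (+ a) (Bd-scale C (coord y≤)) (Bd-scale c′ (Bd-* {x = y} {y = y} (coord y≤) (coord y≤))) (coord x≤))
            where
            G≡ : ∀ x → cube⁺ (T - quad (+ a) (C * y) (c′ * (y * y)) x) ≡ W x y
            G≡ x = cong (λ u → cube⁺ (T - u)) (l (+ a) C c′ x y)
              where
              l = ring 5 λ a C c x y → a :* (x :* x) :+ C :* y :* x :+ c :* (y :* y) ⊜ a :* (x :* x) :+ C :* (x :* y) :+ c :* (y :* y)
            same : ∀ {a b c d a′ b′ c′ d′} → a ≡ a′ → b ≡ b′ → c ≡ c′ → d ≡ d′ → Δ³ a b c d ≡ Δ³ a′ b′ c′ d′
            same refl refl refl refl = refl

          third-y : ∀ x → ∣ x ∣ ℕ.≤ M ℕ.+ M → ∀ y → ∣ y ∣ ℕ.≤ M ℕ.+ M → Bd S Ky 3 (Δ³ (W x y) (W x (y + + 1)) (W x (y + + 2)) (W x (y + + 3)))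
          third-y x x≤ y y≤ = subst (Bd S Ky 3) (same (G≡ y) (G≡ (y + + 1)) (G≡ (y + + 2)) (G≡ (y + + 3)))
              (quad-third 1≤S c′ (Bd-scale C (coord x≤)) (Bd-scale (+ a) (Bd-* {x = x} {y = x} (coord x≤) (coord x≤))) (coord y≤))
            where
            G≡ : ∀ y → cube⁺ (T - quad c′ (C * x) (+ a * (x * x)) y) ≡ W x y
            G≡ y = cong (λ u → cube⁺ (T - u)) (l (+ a) C c′ x y)
              where
              l = ring 5 λ a C c x y → c :* (y :* y) :+ C :* x :* y :+ a :* (x :* x) ⊜ a :* (x :* x) :+ C :* (x :* y) :+ c :* (y :* y)
            same : ∀ {a b c d a′ b′ c′ d′} → a ≡ a′ → b ≡ b′ → c ≡ c′ → d ≡ d′ → Δ³ a b c d ≡ Δ³ a′ b′ c′ d′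
            same refl refl refl refl = refl

          Ux Uy : ℤ → ℤ
          Ux x = + 2 * box M (λ y → W (+ 2 * x) (+ 2 * y)) - box M (λ y → W (+ 2 * x) y)
          Uy y = + 2 * box M (λ x → W (+ 2 * x) y) - box M (λ x → W x y)

          Ux-bound : ∀ x → ∣ x ∣ ℕ.≤ M → Bd S (3 ℕ.* μ ℕ.* Ky) 4 (Ux x)
          Ux-bound x x≤ = EvenSum.even-sum 1≤M (W (+ 2 * x)) (λ y → vanish-y (+ 2 * x) y) {Ky} {3 ℕ.* μ} count (third-y (+ 2 * x) 2x≤)
            where
            2x≤ : ∣ + 2 * x ∣ ℕ.≤ M ℕ.+ M
            2x≤ = ℕP.≤-trans (ℕP.≤-reflexive (trans (abs-* (+ 2) x) (cong (∣ x ∣ ℕ.+_) (ℕP.+-identityʳ ∣ x ∣)))) (ℕP.+-mono-≤ x≤ x≤)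

          Uy-bound : ∀ y → ∣ y ∣ ℕ.≤ M → Bd S (3 ℕ.* μ ℕ.* Kx) 4 (Uy y)
          Uy-bound y y≤ = EvenSum.even-sum 1≤M (λ x → W x y) (λ x → vanish-x x y) {Kx} {3 ℕ.* μ} count (third-x y (ℕP.≤-trans y≤ (ℕP.m≤m+n M M)))

          -- The doubling is undone one coordinate at a time: first that of y, on the points with
          -- first coordinate 2 x, then that of x.
          telescoped : + 4 * box₂ M (λ x y → W (+ 2 * x) (+ 2 * y)) - box₂ M W ≡ + 2 * box M Ux + box M Uy
          telescoped = sym (begin
            + 2 * box M Ux + box M Uy
              ≡⟨ cong₂ (λ u v → + 2 * u + v) (diff (λ x → box M (λ y → W (+ 2 * x) (+ 2 * y))) (λ x → box M (λ y → W (+ 2 * x) y)))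
                   (diff (λ y → box M (λ x → W (+ 2 * x) y)) (λ y → box M (λ x → W x y))) ⟩
            + 2 * (+ 2 * A - A′) + (+ 2 * A″ - A‴)
              ≡⟨ cong₂ (λ u v → + 2 * (+ 2 * A - u) + (+ 2 * A″ - v)) (box-box M M (λ x y → W (+ 2 * x) y)) (sym (box-box M M W)) ⟩
            + 2 * (+ 2 * A - A″) + (+ 2 * A″ - box₂ M W) ≡⟨ l A A″ (box₂ M W) ⟩
            + 4 * A - box₂ M W ∎)
            where
            open ≡-Reasoning
            A A′ A″ A‴ : ℤ
            A = box₂ M (λ x y → W (+ 2 * x) (+ 2 * y))
            A′ = box M (λ x → box M (λ y → W (+ 2 * x) y))
            A″ = box M (λ y → box M (λ x → W (+ 2 * x) y))
            A‴ = box M (λ y → box M (λ x → W x y))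
            diff : ∀ f g → box M (λ x → + 2 * f x - g x) ≡ + 2 * box M f - box M g
            diff f g = trans (∑-- (suc (M ℕ.+ M)) _ _) (cong (_- box M g) (sym (*-box M (+ 2) f)))
            l = ring 3 λ a b w → # 2 :* (# 2 :* a :- b) :+ (# 2 :* b :- w) ⊜ # 4 :* a :- w

          box-bound : ∀ {K} U → (∀ x → ∣ x ∣ ℕ.≤ M → Bd S K 4 (U x)) → Bd S (3 ℕ.* μ ℕ.* K) 5 (box M U)
          box-bound {K} U h = Bd-∑ (suc (M ℕ.+ M)) {L = 3 ℕ.* μ} {d = 1} count (λ i i< → h (+ i - + M) (centre i<))

        -- Third differences are O(S³), and each of the two summations contributes a factor S; with
        -- T = S² this is O(T^(5/2)). The factor 4 enters as Q(2 x , 2 y) = 4 Q(x , y).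
        scaling : Bd S (2 ℕ.* (3 ℕ.* μ ℕ.* (3 ℕ.* μ ℕ.* Ky)) ℕ.+ 3 ℕ.* μ ℕ.* (3 ℕ.* μ ℕ.* Kx)) 5
          (+ 4 * box₂ M (λ x y → cube⁺ (T - + 4 * Q F x y)) - box₂ M W)
        scaling = subst (Bd S _ 5) (trans (sym telescoped) (cong (λ u → + 4 * u - box₂ M W)
            (box₂-cong M (λ x y → cong (λ u → cube⁺ (T - u)) (Q-scale F (+ 2) x y)))))
          (Bd-+ (Bd-scale (+ 2) (box-bound Ux Ux-bound)) (box-bound Uy Uy-bound))

      scaling-bound : ∃[ K ] ∀ {S} → 1 ℕ.≤ S → Bd S K 5
        (+ 4 * box₂ (μ ℕ.* S) (λ x y → cube⁺ (+ (S ℕ.* S) - + 4 * Q F x y)) - box₂ (μ ℕ.* S) (λ x y → cube⁺ (+ (S ℕ.* S) - Q F x y)))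
      scaling-bound = _ , λ 1≤S → scaling 1≤S

-- Abel summation and the weighted divisor sum.

module Dirichlet where

  open Normalisation using (ring; semiring; _⊜_; _:+_; _:-_; _:*_; :-_; #_)
  open import Data.Integer.Base hiding (suc; _%_; _/_; _^_)
  open ℤP
  open import Data.Nat.Base using (_^_)
  open import Data.Nat.DivMod using (_%_; _/_; m≡m%n+[m/n]*n; m%n<n; m/n*n≤m)
  open Sums
  open Modular
  open Bounds

  ∣∑∣≤-support : ∀ n m K {f : ℕ → ℤ} → (∀ i → i ℕ.< m → ∣ f i ∣ ℕ.≤ K) → (∀ i → m ℕ.≤ i → f i ≡ 0ℤ) → ∣ ∑ n f ∣ ℕ.≤ m ℕ.* K
  ∣∑∣≤-support n m K {f} h z with ℕP.≤-total n m
  ... | inj₁ n≤m = ℕP.≤-trans (∣∑∣≤ n K (λ i i< → h i (ℕP.<-≤-trans i< n≤m))) (ℕP.*-monoˡ-≤ K n≤m)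
  ... | inj₂ m≤n = subst (λ s → ∣ s ∣ ℕ.≤ m ℕ.* K) (sym (∑-extend f m≤n (λ i m≤i _ → z i m≤i))) (∣∑∣≤ m K h)

  by-parts : ∀ n (c v : ℕ → ℤ) → ∑ n (λ j → c j * v j) ≡ ∑ n c * v n + ∑ n (λ j → ∑ (suc j) c * (v j - v (suc j)))
  by-parts zero    c v = refl
  by-parts (suc n) c v = trans (cong (_+ c n * v n) (by-parts n c v)) (l (∑ n c) (c n) (v n) (v (suc n)) _)
    where
    l = ring 5 λ C c v v′ s → C :* v :+ s :+ c :* v ⊜ (C :+ c) :* v′ :+ (s :+ (C :+ c) :* (v :- v′))

  bounded-below : ∀ n (f : ℕ → ℤ) → ∃[ K ] ∀ i → i ℕ.< n → ∣ f i ∣ ℕ.≤ K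
  bounded-below zero    f = 0 , λ i ()
  bounded-below (suc n) f with bounded-below n f
  ... | K , h = K ℕ.+ ∣ f n ∣ , λ i i< → Sum.[ (λ i<n → ℕP.≤-trans (h i i<n) (ℕP.m≤m+n K _)) , (λ { refl → ℕP.m≤n+m _ K }) ]′
    (ℕP.m<1+n⇒m<n∨m≡n i<)

  record ZeroSum (P : ℕ) : Set where
    constructor zeroSum
    field
      at       : ℕ → ℤ
      periodic : Periodic P at
      balanced : ∑ P at ≡ 0ℤ

    prefix : ℕ → ℤ
    prefix j = ∑ j at

    prefix-periodic : Periodic P prefix
    prefix-periodic j = begin
      ∑ (j ℕ.+ P) at ≡⟨ cong (λ k → ∑ k at) (ℕP.+-comm j P) ⟩
      ∑ (P ℕ.+ j) at ≡⟨ ∑-split P j at ⟩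
      ∑ P at + ∑ j (λ i → at (P ℕ.+ i)) ≡⟨ cong₂ _+_ balanced (∑-cong j (λ i → trans (cong at (ℕP.+-comm P i)) (periodic i))) ⟩
      0ℤ + ∑ j at ≡⟨ +-identityˡ (∑ j at) ⟩
      ∑ j at ∎
      where open ≡-Reasoning

    prefix-bounded : .{{_ : ℕ.NonZero P}} → ∃[ K ] ∀ j → ∣ prefix j ∣ ℕ.≤ K
    prefix-bounded with bounded-below P prefix
    ... | K , h = K , λ j → subst (λ z → ∣ z ∣ ℕ.≤ K) (periodic-% prefix-periodic j) (h (j % P) (m%n<n j P))

    at-bounded : .{{_ : ℕ.NonZero P}} → ∃[ K ] ∀ j → ∣ at j ∣ ℕ.≤ K
    at-bounded with bounded-below P at
    ... | K , h = K , λ j → subst (λ z → ∣ z ∣ ℕ.≤ K) (periodic-% periodic j) (h (j % P) (m%n<n j P))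

    prefixSum : ℤ
    prefixSum = ∑ P (λ j → prefix (suc j))

  open ZeroSum using (at; prefix; prefixSum)

  module _ {P : ℕ} (c : ZeroSum P) where

    -- The prefix sums are periodic again. Subtracting their mean restores the sum 0 and so permits
    -- a further summation by parts; the factor P keeps the values integral.
    antidifference : ZeroSum P
    antidifference = zeroSum (λ j → + P * prefix c (suc j) - prefixSum c)
      (λ j → cong (λ z → + P * z - prefixSum c) (ZeroSum.prefix-periodic c (suc j)))
      (trans (∑-- P (λ j → + P * prefix c (suc j)) (λ _ → prefixSum c))
        (trans (cong₂ _-_ (sym (*-∑ P (+ P) (λ j → prefix c (suc j)))) (∑-const P (prefixSum c))) (+-inverseʳ (+ P * prefixSum c))))

  Δ : (ℕ → ℤ) → ℕ → ℤ
  Δ v j = v j - v (suc j)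

  module _ {P : ℕ} (c : ZeroSum P) where

    -- The mean of the prefix sums is summed against a telescoping difference, which leaves the main
    -- term at 0.
    smooth : ∀ n v → v n ≡ 0ℤ →
      + P * ∑ n (λ j → at c j * v j) ≡ prefixSum c * v 0 + ∑ n (λ j → at (antidifference c) j * Δ v j)
    smooth n v vn = begin
      + P * ∑ n (λ j → at c j * v j) ≡⟨ cong (+ P *_) (by-parts n (at c) v) ⟩
      + P * (prefix c n * v n + ∑ n (λ j → prefix c (suc j) * Δ v j)) ≡⟨ cong (λ z → + P * (prefix c n * z + ∑ n (λ j → prefix c (suc j) * Δ v j))) vn ⟩
      + P * (prefix c n * 0ℤ + ∑ n (λ j → prefix c (suc j) * Δ v j)) ≡⟨ l₁ (+ P) (prefix c n) _ ⟩
      + P * ∑ n (λ j → prefix c (suc j) * Δ v j) ≡⟨ *-∑ n (+ P) _ ⟩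
      ∑ n (λ j → + P * (prefix c (suc j) * Δ v j)) ≡⟨ ∑-cong n (λ j → l₂ (+ P) (prefix c (suc j)) (Δ v j) Y) ⟩
      ∑ n (λ j → Y * Δ v j + (+ P * prefix c (suc j) - Y) * Δ v j) ≡⟨ ∑-+ n _ _ ⟩
      ∑ n (λ j → Y * Δ v j) + R ≡⟨ cong (_+ R) (sym (*-∑ n Y (Δ v))) ⟩
      Y * ∑ n (Δ v) + R ≡⟨ cong (λ z → Y * z + R) (trans (telescope n) (trans (cong (_-_ (v 0)) vn) (+-identityʳ (v 0)))) ⟩
      Y * v 0 + R ∎
      where
      open ≡-Reasoning
      Y R : ℤ
      Y = prefixSum c
      R = ∑ n (λ j → at (antidifference c) j * Δ v j)
      l₁ = ring 3 λ p c s → p :* (c :* # 0 :+ s) ⊜ p :* s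
      l₂ = ring 4 λ p c d y → p :* (c :* d) ⊜ y :* d :+ (p :* c :- y) :* d
      telescope : ∀ n → ∑ n (Δ v) ≡ v 0 - v n
      telescope zero    = sym (+-inverseʳ (v 0))
      telescope (suc n) = trans (cong (_+ Δ v n) (telescope n)) (l (v 0) (v n) (v (suc n)))
        where
        l = ring 3 λ a b c → a :- b :+ (b :- c) ⊜ a :- c

  module _ {P : ℕ} (c : ZeroSum P) where

    -- Two smoothings give the two main terms at 0. The third summation by parts only uses that
    -- prefix sums are bounded, and its sum is left over as the error.
    smooth³ : ∀ n w → (∀ i → n ℕ.≤ i → w i ≡ 0ℤ) →
      + P * + P * ∑ n (λ j → at c j * w j) ≡ + P * (prefixSum c * w 0) + prefixSum (antidifference c) * Δ w 0
        + ∑ n (λ j → prefix (antidifference (antidifference c)) (suc j) * Δ (Δ (Δ w)) j)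
    smooth³ n w z = begin
      + P * + P * ∑ n (λ j → at c j * w j) ≡⟨ *-assoc (+ P) (+ P) (∑ n (λ j → at c j * w j)) ⟩
      + P * (+ P * ∑ n (λ j → at c j * w j)) ≡⟨ cong (+ P *_) (smooth c n w (z n ℕP.≤-refl)) ⟩
      + P * (Y * w 0 + ∑ n (λ j → at c′ j * Δ w j)) ≡⟨ *-distribˡ-+ (+ P) (Y * w 0) _ ⟩
      + P * (Y * w 0) + + P * ∑ n (λ j → at c′ j * Δ w j) ≡⟨ cong (_+_ (+ P * (Y * w 0))) (smooth c′ n (Δ w) (z¹ n ℕP.≤-refl)) ⟩
      + P * (Y * w 0) + (Y′ * Δ w 0 + ∑ n (λ j → at c″ j * Δ (Δ w) j))
        ≡⟨ cong (λ s → + P * (Y * w 0) + (Y′ * Δ w 0 + s)) (trans (by-parts n (at c″) (Δ (Δ w)))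
            (trans (cong (λ d → prefix c″ n * d + S₃) (cong₂ _-_ (z¹ n ℕP.≤-refl) (z¹ (suc n) (ℕP.n≤1+n n)))) (l (prefix c″ n) S₃))) ⟩
      + P * (Y * w 0) + (Y′ * Δ w 0 + S₃) ≡⟨ sym (+-assoc (+ P * (Y * w 0)) (Y′ * Δ w 0) S₃) ⟩
      + P * (Y * w 0) + Y′ * Δ w 0 + S₃ ∎
      where
      open ≡-Reasoning
      c′ c″ : ZeroSum P
      c′ = antidifference c
      c″ = antidifference c′
      Y Y′ S₃ : ℤ
      Y = prefixSum c
      Y′ = prefixSum c′
      S₃ = ∑ n (λ j → prefix c″ (suc j) * Δ (Δ (Δ w)) j)
      z¹ : ∀ i → n ℕ.≤ i → Δ w i ≡ 0ℤ
      z¹ i n≤i = cong₂ _-_ (z i n≤i) (z (suc i) (ℕP.m≤n⇒m≤1+n n≤i))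
      l = ring 2 λ p s → p :* # 0 :+ s ⊜ s

  ramp : ℕ → ℕ → ℕ → ℤ
  ramp u d j = cube⁺ (+ u - + (d ℕ.* j))

  ramp-0 : ∀ u d → ramp u d 0 ≡ cube (+ u)
  ramp-0 u d = cong cube⁺ (trans (cong (λ z → + u - + z) (ℕP.*-zeroʳ d)) (+-identityʳ (+ u)))

  ramp-vanish : ∀ {u d j} → u ℕ.≤ d ℕ.* j → ramp u d j ≡ 0ℤ
  ramp-vanish u≤ = cube⁺-nonpos (i≤j⇒i-j≤0 (+≤+ u≤))

  -- The argument of the cube is linear in j, so the second difference is 0 and the term of
  -- `third-difference` that contains the size of p drops out. Any constant will do for p, here its
  -- absolute value.
  ramp-third : ∀ u {d} → 1 ℕ.≤ d → ∀ j → ∣ Δ (Δ (Δ (ramp u d))) j ∣ ℕ.≤ 216 ℕ.* d ^ 3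
  ramp-third u {d} 1≤d j = subst (λ z → ∣ z ∣ ℕ.≤ 216 ℕ.* d ^ 3) (trans (cong -_ (same {a = cube⁺ p} refl at₁ at₂ at₃)) (l (w j) (w (suc j)) (w (2 ℕ.+ j)) (w (3 ℕ.+ j))))
      (Bd.bound (Bd-neg third))
    where
    w : ℕ → ℤ
    w = ramp u d
    p : ℤ
    p = + u - + (d ℕ.* j)
    P : ℕ
    P = ∣ p ∣
    bp : P ℕ.≤ P ℕ.* d ^ 2
    bp = ℕP.m≤m*n P (d ^ 2) {{ℕ.>-nonZero (ℕP.m^n>0 d {{ℕ.>-nonZero 1≤d}} 2)}}
    l₁ = semiring 1 λ d → d ⊜ # 1 :* (d :* # 1)
    third : Bd d 216 3 (Δ³ (cube⁺ p) (cube⁺ (p + - (+ d))) (cube⁺ (p + + 2 * - (+ d) + 0ℤ)) (cube⁺ (p + + 3 * - (+ d) + + 3 * 0ℤ)))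
    third = Bd-mono (ℕP.≤-reflexive (cong (λ z → 18 ℕ.* (z ℕ.* 1) ℕ.+ 216) (ℕP.*-zeroʳ P)))
      (third-difference {d} {1} {0} {P} 1≤d {p} { - (+ d)} {0ℤ} (bd bp) (bd (ℕP.≤-reflexive (trans (∣-i∣≡∣i∣ (+ d)) (l₁ d)))) (bd ℕ.z≤n))
    l = ring 4 λ a b c d → :- (d :- # 3 :* c :+ # 3 :* b :- a) ⊜ a :- b :- (b :- c) :- (b :- c :- (c :- d))
    same : ∀ {a b c d a′ b′ c′ d′} → a ≡ a′ → b ≡ b′ → c ≡ c′ → d ≡ d′ → Δ³ a b c d ≡ Δ³ a′ b′ c′ d′
    same refl refl refl refl = refl
    step : ∀ k → + (d ℕ.* (k ℕ.+ j)) ≡ + d * (+ k + + j)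
    step k = pos-* d (k ℕ.+ j)
    at₁ : cube⁺ (p + - (+ d)) ≡ w (suc j)
    at₁ = cong cube⁺ (trans (cong (λ z → + u - z + - (+ d)) (pos-* d j)) (trans (k (+ u) (+ d) (+ j)) (cong (_-_ (+ u)) (sym (step 1)))))
      where
      k = ring 3 λ u d j → u :- d :* j :+ :- d ⊜ u :- d :* (# 1 :+ j)
    at₂ : cube⁺ (p + + 2 * - (+ d) + 0ℤ) ≡ w (2 ℕ.+ j)
    at₂ = cong cube⁺ (trans (cong (λ z → + u - z + + 2 * - (+ d) + 0ℤ) (pos-* d j)) (trans (k (+ u) (+ d) (+ j)) (cong (_-_ (+ u)) (sym (step 2)))))
      where
      k = ring 3 λ u d j → u :- d :* j :+ # 2 :* :- d :+ # 0 ⊜ u :- d :* (# 2 :+ j)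
    at₃ : cube⁺ (p + + 3 * - (+ d) + + 3 * 0ℤ) ≡ w (3 ℕ.+ j)
    at₃ = cong cube⁺ (trans (cong (λ z → + u - z + + 3 * - (+ d) + + 3 * 0ℤ) (pos-* d j)) (trans (k (+ u) (+ d) (+ j)) (cong (_-_ (+ u)) (sym (step 3)))))
      where
      k = ring 3 λ u d j → u :- d :* j :+ # 3 :* :- d :+ # 3 :* # 0 ⊜ u :- d :* (# 3 :+ j)

  module _ {P : ℕ} .{{_ : ℕ.NonZero P}} (c : ZeroSum P) where

    private
      c′ c″ : ZeroSum P
      c′ = antidifference c
      c″ = antidifference c′
      K : ℕ
      K = proj₁ (ZeroSum.prefix-bounded c″)

    -- Third differences are at most 216 d³ and vanish once d j exceeds u. About T / d of them
    -- survive, which gives T d².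
    ramp-sum : ∃[ K ] ∀ {T u d n} → u ℕ.≤ T → 1 ℕ.≤ d → d ℕ.≤ T → T ℕ.≤ d ℕ.* n →
      ∣ + P * + P * ∑ n (λ j → at c j * ramp u d j) - (+ P * (prefixSum c * cube (+ u)) + prefixSum c′ * (cube (+ u) - ramp u d 1)) ∣ ℕ.≤ K ℕ.* (T ℕ.* (d ℕ.* d))
    ramp-sum = 432 ℕ.* K , bound
      where
      bound : ∀ {T u d n} → u ℕ.≤ T → 1 ℕ.≤ d → d ℕ.≤ T → T ℕ.≤ d ℕ.* n →
        ∣ + P * + P * ∑ n (λ j → at c j * ramp u d j) - (+ P * (prefixSum c * cube (+ u)) + prefixSum c′ * (cube (+ u) - ramp u d 1)) ∣ ℕ.≤ 432 ℕ.* K ℕ.* (T ℕ.* (d ℕ.* d))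
      bound {T} {u} {d} {n} u≤T 1≤d d≤T T≤ = subst (λ z → ∣ z ∣ ℕ.≤ 432 ℕ.* K ℕ.* (T ℕ.* (d ℕ.* d))) (sym error≡)
          (ℕP.≤-trans (∣∑∣≤-support n m (K ℕ.* (216 ℕ.* d ^ 3)) term zero-beyond) (ℕP.≤-trans (ℕP.≤-reflexive (l₁ m K d))
            (ℕP.≤-trans (ℕP.*-monoˡ-≤ (K ℕ.* (216 ℕ.* (d ℕ.* d))) md≤) (ℕP.≤-reflexive (l₂ T K d)))))
        where
        instance
          d≢0 : ℕ.NonZero d
          d≢0 = ℕ.>-nonZero 1≤d
        w : ℕ → ℤ
        w = ramp u d
        S₃ : ℤ
        S₃ = ∑ n (λ j → prefix c″ (suc j) * Δ (Δ (Δ w)) j)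
        error≡ : + P * + P * ∑ n (λ j → at c j * w j) - (+ P * (prefixSum c * cube (+ u)) + prefixSum c′ * (cube (+ u) - w 1)) ≡ S₃
        error≡ = trans (cong₂ (λ s t → s - (+ P * (prefixSum c * t) + prefixSum c′ * (t - w 1)))
          (smooth³ c n w (λ i n≤i → ramp-vanish {u} {d} (ℕP.≤-trans u≤T (ℕP.≤-trans T≤ (ℕP.*-monoʳ-≤ d n≤i))))) (sym (ramp-0 u d)))
          (l (+ P * (prefixSum c * w 0) + prefixSum c′ * Δ w 0) S₃)
          where
          l = ring 2 λ a s → a :+ s :- a ⊜ s
        m : ℕ
        m = suc (u / d)
        md≤ : m ℕ.* d ℕ.≤ 2 ℕ.* T
        md≤ = ℕP.≤-trans (ℕP.+-mono-≤ d≤T (ℕP.≤-trans (m/n*n≤m u d) u≤T)) (ℕP.≤-reflexive (cong (T ℕ.+_) (sym (ℕP.+-identityʳ T))))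
        u≤md : u ℕ.≤ d ℕ.* m
        u≤md = ℕP.≤-trans (ℕP.≤-reflexive (m≡m%n+[m/n]*n u d)) (ℕP.≤-trans (ℕP.+-monoˡ-≤ (u / d ℕ.* d) (ℕP.<⇒≤ (m%n<n u d)))
          (ℕP.≤-reflexive (ℕP.*-comm m d)))
        term : ∀ j → j ℕ.< m → ∣ prefix c″ (suc j) * Δ (Δ (Δ w)) j ∣ ℕ.≤ K ℕ.* (216 ℕ.* d ^ 3)
        term j _ = ℕP.≤-trans (ℕP.≤-reflexive (abs-* (prefix c″ (suc j)) _))
          (ℕP.*-mono-≤ (proj₂ (ZeroSum.prefix-bounded c″) (suc j)) (ramp-third u 1≤d j))
        wz : ∀ j → m ℕ.≤ j → w j ≡ 0ℤ
        wz j m≤j = ramp-vanish {u} {d} (ℕP.≤-trans u≤md (ℕP.*-monoʳ-≤ d m≤j))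
        zero-beyond : ∀ j → m ℕ.≤ j → prefix c″ (suc j) * Δ (Δ (Δ w)) j ≡ 0ℤ
        zero-beyond j m≤j = trans (cong (prefix c″ (suc j) *_) (same (wz j m≤j) (wz (suc j) m≤1) (wz (2 ℕ.+ j) (ℕP.m≤n⇒m≤1+n m≤1))
          (wz (3 ℕ.+ j) (ℕP.m≤n⇒m≤1+n (ℕP.m≤n⇒m≤1+n m≤1))))) (*-zeroʳ (prefix c″ (suc j)))
          where
          m≤1 : m ℕ.≤ suc j
          m≤1 = ℕP.m≤n⇒m≤1+n m≤j
          same : ∀ {a b c d} → a ≡ 0ℤ → b ≡ 0ℤ → c ≡ 0ℤ → d ≡ 0ℤ → a - b - (b - c) - (b - c - (c - d)) ≡ 0ℤ
          same refl refl refl refl = refl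
        l₁ = semiring 3 λ m K d → m :* (K :* (# 216 :* (d :* (d :* (d :* # 1))))) ⊜ m :* d :* (K :* (# 216 :* (d :* d)))
        l₂ = semiring 3 λ T K d → # 2 :* T :* (K :* (# 216 :* (d :* d))) ⊜ # 432 :* K :* (T :* (d :* d))

  drop : ∀ {T} u d → u ℕ.≤ T → ∣ cube (+ u) - ramp u d 1 ∣ ℕ.≤ 3 ℕ.* (d ℕ.* (T ℕ.* T))
  drop {T} u d u≤T = go (ℕP.≤-total d u)
    where
    go : d ℕ.≤ u ⊎ u ℕ.≤ d → ∣ cube (+ u) - ramp u d 1 ∣ ℕ.≤ 3 ℕ.* (d ℕ.* (T ℕ.* T))
    go (inj₁ d≤u) = ℕP.≤-trans (ℕP.≤-trans (ℕP.≤-reflexive (cong ∣_∣ diff≡)) (ℕP.≤-trans (ℕP.m≤m+n e (2 ℕ.* (d ℕ.* d ℕ.* d) ℕ.+ 3 ℕ.* (d ℕ.* d ℕ.* k))) (ℕP.≤-reflexive (l₁ d k))))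
        (ℕP.*-monoʳ-≤ 3 (ℕP.*-monoʳ-≤ d (ℕP.*-mono-≤ d+k≤ d+k≤)))
      where
      k e : ℕ
      k = u ℕ.∸ d
      e = d ℕ.* d ℕ.* d ℕ.+ 3 ℕ.* (d ℕ.* d ℕ.* k) ℕ.+ 3 ℕ.* (d ℕ.* k ℕ.* k)
      u≡ : u ≡ d ℕ.+ k
      u≡ = sym (ℕP.m+[n∸m]≡n d≤u)
      d+k≤ : d ℕ.+ k ℕ.≤ T
      d+k≤ = subst (ℕ._≤ T) u≡ u≤T
      l₁ = semiring 2 λ d k → d :* d :* d :+ # 3 :* (d :* d :* k) :+ # 3 :* (d :* k :* k) :+ (# 2 :* (d :* d :* d) :+ # 3 :* (d :* d :* k)) ⊜ # 3 :* (d :* ((d :+ k) :* (d :+ k)))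
      l₂ = ring 2 λ d k → (d :+ k) :* (d :+ k) :* (d :+ k) :- k :* k :* k ⊜ d :* d :* d :+ # 3 :* (d :* d :* k) :+ # 3 :* (d :* k :* k)
      l₃ = ring 2 λ d k → d :+ k :- d :* # 1 ⊜ k
      p³ : ∀ a b c → + (a ℕ.* b ℕ.* c) ≡ + a * + b * + c
      p³ a b c = trans (pos-* (a ℕ.* b) c) (cong (_* + c) (pos-* a b))
      diff≡ : cube (+ u) - ramp u d 1 ≡ + e
      diff≡ = trans (cong₂ (λ s t → cube s - cube⁺ t) (cong +_ u≡) (trans (cong₂ (λ s t → + s - t) u≡ (pos-* d 1)) (l₃ (+ d) (+ k))))
        (trans (l₂ (+ d) (+ k)) (sym (cong₂ _+_ (cong₂ _+_ (p³ d d d) (trans (pos-* 3 (d ℕ.* d ℕ.* k)) (cong (+ 3 *_) (p³ d d k)))) (trans (pos-* 3 (d ℕ.* k ℕ.* k)) (cong (+ 3 *_) (p³ d k k))))))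
    go (inj₂ u≤d) = ℕP.≤-trans (ℕP.≤-reflexive (trans (cong (λ z → ∣ cube (+ u) - z ∣) (ramp-vanish {u} {d} {1} (ℕP.≤-trans u≤d (ℕP.≤-reflexive (sym (ℕP.*-identityʳ d))))))
        (trans (cong ∣_∣ (+-identityʳ (cube (+ u)))) (trans (abs-* (+ u * + u) (+ u)) (trans (cong (ℕ._* u) (abs-* (+ u) (+ u))) (ℕP.*-comm (u ℕ.* u) u))))))
      (ℕP.≤-trans (ℕP.*-mono-≤ u≤d (ℕP.*-mono-≤ u≤T u≤T)) (ℕP.m≤n*m (d ℕ.* (T ℕ.* T)) 3))

  ramp-+ : ∀ {u d m v} → d ℕ.* m ℕ.+ v ≡ u → ∀ j → ramp u d (m ℕ.+ j) ≡ ramp v d j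
  ramp-+ {d = d} {m} {v} refl j = cong cube⁺ (trans (cong (λ z → + (d ℕ.* m ℕ.+ v) - + z) (ℕP.*-distribˡ-+ d m j)) (l (+ (d ℕ.* m)) (+ v) (+ (d ℕ.* j))))
    where
    l = ring 3 λ a v b → a :+ v :- (a :+ b) ⊜ v :- b

  ramp-comm : ∀ u d j → ramp u d j ≡ ramp u j d
  ramp-comm u d j = cong (λ z → cube⁺ (+ u - + z)) (ℕP.*-comm d j)

  ramp-step : ∀ T m → ∣ Δ (ramp T 1) m ∣ ℕ.≤ 3 ℕ.* (T ℕ.* T)
  ramp-step T m = go (ℕP.≤-total m T)
    where
    go : m ℕ.≤ T ⊎ T ℕ.≤ m → ∣ Δ (ramp T 1) m ∣ ℕ.≤ 3 ℕ.* (T ℕ.* T)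
    go (inj₁ m≤T) = ℕP.≤-trans (ℕP.≤-reflexive (cong ∣_∣ (cong₂ _-_ at₀ at₁)))
        (ℕP.≤-trans (drop (T ℕ.∸ m) 1 (ℕP.m∸n≤m T m)) (ℕP.≤-reflexive (cong (3 ℕ.*_) (ℕP.*-identityˡ (T ℕ.* T)))))
      where
      T≡ : 1 ℕ.* m ℕ.+ (T ℕ.∸ m) ≡ T
      T≡ = trans (cong (ℕ._+ (T ℕ.∸ m)) (ℕP.*-identityˡ m)) (ℕP.m+[n∸m]≡n m≤T)
      at₀ : ramp T 1 m ≡ cube (+ (T ℕ.∸ m))
      at₀ = trans (cong (ramp T 1) (sym (ℕP.+-identityʳ m))) (trans (ramp-+ {T} {1} {m} T≡ 0) (ramp-0 (T ℕ.∸ m) 1))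
      at₁ : ramp T 1 (suc m) ≡ ramp (T ℕ.∸ m) 1 1
      at₁ = trans (cong (ramp T 1) (sym (ℕP.+-comm m 1))) (ramp-+ {T} {1} {m} T≡ 1)
    go (inj₂ T≤m) = ℕP.≤-trans (ℕP.≤-reflexive (cong ∣_∣ (cong₂ _-_ (ramp-vanish {T} {1} T≤1m) (ramp-vanish {T} {1} (ℕP.≤-trans T≤1m (ℕP.*-monoʳ-≤ 1 (ℕP.n≤1+n m))))))) ℕ.z≤n
      where
      T≤1m : T ℕ.≤ 1 ℕ.* m
      T≤1m = ℕP.≤-trans T≤m (ℕP.≤-reflexive (sym (ℕP.*-identityˡ m)))

  module _ {P : ℕ} .{{_ : ℕ.NonZero P}} (c : ZeroSum P) where

    -- The coarser form counts the second main term, O(d T²) by `drop`, as an error; d ≤ T absorbs T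
    -- d² into it.
    ramp-sum′ : ∃[ K ] ∀ {T u d n} → u ℕ.≤ T → 1 ℕ.≤ d → d ℕ.≤ T → T ℕ.≤ d ℕ.* n →
      ∣ + P * + P * ∑ n (λ j → at c j * ramp u d j) - + P * (prefixSum c * cube (+ u)) ∣ ℕ.≤ K ℕ.* (d ℕ.* (T ℕ.* T))
    ramp-sum′ = K ℕ.+ Y′ ℕ.* 3 , bound
      where
      K Y′ : ℕ
      K = proj₁ (ramp-sum c)
      Y′ = ∣ prefixSum (antidifference c) ∣
      bound : ∀ {T u d n} → u ℕ.≤ T → 1 ℕ.≤ d → d ℕ.≤ T → T ℕ.≤ d ℕ.* n →
        ∣ + P * + P * ∑ n (λ j → at c j * ramp u d j) - + P * (prefixSum c * cube (+ u)) ∣ ℕ.≤ (K ℕ.+ Y′ ℕ.* 3) ℕ.* (d ℕ.* (T ℕ.* T))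
      bound {T} {u} {d} {n} u≤T 1≤d d≤T T≤ = ℕP.≤-trans (ℕP.≤-reflexive (cong ∣_∣ (l₁ X A Z)))
          (ℕP.≤-trans (∣i+j∣≤∣i∣+∣j∣ (X - (A + Z)) Z) (ℕP.≤-trans (ℕP.+-mono-≤
            (ℕP.≤-trans (proj₂ (ramp-sum c) u≤T 1≤d d≤T T≤) (ℕP.*-monoʳ-≤ K (ℕP.≤-trans (ℕP.≤-reflexive (l₂ T d)) (ℕP.*-monoʳ-≤ d (ℕP.*-monoʳ-≤ T d≤T)))))
            (ℕP.≤-trans (ℕP.≤-reflexive (abs-* (prefixSum (antidifference c)) _)) (ℕP.*-monoʳ-≤ Y′ (drop u d u≤T))))
            (ℕP.≤-reflexive (l₃ K Y′ (d ℕ.* (T ℕ.* T))))))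
        where
        X A Z : ℤ
        X = + P * + P * ∑ n (λ j → at c j * ramp u d j)
        A = + P * (prefixSum c * cube (+ u))
        Z = prefixSum (antidifference c) * (cube (+ u) - ramp u d 1)
        l₁ = ring 3 λ x a z → x :- a ⊜ x :- (a :+ z) :+ z
        l₂ = semiring 2 λ T d → T :* (d :* d) ⊜ d :* (T :* d)
        l₃ = semiring 3 λ K Y X → K :* X :+ Y :* (# 3 :* X) ⊜ (K :+ Y :* # 3) :* X

  -- The coefficients of (1 - 4^{1-s}) ζ(s).
  ψ : ZeroSum 4
  ψ = zeroSum at₄ (λ j → cong at₄ (ℕP.+-comm j 4)) refl
    where
    at₄ : ℕ → ℤ
    at₄ 0 = - + 3
    at₄ 1 = 1ℤ
    at₄ 2 = 1ℤ
    at₄ 3 = 1ℤ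
    at₄ (suc (suc (suc (suc j)))) = at₄ j

  ∑-ψ : ∀ n (g : ℕ → ℤ) → ∑ (n ℕ.* 4) (λ m → at ψ m * g m) ≡ ∑ (n ℕ.* 4) g - + 4 * ∑ n (λ j → g (j ℕ.* 4))
  ∑-ψ zero    g = refl
  ∑-ψ (suc n) g = trans (cong₂ _+_ (cong₂ _+_ (cong₂ _+_ (cong₂ _+_ (∑-ψ n g) (cong (_* g k) (at-block 0)))
      (cong (_* g (1 ℕ.+ k)) (at-block 1))) (cong (_* g (2 ℕ.+ k)) (at-block 2))) (cong (_* g (3 ℕ.+ k)) (at-block 3)))
    (l (∑ k g) (∑ n (λ j → g (j ℕ.* 4))) (g k) (g (1 ℕ.+ k)) (g (2 ℕ.+ k)) (g (3 ℕ.+ k)))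
    where
    k : ℕ
    k = n ℕ.* 4
    at-block : ∀ i → at ψ (i ℕ.+ k) ≡ at ψ i
    at-block i = periodic-* (ZeroSum.periodic ψ) n i
    l = ring 6 λ A B a b c d → A :- # 4 :* B :+ :- # 3 :* a :+ # 1 :* b :+ # 1 :* c :+ # 1 :* d ⊜ A :+ a :+ b :+ c :+ d :- # 4 :* (B :+ a)

  -- Index 0 is split off where it follows another rule: a step of 0 is outside the reach of
  -- `ramp-sum`, and the vectors of value 0 are counted by h instead of a divisor sum.
  off-zero : (ℕ → ℤ) → ℕ → ℤ
  off-zero f zero    = 0ℤ
  off-zero f (suc i) = f (suc i)

  ∑-off-zero : ∀ {n} (f : ℕ → ℤ) → 0 ℕ.< n → ∑ n f ≡ f 0 + ∑ n (off-zero f)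
  ∑-off-zero {suc n} f _ = trans (∑-cons n f) (cong (_+_ (f 0)) (sym (trans (∑-cons n (off-zero f)) (+-identityˡ _))))

  pw-* : ∀ {V m n K L} d e → m ℕ.≤ K ℕ.* V ^ d → n ℕ.≤ L ℕ.* V ^ e → m ℕ.* n ℕ.≤ K ℕ.* L ℕ.* V ^ (d ℕ.+ e)
  pw-* {V} {m} {n} {K} {L} d e p q = ℕP.≤-trans (ℕP.*-mono-≤ p q)
      (ℕP.≤-reflexive (trans (l K (V ^ d) L (V ^ e)) (cong (K ℕ.* L ℕ.*_) (sym (ℕP.^-distribˡ-+-* V d e)))))
    where
    l = semiring 4 λ a b c d → a :* b :* (c :* d) ⊜ a :* c :* (b :* d)

  module Weighted {N : ℕ} .{{_ : ℕ.NonZero N}} (χ : ZeroSum N) (χ-0 : at χ 0 ≡ 0ℤ) where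

    private
      n Y Y′ : ℤ
      n = + N
      Y = prefixSum χ
      Y′ = prefixSum (antidifference χ)

      X Kψ K₁ K₁′ K₄ : ℕ
      X = proj₁ (ZeroSum.at-bounded χ)
      Kψ = proj₁ (ZeroSum.prefix-bounded ψ)
      K₁ = proj₁ (ramp-sum χ)
      K₁′ = proj₁ (ramp-sum′ χ)
      K₄ = proj₁ (ramp-sum′ ψ)

      ψ≤3 : ∀ m → ∣ at ψ m ∣ ℕ.≤ 3
      ψ≤3 0 = ℕP.≤-refl
      ψ≤3 1 = ℕ.s≤s ℕ.z≤n
      ψ≤3 2 = ℕ.s≤s ℕ.z≤n
      ψ≤3 3 = ℕ.s≤s ℕ.z≤n
      ψ≤3 (suc (suc (suc (suc m)))) = ψ≤3 m

    weighted-K : ℕ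
    weighted-K = 16 ℕ.* (∣ Y′ ∣ ℕ.* (4 ℕ.* (Kψ ℕ.* 3)) ℕ.+ 4 ℕ.* (3 ℕ.* (K₁ ℕ.* 16))) ℕ.+ 24 ℕ.* (K₁′ ℕ.* 4) ℕ.+ ∣ n * n ∣ ℕ.* (1 ℕ.* (X ℕ.* K₄))

    module Estimate {V : ℕ} (2≤V : 2 ℕ.≤ V) {M₁ : ℕ} (T≤M₁ : V ^ 8 ℕ.≤ M₁) (balanced : ∑ (V ^ 5 ℕ.* 4 ℕ.+ M₁) (at χ) ≡ 0ℤ) where

      private
        T M₀ B : ℕ
        T = V ^ 8
        -- A multiple of 4, so that ψ has sum 0 below M₀ and continues in phase above it.
        M₀ = V ^ 5 ℕ.* 4
        B = M₀ ℕ.+ M₁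

        T³ L : ℤ
        T³ = cube (+ T)
        L = n * (Y * T³)

        1≤V : 1 ℕ.≤ V
        1≤V = ℕP.≤-trans (ℕ.s≤s ℕ.z≤n) 2≤V

        1≤M₀ : 1 ℕ.≤ M₀
        1≤M₀ = ℕP.*-mono-≤ {1} {V ^ 5} {1} {4} (ℕP.m^n>0 V {{ℕ.>-nonZero 1≤V}} 5) (ℕ.s≤s ℕ.z≤n)

        M₀≤T : M₀ ℕ.≤ T
        M₀≤T = ℕP.≤-trans (ℕP.*-monoʳ-≤ (V ^ 5) (ℕP.≤-trans (ℕP.m≤m+n 4 4) (ℕP.^-monoˡ-≤ 3 2≤V)))
          (ℕP.≤-reflexive (sym (ℕP.^-distribˡ-+-* V 5 3)))

        T≤V³M₀ : T ℕ.≤ V ^ 3 ℕ.* M₀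
        T≤V³M₀ = ℕP.≤-trans (ℕP.≤-reflexive (ℕP.^-distribˡ-+-* V 3 5)) (ℕP.*-monoʳ-≤ (V ^ 3) (ℕP.m≤m*n (V ^ 5) 4))

        V³≤T : V ^ 3 ℕ.≤ T
        V³≤T = ℕP.^-monoʳ-≤ V {{ℕ.>-nonZero 1≤V}} {3} {8} (ℕ.s≤s (ℕ.s≤s (ℕ.s≤s ℕ.z≤n)))

        T≤B : T ℕ.≤ B
        T≤B = ℕP.≤-trans T≤M₁ (ℕP.m≤n+m M₁ M₀)

        pT : T ℕ.≤ 1 ℕ.* V ^ 8
        pT = ℕP.≤-reflexive (sym (ℕP.*-identityˡ (V ^ 8)))

        pM₀ : M₀ ℕ.≤ 4 ℕ.* V ^ 5
        pM₀ = ℕP.≤-reflexive (ℕP.*-comm (V ^ 5) 4)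

        A : ℕ → ℤ
        A m = ∑ B (λ d → at χ d * ramp T m d)

        -- Small m: smoothing in d.
        v err : ℕ → ℤ
        v m = T³ - ramp T m 1
        err m = n * n * A m - (L + Y′ * v m)

        G₁ S₁ S₂ : ℤ
        G₁ = ∑ M₀ (λ m → at ψ m * A m)
        S₁ = ∑ M₀ (λ m → at ψ m * v m)
        S₂ = ∑ M₀ (off-zero (λ m → at ψ m * err m))

        ramp₀ : ∀ j → ramp T 0 j ≡ T³
        ramp₀ j = cong cube⁺ (+-identityʳ (+ T))

        -- For m = 0 the weight is constantly T³ and the sum over d is 0 by balance, so the
        -- approximation L is off by L itself, and ψ(0) = -3. As ψ has sum 0 below M₀, the
        -- approximations L cancel altogether, and 3 L is the main term that remains of the small m.
        err-0 : at ψ 0 * err 0 ≡ + 3 * L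
        err-0 = trans (cong₂ (λ a b → - + 3 * (n * n * a - (L + Y′ * b))) A₀ (trans (cong (_-_ T³) (ramp₀ 1)) (+-inverseʳ T³))) (l n L Y′)
          where
          A₀ : A 0 ≡ 0ℤ
          A₀ = trans (∑-cong B (λ d → cong (at χ d *_) (ramp₀ d))) (trans (sym (∑-* B T³ (at χ))) (cong (_* T³) balanced))
          l = ring 3 λ n L Y → :- # 3 :* (n :* n :* # 0 :- (L :+ Y :* # 0)) ⊜ # 3 :* L

        small : n * n * G₁ ≡ + 3 * L + Y′ * S₁ + S₂
        small = begin
          n * n * G₁
            ≡⟨ *-∑ M₀ (n * n) (λ m → at ψ m * A m) ⟩
          ∑ M₀ (λ m → n * n * (at ψ m * A m))
            ≡⟨ ∑-cong M₀ (λ m → l₁ n (at ψ m) (A m) L Y′ (v m)) ⟩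
          ∑ M₀ (λ m → at ψ m * L + Y′ * (at ψ m * v m) + at ψ m * err m)
            ≡⟨ trans (∑-+ M₀ (λ m → at ψ m * L + Y′ * (at ψ m * v m)) (λ m → at ψ m * err m))
                 (cong₂ _+_ (∑-+ M₀ (λ m → at ψ m * L) (λ m → Y′ * (at ψ m * v m))) (∑-off-zero (λ m → at ψ m * err m) 1≤M₀)) ⟩
          ∑ M₀ (λ m → at ψ m * L) + ∑ M₀ (λ m → Y′ * (at ψ m * v m)) + (at ψ 0 * err 0 + S₂)
            ≡⟨ cong₂ (λ s t → s + (t + S₂)) (cong₂ _+_ (trans (sym (∑-* M₀ L (at ψ))) (cong (_* L) (periodic-* (ZeroSum.prefix-periodic ψ) (V ^ 5) 0)))
                 (sym (*-∑ M₀ Y′ (λ m → at ψ m * v m)))) err-0 ⟩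
          0ℤ * L + Y′ * S₁ + (+ 3 * L + S₂)
            ≡⟨ l₂ L (Y′ * S₁) S₂ ⟩
          + 3 * L + Y′ * S₁ + S₂ ∎
          where
          open ≡-Reasoning
          l₁ = ring 6 λ n p a L y v → n :* n :* (p :* a) ⊜ p :* L :+ y :* (p :* v) :+ p :* (n :* n :* a :- (L :+ y :* v))
          l₂ = ring 3 λ L s t → # 0 :* L :+ s :+ (# 3 :* L :+ t) ⊜ # 3 :* L :+ s :+ t

        -- Termwise, v m is of order m T², which would give M₀² T², of order V²⁶ and too large.
        -- Summation by parts against ψ replaces v by its differences, of order T², and gains a
        -- factor M₀.
        S₁-bound : Bd V (4 ℕ.* (Kψ ℕ.* 3)) 21 S₁
        S₁-bound = subst (Bd V (4 ℕ.* (Kψ ℕ.* 3)) 21) (sym S₁≡) (Bd-∑ M₀ {L = 4} {d = 5} {e = 16} pM₀ (λ m _ → term m))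
          where
          S₁≡ : S₁ ≡ ∑ M₀ (λ m → prefix ψ (suc m) * (v m - v (suc m)))
          S₁≡ = trans (by-parts M₀ (at ψ) v) (trans (cong (λ z → z * v M₀ + R) (periodic-* (ZeroSum.prefix-periodic ψ) (V ^ 5) 0)) (+-identityˡ R))
            where
            R : ℤ
            R = ∑ M₀ (λ m → prefix ψ (suc m) * (v m - v (suc m)))
          term : ∀ m → Bd V (Kψ ℕ.* 3) 16 (prefix ψ (suc m) * (v m - v (suc m)))
          term m = bd (ℕP.≤-trans (ℕP.≤-reflexive (abs-* (prefix ψ (suc m)) _)) (pw-* {V} {K = Kψ} {L = 3} 0 16
            (ℕP.≤-trans (proj₂ (ZeroSum.prefix-bounded ψ) (suc m)) (ℕP.≤-reflexive (sym (ℕP.*-identityʳ Kψ))))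
            (ℕP.≤-trans (ℕP.≤-reflexive (trans (cong ∣_∣ (trans (l T³ (ramp T m 1) (ramp T (suc m) 1)) (cong -_ (cong₂ _-_ (ramp-comm T m 1) (ramp-comm T (suc m) 1)))))
              (∣-i∣≡∣i∣ (Δ (ramp T 1) m)))) (ℕP.≤-trans (ramp-step T m) (ℕP.≤-reflexive (cong (3 ℕ.*_) (sym (ℕP.^-distribˡ-+-* V 8 8))))))))
            where
            l = ring 3 λ t a b → t :- a :- (t :- b) ⊜ :- (a :- b)

        S₂-bound : Bd V (4 ℕ.* (3 ℕ.* (K₁ ℕ.* 16))) 23 S₂
        S₂-bound = Bd-∑ M₀ {L = 4} {d = 5} {e = 18} pM₀ term
          where
          term : ∀ m → m ℕ.< M₀ → Bd V (3 ℕ.* (K₁ ℕ.* 16)) 18 (off-zero (λ m → at ψ m * err m) m)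
          term zero    _  = bd ℕ.z≤n
          term (suc m) m< = bd (ℕP.≤-trans (ℕP.≤-reflexive (abs-* (at ψ (suc m)) _)) (pw-* {V} {K = 3} {L = K₁ ℕ.* 16} 0 18 (ψ≤3 (suc m))
              (ℕP.≤-trans (proj₂ (ramp-sum χ) {T} {T} {suc m} {B} ℕP.≤-refl (ℕ.s≤s ℕ.z≤n) (ℕP.<⇒≤ (ℕP.<-≤-trans m< M₀≤T)) (ℕP.≤-trans T≤B (ℕP.m≤n*m B (suc m))))
                (pw-* {V} {K = K₁} {L = 16} 0 18 (ℕP.≤-reflexive (sym (ℕP.*-identityʳ K₁))) (pw-* {V} {K = 1} {L = 16} 8 10 pT (pw-* {V} {K = 4} {L = 4} 5 5 m≤ m≤))))))
            where
            m≤ : suc m ℕ.≤ 4 ℕ.* V ^ 5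
            m≤ = ℕP.≤-trans (ℕP.<⇒≤ m<) pM₀

        -- Large m: smoothing in m first.
        F : ℕ → ℤ
        F d = + 4 * + 4 * ∑ M₁ (λ j → at ψ (M₀ ℕ.+ j) * ramp T d (M₀ ℕ.+ j)) + + 24 * ramp T d M₀

        G₂ S₃ E′ : ℤ
        G₂ = ∑ B (λ d → at χ d * ∑ M₁ (λ j → at ψ (M₀ ℕ.+ j) * ramp T d (M₀ ℕ.+ j)))
        S₃ = ∑ B (λ d → at χ d * F d)
        E′ = n * n * A M₀ - L

        -- The correction in `F` adds up to 24 `A M₀`, which smoothing in d evaluates: n² `A M₀` = L
        -- + E′.
        large : + 16 * (n * n * G₂) ≡ - + 24 * (L + E′) + n * n * S₃
        large = sym (trans (cong (λ z → - + 24 * (L + E′) + n * n * z) S₃≡) (l n L (A M₀) G₂))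
          where
          l₀ = ring 3 λ c s r → c :* (# 4 :* # 4 :* s :+ # 24 :* r) ⊜ # 16 :* (c :* s) :+ # 24 :* (c :* r)
          S₃≡ : S₃ ≡ + 16 * G₂ + + 24 * A M₀
          S₃≡ = trans (∑-cong B (λ d → trans (cong (λ z → at χ d * (+ 4 * + 4 * inner d + + 24 * z)) (ramp-comm T d M₀)) (l₀ (at χ d) (inner d) (ramp T M₀ d))))
            (trans (∑-+ B (λ d → + 16 * (at χ d * inner d)) (λ d → + 24 * (at χ d * ramp T M₀ d)))
              (cong₂ _+_ (sym (*-∑ B (+ 16) (λ d → at χ d * inner d))) (sym (*-∑ B (+ 24) (λ d → at χ d * ramp T M₀ d)))))
            where
            inner : ℕ → ℤ
            inner d = ∑ M₁ (λ j → at ψ (M₀ ℕ.+ j) * ramp T d (M₀ ℕ.+ j))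
          l = ring 4 λ n L a g → :- # 24 :* (L :+ (n :* n :* a :- L)) :+ n :* n :* (# 16 :* g :+ # 24 :* a) ⊜ # 16 :* (n :* n :* g)

        -- The boundary at M₀ is once more a sum over d, with step M₀ ≤ T, and `ramp-sum′` applies.
        E′-bound : Bd V (K₁′ ℕ.* 4) 21 E′
        E′-bound = bd (ℕP.≤-trans (proj₂ (ramp-sum′ χ) {T} {T} {M₀} {B} ℕP.≤-refl 1≤M₀ M₀≤T (ℕP.≤-trans T≤B (ℕP.m≤n*m B M₀ {{ℕ.>-nonZero 1≤M₀}})))
          (pw-* {V} {K = K₁′} {L = 4} 0 21 (ℕP.≤-reflexive (sym (ℕP.*-identityʳ K₁′))) (pw-* {V} {K = 4} {L = 1} 5 16 pM₀ (pw-* {V} {K = 1} {L = 1} 8 8 pT pT))))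

        F-vanish : ∀ d → T ℕ.≤ d ℕ.* M₀ → F d ≡ 0ℤ
        F-vanish d T≤ = cong₂ (λ s t → + 4 * + 4 * s + + 24 * t)
          (∑-vanish M₁ (λ j _ → trans (cong (at ψ (M₀ ℕ.+ j) *_) (ramp-vanish {T} {d} (ℕP.≤-trans T≤ (ℕP.*-monoʳ-≤ d (ℕP.m≤m+n M₀ j))))) (*-zeroʳ (at ψ (M₀ ℕ.+ j)))))
          (ramp-vanish {T} {d} T≤)

        -- The prefix sums -3, -2, -1, 0 of ψ add up to -6, so 16 times the sum over m ≥ M₀ has the
        -- main term -4 · 6 · u³ with u = T - d M₀. The correction 24 u³ in `F` removes it.
        F-bound : ∀ d → 1 ℕ.≤ d → d ℕ.≤ V ^ 3 → ∣ F d ∣ ℕ.≤ K₄ ℕ.* (d ℕ.* (T ℕ.* T))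
        F-bound d 1≤d d≤ = go (ℕP.≤-total T (d ℕ.* M₀))
          where
          go : T ℕ.≤ d ℕ.* M₀ ⊎ d ℕ.* M₀ ℕ.≤ T → ∣ F d ∣ ℕ.≤ K₄ ℕ.* (d ℕ.* (T ℕ.* T))
          go (inj₁ T≤) = subst (λ z → ∣ z ∣ ℕ.≤ K₄ ℕ.* (d ℕ.* (T ℕ.* T))) (sym (F-vanish d T≤)) ℕ.z≤n
          go (inj₂ ≤T) = subst (λ z → ∣ z ∣ ℕ.≤ K₄ ℕ.* (d ℕ.* (T ℕ.* T))) (sym F≡)
              (proj₂ (ramp-sum′ ψ) {T} {u} {d} {M₁} (ℕP.m∸n≤m T (d ℕ.* M₀)) 1≤d (ℕP.≤-trans d≤ V³≤T) (ℕP.≤-trans T≤M₁ (ℕP.m≤n*m M₁ d {{ℕ.>-nonZero 1≤d}})))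
            where
            u : ℕ
            u = T ℕ.∸ d ℕ.* M₀
            shift : ∀ j → ramp T d (M₀ ℕ.+ j) ≡ ramp u d j
            shift = ramp-+ {T} {d} {M₀} {u} (ℕP.m+[n∸m]≡n ≤T)
            l = ring 2 λ s t → s :+ # 24 :* t ⊜ s :- # 4 :* (:- # 6 :* t)
            F≡ : F d ≡ + 4 * + 4 * ∑ M₁ (λ j → at ψ j * ramp u d j) - + 4 * (- + 6 * cube (+ u))
            F≡ = trans (cong₂ (λ s t → + 4 * + 4 * s + + 24 * t)
              (∑-cong M₁ (λ j → cong₂ _*_ (trans (cong (at ψ) (ℕP.+-comm M₀ j)) (periodic-* (ZeroSum.periodic ψ) (V ^ 5) j)) (shift j)))
              (trans (cong (ramp T d) (sym (ℕP.+-identityʳ M₀))) (trans (shift 0) (ramp-0 u d))))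
              (l (+ 4 * + 4 * ∑ M₁ (λ j → at ψ j * ramp u d j)) (cube (+ u)))

        S₃-bound : Bd V (1 ℕ.* (X ℕ.* K₄)) 22 S₃
        S₃-bound = bd (ℕP.≤-trans (∣∑∣≤-support B (V ^ 3) (X ℕ.* K₄ ℕ.* V ^ 19) term beyond)
            (pw-* {V} {K = 1} {L = X ℕ.* K₄} 3 19 (ℕP.≤-reflexive (sym (ℕP.*-identityˡ (V ^ 3)))) ℕP.≤-refl))
          where
          term : ∀ d → d ℕ.< V ^ 3 → ∣ at χ d * F d ∣ ℕ.≤ X ℕ.* K₄ ℕ.* V ^ 19
          term zero    _  = subst (λ z → ∣ z * F 0 ∣ ℕ.≤ X ℕ.* K₄ ℕ.* V ^ 19) (sym χ-0) ℕ.z≤n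
          term (suc d) d< = ℕP.≤-trans (ℕP.≤-reflexive (abs-* (at χ (suc d)) (F (suc d)))) (pw-* {V} {K = X} {L = K₄} 0 19
            (ℕP.≤-trans (proj₂ (ZeroSum.at-bounded χ) (suc d)) (ℕP.≤-reflexive (sym (ℕP.*-identityʳ X))))
            (ℕP.≤-trans (F-bound (suc d) (ℕ.s≤s ℕ.z≤n) (ℕP.<⇒≤ d<)) (pw-* {V} {K = K₄} {L = 1} 0 19 (ℕP.≤-reflexive (sym (ℕP.*-identityʳ K₄)))
              (pw-* {V} {K = 1} {L = 1} 3 16 (ℕP.≤-trans (ℕP.<⇒≤ d<) (ℕP.≤-reflexive (sym (ℕP.*-identityˡ (V ^ 3))))) (pw-* {V} {K = 1} {L = 1} 8 8 pT pT)))))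
          beyond : ∀ d → V ^ 3 ℕ.≤ d → at χ d * F d ≡ 0ℤ
          beyond d V³≤ = trans (cong (at χ d *_) (F-vanish d (ℕP.≤-trans T≤V³M₀ (ℕP.*-monoˡ-≤ M₀ V³≤)))) (*-zeroʳ (at χ d))

      weighted : ℤ
      weighted = ∑ B (λ d → at χ d * ∑ B (λ m → at ψ m * ramp T d m))

      private
        weighted≡ : weighted ≡ G₁ + G₂
        weighted≡ = begin
          weighted
            ≡⟨ ∑-cong B (λ d → trans (cong (at χ d *_) (∑-split M₀ M₁ (λ m → at ψ m * ramp T d m))) (*-distribˡ-+ (at χ d) _ _)) ⟩
          ∑ B (λ d → at χ d * ∑ M₀ (λ m → at ψ m * ramp T d m) + at χ d * ∑ M₁ (λ j → at ψ (M₀ ℕ.+ j) * ramp T d (M₀ ℕ.+ j)))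
            ≡⟨ ∑-+ B _ _ ⟩
          ∑ B (λ d → at χ d * ∑ M₀ (λ m → at ψ m * ramp T d m)) + G₂
            ≡⟨ cong (_+ G₂) (trans (∑-cong B (λ d → *-∑ M₀ (at χ d) (λ m → at ψ m * ramp T d m))) (trans (∑-swap B M₀ (λ d m → at χ d * (at ψ m * ramp T d m)))
                (∑-cong M₀ (λ m → trans (∑-cong B (λ d → trans (cong (λ z → at χ d * (at ψ m * z)) (ramp-comm T d m)) (l (at χ d) (at ψ m) (ramp T m d))))
                  (sym (*-∑ B (at ψ m) (λ d → at χ d * ramp T m d))))))) ⟩
          G₁ + G₂ ∎
          where
          open ≡-Reasoning
          l = ring 3 λ a b c → a :* (b :* c) ⊜ b :* (a :* c)

      -- Small m contribute 16 · 3 L and large m -24 L, together 24 L.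
      weighted-bound : Bd V weighted-K 23
        (+ 16 * (n * n * weighted) - + 24 * L)
      weighted-bound = subst (Bd V weighted-K 23) (sym total)
        (Bd-+ (Bd-- (Bd-scale (+ 16) (Bd-+ (Bd-scale Y′ (Bd-raise 1≤V (ℕP.m≤m+n 21 2) S₁-bound)) S₂-bound))
          (Bd-scale (+ 24) (Bd-raise 1≤V (ℕP.m≤m+n 21 2) E′-bound))) (Bd-scale (n * n) (Bd-raise 1≤V (ℕP.m≤m+n 22 1) S₃-bound)))
        where
        l₁ = ring 4 λ n g h L → # 16 :* (n :* n :* (g :+ h)) :- # 24 :* L ⊜ # 16 :* (n :* n :* g) :+ # 16 :* (n :* n :* h) :- # 24 :* L
        l₂ = ring 5 λ L a b e s → # 16 :* (# 3 :* L :+ a :+ b) :+ (:- # 24 :* (L :+ e) :+ s) :- # 24 :* L ⊜ # 16 :* (a :+ b) :- # 24 :* e :+ s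
        total : + 16 * (n * n * weighted) - + 24 * L ≡ + 16 * (Y′ * S₁ + S₂) - + 24 * E′ + n * n * S₃
        total = trans (cong (λ z → + 16 * (n * n * z) - + 24 * L) weighted≡) (trans (l₁ n G₁ G₂ L)
          (trans (cong₂ (λ s t → + 16 * s + t - + 24 * L) small large) (l₂ L (Y′ * S₁) S₂ E′ (n * n * S₃))))

-- Character sums over halves and quarters of a period.

module Character where

  open Normalisation using (ring; semiring; _⊜_; _:+_; _:-_; _:*_; :-_; #_)
  open import Data.Integer.Base hiding (suc; _%_; _/_; _^_)
  open ℤD
  open ℤP
  open import Data.List.Base using (_∷_; map; filter; foldr; applyUpTo)
  import Data.Nat.GCD as GCD
  open import Relation.Unary using (Pred; Decidable)
  open import Defs using (inSector?)
  open Sums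
  open Modular
  open Counting
  open Dirichlet

  ∑-parity : ∀ m (f : ℕ → ℤ) → ∑ (suc (m ℕ.+ m)) f ≡ f 0 + (∑ m (λ i → f (suc (i ℕ.+ i))) + ∑ m (λ i → f (suc i ℕ.+ suc i)))
  ∑-parity zero    f = trans (+-identityˡ (f 0)) (sym (+-identityʳ (f 0)))
  ∑-parity (suc m) f = trans (cong (λ k → ∑ k f) (cong suc (cong suc (ℕP.+-suc m m)))) (trans
    (cong (λ s → s + f (suc (m ℕ.+ m)) + f (suc (suc (m ℕ.+ m)))) (∑-parity m f))
    (trans (l (f 0) (∑ m (λ i → f (suc (i ℕ.+ i)))) (∑ m (λ i → f (suc i ℕ.+ suc i))) (f (suc (m ℕ.+ m))) (f (suc (suc (m ℕ.+ m)))))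
      (cong (λ k → f 0 + (∑ m (λ i → f (suc (i ℕ.+ i))) + f (suc (m ℕ.+ m)) + (∑ m (λ i → f (suc i ℕ.+ suc i)) + f k))) (cong suc (sym (ℕP.+-suc m m))))))
    where
    l = ring 5 λ z a b x y → z :+ (a :+ b) :+ x :+ y ⊜ z :+ (a :+ x :+ (b :+ y))

  ∑-filter : ∀ {P : Pred ℕ _} (P? : Decidable P) (g : ℕ → ℤ) n (k : ℕ → ℕ) →
    foldr _+_ 0ℤ (map g (filter P? (applyUpTo k n))) ≡ ∑ n (λ i → ⟦ P? (k i) ⟧ * g (k i))
  ∑-filter P? g zero    k = refl
  ∑-filter P? g (suc n) k = trans (go (P? (k 0)) refl) (sym (∑-cons n (λ i → ⟦ P? (k i) ⟧ * g (k i))))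
    where
    go : ∀ d → P? (k 0) ≡ d → foldr _+_ 0ℤ (map g (filter P? (k 0 ∷ applyUpTo (k ∘ suc) n))) ≡ ⟦ P? (k 0) ⟧ * g (k 0) + ∑ n (λ i → ⟦ P? (k (suc i)) ⟧ * g (k (suc i)))
    go (yes p) e rewrite e = cong₂ _+_ (sym (trans (cong (_* g (k 0)) (⟦⟧-yes (yes p) p)) (*-identityˡ (g (k 0))))) (∑-filter P? g n (k ∘ suc))
    go (no ¬p) e rewrite e = trans (∑-filter P? g n (k ∘ suc)) (sym (trans (cong (λ u → u * g (k 0) + S) (⟦⟧-no (no ¬p) ¬p)) (+-identityˡ S)))
      where
      S : ℤ
      S = ∑ n (λ i → ⟦ P? (k (suc i)) ⟧ * g (k (suc i)))

  -- For N = 4 c₁ + 3, the number N / 2 lies between m and m + 1, and N / 4 between c₁ and c₁ + 1.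
  module Odd (c₁ : ℕ) (N-sqfree : ∀ d → d ℕ.* d ℕD.∣ 3 ℕ.+ c₁ ℕ.* 4 → d ≡ 1) where

    N m : ℕ
    N = 3 ℕ.+ c₁ ℕ.* 4
    m = suc (c₁ ℕ.+ c₁)

    N+1 : suc N ≡ 4 ℕ.* suc c₁
    N+1 = l c₁
      where
      l = semiring 1 λ c → # 1 :+ (# 3 :+ c :* # 4) ⊜ # 4 :* (# 1 :+ c)

    open ClassCount N (suc c₁) N+1 N-sqfree public

    N≡ : N ≡ suc (m ℕ.+ m)
    N≡ = l c₁
      where
      l = semiring 1 λ c → # 3 :+ c :* # 4 ⊜ # 1 :+ (# 1 :+ (c :+ c) :+ (# 1 :+ (c :+ c)))

    χ-neg : ∀ {x y} → x ℕ.+ y ≡ N → χ y ≡ - χ x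
    χ-neg {x} {y} e = trans (χ-cong y (N-1 ℕ.* x) (mod (1ℤ - + x) y≡)) (trans (χ-* N-1 x)
        (trans (cong (_* χ x) (χ-neg1 {N-1} (mod 1ℤ (l₁ (+ N-1))))) (-1*i≡-i (χ x))))
      where
      N-1 : ℕ
      N-1 = 2 ℕ.+ c₁ ℕ.* 4
      l₁ = ring 1 λ n → n ⊜ (:- # 1) :+ # 1 :* (# 1 :+ n)
      l₂ : ∀ x y n → n + 1ℤ ≡ x + y → y ≡ n * x + (1ℤ - x) * (1ℤ + n)
      l₂ x y n e = trans (l₃ x y) (trans (cong (_- x) (sym e)) (l₄ x n))
        where
        l₃ = ring 2 λ x y → y ⊜ x :+ y :- x
        l₄ = ring 2 λ x n → n :+ # 1 :- x ⊜ n :* x :+ (# 1 :- x) :* (# 1 :+ n)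
      y≡ : + y ≡ + (N-1 ℕ.* x) + (1ℤ - + x) * + N
      y≡ = trans (l₂ (+ x) (+ y) (+ N-1) (trans (+-comm (+ N-1) 1ℤ) (cong +_ (sym e)))) (cong (_+ (1ℤ - + x) * + N) (sym (pos-* N-1 x)))

    χ-periodic : Periodic N χ
    χ-periodic x = χ-cong (x ℕ.+ N) x (mod 1ℤ (cong (_+_ (+ x)) (sym (*-identityˡ (+ N)))))

    χ-0 : χ 0 ≡ 0ℤ
    χ-0 = self-neg (trans (sym (χ-periodic 0)) (χ-neg {0} {N} refl))
      where
      self-neg : ∀ {z} → z ≡ - z → z ≡ 0ℤ
      self-neg {+ zero} _ = refl
      self-neg {+ suc _} ()
      self-neg { -[1+ _ ]} ()

    ∑-χ-pair : ∀ (g : ℕ → ℤ) → ∑ N (λ x → χ x * g x) ≡ ∑ m (λ i → χ (suc i) * (g (suc i) - g (N ℕ.∸ suc i)))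
    ∑-χ-pair g = begin
      ∑ N F ≡⟨ cong (λ k → ∑ k F) N≡ ⟩
      ∑ (suc (m ℕ.+ m)) F ≡⟨ ∑-cons (m ℕ.+ m) F ⟩
      F 0 + ∑ (m ℕ.+ m) (F ∘ suc) ≡⟨ cong₂ _+_ (cong (_* g 0) χ-0) (∑-split m m (F ∘ suc)) ⟩
      0ℤ + (∑ m (F ∘ suc) + ∑ m (λ i → F (suc (m ℕ.+ i)))) ≡⟨ +-identityˡ _ ⟩
      ∑ m (F ∘ suc) + ∑ m (λ i → F (suc (m ℕ.+ i))) ≡⟨ cong (_+_ (∑ m (F ∘ suc))) (sym (∑-reverse m (λ i → F (suc (m ℕ.+ i))))) ⟩
      ∑ m (F ∘ suc) + ∑ m (λ i → F (suc (m ℕ.+ (m ℕ.∸ suc i)))) ≡⟨ sym (∑-+ m _ _) ⟩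
      ∑ m (λ i → F (suc i) + F (suc (m ℕ.+ (m ℕ.∸ suc i)))) ≡⟨ ∑-cong< m (λ i i< → trans
        (cong₂ (λ u k → F (suc i) + u * g k) (χ-neg {suc i} (opposite i<)) (trans (sym (ℕP.m+n∸m≡n (suc i) _)) (cong (ℕ._∸ suc i) (opposite i<))))
        (l (χ (suc i)) (g (suc i)) (g (N ℕ.∸ suc i)))) ⟩
      ∑ m (λ i → χ (suc i) * (g (suc i) - g (N ℕ.∸ suc i))) ∎
      where
      open ≡-Reasoning
      F : ℕ → ℤ
      F x = χ x * g x
      opposite : ∀ {i} → i ℕ.< m → suc i ℕ.+ suc (m ℕ.+ (m ℕ.∸ suc i)) ≡ N
      opposite {i} i< = trans (l₁ i m (m ℕ.∸ suc i)) (trans (cong (λ k → suc (m ℕ.+ k)) (ℕP.m+[n∸m]≡n i<)) (sym N≡))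
        where
        l₁ = semiring 3 λ i m k → # 1 :+ i :+ (# 1 :+ (m :+ k)) ⊜ # 1 :+ (m :+ (# 1 :+ i :+ k))
      l = ring 3 λ x g h → x :* g :+ :- x :* h ⊜ x :* (g :- h)

    ∑-χ : ∑ N χ ≡ 0ℤ
    ∑-χ = trans (∑-cong N (λ x → sym (*-identityʳ (χ x)))) (trans (∑-χ-pair (λ _ → 1ℤ))
      (∑-vanish m (λ i _ → *-zeroʳ (χ (suc i)))))

    character : ZeroSum N
    character = zeroSum χ χ-periodic ∑-χ

    Σxχ A Bs E₀ E₁ Y : ℤ
    Σxχ = ∑ N (λ x → χ x * + x)
    A = ∑ m (χ ∘ suc)
    Bs = ∑ m (λ i → χ (suc i) * + suc i)
    E₀ = ∑ c₁ (χ ∘ suc)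
    E₁ = ∑ (suc c₁) (λ i → χ (suc (c₁ ℕ.+ i)))
    Y = ZeroSum.prefixSum character

    private
      linear : ∀ a b → ∑ m (λ i → χ (suc i) * (a * + suc i - b)) ≡ a * Bs - b * A
      linear a b = trans (∑-cong m (λ i → l (χ (suc i)) a (+ suc i) b)) (trans (∑-- m _ _)
          (cong₂ _-_ (sym (*-∑ m a _)) (sym (*-∑ m b _))))
        where
        l = ring 4 λ x a i b → x :* (a :* i :- b) ⊜ a :* (x :* i) :- b :* x

      χ-double : ∀ y → χ (y ℕ.+ y) ≡ χ 2 * χ y
      χ-double y = trans (cong (λ k → χ (y ℕ.+ k)) (sym (ℕP.+-identityʳ y))) (χ-* 2 y)

    -- Summation by parts against x, whose differences are -1; the boundary term contains a full
    -- period of χ.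
    Y≡-Σxχ : Y ≡ - Σxχ
    Y≡-Σxχ = begin
      ∑ N (λ j → prefix (suc j)) ≡⟨ ∑-cong N (λ j → l (prefix (suc j)) (+ j)) ⟩
      ∑ N (λ j → - (prefix (suc j) * (+ j - + suc j))) ≡⟨ ∑-neg N _ ⟩
      - ∑ N (λ j → prefix (suc j) * (+ j - + suc j)) ≡⟨ cong -_ (sym (+-identityˡ _)) ⟩
      - (0ℤ * + N + ∑ N (λ j → prefix (suc j) * (+ j - + suc j))) ≡⟨ cong (λ z → - (z * + N + ∑ N (λ j → prefix (suc j) * (+ j - + suc j)))) (sym ∑-χ) ⟩
      - (∑ N χ * + N + ∑ N (λ j → prefix (suc j) * (+ j - + suc j))) ≡⟨ cong -_ (sym (by-parts N χ (λ x → + x))) ⟩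
      - Σxχ ∎
      where
      open ≡-Reasoning
      prefix : ℕ → ℤ
      prefix = ZeroSum.prefix character
      l = ring 2 λ p j → p ⊜ :- (p :* (j :- (# 1 :+ j)))

    Σxχ-half : Σxχ ≡ + 2 * Bs - + N * A
    Σxχ-half = trans (∑-χ-pair (λ x → + x)) (trans (∑-cong< m (λ i i< → cong (χ (suc i) *_)
        (trans (cong (_-_ (+ suc i)) (sym (⊖-≥ (i≤N i<)))) (trans (cong (_-_ (+ suc i)) (sym (m-n≡m⊖n N (suc i)))) (l (+ suc i) (+ N))))))
        (linear (+ 2) (+ N)))
      where
      i≤N : ∀ {i} → i ℕ.< m → suc i ℕ.≤ N
      i≤N i< = ℕP.≤-trans i< (ℕP.≤-trans (ℕP.m≤n+m m (suc m)) (ℕP.≤-reflexive (sym N≡)))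
      l = ring 2 λ i n → i :- (n :- i) ⊜ # 2 :* i :- n

    -- Every odd x below N is N - 2 y with 1 ≤ y ≤ m, so each y contributes χ(2 y) 2 y - χ(2 y) (N -
    -- 2 y) = χ(2) χ(y) (4 y - N).
    Σxχ-double : Σxχ ≡ χ 2 * (+ 4 * Bs - + N * A)
    Σxχ-double = begin
      ∑ N F ≡⟨ cong (λ k → ∑ k F) N≡ ⟩
      ∑ (suc (m ℕ.+ m)) F ≡⟨ ∑-parity m F ⟩
      F 0 + (∑ m (λ i → F (suc (i ℕ.+ i))) + ∑ m (λ i → F (suc i ℕ.+ suc i)))
        ≡⟨ cong₂ (λ u v → u + (v + ∑ m (λ i → F (suc i ℕ.+ suc i)))) (*-zeroʳ (χ 0)) (sym (∑-reverse m (λ i → F (suc (i ℕ.+ i))))) ⟩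
      0ℤ + (∑ m (λ i → F (odd′ i)) + ∑ m (λ i → F (suc i ℕ.+ suc i))) ≡⟨ trans (+-identityˡ _) (sym (∑-+ m _ _)) ⟩
      ∑ m (λ i → F (odd′ i) + F (suc i ℕ.+ suc i)) ≡⟨ ∑-cong< m term ⟩
      ∑ m (λ i → χ 2 * (χ (suc i) * (+ 4 * + suc i - + N))) ≡⟨ sym (*-∑ m (χ 2) _) ⟩
      χ 2 * ∑ m (λ i → χ (suc i) * (+ 4 * + suc i - + N)) ≡⟨ cong (χ 2 *_) (linear (+ 4) (+ N)) ⟩
      χ 2 * (+ 4 * Bs - + N * A) ∎
      where
      open ≡-Reasoning
      F : ℕ → ℤ
      F x = χ x * + x
      odd′ : ℕ → ℕ
      odd′ i = suc (m ℕ.∸ suc i ℕ.+ (m ℕ.∸ suc i))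
      opposite : ∀ {i} → i ℕ.< m → suc i ℕ.+ suc i ℕ.+ odd′ i ≡ N
      opposite {i} i< = trans (l (suc i) (m ℕ.∸ suc i)) (trans (cong (λ k → suc (k ℕ.+ k)) (ℕP.m+[n∸m]≡n i<)) (sym N≡))
        where
        l = semiring 2 λ i k → i :+ i :+ (# 1 :+ (k :+ k)) ⊜ # 1 :+ (i :+ k :+ (i :+ k))
      term : ∀ i → i ℕ.< m → F (odd′ i) + F (suc i ℕ.+ suc i) ≡ χ 2 * (χ (suc i) * (+ 4 * + suc i - + N))
      term i i< = trans (cong₂ (λ u v → u * + odd′ i + v * + (suc i ℕ.+ suc i)) (trans (χ-neg {suc i ℕ.+ suc i} (opposite i<)) (cong -_ (χ-double (suc i)))) (χ-double (suc i)))
          (trans (l (χ 2) (χ (suc i)) (+ suc i) (+ odd′ i)) (cong (λ z → χ 2 * (χ (suc i) * (+ 4 * + suc i - z))) (cong +_ (opposite i<))))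
        where
        l = ring 4 λ t x i o → :- (t :* x) :* o :+ t :* x :* (i :+ i) ⊜ t :* (x :* (# 4 :* i :- (i :+ i :+ o)))

    A-split : A ≡ E₀ + E₁
    A-split = trans (cong (λ k → ∑ k (χ ∘ suc)) (sym (ℕP.+-suc c₁ c₁))) (∑-split c₁ (suc c₁) (χ ∘ suc))

    -- The even x below N / 2 are the 2 y with y < N / 4; the odd ones are the N - 2 y with N / 4 <
    -- y < N / 2.
    A-double : A ≡ χ 2 * (E₀ - E₁)
    A-double = begin
      ∑ (suc (c₁ ℕ.+ c₁)) (χ ∘ suc) ≡⟨ ∑-parity c₁ (χ ∘ suc) ⟩
      χ 1 + (∑ c₁ (λ i → χ (2 ℕ.+ (i ℕ.+ i))) + ∑ c₁ (λ i → χ (suc (suc i ℕ.+ suc i))))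
        ≡⟨ l₁ (χ 1) (∑ c₁ (λ i → χ (2 ℕ.+ (i ℕ.+ i)))) (∑ c₁ (λ i → χ (suc (suc i ℕ.+ suc i)))) ⟩
      ∑ c₁ (λ i → χ (2 ℕ.+ (i ℕ.+ i))) + (χ 1 + ∑ c₁ (λ i → χ (suc (suc i ℕ.+ suc i))))
        ≡⟨ cong₂ _+_ (∑-cong c₁ (λ i → trans (cong (λ k → χ (suc k)) (sym (ℕP.+-suc i i))) (χ-double (suc i)))) (sym (∑-cons c₁ (λ i → χ (suc (i ℕ.+ i))))) ⟩
      ∑ c₁ (λ i → χ 2 * χ (suc i)) + ∑ (suc c₁) (λ i → χ (suc (i ℕ.+ i)))
        ≡⟨ cong₂ _+_ (sym (*-∑ c₁ (χ 2) (χ ∘ suc))) (trans (sym (∑-reverse (suc c₁) (λ i → χ (suc (i ℕ.+ i))))) (∑-cong< (suc c₁) term)) ⟩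
      χ 2 * E₀ + ∑ (suc c₁) (λ i → - χ 2 * χ (suc (c₁ ℕ.+ i))) ≡⟨ cong (_+_ (χ 2 * E₀)) (sym (*-∑ (suc c₁) (- χ 2) (λ i → χ (suc (c₁ ℕ.+ i))))) ⟩
      χ 2 * E₀ + - χ 2 * E₁ ≡⟨ l₂ (χ 2) E₀ E₁ ⟩
      χ 2 * (E₀ - E₁) ∎
      where
      open ≡-Reasoning
      l₁ = ring 3 λ a b c → a :+ (b :+ c) ⊜ b :+ (a :+ c)
      l₂ = ring 3 λ t x y → t :* x :+ :- t :* y ⊜ t :* (x :- y)
      term : ∀ i → i ℕ.< suc c₁ → χ (suc (suc c₁ ℕ.∸ suc i ℕ.+ (suc c₁ ℕ.∸ suc i))) ≡ - χ 2 * χ (suc (c₁ ℕ.+ i))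
      term i i< = trans (χ-neg {y ℕ.+ y} sum≡) (trans (cong -_ (χ-double y)) (neg-distribˡ-* (χ 2) (χ y)))
        where
        y k : ℕ
        y = suc (c₁ ℕ.+ i)
        k = c₁ ℕ.∸ i
        sum≡ : y ℕ.+ y ℕ.+ suc (k ℕ.+ k) ≡ N
        sum≡ = trans (l c₁ i k) (trans (cong (λ z → 3 ℕ.+ (c₁ ℕ.+ c₁ ℕ.+ (z ℕ.+ z))) (ℕP.m+[n∸m]≡n (ℕ.s≤s⁻¹ i<))) (l′ c₁))
          where
          l = semiring 3 λ c i k → # 1 :+ (c :+ i) :+ (# 1 :+ (c :+ i)) :+ (# 1 :+ (k :+ k)) ⊜ # 3 :+ (c :+ c :+ (i :+ k :+ (i :+ k)))
          l′ = semiring 1 λ c → # 3 :+ (c :+ c :+ (c :+ c)) ⊜ # 3 :+ c :* # 4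

    module _ {H : ℤ} (NH : + N * H ≡ Y) where

      private
        cancel : ∀ k .{{_ : NonZero k}} {x y} → k * x ≡ k * y → x ≡ y
        cancel k {x} {y} e = *-cancelˡ-≡ k x y e

        Nx : ∀ {x y} → + N * x ≡ + N * y → x ≡ y
        Nx = cancel (+ N)

        NH≡ : + N * H ≡ - Σxχ
        NH≡ = trans NH Y≡-Σxχ

      -- The two expressions for `A` give `E₁` = 0 and those for `Σxχ` give `Bs` = 0, whence N `A` =
      -- - `Σxχ` = N H.
      E-split : χ 2 ≡ 1ℤ → E₀ ≡ H × E₁ ≡ 0ℤ
      E-split t = trans (trans (l₁ E₀) (trans (cong (_+_ E₀) (sym E₁≡0)) (sym A-split))) A≡H , E₁≡0
        where
        l₁ = ring 1 λ x → x ⊜ x :+ # 0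
        E₁≡0 : E₁ ≡ 0ℤ
        E₁≡0 = cancel (+ 2) (trans (l E₀ E₁) (trans (cong (_- (E₀ - E₁)) (trans (sym A-split) (trans A-double (trans (cong (_* (E₀ - E₁)) t) (*-identityˡ (E₀ - E₁)))))) (+-inverseʳ (E₀ - E₁))))
          where
          l = ring 2 λ x y → # 2 :* y ⊜ x :+ y :- (x :- y)
        Bs≡0 : Bs ≡ 0ℤ
        Bs≡0 = cancel (+ 2) (trans (l Bs (+ N * A)) (trans (cong (_- (+ 2 * Bs - + N * A)) (trans (sym (*-identityˡ _)) (trans (cong (_* (+ 4 * Bs - + N * A)) (sym t)) (trans (sym Σxχ-double) Σxχ-half)))) (+-inverseʳ (+ 2 * Bs - + N * A))))
          where
          l = ring 2 λ b a → # 2 :* b ⊜ # 4 :* b :- a :- (# 2 :* b :- a)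
        A≡H : A ≡ H
        A≡H = Nx (trans (l (+ N * A)) (trans (cong (λ z → - (+ 2 * z - + N * A)) (sym Bs≡0)) (trans (cong -_ (sym Σxχ-half)) (sym NH≡))))
          where
          l = ring 1 λ a → a ⊜ :- (# 2 :* # 0 :- a)

      -- Here the two expressions for `A` give `E₀` = 0. Eliminating `Bs` from those for `Σxχ`
      -- leaves N `A` = -3 `Σxχ`.
      E-inert : χ 2 ≡ -1ℤ → E₀ ≡ 0ℤ × E₁ ≡ + 3 * H
      E-inert t = E₀≡0 , trans (sym (trans A-split (trans (cong (_+ E₁) E₀≡0) (+-identityˡ E₁)))) A≡3H
        where
        E₀≡0 : E₀ ≡ 0ℤ
        E₀≡0 = cancel (+ 2) (trans (l E₀ E₁) (trans (cong (_- (-1ℤ * (E₀ - E₁))) (trans (sym A-split) (trans A-double (cong (_* (E₀ - E₁)) t)))) (+-inverseʳ (-1ℤ * (E₀ - E₁)))))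
          where
          l = ring 2 λ x y → # 2 :* x ⊜ x :+ y :- (:- # 1) :* (x :- y)
        A≡3H : A ≡ + 3 * H
        A≡3H = Nx (trans (l₁ (+ N) A Bs) (trans (cong₂ (λ u v → - (+ 2 * u + v)) (sym Σxχ-half) (trans (cong (_* (+ 4 * Bs - + N * A)) (sym t)) (sym Σxχ-double)))
            (trans (l₂ Σxχ) (trans (cong (+ 3 *_) (sym NH≡)) (l₃ (+ N) H)))))
          where
          l₁ = ring 3 λ n a b → n :* a ⊜ :- (# 2 :* (# 2 :* b :- n :* a) :+ (:- # 1) :* (# 4 :* b :- n :* a))
          l₂ = ring 1 λ s → :- (# 2 :* s :+ s) ⊜ # 3 :* :- s
          l₃ = ring 2 λ n h → # 3 :* (n :* h) ⊜ n :* (# 3 :* h)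

    χ-noncoprime : ∀ {x} → ¬ Coprime x N → χ x ≡ 0ℤ
    χ-noncoprime {x} ¬cop with GCD.gcd x N in e
    ... | zero = contradiction (GCD.gcd[m,n]≡0⇒n≡0 x e) λ ()
    ... | suc zero = ⊥-elim (¬cop (gcd≡1⇒coprime e))
    ... | suc (suc g) with prime-divisor (suc (suc g)) (ℕ.s≤s (ℕ.s≤s ℕ.z≤n))
    ...   | p , pr , p∣g = χ-prime-∣ pr (ℕD.∣-trans (subst (p ℕD.∣_) (sym e) p∣g) (GCD.gcd[m,n]∣n x N))
              (ℕD.∣-trans (subst (p ℕD.∣_) (sym e) p∣g) (GCD.gcd[m,n]∣m x N))

    private
      sum : ℕ → ℤ
      sum r = foldr _+_ 0ℤ (map χ (filter (inSector? N r 4) (applyUpTo suc N)))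

      sum≡ : ∀ r → sum r ≡ ∑ N (λ i → ⟦ inSector? N r 4 (suc i) ⟧ * χ (suc i))
      sum≡ r = ∑-filter (inSector? N r 4) χ N suc

      -- For x not prime to N both sides are 0.
      inside : ∀ r x → r ℕ.* N ℕ.< 4 ℕ.* x → 4 ℕ.* x ℕ.< suc r ℕ.* N → ⟦ inSector? N r 4 x ⟧ * χ x ≡ χ x
      inside r x l u = go (coprime? x N)
        where
        go : Dec (Coprime x N) → ⟦ inSector? N r 4 x ⟧ * χ x ≡ χ x
        go (yes cop) = trans (cong (_* χ x) (⟦⟧-yes (inSector? N r 4 x) (l , u , cop))) (*-identityˡ (χ x))
        go (no ¬cop) = trans (cong (⟦ inSector? N r 4 x ⟧ *_) (χ-noncoprime ¬cop)) (trans (*-zeroʳ ⟦ inSector? N r 4 x ⟧) (sym (χ-noncoprime ¬cop)))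

      outside : ∀ r x → ¬ (r ℕ.* N ℕ.< 4 ℕ.* x × 4 ℕ.* x ℕ.< suc r ℕ.* N) → ⟦ inSector? N r 4 x ⟧ * χ x ≡ 0ℤ
      outside r x ¬lu = cong (_* χ x) (⟦⟧-no (inSector? N r 4 x) (λ (l , u , _) → ¬lu (l , u)))

      4*≤ : ∀ {x y} → x ℕ.≤ y → 4 ℕ.* x ℕ.≤ 4 ℕ.* y
      4*≤ = ℕP.*-monoʳ-≤ 4

    sector-0 : sum 0 ≡ E₀
    sector-0 = trans (sum≡ 0) (trans (∑-extend {c₁} {N} _ (ℕP.≤-trans (ℕP.m≤m*n c₁ 4) (ℕP.m≤n+m (c₁ ℕ.* 4) 3))
        (λ i c₁≤i _ → outside 0 (suc i) (λ (_ , u) → ℕP.<⇒≱ u (ℕP.≤-trans (ℕP.≤-trans (ℕP.≤-reflexive (ℕP.*-identityˡ N)) (ℕP.≤-trans (ℕP.n≤1+n N) (ℕP.≤-reflexive N+1))) (4*≤ (ℕ.s≤s c₁≤i))))))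
      (∑-cong< c₁ (λ i i< → inside 0 (suc i) (ℕ.s≤s ℕ.z≤n) (ℕP.≤-<-trans (4*≤ i<) (ℕP.<-≤-trans (ℕP.≤-<-trans (ℕP.≤-reflexive (ℕP.*-comm 4 c₁)) (ℕP.m<n+m (c₁ ℕ.* 4) {3} (ℕ.s≤s ℕ.z≤n))) (ℕP.≤-reflexive (sym (ℕP.*-identityˡ N))))))))

    sector-1 : sum 1 ≡ E₁
    sector-1 = trans (sum≡ 1) (trans (∑-extend {c₁ ℕ.+ suc c₁} {N} g
          (ℕP.≤-trans (ℕP.m≤m+n (c₁ ℕ.+ suc c₁) (2 ℕ.+ (c₁ ℕ.+ c₁))) (ℕP.≤-reflexive (l₁ c₁)))
          (λ i m≤i _ → outside 1 (suc i) (λ (_ , u) → ℕP.<⇒≱ u (ℕP.≤-trans (ℕP.≤-trans (ℕP.m≤m+n (2 ℕ.* N) 2) (ℕP.≤-reflexive (l₂ c₁))) (4*≤ (ℕ.s≤s m≤i))))))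
        (trans (∑-split c₁ (suc c₁) g) (trans (cong₂ _+_
          (∑-vanish c₁ (λ i i< → outside 1 (suc i) (λ (l , _) → ℕP.<⇒≱ l (ℕP.≤-trans (4*≤ i<) (ℕP.≤-trans (ℕP.≤-trans (ℕP.≤-reflexive (ℕP.*-comm 4 c₁)) (ℕP.m≤n+m (c₁ ℕ.* 4) 3)) (ℕP.≤-reflexive (sym (ℕP.*-identityˡ N))))))))
          (∑-cong< (suc c₁) (λ i i< → inside 1 (suc (c₁ ℕ.+ i))
            (ℕP.<-≤-trans (ℕP.≤-<-trans (ℕP.≤-reflexive (ℕP.*-identityˡ N)) (ℕP.≤-reflexive N+1)) (4*≤ (ℕ.s≤s (ℕP.m≤m+n c₁ i))))
            (ℕP.≤-<-trans (4*≤ (ℕ.s≤s (ℕP.+-monoʳ-≤ c₁ (ℕ.s≤s⁻¹ i<)))) (ℕP.<-≤-trans (ℕP.m<m+n (4 ℕ.* suc (c₁ ℕ.+ c₁)) {2} (ℕ.s≤s ℕ.z≤n)) (ℕP.≤-reflexive (l₃ c₁)))))))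
          (+-identityˡ E₁))))
      where
      g : ℕ → ℤ
      g i = ⟦ inSector? N 1 4 (suc i) ⟧ * χ (suc i)
      l₁ = semiring 1 λ c → c :+ (# 1 :+ c) :+ (# 2 :+ (c :+ c)) ⊜ # 3 :+ c :* # 4
      l₂ = semiring 1 λ c → # 2 :* (# 3 :+ c :* # 4) :+ # 2 ⊜ # 4 :* (# 1 :+ (c :+ (# 1 :+ c)))
      l₃ = semiring 1 λ c → # 4 :* (# 1 :+ (c :+ c)) :+ # 2 ⊜ # 2 :* (# 3 :+ c :* # 4)

-- The class number formula.

module ClassNumber where

  open Normalisation using (ring; semiring; _⊜_; _:+_; _:-_; _:*_; :-_; #_)
  open import Data.Integer.Base hiding (suc; _%_; _/_; _^_)
  open ℤP
  open import Data.Nat.Base using (_^_)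
  open import Defs using (IsClassNumber)
  open Sums
  open Modular
  open Bounds
  open Ideals
  open VectorCount
  open Lattice
  open Dirichlet
  open Character

  sumℕ : ℕ → (ℕ → ℕ) → ℕ
  sumℕ zero    K = 0
  sumℕ (suc n) K = sumℕ n K ℕ.+ K n

  Bd-∑-family : ∀ {S e} n {f : ℕ → ℤ} (K : ℕ → ℕ) → (∀ k → Bd S (K k) e (f k)) → Bd S (sumℕ n K) e (∑ n f)
  Bd-∑-family zero    K h = bd ℕ.z≤n
  Bd-∑-family (suc n) K h = Bd-+ (Bd-∑-family n K h) (h n)

  Bd-^ : ∀ S m {K e x} → Bd (S ^ m) K e x → Bd S K (m ℕ.* e) x
  Bd-^ S m {K} {e} (bd p) = bd (ℕP.≤-trans p (ℕP.≤-reflexive (cong (K ℕ.*_) (ℕP.^-*-assoc S m e))))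

  module _ {D : ℤ} {h : ℕ} (c₁ : ℕ) (N-sqfree : ∀ d → d ℕ.* d ℕD.∣ 3 ℕ.+ c₁ ℕ.* 4 → d ≡ 1)
    (D≡ : D ≡ 1ℤ - + 4 * + suc c₁) (4<N : 4 ℕ.< 3 ℕ.+ c₁ ℕ.* 4) (inv : IsClassNumber D h) where

    open Odd c₁ N-sqfree hiding (f; ρ; rootOf)
    open FormCount {D} N (suc c₁) D≡ +N N-sqfree 4<N hiding (ρ; rootOf)
    open Representatives inv
    module FS = FormSum {D} N (suc c₁) D≡ +N N-sqfree 4<N

    abstract
      -- Sealed, so that type checking does not unfold these large polynomials in the coefficients
      -- of the form; what matters is that they do not depend on S.
      scaling-K : ℕ → ℕ
      scaling-K k = proj₁ (FS.scaling-bound (F k))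

      scaling : ∀ k {S} → 1 ℕ.≤ S → Bd S (scaling-K k) 5
        (+ 4 * box₂ (FS.μ (F k) ℕ.* S) (λ x y → cube⁺ (+ (S ℕ.* S) - + 4 * Q (F k) x y)) - box₂ (FS.μ (F k) ℕ.* S) (λ x y → cube⁺ (+ (S ℕ.* S) - Q (F k) x y)))
      scaling k = proj₂ (FS.scaling-bound (F k))

    module At {V : ℕ} (2≤V : 2 ℕ.≤ V) where

      S T M₁ b B : ℕ
      S = V ^ 4
      T = S ℕ.* S
      -- Chosen so that B = 4 N (V⁵ + T): a multiple of N balances χ, and a multiple of 4 fits ψ.
      M₁ = T ℕ.* 4 ℕ.+ (2 ℕ.+ c₁ ℕ.* 4) ℕ.* ((V ^ 5 ℕ.+ T) ℕ.* 4)
      b = N ℕ.* (V ^ 5 ℕ.+ T)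
      B = V ^ 5 ℕ.* 4 ℕ.+ M₁

      T≡ : V ^ 8 ≡ T
      T≡ = ℕP.^-distribˡ-+-* V 4 4

      1≤V : 1 ℕ.≤ V
      1≤V = ℕP.≤-trans (ℕ.s≤s ℕ.z≤n) 2≤V

      1≤S : 1 ℕ.≤ S
      1≤S = ℕP.m^n>0 V {{ℕ.>-nonZero 1≤V}} 4

      1≤T : 1 ℕ.≤ T
      1≤T = ℕP.*-mono-≤ 1≤S 1≤S

      T≤M₁ : T ℕ.≤ M₁
      T≤M₁ = ℕP.≤-trans (ℕP.m≤m*n T 4) (ℕP.m≤m+n (T ℕ.* 4) _)

      T≤B : T ℕ.≤ B
      T≤B = ℕP.≤-trans T≤M₁ (ℕP.m≤n+m M₁ (V ^ 5 ℕ.* 4))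

      B≡4b : B ≡ b ℕ.* 4
      B≡4b = l (V ^ 5) T (2 ℕ.+ c₁ ℕ.* 4)
        where
        l = semiring 3 λ v t n → v :* # 4 :+ (t :* # 4 :+ n :* ((v :+ t) :* # 4)) ⊜ (# 1 :+ n) :* (v :+ t) :* # 4

      ∑χ-B : ∑ B χ ≡ 0ℤ
      ∑χ-B = trans (cong (λ k → ∑ k χ) (trans B≡4b (l (V ^ 5 ℕ.+ T) N))) (periodic-* (ZeroSum.prefix-periodic character) ((V ^ 5 ℕ.+ T) ℕ.* 4) 0)
        where
        l = semiring 2 λ v n → n :* v :* # 4 ⊜ v :* # 4 :* n

      W : ℕ → ℕ → ℤ
      W t n = cube⁺ (+ T - + t * + n)

      W-vanish : ∀ t {n} → T ℕ.≤ t ℕ.* n → W t n ≡ 0ℤ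
      W-vanish t {n} T≤ = cube⁺-nonpos (i≤j⇒i-j≤0 (≤-trans (+≤+ T≤) (≤-reflexive (pos-* t n))))

      W-0 : ∀ t → W t 0 ≡ cube (+ T)
      W-0 t = cong cube⁺ (trans (cong (_-_ (+ T)) (*-zeroʳ (+ t))) (+-identityʳ (+ T)))

      open Count h F cover distinct (λ k → FS.μ (F k) ℕ.* S) T (λ k x y → FS.in-box (F k) {S} x y)
      open Convolution B

      formSum : ℕ → ℕ → ℤ
      formSum t k = box₂ (FS.μ (F k) ℕ.* S) (λ x y → cube⁺ (+ T - + t * Q (F k) x y))

      D[_] : ℕ → ℤ
      D[ t ] = ∑ B (λ d → χ d * ∑ B (λ e → W t (d ℕ.* e)))

      -- Sorts lattice points by the value of the form; from T on the weight is 0.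
      by-value : ∀ t → 1 ℕ.≤ t → ∀ k x y → cube⁺ (+ T - + t * Q (F k) x y) ≡ ∑ T (λ i → W t i * ⟦ Q (F k) x y ≟ + i ⟧)
      by-value t 1≤t k x y = go (Q (F k) x y) (0≤Q (F k) x y)
        where
        go : ∀ q → 0ℤ ≤ q → cube⁺ (+ T - + t * q) ≡ ∑ T (λ i → W t i * ⟦ q ≟ + i ⟧)
        go (+ q) _ = at (ℕP.<-≤-connex q T)
          where
          off : ∀ i → i ≢ q → W t i * ⟦ + q ≟ + i ⟧ ≡ 0ℤ
          off i i≢ = trans (cong (W t i *_) (⟦⟧-no (+ q ≟ + i) (λ e → i≢ (sym (+-injective e))))) (*-zeroʳ (W t i))
          at : q ℕ.< T ⊎ T ℕ.≤ q → W t q ≡ ∑ T (λ i → W t i * ⟦ + q ≟ + i ⟧)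
          at (inj₁ q<T) = sym (trans (∑-collapse T (λ i → W t i * ⟦ + q ≟ + i ⟧) q<T (λ i _ → off i))
            (trans (cong (W t q *_) (⟦⟧-yes (+ q ≟ + q) refl)) (*-identityʳ (W t q))))
          at (inj₂ T≤q) = trans (W-vanish t {q} (ℕP.≤-trans T≤q (ℕP.m≤n*m q t {{ℕ.>-nonZero 1≤t}})))
            (sym (∑-vanish T (λ i i<T → off i (ℕP.<⇒≢ (ℕP.<-≤-trans i<T T≤q)))))
        go -[1+ _ ] ()

      -- Terms n = 0 of the divisor sums carry χ (0) or a full period of χ.
      divisor-sum : ∀ t → 1 ℕ.≤ t → ∑ T (off-zero (λ i → W t i * τ i)) ≡ D[ t ]
      divisor-sum t 1≤t = begin
        ∑ T (off-zero (λ i → W t i * τ i))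
          ≡⟨ ∑-cong T (λ i → trans (g* i) (trans (*-∑ B (g i) _) (∑-cong B (λ d → *-∑ B (g i) (λ e → ⟦ d ℕ.* e ℕP.≟ i ⟧ * χ d))))) ⟩
        ∑ T (λ i → ∑ B (λ d → ∑ B (λ e → g i * (⟦ d ℕ.* e ℕP.≟ i ⟧ * χ d))))
          ≡⟨ trans (∑-swap T B (λ i d → ∑ B (λ e → g i * (⟦ d ℕ.* e ℕP.≟ i ⟧ * χ d)))) (∑-cong B (λ d → trans (∑-swap T B (λ i e → g i * (⟦ d ℕ.* e ℕP.≟ i ⟧ * χ d)))
               (∑-cong B (λ e → value d e)))) ⟩
        ∑ B (λ d → ∑ B (λ e → χ d * g (d ℕ.* e)))
          ≡⟨ ∑-cong B restore ⟩
        ∑ B (λ d → χ d * ∑ B (λ e → W t (d ℕ.* e)) - χ d * T³)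
          ≡⟨ trans (∑-- B _ _) (cong (_-_ D[ t ]) (trans (sym (∑-* B T³ χ)) (cong (_* T³) ∑χ-B))) ⟩
        D[ t ] - 0ℤ * T³
          ≡⟨ +-identityʳ D[ t ] ⟩
        D[ t ] ∎
        where
        open ≡-Reasoning
        g : ℕ → ℤ
        g = off-zero (W t)
        T³ : ℤ
        T³ = cube (+ T)
        g* : ∀ i → off-zero (λ i → W t i * τ i) i ≡ g i * τ i
        g* zero    = refl
        g* (suc i) = refl
        g-vanish : ∀ n → T ℕ.≤ n → g n ≡ 0ℤ
        g-vanish zero    _ = refl
        g-vanish (suc n) p = W-vanish t {suc n} (ℕP.≤-trans p (ℕP.m≤n*m (suc n) t {{ℕ.>-nonZero 1≤t}}))
        value : ∀ d e → ∑ T (λ i → g i * (⟦ d ℕ.* e ℕP.≟ i ⟧ * χ d)) ≡ χ d * g (d ℕ.* e)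
        value d e = go (ℕP.<-≤-connex (d ℕ.* e) T)
          where
          n : ℕ
          n = d ℕ.* e
          off : ∀ i → i ≢ n → g i * (⟦ n ℕP.≟ i ⟧ * χ d) ≡ 0ℤ
          off i i≢ = trans (cong (λ z → g i * (z * χ d)) (⟦⟧-no (n ℕP.≟ i) (i≢ ∘ sym))) (*-zeroʳ (g i))
          go : n ℕ.< T ⊎ T ℕ.≤ n → ∑ T (λ i → g i * (⟦ n ℕP.≟ i ⟧ * χ d)) ≡ χ d * g n
          go (inj₁ n<T) = trans (∑-collapse T (λ i → g i * (⟦ n ℕP.≟ i ⟧ * χ d)) n<T (λ i _ → off i))
            (trans (cong (λ z → g n * (z * χ d)) (⟦⟧-yes (n ℕP.≟ n) refl)) (l (g n) (χ d)))
            where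
            l = ring 2 λ g x → g :* (# 1 :* x) ⊜ x :* g
          go (inj₂ T≤n) = trans (∑-vanish T (λ i i<T → off i (ℕP.<⇒≢ (ℕP.<-≤-trans i<T T≤n))))
            (sym (trans (cong (χ d *_) (g-vanish n T≤n)) (*-zeroʳ (χ d))))
        restore : ∀ d → ∑ B (λ e → χ d * g (d ℕ.* e)) ≡ χ d * ∑ B (λ e → W t (d ℕ.* e)) - χ d * T³
        restore zero = trans (∑-vanish B (λ e _ → *-zeroʳ (χ 0))) (cong (λ z → z * ∑ B (λ e → W t 0) - z * T³) (sym χ-0))
        restore d@(suc d′) = trans (sym (*-∑ B (χ d) (λ e → g (d ℕ.* e)))) (trans (cong (χ d *_)
            (trans (add-sub (∑ B (λ e → g (d ℕ.* e)))  (W t 0)) (cong₂ _-_ (sym whole) (W-0 t)))) (l (χ d) (∑ B (λ e → W t (d ℕ.* e))) T³))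
          where
          add-sub = ring 2 λ s w → s ⊜ w :+ s :- w
          l = ring 3 λ x s t → x :* (s :- t) ⊜ x :* s :- x :* t
          whole : ∑ B (λ e → W t (d ℕ.* e)) ≡ W t 0 + ∑ B (λ e → g (d ℕ.* e))
          whole = trans (∑-off-zero (λ e → W t (d ℕ.* e)) (ℕP.≤-trans 1≤T T≤B)) (cong₂ _+_ (cong (W t) (ℕP.*-zeroʳ d)) (∑-cong B same))
            where
            same : ∀ e → off-zero (λ e → W t (d ℕ.* e)) e ≡ g (d ℕ.* e)
            same zero    = cong g (sym (ℕP.*-zeroʳ d))
            same (suc e) = refl

      form-sums : ∀ t → 1 ℕ.≤ t → ∑ h (formSum t) ≡ + h * cube (+ T) + + 2 * D[ t ]
      form-sums t 1≤t = begin
        ∑ h (formSum t)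
          ≡⟨ ∑-cong h expand ⟩
        ∑ h (λ k → ∑ T (λ i → W t i * vectors k i))
          ≡⟨ ∑-swap h T (λ k i → W t i * vectors k i) ⟩
        ∑ T (λ i → ∑ h (λ k → W t i * vectors k i))
          ≡⟨ ∑-cong T (λ i → sym (*-∑ h (W t i) (λ k → vectors k i))) ⟩
        ∑ T (λ i → W t i * ∑ h (λ k → vectors k i))
          ≡⟨ ∑-off-zero (λ i → W t i * ∑ h (λ k → vectors k i)) 1≤T ⟩
        W t 0 * ∑ h (λ k → vectors k 0) + ∑ T (off-zero (λ i → W t i * ∑ h (λ k → vectors k i)))
          ≡⟨ cong₂ _+_ (trans (cong₂ _*_ (W-0 t) zero-count) (*-comm (cube (+ T)) (+ h))) (trans (∑-cong< T counted) (sym (*-∑ T (+ 2) (off-zero (λ i → W t i * τ i))))) ⟩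
        + h * cube (+ T) + + 2 * ∑ T (off-zero (λ i → W t i * τ i))
          ≡⟨ cong (λ z → + h * cube (+ T) + + 2 * z) (divisor-sum t 1≤t) ⟩
        + h * cube (+ T) + + 2 * D[ t ] ∎
        where
        open ≡-Reasoning
        expand : ∀ k → formSum t k ≡ ∑ T (λ i → W t i * vectors k i)
        expand k = begin
          box₂ M (λ x y → cube⁺ (+ T - + t * Q (F k) x y))
            ≡⟨ box₂-cong M {λ x y → cube⁺ (+ T - + t * Q (F k) x y)} {λ x y → ∑ T (λ i → W t i * ⟦ Q (F k) x y ≟ + i ⟧)} (λ x y → by-value t 1≤t k x y) ⟩
          box₂ M (λ x y → ∑ T (λ i → W t i * ⟦ Q (F k) x y ≟ + i ⟧))
            ≡⟨ box₂-∑ M T (λ x y i → W t i * ⟦ Q (F k) x y ≟ + i ⟧) ⟩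
          ∑ T (λ i → box₂ M (λ x y → W t i * ⟦ Q (F k) x y ≟ + i ⟧))
            ≡⟨ ∑-cong T (λ i → sym (*-box₂ M (W t i) (λ x y → ⟦ Q (F k) x y ≟ + i ⟧))) ⟩
          ∑ T (λ i → W t i * vectors k i) ∎
          where
          M : ℕ
          M = FS.μ (F k) ℕ.* S
        counted : ∀ i → i ℕ.< T → off-zero (λ i → W t i * ∑ h (λ k → vectors k i)) i ≡ + 2 * off-zero (λ i → W t i * τ i) i
        counted zero    _ = refl
        counted (suc i) i< = trans (cong (W t (suc i) *_) (trans (vector-count B {suc i} (λ ()) (ℕP.<-≤-trans i< T≤B) (ℕP.<⇒≤ i<)) (cong (+ 2 *_) (R≡τ (suc i) (ℕP.<-≤-trans i< T≤B)))))
          (l (W t (suc i)) (τ (suc i)))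
          where
          l = ring 2 λ w t → w :* (# 2 :* t) ⊜ # 2 :* (w :* t)

      open Weighted character χ-0
      open Estimate 2≤V {M₁} (ℕP.≤-trans (ℕP.≤-reflexive T≡) T≤M₁) ∑χ-B public

      -- ψ is 1 minus 4 times the indicator of the multiples of 4, and for m = 4 j the weight (T - d
      -- m)³ is that of scale 4 at d j.
      weighted≡D : weighted ≡ D[ 1 ] - + 4 * D[ 4 ]
      weighted≡D = trans (∑-cong B term) (trans (∑-- B _ _) (cong (_-_ D[ 1 ]) (sym (*-∑ B (+ 4) (λ d → χ d * ∑ B (λ e → W 4 (d ℕ.* e)))))))
        where
        ramp≡ : ∀ t d n k → d ℕ.* n ≡ t ℕ.* k → ramp (V ^ 8) d n ≡ W t k
        ramp≡ t d n k e = cong cube⁺ (cong₂ _-_ (cong +_ T≡) (trans (cong +_ e) (pos-* t k)))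
        term : ∀ d → χ d * ∑ B (λ m → ZeroSum.at ψ m * ramp (V ^ 8) d m) ≡
          χ d * ∑ B (λ e → W 1 (d ℕ.* e)) - + 4 * (χ d * ∑ B (λ e → W 4 (d ℕ.* e)))
        term zero = trans (cong (_* ∑ B (λ m → ZeroSum.at ψ m * ramp (V ^ 8) 0 m)) χ-0) (sym (cong₂ (λ u v → u * ∑ B (λ e → W 1 0) - + 4 * (v * ∑ B (λ e → W 4 0))) χ-0 χ-0))
        term d@(suc d′) = trans (cong (χ d *_) split) (l (χ d) (∑ B (λ e → W 1 (d ℕ.* e))) (∑ B (λ e → W 4 (d ℕ.* e))))
          where
          l = ring 3 λ x a b → x :* (a :- # 4 :* b) ⊜ x :* a :- # 4 :* (x :* b)
          k = semiring 2 λ d j → d :* (j :* # 4) ⊜ # 4 :* (d :* j)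
          b≤B : b ℕ.≤ B
          b≤B = ℕP.≤-trans (ℕP.m≤m*n b 4) (ℕP.≤-reflexive (sym B≡4b))
          ψ-sum : ∀ n (g : ℕ → ℤ) → n ≡ b ℕ.* 4 → ∑ n (λ m → ZeroSum.at ψ m * g m) ≡ ∑ n g - + 4 * ∑ b (λ j → g (j ℕ.* 4))
          ψ-sum _ g refl = ∑-ψ b g
          beyond : ∀ e → b ℕ.≤ e → e ℕ.< B → W 4 (d ℕ.* e) ≡ 0ℤ
          beyond e b≤e _ = W-vanish 4 {d ℕ.* e} (ℕP.≤-trans T≤B (ℕP.≤-trans (ℕP.≤-reflexive (trans B≡4b (ℕP.*-comm b 4)))
            (ℕP.*-monoʳ-≤ 4 (ℕP.≤-trans b≤e (ℕP.m≤n*m e d)))))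
          split : ∑ B (λ m → ZeroSum.at ψ m * ramp (V ^ 8) d m) ≡ ∑ B (λ e → W 1 (d ℕ.* e)) - + 4 * ∑ B (λ e → W 4 (d ℕ.* e))
          split = trans (ψ-sum B (ramp (V ^ 8) d) B≡4b) (cong₂ (λ u v → u - + 4 * v)
            (∑-cong B (λ e → ramp≡ 1 d e (d ℕ.* e) (sym (ℕP.*-identityˡ (d ℕ.* e)))))
            (trans (∑-cong b (λ j → ramp≡ 4 d (j ℕ.* 4) (d ℕ.* j) (k d j))) (sym (∑-extend (λ e → W 4 (d ℕ.* e)) b≤B beyond))))

      scaled-sum : ℤ
      scaled-sum = ∑ h (λ k → + 4 * formSum 4 k - formSum 1 k)

      scaled-sum≡ : scaled-sum ≡ + 3 * + h * cube (+ T) - + 2 * weighted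
      scaled-sum≡ = trans (∑-- h _ _) (trans (cong₂ _-_ (trans (sym (*-∑ h (+ 4) (formSum 4))) (cong (+ 4 *_) (form-sums 4 (ℕ.s≤s ℕ.z≤n)))) (form-sums 1 ℕP.≤-refl))
        (trans (l (+ h * cube (+ T)) (+ h) (cube (+ T)) D[ 1 ] D[ 4 ] refl) (cong (λ z → + 3 * + h * cube (+ T) - + 2 * z) (sym weighted≡D))))
        where
        l : ∀ x h t a b → x ≡ h * t → + 4 * (x + + 2 * b) - (x + + 2 * a) ≡ + 3 * h * t - + 2 * (a - + 4 * b)
        l _ h t a b refl = l′ h t a b
          where
          l′ = ring 4 λ h t a b → # 4 :* (h :* t :+ # 2 :* b) :- (h :* t :+ # 2 :* a) ⊜ # 3 :* h :* t :- # 2 :* (a :- # 4 :* b)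

      scaled-sum-bound : Bd V (sumℕ h scaling-K) 20 scaled-sum
      scaled-sum-bound = Bd-∑-family h scaling-K each
        where
        each : ∀ k → Bd V (scaling-K k) 20 (+ 4 * formSum 4 k - formSum 1 k)
        each k = subst (λ z → Bd V (scaling-K k) 20 (+ 4 * formSum 4 k - z)) (sym unscaled) (Bd-^ V 4 (scaling k 1≤S))
          where
          M : ℕ
          M = FS.μ (F k) ℕ.* S
          unscaled : formSum 1 k ≡ box₂ M (λ x y → cube⁺ (+ T - Q (F k) x y))
          unscaled = box₂-cong M {λ x y → cube⁺ (+ T - + 1 * Q (F k) x y)} {λ x y → cube⁺ (+ T - Q (F k) x y)}
            (λ x y → cong (λ q → cube⁺ (+ T - q)) (*-identityˡ (Q (F k) x y)))

    -- With w the weighted divisor sum, the two estimates are combined as 16 N² (3 h T³ - 2 w) + 2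
    -- (16 N² w - 24 N Y T³). The sum w cancels, and 48 N (N h - Y) T³ remains.
    gap : ℤ
    gap = + 48 * + N * (+ N * + h - Odd.Y c₁ N-sqfree)

    gap-K : ℕ
    gap-K = ∣ + 16 * (+ N * + N) ∣ ℕ.* sumℕ h scaling-K ℕ.+ 2 ℕ.* Weighted.weighted-K character χ-0

    -- T³ = V²⁴, while the errors are O(V²³); one factor V is left after cancellation.
    gap-bound : ∀ {V} → 2 ℕ.≤ V → ∣ gap ∣ ℕ.* V ℕ.≤ gap-K
    gap-bound {V} 2≤V = ℕP.*-cancelʳ-≤ (∣ gap ∣ ℕ.* V) gap-K (V ^ 23) {{ℕP.m^n≢0 V 23 {{ℕ.>-nonZero 1≤V}}}}
        (ℕP.≤-trans (ℕP.≤-reflexive (size V T T≡)) (Bd.bound total))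
      where
      open At 2≤V
      size : ∀ V T → V ^ 8 ≡ T → ∣ gap ∣ ℕ.* V ℕ.* V ^ 23 ≡ ∣ gap * cube (+ T) ∣
      size V T refl = trans (ℕP.*-assoc ∣ gap ∣ V (V ^ 23)) (sym (trans (abs-* gap (cube (+ V ^ 8))) (cong (∣ gap ∣ ℕ.*_)
        (trans (abs-* (+ (V ^ 8) * + (V ^ 8)) (+ (V ^ 8))) (trans (cong (ℕ._* V ^ 8) (abs-* (+ (V ^ 8)) (+ (V ^ 8))))
          (trans (cong (ℕ._* V ^ 8) (sym (ℕP.^-distribˡ-+-* V 8 8))) (sym (ℕP.^-distribˡ-+-* V 16 8))))))))
      identity : ∀ n h Y t t′ w s → s ≡ + 3 * h * t - + 2 * w → t′ ≡ t →
        + 48 * n * (n * h - Y) * t ≡ + 16 * (n * n) * s + + 2 * (+ 16 * (n * n * w) - + 24 * (n * (Y * t′)))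
      identity n h Y t _ w _ refl refl = l n h Y t w
        where
        l = ring 5 λ n h Y t w → # 48 :* n :* (n :* h :- Y) :* t ⊜ # 16 :* (n :* n) :* (# 3 :* h :* t :- # 2 :* w) :+ # 2 :* (# 16 :* (n :* n :* w) :- # 24 :* (n :* (Y :* t)))
      total : Bd V gap-K 23 (gap * cube (+ T))
      total = subst (Bd V gap-K 23) (sym (identity (+ N) (+ h) (Odd.Y c₁ N-sqfree) (cube (+ T)) (cube (+ (V ^ 8))) weighted scaled-sum scaled-sum≡ (cong (λ t → cube (+ t)) T≡)))
        (Bd-+ (Bd-scale (+ 16 * (+ N * + N)) (Bd-raise 1≤V (ℕP.m≤m+n 20 3) scaled-sum-bound)) (Bd-scale (+ 2) weighted-bound))

    -- `gap-bound` holds for every V ≥ 2 with a constant free of V. As the gap is an integer, the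
    -- single value V = 2 + `gap-K` already forces it to be 0.
    class-number : + Odd.N c₁ N-sqfree * + h ≡ Odd.Y c₁ N-sqfree
    class-number = i-j≡0⇒i≡j (+ N * + h) (Odd.Y c₁ N-sqfree) (*-cancelˡ-≡ (+ 48 * + N) (+ N * + h - Odd.Y c₁ N-sqfree) 0ℤ (trans gap≡0 (sym (*-zeroʳ (+ 48 * + N)))))
      where
      gap≡0 : gap ≡ 0ℤ
      gap≡0 = ∣i∣≡0⇒i≡0 (go ∣ gap ∣ gap-K (gap-bound {2 ℕ.+ gap-K} (ℕP.m≤m+n 2 gap-K)))
        where
        go : ∀ g K → g ℕ.* (2 ℕ.+ K) ℕ.≤ K → g ≡ 0
        go zero    K _ = refl
        go (suc g) K p = contradiction (ℕP.≤-trans (ℕP.m≤m+n (2 ℕ.+ K) (g ℕ.* (2 ℕ.+ K))) p) (ℕP.<⇒≱ (ℕP.m<n+m K {2} (ℕ.s≤s ℕ.z≤n)))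

-- The two residue classes of N modulo 8.

open import Defs
open import Data.Integer.Base using (ℤ; +_; -_; 0ℤ; _<_; _*_; ∣_∣; NonZero; _%ℕ_)
open import Data.Nat.Base using (ℕ; _%_)
open import Data.Product.Base using (_×_)
open import Relation.Binary.PropositionalEquality using (_≡_)
open import Data.Integer.Base using (_-_; -<-)
open import Data.Nat.DivMod using (_/_; m≡m%n+[m/n]*n)
open Normalisation using (ring; _⊜_; _:+_; _:-_; _:*_; :-_; #_)
open Jacobi using (tab₈)
open Character using (module Odd)
open ClassNumber using (class-number)

-- For D = -(k + 1) the condition modulo 4 becomes N = k + 1 ≡ 3. Solving for k puts N literally
-- into the shape 3 + 4 c for which the character sums were computed.
discriminant : ∀ k → -[1+ k ] %ℕ 4 ≡ 1 → ∃[ c ] k ≡ 2 ℕ.+ c ℕ.* 4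
discriminant k e = suc k / 4 , ℕP.suc-injective (trans (m≡m%n+[m/n]*n (suc k) 4) (cong (ℕ._+ suc k / 4 ℕ.* 4) (residue k e)))
  where
  residue : ∀ k → -[1+ k ] %ℕ 4 ≡ 1 → suc k % 4 ≡ 3
  residue k e with suc k % 4
  residue k () | 0
  residue k () | 1
  residue k () | 2
  residue k e  | 3 = refl
  residue k () | 4
  residue k () | suc (suc (suc (suc (suc _))))

module _ (c h : ℕ) (N-sqfree : ∀ d → d ℕ.* d ℕD.∣ 3 ℕ.+ c ℕ.* 4 → d ≡ 1) (Nh≡Y : + Odd.N c N-sqfree * + h ≡ Odd.Y c N-sqfree) where

  open Odd c N-sqfree using (N; E-split; E-inert; χ-2; sector-0; sector-1)

  split : N % 8 ≡ 7 → E -[1+ 2 ℕ.+ c ℕ.* 4 ] 0 4 ≡ + h × E -[1+ 2 ℕ.+ c ℕ.* 4 ] 1 4 ≡ 0ℤ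
  split e = Product.map (trans sector-0) (trans sector-1) (E-split {+ h} Nh≡Y (trans χ-2 (cong tab₈ e)))

  inert : N % 8 ≡ 3 → E -[1+ 2 ℕ.+ c ℕ.* 4 ] 0 4 ≡ 0ℤ × E -[1+ 2 ℕ.+ c ℕ.* 4 ] 1 4 ≡ + 3 * + h
  inert e = Product.map (trans sector-0) (trans sector-1) (E-inert {+ h} Nh≡Y (trans χ-2 (cong tab₈ e)))

theorem4p1 : (D : ℤ) .{{_ : NonZero D}} →
    D < - (+ 4) → D %ℕ 4 ≡ 1 → SquareFree D →
    (h : ℕ) → IsClassNumber D h →
    (∣ D ∣ % 8 ≡ 7 → E D 0 4 ≡ + h × E D 1 4 ≡ 0ℤ) ×
    (∣ D ∣ % 8 ≡ 3 → E D 0 4 ≡ 0ℤ × E D 1 4 ≡ + 3 * + h)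
theorem4p1 (+ _) ()
theorem4p1 -[1+ k ] (-<- 3<k) D%4 sqfree h inv = go (discriminant k D%4)
  where
  Claim : ℕ → Set
  Claim k = (∣ -[1+ k ] ∣ % 8 ≡ 7 → E -[1+ k ] 0 4 ≡ + h × E -[1+ k ] 1 4 ≡ 0ℤ) ×
    (∣ -[1+ k ] ∣ % 8 ≡ 3 → E -[1+ k ] 0 4 ≡ 0ℤ × E -[1+ k ] 1 4 ≡ + 3 * + h)
  go : ∃[ c ] k ≡ 2 ℕ.+ c ℕ.* 4 → Claim k
  go (c , k≡) = subst Claim (sym k≡) (split c h N-sqfree Nh≡Y , inert c h N-sqfree Nh≡Y)
    where
    N-sqfree : ∀ d → d ℕ.* d ℕD.∣ 3 ℕ.+ c ℕ.* 4 → d ≡ 1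
    N-sqfree d d²∣N = sqfree (+ d) (subst₂ ℕD._∣_ (sym (ℤP.abs-* (+ d) (+ d))) (cong suc (sym k≡)) d²∣N)
    D≡ : -[1+ k ] ≡ 1ℤ - + 4 * + suc c
    D≡ = trans (cong -[1+_] k≡) (trans (cong (λ z → - (+ 3 ℤ.+ z)) (ℤP.pos-* c 4)) (l (+ c)))
      where
      l = ring 1 λ c → :- (# 3 :+ c :* # 4) ⊜ # 1 :- # 4 :* (# 1 :+ c)
    Nh≡Y : + Odd.N c N-sqfree * + h ≡ Odd.Y c N-sqfree
    Nh≡Y = class-number c N-sqfree D≡ (subst (4 ℕ.<_) (cong suc k≡) (ℕ.s≤s 3<k)) inv
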